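{- Let $\ell$ be a rational prime, $X$ a connected (finite) graph, and $S=\{s_1,\dots,s_t\}$ an orientation of $X$. Let $G$ be an infinite pro-$\ell$ group with lower central $\ell$-series $(G_n)_{n\ge0}$ and put $G^{(n)}=G/G_n$. Let $g_1,\dots,g_k$ with $k\le t$ be a set of topological generators of $G$, and let $\alpha:S\to G$ be a voltage assignment with $\alpha(s_i)=g_i$ for $i\le k$ and $\alpha(s_i)\in G$ arbitrary for $i>k$. Suppose given a $\mathbb{Z}_\ell$-tower $X=X_0\leftarrow X_1\leftarrow\cdots\leftarrow X_n\leftarrow\cdots$ above $X$; put $\Gamma^{(m)}=\mathrm{Gal}(X_m/X)\simeq\mathbb{Z}/\ell^m\mathbb{Z}$ and $\Gamma=\varprojlim_m\Gamma^{(m)}\simeq\mathbb{Z}_\ell$, and let $\beta:S\to\Gamma$ be a voltage assignment such that $X_m=X(\Gamma^{(m)},S,\beta_{/m})$ for all $m$, where $\beta_{/m}$ is the composite of $\beta$ with $\Gamma\to\Gamma^{(m)}$. Let $\gamma:S\to G\times\Gamma$ be $\gamma(s)=(\alpha(s),\beta(s))$, let $\gamma_{n,m}$ be the composite of $\gamma$ with the quotient map $G\times\Gamma\to G^{(n)}\times\Gamma^{(m)}$, and set $Y_{n,m}=X(G^{(n)}\times\Gamma^{(m)},S,\gamma_{n,m})$ and $Y_n=Y_{n,0}$. Assume that 1. the group $G$ is uniform of dimension $d$; 2. the graph $Y_{n,m}$ is connected for all $n,m\ge 0$; 3. $\mu_0=0$; where, for $n\ge 0$, $\mu_n$ and $\lambda_n$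 denote the Iwasawa $\mu$- and $\lambda$-invariants of the $\mathbb{Z}_\ell$-tower $$Y_n=Y_{n,0}\leftarrow Y_{n,1}\leftarrow Y_{n,2}\leftarrow\cdots\leftarrow Y_{n,m}\leftarrow\cdots$$ above $Y_n$. Write $\lambda=\lambda_0$. Then for all $n\ge 0$ one has $\mu_n=0$ and $$\lambda_n=\ell^{dn}(\lambda+1)-1.$$
   Context: Graphs (in the sense of Serre). A graph $X$ consists of a finite set of vertices $V_X$, a finite set of directed edges $\mathbf{E}_X$, an incidence map $e\mapsto (o(e),t(e))\in V_X\times V_X$ and an inversion $e\mapsto\bar e$ on $\mathbf{E}_X$ with $\bar e\ne e$, $\bar{\bar e}=e$, $o(\bar e)=t(e)$, $t(\bar e)=o(e)$. Loops and parallel edges are allowed; all graphs are finite. For $v\in V_X$, $\mathbf{E}_{X,v}=\{e\in\mathbf{E}_X:o(e)=v\}$. A morphism $f:Y\to X$ is a pair of maps on vertices and directed edges commuting with $o$, $t$ and inversion. It is a cover if it is surjective on vertices and restricts to bijections $\mathbf{E}_{Y,w}\to\mathbf{E}_{X,f(w)}$ for all $w\in V_Y$. A cover is Galois if $Y$ is connected and $\mathrm{Aut}_f(Y/X)=\{\sigma\in\mathrm{Aut}(Y):f\circ\sigma=f\}$, then denoted $\mathrm{Gal}(Y/X)$, acts transitively on each fiber of $f$ over a vertex of $X$. $\mathbb{Z}_\ell$-towers and Iwasawa invariants. A $\mathbb{Z}_\ell$-tower above a connected graph $X$ is a sequence of covers of connected graphs $X=X_0\leftarrow X_1\leftarrow\cdots$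 such that each composite $X_n\to X$ ($n\geq 1$) is Galois with group isomorphic to $\mathbb{Z}/\ell^n\mathbb{Z}$. It is a known theorem that (when the Euler characteristic $|V_X|-|E_X|$ of the base is nonzero, where $E_X$ is the set of undirected edges) there are unique integers $\mu\ge0,\lambda\ge0,\nu$ with $\mathrm{ord}_\ell(\kappa_n)=\mu\ell^n+\lambda n+\nu$ for all large $n$, where $\kappa_n$ is the number of spanning trees of $X_n$; $\mu$ and $\lambda$ are the Iwasawa invariants of the tower. Voltage assignments. An orientation of $X$ is a subset $S\subseteq\mathbf{E}_X$ with $S\cap\overline S=\varnothing$ and $\mathbf{E}_X=S\cup\overline S$. A voltage assignment is a function $\alpha:S\to H$ to a group $H$, extended to $\mathbf{E}_X$ by $\alpha(\bar s)=\alpha(s)^{ -1}$. For $H$ finite, the graph $X(H,S,\alpha)$ has vertex set $V_X\times H$ and directed edge set $\mathbf{E}_X\times H$, where $(e,\sigma)$ goes from $(o(e),\sigma)$ to $(t(e),\sigma\alpha(e))$ and $\overline{(e,\sigma)}=(\bar e,\sigma\alpha(e))$. It maps to $X$ by projection on the first component, and a surjective homomorphism $q:H\to H'$ induces a cover $X(H,S,\alpha)\to X(H',S,q\circ\alpha)$, $(v,\sigma)\mapsto(v,q(\sigma))$, $(e,\sigma)\mapsto(e,q(\sigma))$; the maps in the towers above are those induced by the natural quotient maps. Uniform groups. For a pro-$\ell$ group $G$, the lower central $\ell$-series is $G_0=G$, $G_{n+1}=(G_n)^\ell[G_n,G]$, where for a group $H$, $H^\ell$ denotes the subgroup generated by $\ell$-th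 powers and subgroups are understood as closed subgroups. Elements of $G$ are topological generators if the closure of the subgroup they generate is $G$. $G$ is finitely generated if it has a finite set of topological generators. $G$ is uniform if (1) $G$ is finitely generated; (2) $[G,G]\subseteq G^\ell$ if $\ell$ is odd, and $[G,G]\subseteq G^4$ if $\ell=2$; (3) $[G_n:G_{n+1}]=[G:G_1]$ for all $n\ge1$. The dimension of a uniform $G$ is the integer $d\geq 1$ with $[G:G_1]=\ell^d$. -}

module Defs where

open import Level using (0ℓ)
open import Algebra.Bundles using (Group; module AbelianGroup)
open import Algebra.Morphism.Structures using (module GroupMorphisms)
import Algebra.Construct.DirectProduct as DirectProduct
import Algebra.Definitions.RawMonoid as RawMonoidDefs
import Algebra.Properties.Group as GroupProperties
import Data.Product.Relation.Binary.Pointwise.NonDependent as Pointwise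
open import Data.Bool.Base using (Bool; true)
open import Data.Empty using (⊥-elim)
open import Data.Fin.Base using (Fin)
open import Data.Integer.Base as ℤ using (ℤ; +_)
import Data.Integer.Properties as ℤ
import Data.Integer.Divisibility.Signed as ℤ
open import Data.List.Base using (List; []; _∷_)
open import Data.List.Relation.Unary.Linked using (Linked)
open import Data.Nat.Base as ℕ using (ℕ; zero; suc)
import Data.Nat.Divisibility as ℕ
open import Data.Product.Base using (Σ; _×_; _,_; proj₁; proj₂; ∃; ∃-syntax; Σ-syntax)
open import Data.Sum.Base using (_⊎_; inj₁; inj₂)
open import Data.Unit.Base using (⊤; tt)
open import Function.Base using (_∘_)
open import Function.Bundles using (Func; Inverse; _⟨$⟩_)
open import Function.Definitions using (Bijective)
import Function.Construct.Identity as Identity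
import Function.Construct.Composition as Composition
open import Relation.Binary.Bundles using (Setoid; Preorder)
import Relation.Binary.Construct.On as On
open import Relation.Binary.PropositionalEquality as ≡ using (_≡_)
import Relation.Binary.Reasoning.Setoid as SetoidReasoning
open import Relation.Nullary.Negation using (¬_)
open import Relation.Unary using (Pred; _⊆_)

open Setoid using () renaming (Carrier to ∣_∣)

HasSize : Setoid 0ℓ 0ℓ → ℕ → Set
HasSize A n = Inverse A (≡.setoid (Fin n))

Finite : Setoid 0ℓ 0ℓ → Set
Finite A = ∃ (HasSize A)

-- Ord ℓ a k says that ord_ℓ(a) = k.
Ord : ℕ → ℕ → ℕ → Set
Ord ℓ a k = ((ℓ ℕ.^ k) ℕ.∣ a) × ¬ ((ℓ ℕ.^ suc k) ℕ.∣ a)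

-- Vertices and edges form setoids, so that quotient groups can serve as vertex
-- sets.  Finiteness is the separate predicate IsFiniteGraph; it is inherited by
-- derived graphs over finite groups.
record Graph : Set₁ where
  field
    V E : Setoid 0ℓ 0ℓ
    o t : Func E V
    inv : Func E E
  open Setoid V public using () renaming (_≈_ to _≈ⱽ_)
  open Setoid E public using () renaming (_≈_ to _≈ᴱ_)
  field
    inv-inv : ∀ e → (inv ⟨$⟩ (inv ⟨$⟩ e)) ≈ᴱ e
    inv-≉   : ∀ e → ¬ ((inv ⟨$⟩ e) ≈ᴱ e)
    o-inv   : ∀ e → (o ⟨$⟩ (inv ⟨$⟩ e)) ≈ⱽ (t ⟨$⟩ e)
    t-inv   : ∀ e → (t ⟨$⟩ (inv ⟨$⟩ e)) ≈ⱽ (o ⟨$⟩ e)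
  module V = Setoid V
  module E = Setoid E

IsFiniteGraph : Graph → Set
IsFiniteGraph X = Finite (Graph.V X) × Finite (Graph.E X)

OutEdges : (X : Graph) → ∣ Graph.V X ∣ → Setoid 0ℓ 0ℓ
OutEdges X v = record
  { Carrier       = Σ[ e ∈ ∣ E ∣ ] (o ⟨$⟩ e) ≈ⱽ v
  ; _≈_           = λ a b → proj₁ a ≈ᴱ proj₁ b
  ; isEquivalence = On.isEquivalence proj₁ (Setoid.isEquivalence E)
  } where open Graph X

module _ (X : Graph) where
  open Graph X

  data Walk : ∣ V ∣ → ∣ V ∣ → Set where
    stop : ∀ {v w} → v ≈ⱽ w → Walk v w
    step : ∀ {v w} (e : ∣ E ∣) → (o ⟨$⟩ e) ≈ⱽ v → Walk (t ⟨$⟩ e) w → Walk v w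

  edges : ∀ {v w} → Walk v w → List ∣ E ∣
  edges (stop _)     = []
  edges (step e _ p) = e ∷ edges p

  Reduced : ∀ {v w} → Walk v w → Set
  Reduced p = Linked (λ e e′ → ¬ (e′ ≈ᴱ (inv ⟨$⟩ e))) (edges p)

  IsConnected : Set
  IsConnected = ∣ V ∣ × (∀ v w → Walk v w)

  IsAcyclic : Set
  IsAcyclic = ∀ {v} (p : Walk v v) → Reduced p → edges p ≡ []

  IsTree : Set
  IsTree = IsConnected × IsAcyclic

  -- An inversion-stable set of directed edges, i.e. a set of undirected edges.
  record EdgeSet : Set where
    field
      mem      : ∣ E ∣ → Bool
      mem-cong : ∀ {e e′} → e ≈ᴱ e′ → mem e ≡ mem e′
      mem-inv  : ∀ e → mem (inv ⟨$⟩ e) ≡ mem e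

spanningSubgraph : (X : Graph) → EdgeSet X → Graph
spanningSubgraph X T = record
  { V = V
  ; E = record
      { Carrier       = Σ[ e ∈ ∣ E ∣ ] mem e ≡ true
      ; _≈_           = λ a b → proj₁ a ≈ᴱ proj₁ b
      ; isEquivalence = On.isEquivalence proj₁ (Setoid.isEquivalence E)
      }
  ; o = record { to = λ a → o ⟨$⟩ proj₁ a ; cong = Func.cong o }
  ; t = record { to = λ a → t ⟨$⟩ proj₁ a ; cong = Func.cong t }
  ; inv = record
      { to   = λ a → (inv ⟨$⟩ proj₁ a) , ≡.trans (mem-inv (proj₁ a)) (proj₂ a)
      ; cong = Func.cong inv
      }
  ; inv-inv = λ a → inv-inv (proj₁ a)
  ; inv-≉   = λ a → inv-≉ (proj₁ a)
  ; o-inv   = λ a → o-inv (proj₁ a)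
  ; t-inv   = λ a → t-inv (proj₁ a)
  } where open Graph X
          open EdgeSet T

SpanningTrees : Graph → Setoid 0ℓ 0ℓ
SpanningTrees X = record
  { Carrier       = Σ[ T ∈ EdgeSet X ] IsTree (spanningSubgraph X T)
  ; _≈_           = λ S T → ∀ e → mem (proj₁ S) e ≡ mem (proj₁ T) e
  ; isEquivalence = record
      { refl  = λ _ → ≡.refl
      ; sym   = λ p e → ≡.sym (p e)
      ; trans = λ p q e → ≡.trans (p e) (q e)
      }
  } where open EdgeSet

record Morphism (Y X : Graph) : Set where
  private
    module Y = Graph Y
    module X = Graph X
  field
    onV      : Func Y.V X.V
    onE      : Func Y.E X.E
    onE-o    : ∀ e → (X.o ⟨$⟩ (onE ⟨$⟩ e)) X.≈ⱽ (onV ⟨$⟩ (Y.o ⟨$⟩ e))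
    onE-t    : ∀ e → (X.t ⟨$⟩ (onE ⟨$⟩ e)) X.≈ⱽ (onV ⟨$⟩ (Y.t ⟨$⟩ e))
    onE-inv  : ∀ e → (onE ⟨$⟩ (Y.inv ⟨$⟩ e)) X.≈ᴱ (X.inv ⟨$⟩ (onE ⟨$⟩ e))

open Morphism public

infixr 9 _∘ᴹ_
infix  4 _≗ᴹ_

idᴹ : ∀ {X} → Morphism X X
idᴹ {X} = record
  { onV = Identity.function V ; onE = Identity.function E
  ; onE-o = λ _ → V.refl ; onE-t = λ _ → V.refl ; onE-inv = λ _ → E.refl }
  where open Graph X

_∘ᴹ_ : ∀ {Z Y X} → Morphism Y X → Morphism Z Y → Morphism Z X
_∘ᴹ_ {X = X} f g = record
  { onV = Composition.function (onV g) (onV f)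
  ; onE = Composition.function (onE g) (onE f)
  ; onE-o = λ e → V.trans (onE-o f _) (Func.cong (onV f) (onE-o g e))
  ; onE-t = λ e → V.trans (onE-t f _) (Func.cong (onV f) (onE-t g e))
  ; onE-inv = λ e → E.trans (Func.cong (onE f) (onE-inv g e)) (onE-inv f _)
  } where open Graph X

_≗ᴹ_ : ∀ {Y X} → Morphism Y X → Morphism Y X → Set
_≗ᴹ_ {X = X} f g = (∀ v → (onV f ⟨$⟩ v) ≈ⱽ (onV g ⟨$⟩ v))
                 × (∀ e → (onE f ⟨$⟩ e) ≈ᴱ (onE g ⟨$⟩ e))
  where open Graph X

record GraphIso (Y X : Graph) : Set where
  field
    to      : Morphism Y X
    from    : Morphism X Y
    to-from : to ∘ᴹ from ≗ᴹ idᴹ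
    from-to : from ∘ᴹ to ≗ᴹ idᴹ

open GraphIso public

module _ {Y X : Graph} (f : Morphism Y X) where
  private
    module Y = Graph Y
    module X = Graph X

  onOutEdges : ∀ w → ∣ OutEdges Y w ∣ → ∣ OutEdges X (onV f ⟨$⟩ w) ∣
  onOutEdges w (e , oe≈w) =
    (onE f ⟨$⟩ e) , X.V.trans (onE-o f e) (Func.cong (onV f) oe≈w)

  IsCover : Set
  IsCover =
      (∀ v → ∃[ w ] (onV f ⟨$⟩ w) X.≈ⱽ v)
    × (∀ w → Bijective (Setoid._≈_ (OutEdges Y w))
                       (Setoid._≈_ (OutEdges X (onV f ⟨$⟩ w)))
                       (onOutEdges w))

  DeckCarrier : Set
  DeckCarrier = Σ[ σ ∈ GraphIso Y Y ] f ∘ᴹ to σ ≗ᴹ f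

  private
    _≋_ : DeckCarrier → DeckCarrier → Set
    a ≋ b = to (proj₁ a) ≗ᴹ to (proj₁ b)

    id′ : DeckCarrier
    id′ = record { to = idᴹ ; from = idᴹ
                 ; to-from = (λ _ → Y.V.refl) , (λ _ → Y.E.refl)
                 ; from-to = (λ _ → Y.V.refl) , (λ _ → Y.E.refl) }
        , (λ _ → X.V.refl) , (λ _ → X.E.refl)

    _·_ : DeckCarrier → DeckCarrier → DeckCarrier
    (σ , p) · (τ , q) =
      record
        { to = to σ ∘ᴹ to τ
        ; from = from τ ∘ᴹ from σ
        ; to-from =
            (λ v → Y.V.trans (Func.cong (onV (to σ)) (proj₁ (to-from τ) _)) (proj₁ (to-from σ) v))
          , (λ e → Y.E.trans (Func.cong (onE (to σ)) (proj₂ (to-from τ) _)) (proj₂ (to-from σ) e))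
        ; from-to =
            (λ v → Y.V.trans (Func.cong (onV (from τ)) (proj₁ (from-to σ) _)) (proj₁ (from-to τ) v))
          , (λ e → Y.E.trans (Func.cong (onE (from τ)) (proj₂ (from-to σ) _)) (proj₂ (from-to τ) e))
        }
      , (λ v → X.V.trans (proj₁ p _) (proj₁ q v))
      , (λ e → X.E.trans (proj₂ p _) (proj₂ q e))

    inverse : DeckCarrier → DeckCarrier
    inverse (σ , p) =
      record { to = from σ ; from = to σ ; to-from = from-to σ ; from-to = to-from σ }
      , (λ v → X.V.trans (X.V.sym (proj₁ p _)) (Func.cong (onV f) (proj₁ (to-from σ) v)))
      , (λ e → X.E.trans (X.E.sym (proj₂ p _)) (Func.cong (onE f) (proj₂ (to-from σ) e)))

    inverse-cong : ∀ {a b} → a ≋ b → inverse a ≋ inverse b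
    inverse-cong {σ , _} {τ , _} (p , q) =
        (λ v → Y.V.trans (Func.cong (onV (from σ)) (Y.V.sym (proj₁ (to-from τ) v)))
              (Y.V.trans (Func.cong (onV (from σ)) (Y.V.sym (p _))) (proj₁ (from-to σ) _)))
      , (λ e → Y.E.trans (Func.cong (onE (from σ)) (Y.E.sym (proj₂ (to-from τ) e)))
              (Y.E.trans (Func.cong (onE (from σ)) (Y.E.sym (q _))) (proj₂ (from-to σ) _)))

  Gal : Group 0ℓ 0ℓ
  Gal = record
    { Carrier = DeckCarrier
    ; _≈_ = _≋_
    ; _∙_ = _·_
    ; ε   = id′
    ; _⁻¹ = inverse
    ; isGroup = record
        { isMonoid = record
            { isSemigroup = record
                { isMagma = record
                    { isEquivalence = record
                        { refl  = (λ _ → Y.V.refl) , (λ _ → Y.E.refl)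
                        ; sym   = λ (p , q) → (λ v → Y.V.sym (p v)) , (λ e → Y.E.sym (q e))
                        ; trans = λ (p , q) (p′ , q′) → (λ v → Y.V.trans (p v) (p′ v))
                                                      , (λ e → Y.E.trans (q e) (q′ e))
                        }
                    ; ∙-cong = λ {a} {b} (p , q) (p′ , q′) →
                        (λ v → Y.V.trans (Func.cong (onV (to (proj₁ a))) (p′ v)) (p _))
                      , (λ e → Y.E.trans (Func.cong (onE (to (proj₁ a))) (q′ e)) (q _))
                    }
                ; assoc = λ _ _ _ → (λ _ → Y.V.refl) , (λ _ → Y.E.refl)
                }
            ; identity = (λ _ → (λ _ → Y.V.refl) , (λ _ → Y.E.refl))
                       , (λ _ → (λ _ → Y.V.refl) , (λ _ → Y.E.refl))
            }
        ; inverse = (λ a → from-to (proj₁ a)) , (λ a → to-from (proj₁ a))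
        ; ⁻¹-cong = λ {a} {b} → inverse-cong {a} {b}
        }
    }

  IsGalois : Set
  IsGalois =
      IsCover
    × IsConnected Y
    × (∀ w w′ → (onV f ⟨$⟩ w) X.≈ⱽ (onV f ⟨$⟩ w′) →
         Σ[ σ ∈ DeckCarrier ] (onV (to (proj₁ σ)) ⟨$⟩ w) Y.≈ⱽ w′)

module _ (G : Group 0ℓ 0ℓ) where
  open Group G
  open GroupProperties G using (⁻¹-anti-homo-∙; ⁻¹-involutive; \\-leftDividesˡ; \\-leftDividesʳ)
  open SetoidReasoning setoid

  conj : Carrier → Carrier → Carrier
  conj g x = g ∙ x ∙ g ⁻¹

  record NormalSubgroup : Set₁ where
    field
      mem     : Pred Carrier 0ℓ
      mem-≈   : ∀ {x y} → x ≈ y → mem x → mem y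
      mem-ε   : mem ε
      mem-∙   : ∀ {x y} → mem x → mem y → mem (x ∙ y)
      mem-⁻¹  : ∀ {x} → mem x → mem (x ⁻¹)
      mem-conj : ∀ g {x} → mem x → mem (conj g x)

  open NormalSubgroup

  whole : NormalSubgroup
  whole = record { mem = λ _ → ⊤ ; mem-≈ = λ _ _ → tt ; mem-ε = tt
                 ; mem-∙ = λ _ _ → tt ; mem-⁻¹ = λ _ → tt ; mem-conj = λ _ _ → tt }

  conj-cong : ∀ g {x y} → x ≈ y → conj g x ≈ conj g y
  conj-cong g p = ∙-congʳ (∙-congˡ p)

  conj-∙ : ∀ g x y → conj g x ∙ conj g y ≈ conj g (x ∙ y)
  conj-∙ g x y = begin
    (g ∙ x ∙ g ⁻¹) ∙ (g ∙ y ∙ g ⁻¹)   ≈⟨ assoc _ _ _ ⟩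
    g ∙ x ∙ (g ⁻¹ ∙ (g ∙ y ∙ g ⁻¹))   ≈⟨ ∙-congˡ (∙-congˡ (assoc _ _ _)) ⟩
    g ∙ x ∙ (g ⁻¹ ∙ (g ∙ (y ∙ g ⁻¹))) ≈⟨ ∙-congˡ (\\-leftDividesʳ g _) ⟩
    g ∙ x ∙ (y ∙ g ⁻¹)                ≈⟨ assoc _ _ _ ⟨
    g ∙ x ∙ y ∙ g ⁻¹                  ≈⟨ ∙-congʳ (assoc _ _ _) ⟩
    g ∙ (x ∙ y) ∙ g ⁻¹                ∎

  conj-ε : ∀ g → conj g ε ≈ ε
  conj-ε g = trans (∙-congʳ (identityʳ g)) (inverseʳ g)

  conj-⁻¹ : ∀ g x → (conj g x) ⁻¹ ≈ conj g (x ⁻¹)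
  conj-⁻¹ g x = begin
    (g ∙ x ∙ g ⁻¹) ⁻¹       ≈⟨ ⁻¹-anti-homo-∙ _ _ ⟩
    g ⁻¹ ⁻¹ ∙ (g ∙ x) ⁻¹    ≈⟨ ∙-cong (⁻¹-involutive g) (⁻¹-anti-homo-∙ g x) ⟩
    g ∙ (x ⁻¹ ∙ g ⁻¹)       ≈⟨ assoc _ _ _ ⟨
    g ∙ x ⁻¹ ∙ g ⁻¹         ∎

  private
    swapʳ : ∀ x y → x ∙ y ≈ y ∙ conj (y ⁻¹) x
    swapʳ x y = begin
      x ∙ y                        ≈⟨ \\-leftDividesˡ y _ ⟨
      y ∙ (y ⁻¹ ∙ (x ∙ y))         ≈⟨ ∙-congˡ (assoc _ _ _) ⟨
      y ∙ (y ⁻¹ ∙ x ∙ y)           ≈⟨ ∙-congˡ (∙-congˡ (⁻¹-involutive y)) ⟨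
      y ∙ (y ⁻¹ ∙ x ∙ y ⁻¹ ⁻¹)     ∎

    \\-∙ : ∀ x x′ y y′ → (x ∙ y) ⁻¹ ∙ (x′ ∙ y′) ≈ conj (y ⁻¹) (x ⁻¹ ∙ x′) ∙ (y ⁻¹ ∙ y′)
    \\-∙ x x′ y y′ = begin
      (x ∙ y) ⁻¹ ∙ (x′ ∙ y′)               ≈⟨ ∙-congʳ (⁻¹-anti-homo-∙ x y) ⟩
      y ⁻¹ ∙ x ⁻¹ ∙ (x′ ∙ y′)              ≈⟨ assoc _ _ _ ⟨
      y ⁻¹ ∙ x ⁻¹ ∙ x′ ∙ y′                ≈⟨ ∙-congʳ (assoc _ _ _) ⟩
      y ⁻¹ ∙ (x ⁻¹ ∙ x′) ∙ y′              ≈⟨ ∙-congˡ (\\-leftDividesˡ y y′) ⟨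
      y ⁻¹ ∙ (x ⁻¹ ∙ x′) ∙ (y ∙ (y ⁻¹ ∙ y′))      ≈⟨ ∙-congˡ (∙-congʳ (⁻¹-involutive y)) ⟨
      y ⁻¹ ∙ (x ⁻¹ ∙ x′) ∙ (y ⁻¹ ⁻¹ ∙ (y ⁻¹ ∙ y′)) ≈⟨ assoc _ _ _ ⟨
      conj (y ⁻¹) (x ⁻¹ ∙ x′) ∙ (y ⁻¹ ∙ y′) ∎

  module _ (N : NormalSubgroup) where

    private
      ~-refl : ∀ {x y} → x ≈ y → mem N (x ⁻¹ ∙ y)
      ~-refl {x} p = mem-≈ N (trans (sym (inverseˡ x)) (∙-congˡ p)) (mem-ε N)

      ~-sym : ∀ {x y} → mem N (x ⁻¹ ∙ y) → mem N (y ⁻¹ ∙ x)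
      ~-sym {x} {y} p = mem-≈ N
        (trans (⁻¹-anti-homo-∙ _ _) (∙-congˡ (⁻¹-involutive x))) (mem-⁻¹ N p)

      ~-trans : ∀ {x y z} → mem N (x ⁻¹ ∙ y) → mem N (y ⁻¹ ∙ z) → mem N (x ⁻¹ ∙ z)
      ~-trans {x} {y} {z} p q = mem-≈ N
        (trans (assoc _ _ _) (∙-congˡ (\\-leftDividesˡ y z))) (mem-∙ N p q)

    -- The quotient group: the same elements, with xN = yN as equality.
    quotient : Group 0ℓ 0ℓ
    quotient = record
      { Carrier = Carrier
      ; _≈_ = λ x y → mem N (x ⁻¹ ∙ y)
      ; _∙_ = _∙_
      ; ε   = ε
      ; _⁻¹ = _⁻¹
      ; isGroup = record
          { isMonoid = record
              { isSemigroup = record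
                  { isMagma = record
                      { isEquivalence = record { refl = ~-refl refl ; sym = ~-sym ; trans = ~-trans }
                      ; ∙-cong = λ {x} {x′} {y} {y′} p q →
                          mem-≈ N (sym (\\-∙ x x′ y y′)) (mem-∙ N (mem-conj N (y ⁻¹) p) q)
                      }
                  ; assoc = λ x y z → ~-refl (assoc x y z)
                  }
              ; identity = (λ x → ~-refl (identityˡ x)) , (λ x → ~-refl (identityʳ x))
              }
          ; inverse = (λ x → ~-refl (inverseˡ x)) , (λ x → ~-refl (inverseʳ x))
          ; ⁻¹-cong = λ {x} {y} p → mem-≈ N
              (begin
                conj x (y ⁻¹ ∙ x)          ≈⟨ assoc _ _ _ ⟩
                x ∙ (y ⁻¹ ∙ x ∙ x ⁻¹)      ≈⟨ ∙-congˡ (trans (assoc _ _ _) (trans (∙-congˡ (inverseʳ x)) (identityʳ _))) ⟩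
                x ∙ y ⁻¹                   ≈⟨ ∙-congʳ (⁻¹-involutive x) ⟨
                x ⁻¹ ⁻¹ ∙ y ⁻¹             ∎)
              (mem-conj N x (~-sym p))
          }
      }

    cosets : NormalSubgroup → Setoid 0ℓ 0ℓ
    cosets H = record
      { Carrier       = Σ[ x ∈ Carrier ] mem H x
      ; _≈_           = λ a b → mem N (proj₁ a ⁻¹ ∙ proj₁ b)
      ; isEquivalence = On.isEquivalence proj₁ (Group.isEquivalence quotient)
      }

  productSubgroup : NormalSubgroup → NormalSubgroup → NormalSubgroup
  productSubgroup A B = record
    { mem      = λ x → ∃[ a ] ∃[ b ] (mem A a × mem B b × x ≈ a ∙ b)
    ; mem-≈    = λ { p (a , b , a∈ , b∈ , q) → a , b , a∈ , b∈ , trans (sym p) q }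
    ; mem-ε    = ε , ε , mem-ε A , mem-ε B , sym (identityˡ ε)
    ; mem-∙    = λ { {x} {y} (a , b , a∈ , b∈ , p) (c , d , c∈ , d∈ , q) →
        a ∙ c , conj (c ⁻¹) b ∙ d , mem-∙ A a∈ c∈ , mem-∙ B (mem-conj B (c ⁻¹) b∈) d∈ ,
        (begin
          x ∙ y                             ≈⟨ ∙-cong p q ⟩
          a ∙ b ∙ (c ∙ d)                   ≈⟨ assoc _ _ _ ⟩
          a ∙ (b ∙ (c ∙ d))                 ≈⟨ ∙-congˡ (assoc _ _ _) ⟨
          a ∙ (b ∙ c ∙ d)                   ≈⟨ ∙-congˡ (∙-congʳ (swapʳ b c)) ⟩
          a ∙ (c ∙ conj (c ⁻¹) b ∙ d)       ≈⟨ ∙-congˡ (assoc _ _ _) ⟩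
          a ∙ (c ∙ (conj (c ⁻¹) b ∙ d))     ≈⟨ assoc _ _ _ ⟨
          a ∙ c ∙ (conj (c ⁻¹) b ∙ d)       ∎) }
    ; mem-⁻¹   = λ { {x} (a , b , a∈ , b∈ , p) →
        a ⁻¹ , conj (a ⁻¹ ⁻¹) (b ⁻¹) , mem-⁻¹ A a∈ , mem-conj B _ (mem-⁻¹ B b∈) ,
        trans (⁻¹-cong p) (trans (⁻¹-anti-homo-∙ a b) (swapʳ (b ⁻¹) (a ⁻¹))) }
    ; mem-conj = λ { g {x} (a , b , a∈ , b∈ , p) →
        conj g a , conj g b , mem-conj A g a∈ , mem-conj B g b∈ ,
        trans (conj-cong g p) (sym (conj-∙ g a b)) }
    }

  -- The subgroup generated by a set, without closure.
  data ⟨_⟩ (A : Pred Carrier 0ℓ) : Carrier → Set where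
    gen  : ∀ {x} → A x → ⟨ A ⟩ x
    resp : ∀ {x y} → x ≈ y → ⟨ A ⟩ x → ⟨ A ⟩ y
    unit : ⟨ A ⟩ ε
    mul  : ∀ {x y} → ⟨ A ⟩ x → ⟨ A ⟩ y → ⟨ A ⟩ (x ∙ y)
    invs : ∀ {x} → ⟨ A ⟩ x → ⟨ A ⟩ (x ⁻¹)

  ConjInvariant : Pred Carrier 0ℓ → Set
  ConjInvariant A = ∀ g {x} → A x → A (conj g x)

  generated : (A : Pred Carrier 0ℓ) → ConjInvariant A → NormalSubgroup
  generated A inv = record
    { mem = ⟨ A ⟩ ; mem-≈ = resp ; mem-ε = unit ; mem-∙ = mul ; mem-⁻¹ = invs ; mem-conj = go }
    where
    go : ConjInvariant ⟨ A ⟩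
    go g (gen a)     = gen (inv g a)
    go g (resp p a)  = resp (conj-cong g p) (go g a)
    go g unit        = resp (sym (conj-ε g)) unit
    go g (mul a b)   = resp (conj-∙ g _ _) (mul (go g a) (go g b))
    go g (invs a)    = resp (conj-⁻¹ g _) (invs (go g a))

  open RawMonoidDefs rawMonoid using () renaming (_×_ to pow)

  -- pow k x is the k-th power of x.
  Powers : NormalSubgroup → ℕ → Pred Carrier 0ℓ
  Powers H k y = ∃[ x ] (mem H x × y ≈ pow k x)

  ⁅_,_⁆ : Carrier → Carrier → Carrier
  ⁅ x , y ⁆ = x ⁻¹ ∙ y ⁻¹ ∙ (x ∙ y)

  Commutators : NormalSubgroup → NormalSubgroup → Pred Carrier 0ℓ
  Commutators H K z = ∃[ x ] ∃[ y ] (mem H x × mem K y × z ≈ ⁅ x , y ⁆)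

  Powers-conj : ∀ H k → ConjInvariant (Powers H k)
  Powers-conj H k g (x , x∈ , p) =
    conj g x , mem-conj H g x∈ , trans (conj-cong g p) (go k)
    where
    go : ∀ k → conj g (pow k x) ≈ pow k (conj g x)
    go zero    = conj-ε g
    go (suc k) = trans (sym (conj-∙ g _ _)) (∙-congˡ (go k))

  Commutators-conj : ∀ H K → ConjInvariant (Commutators H K)
  Commutators-conj H K g (x , y , x∈ , y∈ , p) =
    conj g x , conj g y , mem-conj H g x∈ , mem-conj K g y∈ ,
    trans (conj-cong g p) (sym (begin
      conj g x ⁻¹ ∙ conj g y ⁻¹ ∙ (conj g x ∙ conj g y)
        ≈⟨ ∙-cong (∙-cong (conj-⁻¹ g x) (conj-⁻¹ g y)) (conj-∙ g x y) ⟩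
      conj g (x ⁻¹) ∙ conj g (y ⁻¹) ∙ conj g (x ∙ y)
        ≈⟨ ∙-congʳ (conj-∙ g _ _) ⟩
      conj g (x ⁻¹ ∙ y ⁻¹) ∙ conj g (x ∙ y)
        ≈⟨ conj-∙ g _ _ ⟩
      conj g ⁅ x , y ⁆ ∎))

GroupIsomorphic : Group 0ℓ 0ℓ → Group 0ℓ 0ℓ → Set
GroupIsomorphic A B = Σ (Group.Carrier A → Group.Carrier B) IsGroupIsomorphism
  where open GroupMorphisms (Group.rawGroup A) (Group.rawGroup B)

ℤ-group : Group 0ℓ 0ℓ
ℤ-group = AbelianGroup.group ℤ.+-0-abelianGroup

multiplesOf : ℕ → NormalSubgroup ℤ-group
multiplesOf N = record
  { mem      = (+ N) ℤ.∣_
  ; mem-≈    = λ { ≡.refl p → p }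
  ; mem-ε    = ℤ.divides (+ 0) ≡.refl
  ; mem-∙    = ℤ.∣m∣n⇒∣m+n
  ; mem-⁻¹   = ℤ.∣m⇒∣-m
  ; mem-conj = λ g {x} p → ≡.subst ((+ N) ℤ.∣_) (≡.sym (conj-trivial g x)) p
  }
  where
  conj-trivial : ∀ g x → g ℤ.+ x ℤ.+ (ℤ.- g) ≡ x
  conj-trivial g x = ≡.trans (≡.cong (ℤ._+ (ℤ.- g)) (ℤ.+-comm g x))
    (≡.trans (ℤ.+-assoc x g (ℤ.- g))
    (≡.trans (≡.cong (λ y → x ℤ.+ y) (ℤ.+-inverseʳ g)) (ℤ.+-identityʳ x)))

ℤ/_ : ℕ → Group 0ℓ 0ℓ
ℤ/ N = quotient ℤ-group (multiplesOf N)

-- An inverse system of finite ℓ-groups over a directed set; the pro-ℓ group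
-- itself is its limit, Pro.limit below.
record ProGroup (ℓ : ℕ) : Set₁ where
  field
    index : Preorder 0ℓ 0ℓ 0ℓ
  open Preorder index public using (_≲_) renaming (Carrier to I)
  field
    inhabited : I
    directed  : ∀ i j → ∃[ k ] (i ≲ k × j ≲ k)
    grp       : I → Group 0ℓ 0ℓ
    ℓ-group   : ∀ i → ∃[ r ] HasSize (Group.setoid (grp i)) (ℓ ℕ.^ r)
    res       : ∀ {i j} → i ≲ j → Group.Carrier (grp j) → Group.Carrier (grp i)
    res-hom : ∀ {i j} (p : i ≲ j) →
      GroupMorphisms.IsGroupHomomorphism (Group.rawGroup (grp j)) (Group.rawGroup (grp i)) (res p)
    res-id  : ∀ {i} (p : i ≲ i) x → Group._≈_ (grp i) (res p x) x
    res-∘   : ∀ {i j k} (p : i ≲ j) (q : j ≲ k) (r : i ≲ k) x →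
      Group._≈_ (grp i) (res p (res q x)) (res r x)

module Pro {ℓ : ℕ} (𝒢 : ProGroup ℓ) where
  open ProGroup 𝒢

  private
    module P i = Group (grp i)
    module H {i} {j} (p : i ≲ j) = GroupMorphisms.IsGroupHomomorphism (res-hom p)

  record Thread : Set where
    field
      at  : ∀ i → P.Carrier i
      coh : ∀ {i j} (p : i ≲ j) → P._≈_ i (res p (at j)) (at i)

  open Thread public

  limit : Group 0ℓ 0ℓ
  limit = record
    { Carrier = Thread
    ; _≈_ = λ x y → ∀ i → P._≈_ i (at x i) (at y i)
    ; _∙_ = λ x y → record
        { at  = λ i → P._∙_ i (at x i) (at y i)
        ; coh = λ {i} p → P.trans i (H.homo p _ _) (P.∙-cong i (coh x p) (coh y p)) }
    ; ε   = record { at = P.ε ; coh = λ p → H.ε-homo p }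
    ; _⁻¹ = λ x → record
        { at  = λ i → P._⁻¹ i (at x i)
        ; coh = λ {i} p → P.trans i (H.⁻¹-homo p _) (P.⁻¹-cong i (coh x p)) }
    ; isGroup = record
        { isMonoid = record
            { isSemigroup = record
                { isMagma = record
                    { isEquivalence = record
                        { refl  = λ i → P.refl i
                        ; sym   = λ p i → P.sym i (p i)
                        ; trans = λ p q i → P.trans i (p i) (q i)
                        }
                    ; ∙-cong = λ p q i → P.∙-cong i (p i) (q i)
                    }
                ; assoc = λ x y z i → P.assoc i _ _ _
                }
            ; identity = (λ x i → P.identityˡ i _) , (λ x i → P.identityʳ i _)
            }
        ; inverse = (λ x i → P.inverseˡ i _) , (λ x i → P.inverseʳ i _)
        ; ⁻¹-cong = λ p i → P.⁻¹-cong i (p i)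
        }
    }

  open Group limit public using (Carrier; _≈_; setoid)

  -- The sets { h | at h i ≈ at g i } form a base of neighbourhoods of g,
  -- because the index set is directed.
  closure : Pred Carrier 0ℓ → Pred Carrier 0ℓ
  closure A g = ∀ i → Σ[ a ∈ Carrier ] (A a × P._≈_ i (at a i) (at g i))

  Subgrp : Set₁
  Subgrp = NormalSubgroup limit

  open NormalSubgroup

  closureSubgroup : Subgrp → Subgrp
  closureSubgroup N = record
    { mem      = closure (mem N)
    ; mem-≈    = λ p c i → let (a , a∈ , q) = c i in a , a∈ , P.trans i q (p i)
    ; mem-ε    = λ i → Group.ε limit , mem-ε N , P.refl i
    ; mem-∙    = λ c c′ i → let (a , a∈ , q) = c i ; (b , b∈ , r) = c′ i
                           in Group._∙_ limit a b , mem-∙ N a∈ b∈ , P.∙-cong i q r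
    ; mem-⁻¹   = λ c i → let (a , a∈ , q) = c i
                         in Group._⁻¹ limit a , mem-⁻¹ N a∈ , P.⁻¹-cong i q
    ; mem-conj = λ g c i → let (a , a∈ , q) = c i
                           in conj limit g a , mem-conj N g a∈ , P.∙-congʳ i (P.∙-congˡ i q)
    }

  -- H^k and [H, K], as closed subgroups.
  powerSubgroup : Subgrp → ℕ → Subgrp
  powerSubgroup H k = closureSubgroup (generated limit (Powers limit H k) (Powers-conj limit H k))

  commutatorSubgroup : Subgrp → Subgrp → Subgrp
  commutatorSubgroup H K =
    closureSubgroup (generated limit (Commutators limit H K) (Commutators-conj limit H K))

  -- lower n is G_n.  The product of two closed normal subgroups is closed.
  lower : ℕ → Subgrp
  lower zero    = whole limit
  lower (suc n) = productSubgroup limit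
    (powerSubgroup (lower n) ℓ) (commutatorSubgroup (lower n) (whole limit))

  infix 8 _/lower_
  _/lower_ : Subgrp → ℕ → Setoid 0ℓ 0ℓ
  H /lower n = cosets limit (lower n) H

  TopologicallyGenerate : ∀ {k} → (Fin k → Carrier) → Set
  TopologicallyGenerate g = ∀ x → closure (⟨_⟩ limit (λ y → ∃[ i ] y ≈ g i)) x

  record IsUniform : Set where
    field
      finitelyGenerated : ∃[ k ] Σ[ g ∈ (Fin k → Carrier) ] TopologicallyGenerate g
      powerful-odd : ¬ (2 ℕ.∣ ℓ) →
        mem (commutatorSubgroup (whole limit) (whole limit)) ⊆ mem (powerSubgroup (whole limit) ℓ)
      powerful-2 : ℓ ≡ 2 →
        mem (commutatorSubgroup (whole limit) (whole limit)) ⊆ mem (powerSubgroup (whole limit) 4)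
      -- [G_n : G_{n+1}] = [G : G_1], as an equality of cardinalities
      indices : ∀ n → 1 ℕ.≤ n → Inverse (lower n /lower suc n) (whole limit /lower 1)

  HasDimension : ℕ → Set
  HasDimension d = (1 ℕ.≤ d) × HasSize (whole limit /lower 1) (ℓ ℕ.^ d)

-- A set S = {s_1, …, s_size}, enumerated without repetition.
record Orientation (X : Graph) : Set where
  open Graph X
  field
    size     : ℕ
    s        : Fin size → ∣ E ∣
    distinct : ∀ i j → s i ≈ᴱ s j → i ≡ j
    disjoint : ∀ i j → ¬ (s i ≈ᴱ (inv ⟨$⟩ s j))
    covers   : ∀ e → ∃[ i ] (e ≈ᴱ s i ⊎ e ≈ᴱ (inv ⟨$⟩ s i))

Voltage : ∀ {X} → Orientation X → Group 0ℓ 0ℓ → Set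
Voltage S H = Fin (Orientation.size S) → Group.Carrier H

module _ {X : Graph} (S : Orientation X) (H : Group 0ℓ 0ℓ) (α : Voltage S H) where
  open Graph X
  open Orientation S
  private
    module H = Group H
    open GroupProperties H using (⁻¹-involutive)

    Cov : ∣ E ∣ → Set
    Cov e = ∃[ i ] (e ≈ᴱ s i ⊎ e ≈ᴱ (inv ⟨$⟩ s i))

    value : ∀ {e} → Cov e → H.Carrier
    value (i , inj₁ _) = α i
    value (i , inj₂ _) = α i H.⁻¹

    inv-swap : ∀ {e e′} → (inv ⟨$⟩ e) ≈ᴱ e′ → e ≈ᴱ (inv ⟨$⟩ e′)
    inv-swap p = E.trans (E.sym (inv-inv _)) (Func.cong inv p)

    inv-injective : ∀ {e e′} → (inv ⟨$⟩ e) ≈ᴱ (inv ⟨$⟩ e′) → e ≈ᴱ e′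
    inv-injective p = E.trans (inv-swap p) (inv-inv _)

    same : ∀ {i j} → s i ≈ᴱ s j → α i H.≈ α j
    same p = H.reflexive (≡.cong α (distinct _ _ p))

    value-cong : ∀ {e e′} → e ≈ᴱ e′ → (c : Cov e) (c′ : Cov e′) → value c H.≈ value c′
    value-cong p (i , inj₁ q) (j , inj₁ r) = same (E.trans (E.sym q) (E.trans p r))
    value-cong p (i , inj₁ q) (j , inj₂ r) =
      ⊥-elim (disjoint i j (E.trans (E.sym q) (E.trans p r)))
    value-cong p (i , inj₂ q) (j , inj₁ r) =
      ⊥-elim (disjoint j i (E.trans (E.sym r) (E.trans (E.sym p) q)))
    value-cong p (i , inj₂ q) (j , inj₂ r) =
      H.⁻¹-cong (same (inv-injective (E.trans (E.sym q) (E.trans p r))))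

    value-inv : ∀ {e} (c : Cov e) (c′ : Cov (inv ⟨$⟩ e)) → value c′ H.≈ value c H.⁻¹
    value-inv (i , inj₁ q) c′ =
      value-cong {e′ = inv ⟨$⟩ s i} (Func.cong inv q) c′ (i , inj₂ E.refl)
    value-inv (i , inj₂ q) c′ = H.trans
      (value-cong {e′ = s i} (E.trans (Func.cong inv q) (inv-inv _)) c′ (i , inj₁ E.refl))
      (H.sym (⁻¹-involutive _))

  extend : Func E H.setoid
  extend = record { to = λ e → value (covers e)
                  ; cong = λ p → value-cong p (covers _) (covers _) }

  extend-inv : ∀ e → (extend ⟨$⟩ (inv ⟨$⟩ e)) H.≈ ((extend ⟨$⟩ e) H.⁻¹)
  extend-inv e = value-inv (covers e) (covers _)

  private
    cancel : ∀ e σ → (σ H.∙ (extend ⟨$⟩ e)) H.∙ (extend ⟨$⟩ (inv ⟨$⟩ e)) H.≈ σ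
    cancel e σ = H.trans (H.∙-congˡ (extend-inv e))
      (H.trans (H.assoc _ _ _) (H.trans (H.∙-congˡ (H.inverseʳ _)) (H.identityʳ σ)))

  -- X(H, S, α); derived-projection is (v, σ) ↦ v, (e, σ) ↦ e.
  derived : Graph
  derived = record
    { V = Pointwise.×-setoid V H.setoid
    ; E = Pointwise.×-setoid E H.setoid
    ; o = record { to = λ { (e , σ) → (o ⟨$⟩ e) , σ }
                 ; cong = λ { (p , q) → Func.cong o p , q } }
    ; t = record { to = λ { (e , σ) → (t ⟨$⟩ e) , σ H.∙ (extend ⟨$⟩ e) }
                 ; cong = λ { (p , q) → Func.cong t p , H.∙-cong q (Func.cong extend p) } }
    ; inv = record { to = λ { (e , σ) → (inv ⟨$⟩ e) , σ H.∙ (extend ⟨$⟩ e) }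
                   ; cong = λ { (p , q) → Func.cong inv p , H.∙-cong q (Func.cong extend p) } }
    ; inv-inv = λ { (e , σ) → inv-inv e , cancel e σ }
    ; inv-≉   = λ { (e , σ) (p , _) → inv-≉ e p }
    ; o-inv   = λ { (e , σ) → o-inv e , H.refl }
    ; t-inv   = λ { (e , σ) → t-inv e , cancel e σ }
    }

  derived-projection : Morphism derived X
  derived-projection = record
    { onV = record { to = proj₁ ; cong = proj₁ }
    ; onE = record { to = proj₁ ; cong = proj₁ }
    ; onE-o = λ _ → V.refl
    ; onE-t = λ _ → V.refl
    ; onE-inv = λ _ → E.refl
    }

prepend : Graph → (ℕ → Graph) → ℕ → Graph
prepend X Z zero    = X
prepend X Z (suc n) = Z n

composeDown : ∀ (Z : ℕ → Graph) → (∀ n → Morphism (Z (suc n)) (Z n)) → ∀ n → Morphism (Z n) (Z 0)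
composeDown Z f zero    = idᴹ
composeDown Z f (suc n) = composeDown Z f n ∘ᴹ f n

record Tower (ℓ : ℕ) (X : Graph) : Set₁ where
  field
    above : ℕ → Graph

  level : ℕ → Graph
  level = prepend X above

  field
    map : ∀ n → Morphism (level (suc n)) (level n)

  composite : ∀ n → Morphism (level n) X
  composite = composeDown level map

  field
    finite    : ∀ n → IsFiniteGraph (level n)
    connected : ∀ n → IsConnected (level n)
    cover     : ∀ n → IsCover (map n)
    galois    : ∀ n → 1 ℕ.≤ n → IsGalois (composite n)
    group     : ∀ n → 1 ℕ.≤ n → GroupIsomorphic (Gal (composite n)) (ℤ/ (ℓ ℕ.^ n))

module TowerGal {ℓ : ℕ} {X : Graph} (T : Tower ℓ X) where
  open Tower T

  -- Γ^(m)
  GalAt : ℕ → Group 0ℓ 0ℓ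
  GalAt m = Gal (composite m)

  -- τ is the image of σ under the natural map Γ^(m+1) → Γ^(m): it is the
  -- unique τ for which this square commutes.
  Restricts : ∀ {m} → Group.Carrier (GalAt (suc m)) → Group.Carrier (GalAt m) → Set
  Restricts {m} σ τ = map m ∘ᴹ to (proj₁ σ) ≗ᴹ to (proj₁ τ) ∘ᴹ map m

  record GalThread : Set where
    field
      at  : ∀ m → Group.Carrier (GalAt m)
      coh : ∀ m → Restricts {m} (at (suc m)) (at m)

  open GalThread public

  private
    module Γ m = Group (GalAt m)
    module L m = Graph (level m)

    mulᵀ : GalThread → GalThread → GalThread
    mulᵀ x y = record
      { at = λ m → Γ._∙_ m (at x m) (at y m)
      ; coh = λ m →
            (λ v → L.V.trans m (proj₁ (coh x m) _)
                     (Func.cong (onV (to (proj₁ (at x m)))) (proj₁ (coh y m) v)))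
          , (λ e → L.E.trans m (proj₂ (coh x m) _)
                     (Func.cong (onE (to (proj₁ (at x m)))) (proj₂ (coh y m) e)))
      }

    unitᵀ : GalThread
    unitᵀ = record { at = Γ.ε ; coh = λ m → (λ _ → L.V.refl m) , (λ _ → L.E.refl m) }

    inverseᵀ : GalThread → GalThread
    inverseᵀ x = record
      { at = λ m → Γ._⁻¹ m (at x m)
      ; coh = λ m → let σ = proj₁ (at x (suc m)) ; τ = proj₁ (at x m) in
            (λ v → L.V.trans m (L.V.sym m (proj₁ (from-to τ) _))
                     (Func.cong (onV (from τ))
                       (L.V.trans m (L.V.sym m (proj₁ (coh x m) _))
                         (Func.cong (onV (map m)) (proj₁ (to-from σ) v)))))
          , (λ e → L.E.trans m (L.E.sym m (proj₂ (from-to τ) _))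
                     (Func.cong (onE (from τ))
                       (L.E.trans m (L.E.sym m (proj₂ (coh x m) _))
                         (Func.cong (onE (map m)) (proj₂ (to-from σ) e)))))
      }

  -- Γ, the inverse limit of the Γ^(m)
  GalLimit : Group 0ℓ 0ℓ
  GalLimit = record
    { Carrier = GalThread
    ; _≈_ = λ x y → ∀ m → Γ._≈_ m (at x m) (at y m)
    ; _∙_ = mulᵀ
    ; ε   = unitᵀ
    ; _⁻¹ = inverseᵀ
    ; isGroup = record
        { isMonoid = record
            { isSemigroup = record
                { isMagma = record
                    { isEquivalence = record
                        { refl  = λ {x} m → Γ.refl m {at x m}
                        ; sym   = λ {x} {y} p m → Γ.sym m {at x m} {at y m} (p m)
                        ; trans = λ {x} {y} {z} p q m →
                            Γ.trans m {at x m} {at y m} {at z m} (p m) (q m)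
                        }
                    ; ∙-cong = λ {x} {x′} {y} {y′} p q m →
                        Γ.∙-cong m {at x m} {at x′ m} {at y m} {at y′ m} (p m) (q m)
                    }
                ; assoc = λ x y z m → Γ.assoc m (at x m) (at y m) (at z m)
                }
            ; identity = (λ x m → Γ.identityˡ m (at x m)) , (λ x m → Γ.identityʳ m (at x m))
            }
        ; inverse = (λ x m → Γ.inverseˡ m (at x m)) , (λ x m → Γ.inverseʳ m (at x m))
        ; ⁻¹-cong = λ {x} {y} p m → Γ.⁻¹-cong m {at x m} {at y m} (p m)
        }
    }

-- The identification X_m = X(Γ^(m), S, β_{/m}): isomorphisms over X carrying
-- the maps of the tower to (v, σ) ↦ (v, τ), (e, σ) ↦ (e, τ), where τ ∈ Γ^(m)
-- is the restriction of σ ∈ Γ^(m+1).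
module _ {ℓ : ℕ} {X : Graph} (T : Tower ℓ X) (S : Orientation X)
         (β : Voltage S (TowerGal.GalLimit T)) where
  open Tower T
  open TowerGal T

  β-at : ∀ m → Voltage S (GalAt m)
  β-at m i = GalThread.at (β i) m

  record IsVoltageTower : Set where
    field
      iso      : ∀ m → GraphIso (derived S (GalAt m) (β-at m)) (level m)
      iso-over : ∀ m → composite m ∘ᴹ to (iso m) ≗ᴹ derived-projection S (GalAt m) (β-at m)
      iso-mapV : ∀ m {σ τ} → Restricts {m} σ τ → ∀ v →
        Graph._≈ⱽ_ (level m) (onV (map m) ⟨$⟩ (onV (to (iso (suc m))) ⟨$⟩ (v , σ)))
                             (onV (to (iso m)) ⟨$⟩ (v , τ))
      iso-mapE : ∀ m {σ τ} → Restricts {m} σ τ → ∀ e →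
        Graph._≈ᴱ_ (level m) (onE (map m) ⟨$⟩ (onE (to (iso (suc m))) ⟨$⟩ (e , σ)))
                             (onE (to (iso m)) ⟨$⟩ (e , τ))

-- The invariants of a tower depend only on the graphs in it, here Z 0, Z 1, ….
IwasawaInvariants : ℕ → (ℕ → Graph) → ℕ → ℕ → Set
IwasawaInvariants ℓ Z μ lam =
  Σ[ ν ∈ ℤ ] ∃[ n₀ ] (∀ n → n₀ ℕ.≤ n →
    ∃[ κ ] ∃[ k ] (HasSize (SpanningTrees (Z n)) κ
                  × Ord ℓ κ k
                  × + k ≡ + (μ ℕ.* ℓ ℕ.^ n ℕ.+ lam ℕ.* n) ℤ.+ ν))

module _ {ℓ : ℕ} {X : Graph} (S : Orientation X) (𝒢 : ProGroup ℓ) (T : Tower ℓ X) where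
  open Pro 𝒢
  open TowerGal T hiding (at; coh)

  _×ᴳ_ : Group 0ℓ 0ℓ → Group 0ℓ 0ℓ → Group 0ℓ 0ℓ
  _×ᴳ_ = DirectProduct.group

  -- G^(n) × Γ^(m)
  finiteLevel : ℕ → ℕ → Group 0ℓ 0ℓ
  finiteLevel n m = quotient limit (lower n) ×ᴳ GalAt m

  toFiniteLevel : ∀ n m → Group.Carrier (limit ×ᴳ GalLimit) → Group.Carrier (finiteLevel n m)
  toFiniteLevel n m (g , x) = g , GalThread.at x m

  -- Y_{n,m}, for γ : S → G × Γ
  derivedLevel : Voltage S (limit ×ᴳ GalLimit) → ℕ → ℕ → Graph
  derivedLevel γ n m = derived S (finiteLevel n m) (toFiniteLevel n m ∘ γ)

module Submission where

-- By the matrix-tree theorem κ is read off det(L + cJ).  Over ℤ[ζ], ζ of order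
-- ℓ^m, and for a fixed base B × G^(n), this determinant of a derived graph
-- factors over the characters of the abelian voltage group, so that ℓ κ_m / κ_{m-1}
-- is the product, over the characters faithful on Γ^(m), of twisted determinants.
-- The Galois conjugates of one such determinant f have the same valuation at
-- π = ζ − 1, so ord_ℓ(κ_m) − ord_ℓ(κ_{m-1}) + 1 = v_π(f) for m large.
-- Passing from n to n + 1 multiplies the voltage group by the elementary abelian
-- G_n/G_{n+1} of order ℓ^d.  Its characters have values ≡ 1 modulo π^{ℓ^{m-1}},
-- hence none of them changes the valuation of the twisted determinant, as long as
-- it is at most m: the exponent λ_n + 1 is multiplied by ℓ^d.

open import Level using (0ℓ)
open import Algebra.Bundles using (CommutativeRing; Group; AbelianGroup)
import Algebra.Definitions.RawMonoid
open import Data.Nat.Base as ℕ using (ℕ; zero; suc)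
open import Data.Nat.Primality using (Prime; ¬prime[0]; ¬prime[1])
open import Data.Product.Base using (_×_; _,_)
open import Relation.Binary.Bundles using (Setoid)
open import Relation.Binary.PropositionalEquality using (_≡_; cong)
open import Relation.Nullary.Negation using (¬_; contradiction)
open import Defs using (Graph; Orientation; IsFiniteGraph; ProGroup; Voltage; module Pro; Tower; module TowerGal; IsConnected; derivedLevel; IwasawaInvariants; NormalSubgroup; ⁅_,_⁆)

-- `G` need not be abelian, so `G^(n)` stays in the base graph and only the fibre G_n/G_{n+1} ×
-- Γ^(m) is diagonalised. This works because G_n/G_{n+1} is central in G/G_{n+1}: right
-- multiplication then translates fibres, by an amount that depends on the point of the base. Level
-- n is the same lift with a fibre factor of rank 0, which is how one twisted determinant f serves
-- both levels. The only congruence used is that ζ^(ℓ^(m-1)) - 1 is divisible by π^m. It suffices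
-- because μ_n = 0 makes v_π(f) equal to λ_n + 1, which is less than m for large m. No valuation
-- beyond π^m is computed, and the formulas at successive m then force μ_{n+1} = 0. ℤ[ζ] is realised
-- by polynomial expressions acting on integer sequences that satisfy the cyclotomic recurrence.
-- Equality is equality of integer values, so nonzero integers cancel, and so do the divisors of ℓ.
-- Finally, the isomorphisms Γ^(m) ≅ ℤ/ℓ^m need not be compatible for different m; rescaling by
-- units aligns them so that each voltage has the same exponent at both levels.

-- Integer coefficients in a commutative ring

module RingKit (R : CommutativeRing 0ℓ 0ℓ) where
  open CommutativeRing R
  open import Algebra.Properties.Ring ring using (-‿distribˡ-*; -‿distribʳ-*; -‿+-comm; -‿involutive; -0#≈0#)
  open import Algebra.Properties.Semiring.Mult.TCOptimised semiring using (×-homo-+; ×1-homo-*; 1+×) renaming (_×_ to _⊠_)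
  open import Algebra.Properties.Semiring.Sum semiring public
    using (sum; sum-cong-≋; ∑-distrib-+; ∑-comm; *-distribˡ-sum; *-distribʳ-sum; sum-remove; sum-replicate-zero)
  open import Algebra.Solver.Ring.AlmostCommutativeRing using (fromCommutativeRing; _-Raw-AlmostCommutative⟶_)
  open import Data.Integer.Base as ℤ using (ℤ; +_; -[1+_])
  import Data.Integer.Properties as ℤ
  open import Data.Maybe.Base using (Maybe; just; nothing)
  open import Relation.Nullary.Decidable using (yes; no)
  import Relation.Binary.PropositionalEquality as ≡
  open import Relation.Binary.Reasoning.Setoid setoid

  infix 20 ⟪_⟫

  fromℕ : ℕ → Carrier
  fromℕ n = n ⊠ 1#

  fromℕ-suc : ∀ n → fromℕ (suc n) ≈ 1# + fromℕ n
  fromℕ-suc n = 1+× n 1#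

  -- The homomorphism from ℤ that serves as coefficient map of the ring solver: coefficients are
  -- compared in ℤ, so identities are checked even in rings whose own equality is not decidable.
  ⟪_⟫ : ℤ → Carrier
  ⟪ + n ⟫      = fromℕ n
  ⟪ -[1+ n ] ⟫ = - fromℕ (suc n)

  private
    cancel-1 : ∀ a b → (1# + a) + - (1# + b) ≈ a + - b
    cancel-1 a b = begin
      (1# + a) + - (1# + b)     ≈⟨ +-congˡ (-‿+-comm 1# b) ⟨
      (1# + a) + (- 1# + - b)   ≈⟨ +-congʳ (+-comm 1# a) ⟩
      (a + 1#) + (- 1# + - b)   ≈⟨ +-assoc a 1# _ ⟩
      a + (1# + (- 1# + - b))   ≈⟨ +-congˡ (+-assoc 1# _ _) ⟨
      a + ((1# + - 1#) + - b)   ≈⟨ +-congˡ (+-congʳ (-‿inverseʳ 1#)) ⟩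
      a + (0# + - b)            ≈⟨ +-congˡ (+-identityˡ _) ⟩
      a + - b                   ∎

    ⟪⊖⟫ : ∀ m n → ⟪ m ℤ.⊖ n ⟫ ≈ fromℕ m + - fromℕ n
    ⟪⊖⟫ zero    zero    = sym (trans (+-congˡ -0#≈0#) (+-identityˡ 0#))
    ⟪⊖⟫ zero    (suc n) = sym (+-identityˡ _)
    ⟪⊖⟫ (suc m) zero    = sym (trans (+-congˡ -0#≈0#) (+-identityʳ _))
    ⟪⊖⟫ (suc m) (suc n) = begin
      ⟪ suc m ℤ.⊖ suc n ⟫                 ≡⟨ ≡.cong ⟪_⟫ (ℤ.[1+m]⊖[1+n]≡m⊖n m n) ⟩
      ⟪ m ℤ.⊖ n ⟫                         ≈⟨ ⟪⊖⟫ m n ⟩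
      fromℕ m + - fromℕ n                 ≈⟨ cancel-1 _ _ ⟨
      1# + fromℕ m + - (1# + fromℕ n)     ≈⟨ +-cong (fromℕ-suc m) (-‿cong (fromℕ-suc n)) ⟨
      fromℕ (suc m) + - fromℕ (suc n)     ∎

  ⟪⟫-+ : ∀ x y → ⟪ x ℤ.+ y ⟫ ≈ ⟪ x ⟫ + ⟪ y ⟫
  ⟪⟫-+ (+ m)      (+ n)      = ×-homo-+ 1# m n
  ⟪⟫-+ (+ m)      (-[1+ n ]) = ⟪⊖⟫ m (suc n)
  ⟪⟫-+ (-[1+ m ]) (+ n)      = trans (⟪⊖⟫ n (suc m)) (+-comm _ _)
  ⟪⟫-+ (-[1+ m ]) (-[1+ n ]) = begin
    - fromℕ (suc (suc (m ℕ.+ n)))       ≡⟨ ≡.cong (λ k → - fromℕ (suc k)) (≡.sym (ℕ-+-suc m n)) ⟩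
    - fromℕ (suc m ℕ.+ suc n)           ≈⟨ -‿cong (×-homo-+ 1# (suc m) (suc n)) ⟩
    - (fromℕ (suc m) + fromℕ (suc n))   ≈⟨ -‿+-comm _ _ ⟨
    - fromℕ (suc m) + - fromℕ (suc n)   ∎
    where open import Data.Nat.Properties using () renaming (+-suc to ℕ-+-suc)

  ⟪⟫-neg : ∀ x → ⟪ ℤ.- x ⟫ ≈ - ⟪ x ⟫
  ⟪⟫-neg (+ zero)    = sym -0#≈0#
  ⟪⟫-neg (+ suc n)   = refl
  ⟪⟫-neg (-[1+ n ])  = sym (-‿involutive _)

  private
    ⟪⟫-*⁺ : ∀ m y → ⟪ + m ℤ.* y ⟫ ≈ ⟪ + m ⟫ * ⟪ y ⟫
    ⟪⟫-*⁺ m (+ n) = trans (reflexive (≡.cong ⟪_⟫ (≡.sym (ℤ.pos-* m n)))) (×1-homo-* m n)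
    ⟪⟫-*⁺ m (-[1+ n ]) = begin
      ⟪ + m ℤ.* ℤ.- (+ suc n) ⟫       ≡⟨ ≡.cong ⟪_⟫ (≡.sym (ℤ.neg-distribʳ-* (+ m) (+ suc n))) ⟩
      ⟪ ℤ.- (+ m ℤ.* + suc n) ⟫       ≈⟨ ⟪⟫-neg (+ m ℤ.* + suc n) ⟩
      - ⟪ + m ℤ.* + suc n ⟫           ≈⟨ -‿cong (⟪⟫-*⁺ m (+ suc n)) ⟩
      - (⟪ + m ⟫ * ⟪ + suc n ⟫)       ≈⟨ -‿distribʳ-* _ _ ⟩
      ⟪ + m ⟫ * - ⟪ + suc n ⟫         ∎

  ⟪⟫-* : ∀ x y → ⟪ x ℤ.* y ⟫ ≈ ⟪ x ⟫ * ⟪ y ⟫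
  ⟪⟫-* (+ m) y = ⟪⟫-*⁺ m y
  ⟪⟫-* (-[1+ m ]) y = begin
    ⟪ ℤ.- (+ suc m) ℤ.* y ⟫     ≡⟨ ≡.cong ⟪_⟫ (≡.sym (ℤ.neg-distribˡ-* (+ suc m) y)) ⟩
    ⟪ ℤ.- (+ suc m ℤ.* y) ⟫     ≈⟨ ⟪⟫-neg (+ suc m ℤ.* y) ⟩
    - ⟪ + suc m ℤ.* y ⟫         ≈⟨ -‿cong (⟪⟫-*⁺ (suc m) y) ⟩
    - (⟪ + suc m ⟫ * ⟪ y ⟫)     ≈⟨ -‿distribˡ-* _ _ ⟩
    - ⟪ + suc m ⟫ * ⟪ y ⟫       ∎

  ⟪⟫-0 : ⟪ + 0 ⟫ ≈ 0#
  ⟪⟫-0 = refl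

  ⟪⟫-1 : ⟪ + 1 ⟫ ≈ 1#
  ⟪⟫-1 = refl

  private
    ⟪⟫-hom : ℤ.+-*-rawRing -Raw-AlmostCommutative⟶ fromCommutativeRing R
    ⟪⟫-hom = record { ⟦_⟧ = ⟪_⟫ ; +-homo = ⟪⟫-+ ; *-homo = ⟪⟫-* ; -‿homo = ⟪⟫-neg
                    ; 0-homo = ⟪⟫-0 ; 1-homo = ⟪⟫-1 }

    _coeff≟_ : ∀ x y → Maybe (⟪ x ⟫ ≈ ⟪ y ⟫)
    x coeff≟ y with x ℤ.≟ y
    ... | yes p = just (reflexive (≡.cong ⟪_⟫ p))
    ... | no _  = nothing

  open import Algebra.Solver.Ring ℤ.+-*-rawRing (fromCommutativeRing R) ⟪⟫-hom _coeff≟_ public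
    using (solve; _:=_; _:+_; _:*_; _:-_; :-_; con)

-- Alternating forms and the determinant

module Determinant (R : CommutativeRing 0ℓ 0ℓ) where
  open CommutativeRing R hiding (zero)
  open RingKit R
  open import Data.Integer.Base using (+_)
  open import Data.Fin.Base using (Fin; zero; suc)
  open import Data.Unit.Base using (⊤; tt)
  open import Data.Vec.Functional using (_∷_; tail)
  open import Function.Base using (_∘_)
  open import Relation.Binary.Reasoning.Setoid setoid

  Row : ℕ → Set
  Row m = Fin m → Carrier

  Rows : ℕ → ℕ → Set
  Rows n m = Fin n → Row m

  Form : ℕ → ℕ → Set
  Form n m = Rows n m → Carrier

  infix 4 _≋_ _≋≋_
  _≋_ : ∀ {m} → Row m → Row m → Set
  x ≋ y = ∀ i → x i ≈ y i

  _≋≋_ : ∀ {n m} → Rows n m → Rows n m → Set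
  M ≋≋ N = ∀ i → M i ≋ N i

  infixr 6 _⊙_⊕_
  _⊙_⊕_ : ∀ {m} → Carrier → Row m → Row m → Row m
  (a ⊙ x ⊕ y) i = a * x i + y i

  ∷-≋ : ∀ {n m} {x y : Row m} {M N : Rows n m} → x ≋ y → M ≋≋ N → (x ∷ M) ≋≋ (y ∷ N)
  ∷-≋ p q zero    = p
  ∷-≋ p q (suc i) = q i

  ≋≋-refl : ∀ {n m} {M : Rows n m} → M ≋≋ M
  ≋≋-refl i j = refl

  η : ∀ {n m} (M : Rows (suc n) m) → M ≋≋ (M zero ∷ (λ i → M (suc i)))
  η M zero    j = refl
  η M (suc i) j = refl

  Alternates : ∀ {m} n → Form (suc n) m → Set
  Alternates zero    D = ⊤
  Alternates (suc n) D = ∀ x M → D (x ∷ x ∷ M) ≈ 0#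

  -- Multilinear in the rows and zero whenever two adjacent rows agree, phrased
  -- one row at a time.
  data Alternating {m} : ∀ {n} → Form n m → Set where
    nil  : {D : Form 0 m} → (∀ {M N} → D M ≈ D N) → Alternating D
    cons : ∀ {n} {D : Form (suc n) m} →
      (∀ {M N} → M ≋≋ N → D M ≈ D N) →
      (∀ a x y M → D ((a ⊙ x ⊕ y) ∷ M) ≈ a * D (x ∷ M) + D (y ∷ M)) →
      Alternates n D →
      (∀ x → Alternating (λ M → D (x ∷ M))) →
      Alternating D

  module _ {m : ℕ} where
    D-cong : ∀ {n} {D : Form n m} → Alternating D → ∀ {M N} → M ≋≋ N → D M ≈ D N
    D-cong (nil c)        p = c
    D-cong (cons c _ _ _) p = c p

    D-lin : ∀ {n} {D : Form (suc n) m} → Alternating D →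
      ∀ a x y M → D ((a ⊙ x ⊕ y) ∷ M) ≈ a * D (x ∷ M) + D (y ∷ M)
    D-lin (cons _ l _ _) = l

    D-alt : ∀ {n} {D : Form (suc (suc n)) m} → Alternating D → ∀ x M → D (x ∷ x ∷ M) ≈ 0#
    D-alt (cons _ _ a _) = a

    D-tail : ∀ {n} {D : Form (suc n) m} → Alternating D → ∀ x → Alternating (λ M → D (x ∷ M))
    D-tail (cons _ _ _ t) = t

  -- Needed because fixing the first row of `wedge D` leaves a combination of two alternating forms.
  combination : ∀ {n m} {D D₁ D₂ : Form n m} → ∀ a b → Alternating D₁ → Alternating D₂ →
    (∀ M → D M ≈ a * D₁ M + b * D₂ M) → Alternating D
  combination a b (nil c₁) (nil c₂) p =
    nil (λ {M} {N} → trans (p M) (trans (+-cong (*-congˡ c₁) (*-congˡ c₂)) (sym (p N))))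
  combination {suc n} {m} {D} {D₁} {D₂} a b A₁@(cons c₁ l₁ a₁ t₁) A₂@(cons c₂ l₂ a₂ t₂) p = cons
    (λ {M} {N} q → trans (p M) (trans (+-cong (*-congˡ (c₁ q)) (*-congˡ (c₂ q))) (sym (p N))))
    (λ k x y M → trans (p _) (trans (+-cong (*-congˡ (l₁ k x y M)) (*-congˡ (l₂ k x y M)))
      (trans (solve 7 (λ a b k u v w z → a :* (k :* u :+ v) :+ b :* (k :* w :+ z)
                        := k :* (a :* u :+ b :* w) :+ (a :* v :+ b :* z)) refl a b k _ _ _ _)
      (+-cong (*-congˡ (sym (p _))) (sym (p _))))))
    (alt n a₁ a₂ p)
    (λ x → combination a b (t₁ x) (t₂ x) (λ M → p (x ∷ M)))
    where
    alt : ∀ n {D D₁ D₂ : Form (suc n) m} → Alternates n D₁ → Alternates n D₂ →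
          (∀ M → D M ≈ a * D₁ M + b * D₂ M) → Alternates n D
    alt zero    _  _  _ = tt
    alt (suc n) a₁ a₂ p x M = trans (p _) (trans (+-cong (*-congˡ (a₁ x M)) (*-congˡ (a₂ x M)))
      (solve 2 (λ a b → a :* con (+ 0) :+ b :* con (+ 0) := con (+ 0)) refl a b))

  record IsLinear {m m′} (T : Row m → Row m′) : Set where
    field
      T-cong : ∀ {x y} → x ≋ y → T x ≋ T y
      T-lin  : ∀ a x y → T (a ⊙ x ⊕ y) ≋ a ⊙ T x ⊕ T y
  open IsLinear

  map-∷ : ∀ {n m m′} (T : Row m → Row m′) x (M : Rows n m) → T ∘ (x ∷ M) ≋≋ T x ∷ (T ∘ M)
  map-∷ T x M zero    j = refl
  map-∷ T x M (suc i) j = refl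

  precompose : ∀ {n m m′} {T : Row m → Row m′} → IsLinear T → {D : Form n m′} {D′ : Form n m} →
    Alternating D → (∀ M → D′ M ≈ D (T ∘ M)) → Alternating D′
  precompose lin (nil c) p = nil (λ {M} {N} → trans (p M) (trans c (sym (p N))))
  precompose {suc n} {m} {m′} {T} lin {D} {D′} A@(cons c l a t) p = cons
    (λ {M} {N} q → trans (p M) (trans (c (λ i → T-cong lin (q i))) (sym (p N))))
    (λ k x y M → begin
       D′ ((k ⊙ x ⊕ y) ∷ M)                          ≈⟨ p₁ _ M ⟩
       D (T (k ⊙ x ⊕ y) ∷ (T ∘ M))                   ≈⟨ c (∷-≋ (T-lin lin k x y) ≋≋-refl) ⟩
       D ((k ⊙ T x ⊕ T y) ∷ (T ∘ M))                 ≈⟨ l k (T x) (T y) (T ∘ M) ⟩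
       k * D (T x ∷ (T ∘ M)) + D (T y ∷ (T ∘ M))     ≈⟨ +-cong (*-congˡ (p₁ x M)) (p₁ y M) ⟨
       k * D′ (x ∷ M) + D′ (y ∷ M)                   ∎)
    (alt n c a p)
    (λ x → precompose lin (t (T x)) (p₁ x))
    where
    p₁ : ∀ x M → D′ (x ∷ M) ≈ D (T x ∷ (T ∘ M))
    p₁ x M = trans (p _) (c (map-∷ T x M))
    alt : ∀ n {D : Form (suc n) m′} {D′ : Form (suc n) m} → (∀ {M N} → M ≋≋ N → D M ≈ D N) →
          Alternates n D → (∀ M → D′ M ≈ D (T ∘ M)) → Alternates n D′
    alt zero    c a p = tt
    alt (suc n) c a p x M = trans (p _) (trans (c λ { zero j → refl ; (suc zero) j → refl ; (suc (suc i)) j → refl }) (a (T x) (T ∘ M)))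

  -- The exterior product of the zeroth coordinate with D, evaluated on the
  -- remaining coordinates: cofactor expansion along the first column.
  wedge : ∀ {n m} → Form n m → Form (suc n) (suc m)
  wedge {zero}  D M = M zero zero * D (λ i → tail (M (suc i)))
  wedge {suc n} D M = M zero zero * D (λ i → tail (M (suc i)))
                    - wedge (λ N → D (tail (M zero) ∷ N)) (λ i → M (suc i))

  wedge-cong : ∀ {n m} {D D′ : Form n m} → (∀ {M N} → M ≋≋ N → D M ≈ D′ N) →
    ∀ {M N} → M ≋≋ N → wedge D M ≈ wedge D′ N
  wedge-cong {zero}  p q = *-cong (q zero zero) (p (λ i j → q (suc i) (suc j)))
  wedge-cong {suc n} p q = +-cong (*-cong (q zero zero) (p (λ i j → q (suc i) (suc j))))
    (-‿cong (wedge-cong (λ r → p (∷-≋ (λ j → q zero (suc j)) r)) (λ i → q (suc i))))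

  wedge-lin : ∀ {n m} {D D₁ D₂ : Form n m} a → (∀ N → D N ≈ a * D₁ N + D₂ N) →
    ∀ M → wedge D M ≈ a * wedge D₁ M + wedge D₂ M
  wedge-lin {zero} a p M = trans (*-congˡ (p _))
    (solve 4 (λ a m x y → m :* (a :* x :+ y) := a :* (m :* x) :+ m :* y) refl a _ _ _)
  wedge-lin {suc n} a p M = trans (+-cong (*-congˡ (p _)) (-‿cong (wedge-lin {n} a (λ N → p (_ ∷ N)) _)))
    (solve 6 (λ a m x y u v → m :* (a :* x :+ y) :- (a :* u :+ v)
        := a :* (m :* x :- u) :+ (m :* y :- v)) refl a _ _ _ _ _)

  wedge-scale : ∀ {n m} {D D₁ : Form n m} a → (∀ N → D N ≈ a * D₁ N) →
    ∀ M → wedge D M ≈ a * wedge D₁ M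
  wedge-scale {zero} a p M = trans (*-congˡ (p _))
    (solve 3 (λ a m x → m :* (a :* x) := a :* (m :* x)) refl a _ _)
  wedge-scale {suc n} a p M = trans (+-cong (*-congˡ (p _)) (-‿cong (wedge-scale {n} a (λ N → p (_ ∷ N)) _)))
    (solve 4 (λ a m x u → m :* (a :* x) :- a :* u := a :* (m :* x :- u)) refl a _ _ _)

  wedge-zero : ∀ {n m} {D : Form n m} → (∀ N → D N ≈ 0#) → ∀ M → wedge D M ≈ 0#
  wedge-zero {D = D} p M = trans (wedge-scale {D₁ = D} 0# (λ N → trans (p N) (sym (zeroˡ _))) M) (zeroˡ _)

  wedge-column-zero : ∀ {n m} (D : Form n m) M → (∀ i → M i zero ≈ 0#) → wedge D M ≈ 0#
  wedge-column-zero {zero}  D M p = trans (*-congʳ (p zero)) (zeroˡ _)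
  wedge-column-zero {suc n} D M p = trans (+-cong (trans (*-congʳ (p zero)) (zeroˡ _))
    (-‿cong (wedge-column-zero {n} _ _ (λ i → p (suc i))))) (-‿inverseʳ 0#)

  -- Fixing the first row x leaves `x zero` times D on the tails minus the wedge of D with first row
  -- `tail x`; both are alternating, by induction on the number of rows. If the first two rows
  -- agree, the two leading terms cancel and the remaining one evaluates D on two equal rows.
  wedge-alternating : ∀ {n m} {D : Form n m} → Alternating D → Alternating (wedge D)
  wedge-alternating {zero} A@(nil c) = cons
    (λ p → *-cong (p zero zero) c)
    (λ a x y M → solve 4 (λ a u v d → (a :* u :+ v) :* d := a :* (u :* d) :+ v :* d) refl a _ _ _)
    tt
    (λ x → nil (*-congˡ c))
  wedge-alternating {suc n} {m} {D} A@(cons c l a t) = cons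
    (λ q → wedge-cong c q)
    (λ k x y M → trans (+-congˡ (-‿cong (wedge-lin k (λ N → l k (tail x) (tail y) N) M)))
      (solve 6 (λ k x y d u v → (k :* x :+ y) :* d :- (k :* u :+ v)
          := k :* (x :* d :- u) :+ (y :* d :- v)) refl k _ _ _ _ _))
    (λ x M → alt x M)
    (λ x → combination (x zero) (- 1#)
       (precompose tail-linear A (λ _ → refl)) (wedge-alternating (t (tail x)))
       (λ M → +-congˡ (solve 1 (λ w → :- w := :- con (+ 1) :* w) refl _)))
    where
    tail-linear : IsLinear {suc m} tail
    tail-linear = record { T-cong = λ p i → p (suc i) ; T-lin = λ _ _ _ _ → refl }
    alt : ∀ x (M : Rows n (suc m)) → wedge D (x ∷ x ∷ M) ≈ 0#
    alt = go A where
      go : ∀ {n} {D : Form (suc n) m} → Alternating D → ∀ x (M : Rows n (suc m)) → wedge D (x ∷ x ∷ M) ≈ 0#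
      go {zero} A x M = trans (+-cong (*-congˡ (D-cong A {N = tail x ∷ (λ i → tail (M i))} λ { zero j → refl }))
        (-‿cong (*-congˡ (D-cong A ≋≋-refl)))) (-‿inverseʳ _)
      go {suc n} A x M = trans
        (+-cong (*-congˡ (D-cong A {N = tail x ∷ (λ i → tail (M i))} λ { zero j → refl ; (suc i) j → refl }))
          (-‿cong (+-cong (*-congˡ (D-cong A {N = tail x ∷ (λ i → tail (M i))} ≋≋-refl))
                (-‿cong (wedge-zero (λ N → D-alt A (tail x) N) M)))))
        (solve 1 (λ y → y :- (y :- con (+ 0)) := con (+ 0)) refl _)

  det : ∀ {n} → Form n n
  det {zero}  _ = 1#
  det {suc n} = wedge det

  det-alternating : ∀ {n} → Alternating (det {n})
  det-alternating {zero}  = nil refl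
  det-alternating {suc n} = wedge-alternating det-alternating

  det-cong : ∀ {n} {M N : Rows n n} → M ≋≋ N → det M ≈ det N
  det-cong = D-cong det-alternating

  -- Polarisation with z = x + y: the form vanishes on z, z and also on x, x and y, y.
  swap : ∀ {n m} {D : Form (suc (suc n)) m} → Alternating D → ∀ x y M → D (x ∷ y ∷ M) ≈ - D (y ∷ x ∷ M)
  swap {D = D} A x y M = begin
    D (x ∷ y ∷ M)                                     ≈⟨ solve 2 (λ p q → p := (p :+ q) :- q) refl _ _ ⟩
    (D (x ∷ y ∷ M) + D (y ∷ x ∷ M)) - D (y ∷ x ∷ M)   ≈⟨ +-congʳ (trans (sym total) (D-alt A z M)) ⟩
    0# - D (y ∷ x ∷ M)                                ≈⟨ +-identityˡ _ ⟩
    - D (y ∷ x ∷ M)                                   ∎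
    where
    z = 1# ⊙ x ⊕ y
    total : D (z ∷ z ∷ M) ≈ D (x ∷ y ∷ M) + D (y ∷ x ∷ M)
    total = begin
      D (z ∷ z ∷ M)
        ≈⟨ D-lin A 1# x y (z ∷ M) ⟩
      1# * D (x ∷ z ∷ M) + D (y ∷ z ∷ M)
        ≈⟨ +-cong (*-congˡ (D-lin (D-tail A x) 1# x y M)) (D-lin (D-tail A y) 1# x y M) ⟩
      1# * (1# * D (x ∷ x ∷ M) + D (x ∷ y ∷ M)) + (1# * D (y ∷ x ∷ M) + D (y ∷ y ∷ M))
        ≈⟨ +-cong (*-congˡ (+-congʳ (*-congˡ (D-alt A x M)))) (+-congˡ (D-alt A y M)) ⟩
      1# * (1# * 0# + D (x ∷ y ∷ M)) + (1# * D (y ∷ x ∷ M) + 0#)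
        ≈⟨ trans (+-cong (trans (*-identityˡ _) (trans (+-congʳ (zeroʳ _)) (+-identityˡ _)))
                 (trans (+-identityʳ _) (*-identityˡ _))) refl ⟩
      D (x ∷ y ∷ M) + D (y ∷ x ∷ M) ∎

  -- Only adjacent equal rows are known to kill the form, so x is carried past one row at a time;
  -- the two signs produced by `swap` cancel.
  shear : ∀ {n m} {D : Form (suc n) m} → Alternating D → ∀ x (c : Fin n → Carrier) M →
    D (x ∷ (λ i → c i ⊙ x ⊕ M i)) ≈ D (x ∷ M)
  shear {zero}  A x c M = D-cong A (∷-≋ (λ _ → refl) (λ ()))
  shear {suc n} {m} {D} A x c M = begin
    D (x ∷ (λ i → c i ⊙ x ⊕ M i))
      ≈⟨ D-cong A (∷-≋ (λ _ → refl) (η _)) ⟩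
    D (x ∷ (c zero ⊙ x ⊕ y) ∷ M″)
      ≈⟨ swap A x _ M″ ⟩
    - D ((c zero ⊙ x ⊕ y) ∷ x ∷ M″)
      ≈⟨ -‿cong (D-lin A (c zero) x y _) ⟩
    - (c zero * D (x ∷ x ∷ M″) + D (y ∷ x ∷ M″))
      ≈⟨ -‿cong (+-cong (trans (*-congˡ (D-alt A x M″)) (zeroʳ _)) (shear (D-tail A y) x (c ∘ suc) (M ∘ suc))) ⟩
    - (0# + D (y ∷ x ∷ M′))
      ≈⟨ -‿cong (+-identityˡ _) ⟩
    - D (y ∷ x ∷ M′)
      ≈⟨ swap A x y M′ ⟨
    D (x ∷ y ∷ M′)
      ≈⟨ D-cong A (∷-≋ (λ _ → refl) (η M)) ⟨
    D (x ∷ M) ∎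
    where
    y = M zero
    M′ : Rows n m
    M′ i = M (suc i)
    M″ : Rows n m
    M″ i = c (suc i) ⊙ x ⊕ M′ i

  δ : ∀ {n} → Fin n → Fin n → Carrier
  δ zero    zero    = 1#
  δ zero    (suc j) = 0#
  δ (suc i) zero    = 0#
  δ (suc i) (suc j) = δ i j

  ι : ∀ {m} → Row m → Row (suc m)
  ι x = 0# ∷ x

  ι-linear : ∀ {m} → IsLinear (ι {m})
  ι-linear = record
    { T-cong = λ { p zero → refl ; p (suc i) → p i }
    ; T-lin  = λ { a x y zero → solve 1 (λ a → con (+ 0) := a :* con (+ 0) :+ con (+ 0)) refl a
                 ; a x y (suc i) → refl } }

  private
    e₀ : ∀ {m} → Row (suc m)
    e₀ = δ zero

    split : ∀ {m} (x : Row (suc m)) → x ≋ x zero ⊙ e₀ ⊕ ι (tail x)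
    split x zero    = solve 1 (λ a → a := a :* con (+ 1) :+ con (+ 0)) refl _
    split x (suc i) = sym (trans (+-congʳ (zeroʳ _)) (+-identityˡ _))

    D-e₀ : ∀ {n m} {D : Form (suc n) (suc m)} → Alternating D → ∀ M →
      D (e₀ ∷ M) ≈ D (e₀ ∷ (λ i → ι (tail (M i))))
    D-e₀ A M = trans (D-cong A (∷-≋ (λ _ → refl) (λ i → split (M i))))
                     (shear A e₀ (λ i → M i zero) (λ i → ι (tail (M i))))

    D-ι : ∀ {n m} {D : Form n (suc m)} → Alternating D → Alternating (λ N → D (ι ∘ N))
    D-ι A = precompose ι-linear A (λ _ → refl)

  -- Each row is its zeroth coordinate times `e₀` plus a row without zeroth coordinate. Once `e₀`
  -- occurs, `shear` clears the zeroth column of the other rows, and moving `e₀` to the front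
  -- produces the alternating signs of `wedge`.
  expand : ∀ {n m} {D : Form (suc n) (suc m)} → Alternating D → ∀ M →
    D M ≈ wedge (λ N → D (e₀ ∷ (ι ∘ N))) M + D (λ i → ι (tail (M i)))
  expand {n} {m} {D} A M = begin
    D M
      ≈⟨ D-cong A (η M) ⟩
    D (x ∷ M′)
      ≈⟨ D-cong A (∷-≋ (split x) ≋≋-refl) ⟩
    D ((x zero ⊙ e₀ ⊕ ι (tail x)) ∷ M′)
      ≈⟨ D-lin A (x zero) e₀ (ι (tail x)) M′ ⟩
    x zero * D (e₀ ∷ M′) + D (ι (tail x) ∷ M′)
      ≈⟨ +-congʳ (*-congˡ (D-e₀ A M′)) ⟩
    x zero * D (e₀ ∷ (λ i → ι (tail (M′ i)))) + D (ι (tail x) ∷ M′)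
      ≈⟨ rest n A M ⟩
    wedge (λ N → D (e₀ ∷ (ι ∘ N))) M + D (λ i → ι (tail (M i))) ∎
    where
    x = M zero
    M′ : Rows n (suc m)
    M′ i = M (suc i)
    rest : ∀ n {D : Form (suc n) (suc m)} → Alternating D → (M : Rows (suc n) (suc m)) →
      M zero zero * D (e₀ ∷ (λ i → ι (tail (M (suc i))))) + D (ι (tail (M zero)) ∷ (λ i → M (suc i)))
        ≈ wedge (λ N → D (e₀ ∷ (ι ∘ N))) M + D (λ i → ι (tail (M i)))
    rest zero A M = +-congˡ (D-cong A λ { zero j → refl })
    rest (suc n) {D} A M = begin
      a + D (y ∷ N′)
        ≈⟨ +-congˡ (expand (D-tail A y) N′) ⟩
      a + (wedge (λ N → D (y ∷ e₀ ∷ (ι ∘ N))) N′ + D (y ∷ (λ i → ι (tail (N′ i)))))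
        ≈⟨ +-congˡ (+-cong (wedge-scale (- 1#) flip N′) (D-cong A (λ { zero j → refl ; (suc i) j → refl }))) ⟩
      a + (- 1# * w + D (λ i → ι (tail (M i))))
        ≈⟨ +-assoc _ _ _ ⟨
      a + - 1# * w + D (λ i → ι (tail (M i)))
        ≈⟨ +-congʳ (+-congˡ (trans (sym (-‿distribˡ-* 1# w)) (-‿cong (*-identityˡ w)))) ⟩
      a - w + D (λ i → ι (tail (M i))) ∎
      where
      open import Algebra.Properties.Ring ring using (-‿distribˡ-*)
      y = ι (tail (M zero))
      N′ : Rows (suc n) (suc m)
      N′ i = M (suc i)
      a = M zero zero * D (e₀ ∷ (λ i → ι (tail (N′ i))))
      w = wedge (λ N → D (e₀ ∷ (ι ∘ (tail (M zero) ∷ N)))) N′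
      flip : ∀ N → D (y ∷ e₀ ∷ (ι ∘ N)) ≈ - 1# * D (e₀ ∷ (ι ∘ (tail (M zero) ∷ N)))
      flip N = trans (swap A y e₀ (ι ∘ N)) (trans (-‿cong (trans (D-cong A
        (∷-≋ (λ _ → refl) (λ { zero j → refl ; (suc i) j → refl }))) (sym (*-identityˡ _)))) (-‿distribˡ-* 1# _))

  vanish : ∀ {n} {D : Form (suc n) n} → Alternating D → ∀ M → D M ≈ 0#
  vanish {zero} {D} A M = begin
    D M                                   ≈⟨ solve 1 (λ d → d := (d :+ d) :- d) refl (D M) ⟩
    (D M + D M) - D M                     ≈⟨ +-congʳ double ⟨
    D M - D M                             ≈⟨ -‿inverseʳ _ ⟩
    0#                                    ∎
    where
    -- All rows of length 0 agree, so additivity in the first row doubles the value of D.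
    double : D M ≈ D M + D M
    double = trans (D-cong A λ _ ()) (trans (D-lin A 1# (M zero) (M zero) (λ ()))
      (+-cong (trans (*-identityˡ _) (D-cong A λ _ ())) (D-cong A λ _ ())))
  vanish {suc n} {D} A M = trans (expand A M) (trans (+-cong
    (wedge-zero (vanish (D-ι (D-tail A e₀))) M)
    (trans (D-cong A (η _)) (vanish (D-ι (D-tail A (ι (tail (M zero))))) (λ i → tail (M (suc i))))))
    (+-identityˡ 0#))

  -- In `expand` the term without zeroth column has more rows than columns and vanishes, which
  -- leaves the cofactor recursion of `det`. This characterisation yields multiplicativity and the
  -- block formula by checking alternation alone, without permutations.
  det-unique : ∀ {n} {D : Form n n} → Alternating D → ∀ M → D M ≈ det M * D δ
  det-unique {zero} A M = sym (trans (*-identityˡ _) (D-cong A λ ()))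
  det-unique {suc n} {D} A M = begin
    D M
      ≈⟨ expand A M ⟩
    wedge (λ N → D (e₀ ∷ (ι ∘ N))) M + D (λ i → ι (tail (M i)))
      ≈⟨ +-congˡ (vanish (D-ι A) (λ i → tail (M i))) ⟩
    wedge (λ N → D (e₀ ∷ (ι ∘ N))) M + 0#
      ≈⟨ +-identityʳ _ ⟩
    wedge (λ N → D (e₀ ∷ (ι ∘ N))) M
      ≈⟨ wedge-scale (D δ) (λ N → trans (det-unique (D-ι (D-tail A e₀)) N)
           (trans (*-comm _ _) (*-congʳ (D-cong A unit)))) M ⟩
    D δ * det M
      ≈⟨ *-comm _ _ ⟩
    det M * D δ ∎
    where
    unit : (e₀ ∷ (ι ∘ δ)) ≋≋ δ
    unit zero    j       = refl
    unit (suc i) zero    = refl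
    unit (suc i) (suc j) = refl

  sum-cong : ∀ {n} {f g : Fin n → Carrier} → (∀ i → f i ≈ g i) → sum f ≈ sum g
  sum-cong = sum-cong-≋

  sum-δ : ∀ {n} (i : Fin n) (f : Fin n → Carrier) → sum (λ k → δ i k * f k) ≈ f i
  sum-δ {suc n} zero f = trans (+-cong (*-identityˡ _)
    (trans (sum-cong (λ k → zeroˡ (f (suc k)))) (sum-replicate-zero n))) (+-identityʳ _)
  sum-δ {suc n} (suc i) f = trans (+-cong (zeroˡ _) (sum-δ i (f ∘ suc))) (+-identityˡ _)

  infixl 7 _⊗_
  _⊗_ : ∀ {n k m} → Rows n k → Rows k m → Rows n m
  (A ⊗ B) i j = sum (λ k → A i k * B k j)

  rightMul-linear : ∀ {k m} (B : Rows k m) → IsLinear (λ (x : Row k) j → sum (λ i → x i * B i j))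
  rightMul-linear {k} B = record
    { T-cong = λ p j → sum-cong (λ i → *-congʳ (p i))
    ; T-lin  = λ a x y j → trans
        (sum-cong {k} (λ i → trans (distribʳ _ _ _) (+-congʳ (*-assoc _ _ _))))
        (trans (∑-distrib-+ (λ i → a * (x i * B i j)) (λ i → y i * B i j)) (+-congʳ (sym (*-distribˡ-sum a (λ i → x i * B i j))))) }

  det-⊗ : ∀ {n} (A B : Rows n n) → det (A ⊗ B) ≈ det A * det B
  det-⊗ A B = trans (det-unique {D = λ A → det (A ⊗ B)}
      (precompose (rightMul-linear B) det-alternating (λ _ → refl)) A)
    (*-congˡ (det-cong (λ i j → sum-δ i (λ k → B k j))))

-- Congruence, reindexing and block determinants

module DeterminantProducts (R : CommutativeRing 0ℓ 0ℓ) where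
  open CommutativeRing R hiding (zero)
  open RingKit R
  open Determinant R
  open import Algebra.Properties.Semiring.Exp semiring using (_^_)
  open import Algebra.Properties.CommutativeMonoid.Sum *-commutativeMonoid public using ()
    renaming (sum to prod; sum-cong-≋ to prod-cong; ∑-distrib-+ to prod-distrib-*)
  open import Data.Integer.Base using (+_)
  open import Data.Fin.Base using (Fin; zero; suc; splitAt; remQuot)
  open import Data.Sum.Base using (inj₁; inj₂)
  open import Data.Vec.Functional using (_∷_; _++_)
  open import Function.Base using (_∘_)
  open import Relation.Binary.PropositionalEquality as ≡ using (_≡_)
  open import Relation.Binary.Reasoning.Setoid setoid

  δ-comm : ∀ {n} (i j : Fin n) → δ i j ≡ δ j i
  δ-comm zero    zero    = ≡.refl
  δ-comm zero    (suc j) = ≡.refl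
  δ-comm (suc i) zero    = ≡.refl
  δ-comm (suc i) (suc j) = δ-comm i j

  sum-δʳ : ∀ {n} (i : Fin n) (f : Fin n → Carrier) → sum (λ k → f k * δ k i) ≈ f i
  sum-δʳ {n} i f = trans (sum-cong {n} (λ k → trans (*-comm _ _) (*-congʳ (reflexive (δ-comm k i))))) (sum-δ i f)

  minor₀ : ∀ {n} → Rows (suc n) (suc n) → Rows n n
  minor₀ M i j = M (suc i) (suc j)

  det-first-column : ∀ {n} (M : Rows (suc n) (suc n)) → (∀ i → M (suc i) zero ≈ 0#) →
    det M ≈ M zero zero * det (minor₀ M)
  det-first-column {zero}  M p = refl
  det-first-column {suc n} M p =
    trans (+-congˡ (-‿cong (wedge-column-zero _ (λ i → M (suc i)) p)))
          (solve 1 (λ x → x :- con (+ 0) := x) refl _)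

  det-scalar : ∀ n c → det {n} (λ i j → c * δ i j) ≈ c ^ n
  det-scalar zero    c = refl
  det-scalar (suc n) c = trans (det-first-column {n} (λ i j → c * δ i j) (λ i → zeroʳ c))
                               (*-cong (*-identityʳ c) (det-scalar n c))

  det-δ : ∀ n → det {n} δ ≈ 1#
  det-δ zero    = refl
  det-δ (suc n) = trans (det-first-column {n} δ (λ _ → refl)) (trans (*-identityˡ _) (det-δ n))

  -- Linearity in the zeroth row; in the summand whose zeroth row is a unit vector, `shear` clears
  -- the zeroth column and leaves the minor.
  det-add-e₀ : ∀ {n} (M : Rows (suc n) (suc n)) →
    det (λ i j → δ zero i * δ zero j + M i j) ≈ det M + det (minor₀ M)
  det-add-e₀ M = begin
    det (λ i j → δ zero i * δ zero j + M i j)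
      ≈⟨ det-cong rows ⟩
    det ((1# ⊙ δ zero ⊕ M zero) ∷ (λ i → M (suc i)))
      ≈⟨ D-lin det-alternating 1# (δ zero) (M zero) _ ⟩
    1# * det (δ zero ∷ (λ i → M (suc i))) + det (M zero ∷ (λ i → M (suc i)))
      ≈⟨ +-cong (trans (*-identityˡ _) corner) (sym (det-cong (η M))) ⟩
    det (minor₀ M) + det M
      ≈⟨ +-comm _ _ ⟩
    det M + det (minor₀ M) ∎
    where
    rows : (λ i j → δ zero i * δ zero j + M i j) ≋≋ ((1# ⊙ δ zero ⊕ M zero) ∷ (λ i → M (suc i)))
    rows zero    j = refl
    rows (suc i) j = trans (+-congʳ (zeroˡ _)) (+-identityˡ _)
    corner : det (δ zero ∷ (λ i → M (suc i))) ≈ det (minor₀ M)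
    corner = begin
      det (δ zero ∷ (λ i → M (suc i)))
        ≈⟨ det-cong (∷-≋ (λ _ → refl) (λ i → λ { zero → solve 1 (λ m → m := m :* con (+ 1) :+ con (+ 0)) refl _
                                              ; (suc j) → solve 2 (λ m x → x := m :* con (+ 0) :+ x) refl (M (suc i) zero) _ })) ⟩
      det (δ zero ∷ (λ i → M (suc i) zero ⊙ δ zero ⊕ ι (λ j → M (suc i) (suc j))))
        ≈⟨ shear det-alternating (δ zero) (λ i → M (suc i) zero) (λ i → ι (λ j → M (suc i) (suc j))) ⟩
      det (δ zero ∷ (λ i → ι (λ j → M (suc i) (suc j))))
        ≈⟨ det-first-column (δ zero ∷ (λ i → ι (λ j → M (suc i) (suc j)))) (λ _ → refl) ⟩
      1# * det (minor₀ M)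
        ≈⟨ *-identityˡ _ ⟩
      det (minor₀ M) ∎

  -- This is congruence by the elementary matrix 1 + c e₀ᵀ, of determinant 1 since `c zero`
  -- vanishes. The row half is `shear`; the column half is the uniqueness of the determinant.
  det-congruence-shear : ∀ {n} (c : Fin (suc n) → Carrier) → c zero ≈ 0# → ∀ M →
    det (λ i j → (M i j + c i * M zero j) + c j * (M i zero + c i * M zero zero)) ≈ det M
  det-congruence-shear {n} c c₀ M = begin
    det (λ i → T (A i))
      ≈⟨ det-unique {D = λ A → det (λ i → T (A i))} (precompose T-linear det-alternating (λ _ → refl)) A ⟩
    det A * det (λ i → T (δ i))
      ≈⟨ *-cong det-A det-T ⟩
    det M * 1#
      ≈⟨ *-identityʳ _ ⟩
    det M ∎
    where
    A : Rows (suc n) (suc n)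
    A i j = M i j + c i * M zero j
    T : Row (suc n) → Row (suc n)
    T r j = r j + c j * r zero
    T-linear : IsLinear T
    T-linear = record
      { T-cong = λ p j → +-cong (p j) (*-congˡ (p zero))
      ; T-lin  = λ a x y j → solve 6 (λ a u v c x y → (a :* u :+ v) :+ c :* (a :* x :+ y)
          := a :* (u :+ c :* x) :+ (v :+ c :* y)) refl a _ _ _ _ _ }
    det-A : det A ≈ det M
    det-A = begin
      det A
        ≈⟨ det-cong {suc n} (λ { zero j → trans (+-congˡ (trans (*-congʳ c₀) (zeroˡ _))) (+-identityʳ _)
                       ; (suc i) j → +-comm _ _ }) ⟩
      det (M zero ∷ (λ i → c (suc i) ⊙ M zero ⊕ M (suc i)))
        ≈⟨ shear det-alternating (M zero) (c ∘ suc) (λ i → M (suc i)) ⟩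
      det (M zero ∷ (λ i → M (suc i)))
        ≈⟨ det-cong (η M) ⟨
      det M ∎
    det-T : det (λ i → T (δ i)) ≈ 1#
    det-T = trans
      (det-first-column {n} (λ i → T (δ i)) (λ i → solve 1 (λ c → con (+ 0) :+ c :* con (+ 0) := con (+ 0)) refl (c zero)))
      (trans (*-cong (trans (+-congˡ (trans (*-congʳ c₀) (zeroˡ _))) (+-identityʳ _))
                     (trans (det-cong {n} (λ i j → trans (+-congˡ (zeroʳ _)) (+-identityʳ _))) (det-δ n)))
             (*-identityˡ 1#))

  -- `P` is the permutation matrix of `f` and `Q` its transpose. The hypothesis says P Q = 1, so no
  -- inverse of `f` has to be constructed.
  det-reindex : ∀ {n} (f : Fin n → Fin n) → (∀ i j → δ (f i) (f j) ≈ δ i j) → ∀ M →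
    det (λ i j → M (f i) (f j)) ≈ det M
  det-reindex {n} f inj M = begin
    det (λ i j → M (f i) (f j))
      ≈⟨ det-cong (λ i j → trans (sum-cong {n} (λ k → *-congʳ (sum-δ (f i) (λ l → M l k)))) (sum-δʳ (f j) (M (f i)))) ⟨
    det ((P ⊗ M) ⊗ Q)
      ≈⟨ trans (det-⊗ (P ⊗ M) Q) (*-congʳ (det-⊗ P M)) ⟩
    (det P * det M) * det Q
      ≈⟨ solve 3 (λ p m q → (p :* m) :* q := m :* (p :* q)) refl _ _ _ ⟩
    det M * (det P * det Q)
      ≈⟨ *-congˡ (trans (sym (det-⊗ P Q)) (trans (det-cong (λ i j → trans (sum-δ (f i) (λ k → δ k (f j))) (inj i j))) (det-δ n))) ⟩
    det M * 1#
      ≈⟨ *-identityʳ _ ⟩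
    det M ∎
    where
    P Q : Rows n n
    P i k = δ (f i) k
    Q k j = δ k (f j)

  padˡ : ∀ {n m} → Row n → Row (n ℕ.+ m)
  padˡ x = x ++ (λ _ → 0#)

  padʳ : ∀ {n m} → Row m → Row (n ℕ.+ m)
  padʳ {n} x = (λ (_ : Fin n) → 0#) ++ x

  block : ∀ {n m} → Rows n n → Rows m m → Rows (n ℕ.+ m) (n ℕ.+ m)
  block A B = (padˡ ∘ A) ++ (padʳ ∘ B)

  private
    ++-cong : ∀ {n m k} {A A′ : Rows n k} {C C′ : Rows m k} → A ≋≋ A′ → C ≋≋ C′ → (A ++ C) ≋≋ (A′ ++ C′)
    ++-cong {n} p q i j with splitAt n i
    ... | inj₁ x = p x j
    ... | inj₂ y = q y j

    ∷-++ : ∀ {n m k} (x : Row k) (A : Rows n k) (C : Rows m k) → ((x ∷ A) ++ C) ≋≋ (x ∷ (A ++ C))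
    ∷-++ x A C zero j = refl
    ∷-++ {n} x A C (suc i) j with splitAt n i
    ... | inj₁ _ = refl
    ... | inj₂ _ = refl

    fix-tail : ∀ {n m k} {D : Form (n ℕ.+ m) k} → Alternating D → (C : Rows m k) {D′ : Form n k} →
      (∀ A → D′ A ≈ D (A ++ C)) → Alternating D′
    fix-tail {zero}  A C p = nil (λ {M} {N} → trans (p M) (trans (D-cong A (λ _ _ → refl)) (sym (p N))))
    fix-tail {suc n} {m} {k} {D} A@(cons c l a t) C {D′} p = cons
      (λ {M} {N} q → trans (p M) (trans (c (++-cong q ≋≋-refl)) (sym (p N))))
      (λ k x y M → trans (p₁ _ M) (trans (l k x y (M ++ C)) (sym (+-cong (*-congˡ (p₁ x M)) (p₁ y M)))))
      (alt n c a p)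
      (λ x → fix-tail (t x) C (p₁ x))
      where
      p₁ : ∀ x M → D′ (x ∷ M) ≈ D (x ∷ (M ++ C))
      p₁ x M = trans (p _) (c (∷-++ x M C))
      alt : ∀ n {D : Form (suc n ℕ.+ m) k} {D′ : Form (suc n) k} → (∀ {M N} → M ≋≋ N → D M ≈ D N) →
            Alternates (n ℕ.+ m) D → (∀ A → D′ A ≈ D (A ++ C)) → Alternates n D′
      alt zero    c a p = _
      alt (suc n) c a p x M = trans (p _) (trans
        (c (λ i j → trans (∷-++ x (x ∷ M) C i j) (∷-≋ (λ _ → refl) (∷-++ x M C) i j))) (a x (M ++ C)))

    padˡ-linear : ∀ {n m} → IsLinear (padˡ {n} {m})
    padˡ-linear {n} {m} = record { T-cong = cong′ ; T-lin = lin′ }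
      where
      cong′ : ∀ {x y} → x ≋ y → padˡ {n} {m} x ≋ padˡ {n} {m} y
      cong′ p i with splitAt n i
      ... | inj₁ x = p x
      ... | inj₂ y = refl
      lin′ : ∀ a x y → padˡ {n} {m} (a ⊙ x ⊕ y) ≋ a ⊙ padˡ {n} {m} x ⊕ padˡ {n} {m} y
      lin′ a x y i with splitAt n i
      ... | inj₁ _ = refl
      ... | inj₂ _ = solve 1 (λ a → con (+ 0) := a :* con (+ 0) :+ con (+ 0)) refl a

    det-block-δ : ∀ n {m} (B : Rows m m) → det (block {n} δ B) ≈ det B
    det-block-δ zero {m} B = det-cong {m} (λ _ _ → refl)
    det-block-δ (suc n) {m} B = trans (det-first-column {n ℕ.+ m} (block {suc n} δ B) col)
      (trans (*-identityˡ _) (trans (det-cong {n ℕ.+ m} minor) (det-block-δ n B)))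
      where
      col : ∀ i → block {suc n} δ B (suc i) zero ≈ 0#
      col i with splitAt n i
      ... | inj₁ _ = refl
      ... | inj₂ _ = refl
      minor : minor₀ (block {suc n} δ B) ≋≋ block {n} δ B
      minor i j with splitAt n i
      minor i j | inj₁ _ with splitAt n j
      ... | inj₁ _ = refl
      ... | inj₂ _ = refl
      minor i j | inj₂ _ with splitAt n j
      ... | inj₁ _ = refl
      ... | inj₂ _ = refl

  det-block : ∀ {n m} (A : Rows n n) (B : Rows m m) → det (block A B) ≈ det A * det B
  det-block {n} A B = trans
    (det-unique {D = λ A → det (block A B)}
      (precompose (padˡ-linear {n}) (fix-tail {n} det-alternating (padʳ ∘ B) (λ _ → refl)) (λ _ → refl)) A)
    (*-congˡ (det-block-δ n B))

  blockDiagonal : ∀ {q n} → (Fin q → Rows n n) → Rows (q ℕ.* n) (q ℕ.* n)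
  blockDiagonal {q} {n} Ms i j =
    let (a , x) = remQuot {q} n i ; (b , y) = remQuot {q} n j in δ a b * Ms a x y

  det-blockDiagonal : ∀ {q n} (Ms : Fin q → Rows n n) →
    det (blockDiagonal Ms) ≈ prod (λ a → det (Ms a))
  det-blockDiagonal {zero}      Ms = refl
  det-blockDiagonal {suc q} {n} Ms = trans (det-cong rows)
    (trans (det-block (Ms zero) (blockDiagonal (Ms ∘ suc))) (*-congˡ (det-blockDiagonal (Ms ∘ suc))))
    where
    rows : blockDiagonal Ms ≋≋ block (Ms zero) (blockDiagonal (Ms ∘ suc))
    rows i j with splitAt n i
    rows i j | inj₁ _ with splitAt n j
    ... | inj₁ _ = *-identityˡ _
    ... | inj₂ _ = zeroˡ _
    rows i j | inj₂ _ with splitAt n j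
    ... | inj₁ _ = zeroˡ _
    ... | inj₂ _ = refl

-- Deletion and contraction of edges

module Contraction where
  open import Data.Bool.Base using (Bool; true; false)
  open import Function.Bundles using (_↔_; mk↔ₛ′)
  open import Function.Properties.Inverse using (↔-sym)
  open import Function.Construct.Composition using (_↔-∘_)
  open import Data.Sum.Function.Propositional using (_⊎-↔_)
  open import Relation.Nullary.Negation using (¬_)
  open import Data.Fin.Base using (Fin; zero; suc; punchIn; punchOut)
  open import Data.Fin.Properties using (_≟_; +↔⊎; punchOut-injective; punchInᵢ≢i; punchOut-punchIn; punchOut-cong)
  open import Data.Nat.Base using (ℕ; zero; suc; _+_)
  open import Data.Product.Base using (_×_; _,_; ∃-syntax)
  open import Data.Sum.Base using (_⊎_; inj₁; inj₂)
  open import Data.Vec.Base using (Vec; []; _∷_; map)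
  open import Relation.Binary.PropositionalEquality
  open import Relation.Nullary.Decidable using (yes; no)
  open import Relation.Nullary.Negation using (contradiction)

  merge : ∀ {n} {a b : Fin (suc n)} → a ≢ b → Fin (suc n) → Fin n
  merge {a = a} a≢b x with a ≟ x
  ... | yes _  = punchOut a≢b
  ... | no a≢x = punchOut a≢x

  module _ {n} {a b : Fin (suc n)} (a≢b : a ≢ b) where
    merge-a : merge a≢b a ≡ punchOut a≢b
    merge-a with a ≟ a
    ... | yes _  = refl
    ... | no a≢a = contradiction refl a≢a

    merge-other : ∀ {x} (a≢x : a ≢ x) → merge a≢b x ≡ punchOut a≢x
    merge-other {x} a≢x with a ≟ x
    ... | yes a≡x = contradiction a≡x a≢x
    ... | no _    = punchOut-cong a refl

    merge-b : merge a≢b b ≡ punchOut a≢b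
    merge-b = merge-other a≢b

    merge-ends : merge a≢b a ≡ merge a≢b b
    merge-ends = trans merge-a (sym merge-b)

    merge-punchIn : ∀ x → merge a≢b (punchIn a x) ≡ x
    merge-punchIn x = trans (merge-other (λ p → punchInᵢ≢i a x (sym p))) (punchOut-punchIn a)

    merge-kernel : ∀ x y → merge a≢b x ≡ merge a≢b y → x ≡ y ⊎ (x ≡ a × y ≡ b) ⊎ (x ≡ b × y ≡ a)
    merge-kernel x y p with a ≟ x | a ≟ y
    ... | yes a≡x | yes a≡y = inj₁ (trans (sym a≡x) a≡y)
    ... | yes a≡x | no a≢y  = inj₂ (inj₁ (sym a≡x , punchOut-injective a≢y a≢b (sym p)))
    ... | no a≢x  | yes a≡y = inj₂ (inj₂ (punchOut-injective a≢x a≢b p , sym a≡y))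
    ... | no a≢x  | no a≢y  = inj₁ (punchOut-injective a≢x a≢y p)

  Edges : ℕ → ℕ → Set
  Edges n k = Vec (Fin n × Fin n) k

  mapEdges : ∀ {n m k} → (Fin n → Fin m) → Edges n k → Edges m k
  mapEdges f = map (λ (a , b) → f a , f b)

  isOne : ℕ → ℕ
  isOne 1 = 1
  isOne _ = 0

  -- Deletion and contraction; an edge whose ends coincide is only deleted.
  treeCount : ∀ {k} n → Edges n k → ℕ
  treeCount n [] = isOne n
  treeCount {suc k} (suc n) ((a , b) ∷ es) with a ≟ b
  ... | yes _  = treeCount (suc n) es
  ... | no a≢b = treeCount (suc n) es + treeCount {k} n (mapEdges (merge a≢b) es)

  isOneᵇ : ℕ → Bool
  isOneᵇ 1 = true
  isOneᵇ _ = false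

  -- Shaped like `treeCount`, so that its solutions are counted by the recursion itself; a chosen
  -- loop is rejected. The comparison with spanning trees in a graph is made separately.
  spans : ∀ {k} n → Edges n k → Vec Bool k → Bool
  spans n [] [] = isOneᵇ n
  spans (suc n) ((a , b) ∷ es) (false ∷ T) = spans (suc n) es T
  spans (suc n) ((a , b) ∷ es) (true ∷ T) with a ≟ b
  ... | yes _  = false
  ... | no a≢b = spans n (mapEdges (merge a≢b) es) T

  private
    Solutions : ∀ {k} → (Vec Bool k → Bool) → Set
    Solutions P = ∃[ T ] P T ≡ true

    split-head : ∀ {k} (P : Vec Bool (suc k) → Bool) →
      Solutions P ↔ (Solutions (λ T → P (false ∷ T)) ⊎ Solutions (λ T → P (true ∷ T)))
    split-head P = mk↔ₛ′
      (λ { (false ∷ T , p) → inj₁ (T , p) ; (true ∷ T , p) → inj₂ (T , p) })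
      (λ { (inj₁ (T , p)) → false ∷ T , p ; (inj₂ (T , p)) → true ∷ T , p })
      (λ { (inj₁ _) → refl ; (inj₂ _) → refl })
      (λ { (false ∷ T , p) → refl ; (true ∷ T , p) → refl })

    drop-empty : ∀ {A B : Set} → ¬ B → (A ⊎ B) ↔ A
    drop-empty ¬b = mk↔ₛ′ (λ { (inj₁ a) → a ; (inj₂ b) → contradiction b ¬b }) inj₁
      (λ _ → refl) (λ { (inj₁ _) → refl ; (inj₂ b) → contradiction b ¬b })

  spans↔treeCount : ∀ {k} n (es : Edges n k) → (∃[ T ] spans n es T ≡ true) ↔ Fin (treeCount n es)
  spans↔treeCount zero [] = mk↔ₛ′ (λ { ([] , ()) }) (λ ()) (λ ()) (λ { ([] , ()) })
  spans↔treeCount 1 [] = mk↔ₛ′ (λ _ → zero) (λ _ → [] , refl) (λ { zero → refl }) (λ { ([] , refl) → refl })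
  spans↔treeCount (suc (suc n)) [] = mk↔ₛ′ (λ { ([] , ()) }) (λ ()) (λ ()) (λ { ([] , ()) })
  spans↔treeCount {suc k} (suc n) ((a , b) ∷ es) with a ≟ b | split-head (spans (suc n) ((a , b) ∷ es))
  ... | yes _  | s = spans↔treeCount (suc n) es ↔-∘ (drop-empty (λ ()) ↔-∘ s)
  ... | no a≢b | s = ↔-sym +↔⊎ ↔-∘
    ((spans↔treeCount (suc n) es ⊎-↔ spans↔treeCount n (mapEdges (merge a≢b) es)) ↔-∘ s)

-- The weighted matrix-tree theorem

module MatrixTree (R : CommutativeRing 0ℓ 0ℓ) where
  open CommutativeRing R hiding (zero)
  open RingKit R
  open Determinant R
  open DeterminantProducts R
  open Contraction
  open import Data.Integer.Base using (+_)
  open import Data.Fin.Base using (Fin; zero; suc; punchIn; punchOut)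
  open import Data.Fin.Properties using (_≟_; punchInᵢ≢i; punchIn-injective; punchIn-punchOut)
  open import Data.Vec.Base using ([]; _∷_)
  open import Data.Vec.Functional using () renaming (_∷_ to _∷ᶠ_)
  open import Function.Base using (_∘_)
  open import Relation.Binary.PropositionalEquality as ≡ using (_≡_; _≢_)
  open import Relation.Binary.Reasoning.Setoid setoid
  open import Relation.Nullary.Decidable using (yes; no)
  open import Relation.Nullary.Negation using (contradiction)

  δ-refl : ∀ {n} (i : Fin n) → δ i i ≡ 1#
  δ-refl zero    = ≡.refl
  δ-refl (suc i) = δ-refl i

  δ-≢ : ∀ {n} {i j : Fin n} → i ≢ j → δ i j ≡ 0#
  δ-≢ {i = zero}  {zero}  p = contradiction ≡.refl p
  δ-≢ {i = zero}  {suc j} p = ≡.refl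
  δ-≢ {i = suc i} {zero}  p = ≡.refl
  δ-≢ {i = suc i} {suc j} p = δ-≢ (p ∘ ≡.cong suc)

  δ-injective : ∀ {n m} (f : Fin n → Fin m) → (∀ {i j} → f i ≡ f j → i ≡ j) → ∀ i j → δ (f i) (f j) ≡ δ i j
  δ-injective f inj i j with i ≟ j
  ... | yes ≡.refl = ≡.trans (δ-refl (f i)) (≡.sym (δ-refl i))
  ... | no i≢j = ≡.trans (δ-≢ (i≢j ∘ inj)) (≡.sym (δ-≢ i≢j))

  incidence : ∀ {n} → Fin n → Fin n → Row n
  incidence a b i = δ a i - δ b i

  -- The rank-one term c w wᵀ removes the kernel of constant vectors, so the full determinant,
  -- instead of a minor, counts trees. This form is also the one that characters diagonalise.
  laplacian : ∀ {n k} → Edges n k → Carrier → Row n → Rows n n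
  laplacian []             c w i j = c * (w i * w j)
  laplacian ((a , b) ∷ es) c w i j = incidence a b i * incidence a b j + laplacian es c w i j

  module _ {n} {a b : Fin (suc n)} (a≢b : a ≢ b) where
    private
      b′ = punchOut a≢b

    pushforward : Row (suc n) → Row n
    pushforward u x = u (punchIn a x) + δ b′ x * u a

    -- Row and column `a` are added to those of `b` and then deleted: identification of two vertices
    -- at the level of quadratic forms.
    contract : Rows (suc n) (suc n) → Rows n n
    contract M x y = (M (punchIn a x) (punchIn a y) + δ b′ x * M a (punchIn a y))
                   + δ b′ y * (M (punchIn a x) a + δ b′ x * M a a)

    private
      front : Fin (suc n) → Fin (suc n)
      front zero    = a
      front (suc x) = punchIn a x

      front-injective : ∀ {i j} → front i ≡ front j → i ≡ j
      front-injective {zero}  {zero}  p = ≡.refl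
      front-injective {zero}  {suc j} p = contradiction (≡.sym p) (punchInᵢ≢i a j)
      front-injective {suc i} {zero}  p = contradiction p (punchInᵢ≢i a i)
      front-injective {suc i} {suc j} p = ≡.cong suc (punchIn-injective a i j p)

      c : Fin (suc n) → Carrier
      c zero    = 0#
      c (suc x) = δ b′ x

      v : Row (suc n)
      v = incidence a b

      v-front : ∀ i → v (front i) + c i * v (front zero) ≈ δ zero i
      v-front zero = trans (+-cong v-a (zeroˡ _)) (+-identityʳ _)
        where
        v-a : v a ≈ 1#
        v-a = trans (+-cong (reflexive (δ-refl a)) (-‿cong (reflexive (δ-≢ (a≢b ∘ ≡.sym)))))
                    (solve 1 (λ x → con (+ 1) :- con (+ 0) := con (+ 1)) refl 0#)
      v-front (suc x) = trans
        (+-cong (+-cong (reflexive (δ-≢ (λ p → punchInᵢ≢i a x (≡.sym p)))) (-‿cong (reflexive v-x)))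
                (*-congˡ (+-cong (reflexive (δ-refl a)) (-‿cong (reflexive (δ-≢ (a≢b ∘ ≡.sym)))))))
        (solve 1 (λ d → (con (+ 0) :- d) :+ d :* (con (+ 1) :- con (+ 0)) := con (+ 0)) refl (δ b′ x))
        where
        v-x : δ b (punchIn a x) ≡ δ b′ x
        v-x = ≡.trans (≡.cong (λ y → δ y (punchIn a x)) (≡.sym (punchIn-punchOut a≢b)))
                      (δ-injective (punchIn a) (λ {i} {j} → punchIn-injective a i j) b′ x)

    -- With `a` moved to index 0, adding its row and column to those of `b` turns the incidence
    -- vector into a unit vector. The rank-one term then sits in a single entry, whose cofactor is
    -- the contracted matrix.
    det-contract : ∀ M → det (λ i j → v i * v j + M i j) ≈ det M + det (contract M)
    det-contract M = begin
      det (λ i j → v i * v j + M i j)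
        ≈⟨ det-reindex front front-δ _ ⟨
      det (λ i j → v (front i) * v (front j) + N i j)
        ≈⟨ det-congruence-shear c refl (λ i j → v (front i) * v (front j) + N i j) ⟨
      det (λ i j → ((v (front i) * v (front j) + N i j) + c i * (v a * v (front j) + N zero j))
                 + c j * ((v (front i) * v a + N i zero) + c i * (v a * v a + N zero zero)))
        ≈⟨ det-cong {suc n} (λ i j → trans (regroup i j)
             (+-congʳ (*-cong (v-front i) (v-front j)))) ⟩
      det (λ i j → δ zero i * δ zero j + shear-N i j)
        ≈⟨ det-add-e₀ shear-N ⟩
      det shear-N + det (contract M)
        ≈⟨ +-congʳ (trans (det-congruence-shear c refl N) (det-reindex front front-δ M)) ⟩
      det M + det (contract M) ∎
      where
      front-δ : ∀ i j → δ (front i) (front j) ≈ δ i j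
      front-δ i j = reflexive (δ-injective front front-injective i j)
      N shear-N : Rows (suc n) (suc n)
      N i j = M (front i) (front j)
      shear-N i j = (N i j + c i * N zero j) + c j * (N i zero + c i * N zero zero)
      regroup : ∀ i j →
        ((v (front i) * v (front j) + N i j) + c i * (v a * v (front j) + N zero j))
                 + c j * ((v (front i) * v a + N i zero) + c i * (v a * v a + N zero zero))
        ≈ (v (front i) + c i * v a) * (v (front j) + c j * v a) + shear-N i j
      regroup i j = solve 9 (λ vi vj va ci cj m m₁ m₂ m₃ →
          ((vi :* vj :+ m) :+ ci :* (va :* vj :+ m₁)) :+ cj :* ((vi :* va :+ m₂) :+ ci :* (va :* va :+ m₃))
          := (vi :+ ci :* va) :* (vj :+ cj :* va) :+ ((m :+ ci :* m₁) :+ cj :* (m₂ :+ ci :* m₃)))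
        refl _ _ _ _ _ _ _ _ _

    private
      pushforward-δ : ∀ x y → pushforward (δ x) y ≈ δ (merge a≢b x) y
      pushforward-δ x y with a ≟ x
      ... | yes ≡.refl = trans (+-cong (reflexive (δ-≢ (λ p → punchInᵢ≢i a y (≡.sym p)))) (*-congˡ (reflexive (δ-refl a))))
                          (solve 1 (λ d → con (+ 0) :+ d :* con (+ 1) := d) refl _)
      ... | no a≢x = trans (+-cong
          (reflexive (≡.trans (≡.cong (λ z → δ z (punchIn a y)) (≡.sym (punchIn-punchOut a≢x)))
            (δ-injective (punchIn a) (λ {i} {j} → punchIn-injective a i j) (punchOut a≢x) y)))
          (*-congˡ (reflexive (δ-≢ (a≢x ∘ ≡.sym)))))
        (solve 2 (λ d e → d :+ e :* con (+ 0) := d) refl _ _)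

      pushforward-incidence : ∀ x y z → pushforward (incidence x y) z ≈ incidence (merge a≢b x) (merge a≢b y) z
      pushforward-incidence x y z = trans
        (solve 5 (λ p q d r s → (p :- q) :+ d :* (r :- s) := (p :+ d :* r) :- (q :+ d :* s)) refl _ _ _ _ _)
        (+-cong (pushforward-δ x z) (-‿cong (pushforward-δ y z)))

    contract-laplacian : ∀ {k} (es : Edges (suc n) k) c w →
      contract (laplacian es c w) ≋≋ laplacian (mapEdges (merge a≢b) es) c (pushforward w)
    contract-laplacian [] c w x y = solve 7 (λ c d e wx wy wa z →
        (c :* (wx :* wy) :+ d :* (c :* (wa :* wy))) :+ e :* (c :* (wx :* wa) :+ d :* (c :* (wa :* wa)))
        := c :* ((wx :+ d :* wa) :* (wy :+ e :* wa))) refl c (δ b′ x) (δ b′ y) (w (punchIn a x)) (w (punchIn a y)) (w a) 0#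
    contract-laplacian ((s , t) ∷ es) c w x y = trans
      (solve 9 (λ d e ux uy ua m m₁ m₂ m₃ →
         ((ux :* uy :+ m) :+ d :* (ua :* uy :+ m₁)) :+ e :* ((ux :* ua :+ m₂) :+ d :* (ua :* ua :+ m₃))
         := (ux :+ d :* ua) :* (uy :+ e :* ua) :+ ((m :+ d :* m₁) :+ e :* (m₂ :+ d :* m₃)))
       refl _ _ _ _ _ _ _ _ _)
      (+-cong (*-cong (pushforward-incidence s t x) (pushforward-incidence s t y)) (contract-laplacian es c w x y))

    sum-pushforward : ∀ w → sum (pushforward w) ≈ sum w
    sum-pushforward w = begin
      sum (pushforward w)
        ≈⟨ ∑-distrib-+ (λ x → w (punchIn a x)) (λ x → δ b′ x * w a) ⟩
      sum (λ x → w (punchIn a x)) + sum (λ x → δ b′ x * w a)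
        ≈⟨ +-congˡ (sum-δ b′ (λ _ → w a)) ⟩
      sum (λ x → w (punchIn a x)) + w a
        ≈⟨ +-comm _ _ ⟩
      w a + sum (λ x → w (punchIn a x))
        ≈⟨ sum-remove {i = a} w ⟨
      sum w ∎

  private
    det-rank-one : ∀ {n} c (w : Row (suc (suc n))) → det (λ i j → c * (w i * w j)) ≈ 0#
    det-rank-one {n} c w = begin
      det (λ i j → c * (w i * w j))
        ≈⟨ det-cong {suc (suc n)} rows ⟩
      det ((p ⊙ w ⊕ z) ∷ᶠ (q ⊙ w ⊕ z) ∷ᶠ M)
        ≈⟨ D-lin det-alternating p w z _ ⟩
      p * det (w ∷ᶠ (q ⊙ w ⊕ z) ∷ᶠ M) + det (z ∷ᶠ (q ⊙ w ⊕ z) ∷ᶠ M)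
        ≈⟨ +-cong (*-congˡ (trans (D-lin (D-tail det-alternating w) q w z M)
             (+-cong (*-congˡ (D-alt det-alternating w M)) (second-zero w)))) (first-zero _) ⟩
      p * (q * 0# + 0#) + 0#
        ≈⟨ solve 2 (λ p q → p :* (q :* con (+ 0) :+ con (+ 0)) :+ con (+ 0) := con (+ 0)) refl p q ⟩
      0# ∎
      where
      p = c * w zero
      q = c * w (suc zero)
      z : Row (suc (suc n))
      z _ = 0#
      M : Rows n (suc (suc n))
      M i j = c * (w (suc (suc i)) * w j)
      scale : ∀ i j → c * (w i * w j) ≈ (c * w i) * w j + 0#
      scale i j = trans (sym (*-assoc _ _ _)) (sym (+-identityʳ _))
      rows : (λ i j → c * (w i * w j)) ≋≋ ((p ⊙ w ⊕ z) ∷ᶠ (q ⊙ w ⊕ z) ∷ᶠ M)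
      rows zero          j = scale zero j
      rows (suc zero)    j = scale (suc zero) j
      rows (suc (suc i)) j = refl
      first-zero : ∀ N → det (z ∷ᶠ N) ≈ 0#
      first-zero N = trans (det-cong {suc (suc n)} (∷-≋ (λ j → solve 1
            (λ x → con (+ 0) := :- con (+ 1) :* con (+ 0) :+ con (+ 0)) refl 0#) ≋≋-refl))
        (trans (D-lin det-alternating (- 1#) z z N) (solve 1 (λ d → :- con (+ 1) :* d :+ d := con (+ 0)) refl _))
      second-zero : ∀ x → det (x ∷ᶠ z ∷ᶠ M) ≈ 0#
      second-zero x = trans (swap det-alternating x z M) (trans (-‿cong (first-zero _)) (solve 1 (λ x → :- con (+ 0) := con (+ 0)) refl 0#))

  -- `det-contract` is the recursion of `treeCount`. The weights must be arbitrary because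
  -- contraction destroys the all-ones vector: the weight of `a` is added to that of `b`. Only the
  -- sum of the weights is preserved, and only the sum enters the formula.
  matrix-tree : ∀ {k} n (es : Edges (suc n) k) c w →
    det (laplacian es c w) ≈ (c * (sum w * sum w)) * fromℕ (treeCount (suc n) es)
  matrix-tree zero    [] c w = solve 2 (λ c w → (c :* (w :* w)) :* con (+ 1)
    := (c :* ((w :+ con (+ 0)) :* (w :+ con (+ 0)))) :* con (+ 1)) refl c (w zero)
  matrix-tree (suc n) [] c w = trans (det-rank-one c w) (sym (zeroʳ _))
  matrix-tree {suc k} n ((a , b) ∷ es) c w with a ≟ b
  ... | yes ≡.refl = trans (det-cong {suc n} (λ i j →
          trans (+-congʳ (trans (*-congʳ (-‿inverseʳ _)) (zeroˡ _))) (+-identityˡ _))) (matrix-tree n es c w)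
  matrix-tree {suc k} zero ((zero , zero) ∷ es) c w | no a≢b = contradiction ≡.refl a≢b
  matrix-tree {suc k} (suc n) ((a , b) ∷ es) c w | no a≢b = begin
    det (λ i j → incidence a b i * incidence a b j + laplacian es c w i j)
      ≈⟨ det-contract a≢b (laplacian es c w) ⟩
    det (laplacian es c w) + det (contract a≢b (laplacian es c w))
      ≈⟨ +-cong (matrix-tree (suc n) es c w) (trans (det-cong {suc n} (contract-laplacian a≢b es c w))
           (trans (matrix-tree {k} n es′ c w′) (*-congʳ (*-congˡ (*-cong Σw Σw))))) ⟩
    s * fromℕ (treeCount (suc (suc n)) es) + s * fromℕ (treeCount (suc n) es′)
      ≈⟨ distribˡ s _ _ ⟨
    s * (fromℕ (treeCount (suc (suc n)) es) + fromℕ (treeCount (suc n) es′))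
      ≈⟨ *-congˡ (⟪⟫-+ (+ treeCount (suc (suc n)) es) (+ treeCount (suc n) es′)) ⟨
    s * fromℕ (treeCount (suc (suc n)) es ℕ.+ treeCount (suc n) es′) ∎
    where
    es′ = mapEdges (merge a≢b) es
    w′ = pushforward a≢b w
    s = c * (sum w * sum w)
    Σw = sum-pushforward a≢b w

  matrix-tree′ : ∀ {k} n .{{_ : ℕ.NonZero n}} (es : Edges n k) c w →
    det (laplacian es c w) ≈ (c * (sum w * sum w)) * fromℕ (treeCount n es)
  matrix-tree′ (suc n) = matrix-tree n

-- Spanning trees of a graph and the deletion-contraction count

module SpanningTreeCount (Y : Graph) (O : Orientation Y) where
  open import Defs
  open Contraction
  open import Data.Bool.Base using (Bool; true; false)
  open import Data.Bool.Properties using () renaming (_≟_ to _≟ᵇ_)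
  open import Axiom.UniquenessOfIdentityProofs using (module Decidable⇒UIP)
  import Function.Construct.Symmetry as Symmetry
  open import Data.Empty using (⊥; ⊥-elim)
  open import Data.Fin.Base using (Fin; zero; suc)
  open import Data.Fin.Properties using (_≟_; suc-injective)
  import Data.Fin.Permutation as Permutation
  open import Data.List.Base as List using (List; []; _∷_; _++_)
  open import Data.List.Relation.Unary.All as All using (All; []; _∷_)
  import Data.List.Relation.Unary.All.Properties as All
  open import Data.List.Relation.Unary.Linked as Linked using (Linked; []; [-]; _∷_)
  import Data.List.Relation.Unary.Linked.Properties as Linked
  open import Data.Product.Base using (_×_; _,_; proj₁; proj₂; ∃-syntax; Σ-syntax)
  open import Data.Sum.Base using (_⊎_; inj₁; inj₂; [_,_]′)
  open import Data.Vec.Base as Vec using (Vec; []; _∷_; lookup; tabulate)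
  import Data.Vec.Properties as Vec
  open import Function.Base using (_∘_)
  open import Function.Bundles using (Inverse; _⟨$⟩_; Func)
  open import Function.Construct.Composition using (inverse)
  open import Relation.Binary.PropositionalEquality as ≡ using (_≡_; _≢_; refl; cong; subst)
  open import Relation.Nullary.Decidable using (Dec; yes; no)
  open import Relation.Nullary.Negation using (¬_; contradiction)

  open Graph Y
  open Orientation O
  private
    Vertex = V.Carrier
    Edge = E.Carrier

    src tgt : Edge → Vertex
    src e = o ⟨$⟩ e
    tgt e = t ⟨$⟩ e

    rev : Edge → Edge
    rev e = inv ⟨$⟩ e

    rev-cong : ∀ {e f} → e ≈ᴱ f → rev e ≈ᴱ rev f
    rev-cong = Func.cong inv

    src-cong : ∀ {e f} → e ≈ᴱ f → src e ≈ⱽ src f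
    src-cong = Func.cong o

    tgt-cong : ∀ {e f} → e ≈ᴱ f → tgt e ≈ⱽ tgt f
    tgt-cong = Func.cong t

    infix 4 _∼_
    _∼_ : Edge → Edge → Set
    x ∼ e = x ≈ᴱ e ⊎ x ≈ᴱ rev e

    ∼-rev : ∀ {x e} → x ∼ e → rev x ∼ e
    ∼-rev (inj₁ p) = inj₂ (rev-cong p)
    ∼-rev (inj₂ p) = inj₁ (E.trans (rev-cong p) (inv-inv _))

    ∼-resp : ∀ {x y e} → x ≈ᴱ y → x ∼ e → y ∼ e
    ∼-resp q (inj₁ p) = inj₁ (E.trans (E.sym q) p)
    ∼-resp q (inj₂ p) = inj₂ (E.trans (E.sym q) p)

    index-unique : ∀ {x i j} → x ∼ s i → x ∼ s j → i ≡ j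
    index-unique (inj₁ p) (inj₁ q) = distinct _ _ (E.trans (E.sym p) q)
    index-unique (inj₁ p) (inj₂ q) = ⊥-elim (disjoint _ _ (E.trans (E.sym p) q))
    index-unique (inj₂ p) (inj₁ q) = ⊥-elim (disjoint _ _ (E.trans (E.sym q) p))
    index-unique (inj₂ p) (inj₂ q) = distinct _ _
      (E.trans (E.sym (inv-inv _)) (E.trans (rev-cong (E.trans (E.sym p) q)) (inv-inv _)))

    _≟ᴱ_ : ∀ e f → Dec (e ≈ᴱ f)
    e ≟ᴱ f with covers e | covers f
    ... | i , p | j , q with i ≟ j
    ... | no i≢j = no (λ r → i≢j (index-unique (∼-resp r p) q))
    e ≟ᴱ f | i , inj₁ p | .i , inj₁ q | yes refl = yes (E.trans p (E.sym q))
    e ≟ᴱ f | i , inj₂ p | .i , inj₂ q | yes refl = yes (E.trans p (E.sym q))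
    e ≟ᴱ f | i , inj₁ p | .i , inj₂ q | yes refl = no (λ r → disjoint i i (E.trans (E.sym p) (E.trans r q)))
    e ≟ᴱ f | i , inj₂ p | .i , inj₁ q | yes refl = no (λ r → disjoint i i (E.trans (E.sym q) (E.trans (E.sym r) p)))

    -- Walks indexed by their edge lists, so that a path can be cut at a chosen edge and spliced,
    -- and so that conditions on edges and on reducedness are statements about lists.
    data Path : Vertex → List Edge → Vertex → Set where
      nil  : ∀ {u w} → u ≈ⱽ w → Path u [] w
      step : ∀ {u w e es} → src e ≈ⱽ u → Path (tgt e) es w → Path u (e ∷ es) w

    path-respˡ : ∀ {u v w es} → u ≈ⱽ v → Path u es w → Path v es w
    path-respˡ p (nil q)    = nil (V.trans (V.sym p) q)
    path-respˡ p (step q r) = step (V.trans q p) r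

    path-respʳ : ∀ {u v w es} → v ≈ⱽ w → Path u es v → Path u es w
    path-respʳ p (nil q)    = nil (V.trans q p)
    path-respʳ p (step q r) = step q (path-respʳ p r)

    path-++ : ∀ {u v w es fs} → Path u es v → Path v fs w → Path u (es ++ fs) w
    path-++ (nil p)    q = path-respˡ (V.sym p) q
    path-++ (step p r) q = step p (path-++ r q)

    IsReduced : List Edge → Set
    IsReduced = Linked (λ e f → ¬ (f ≈ᴱ rev e))

    Connected : (Edge → Set) → Vertex → Vertex → Set
    Connected P u w = ∃[ es ] (Path u es w × All P es)

    connected-trans : ∀ {P u v w} → Connected P u v → Connected P v w → Connected P u w
    connected-trans (_ , p , a) (_ , q , b) = _ , path-++ p q , All.++⁺ a b

    connected-⊆ : ∀ {P Q : Edge → Set} {u w} → (∀ {e} → P e → Q e) → Connected P u w → Connected Q u w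
    connected-⊆ f (_ , p , a) = _ , p , All.map f a

    single : ∀ {P : Edge → Set} {e} → P e → Connected P (src e) (tgt e)
    single p = _ , step V.refl (nil V.refl) , p ∷ []

    reduce : ∀ {P : Edge → Set} {u w es} → Path u es w → All P es →
      ∃[ fs ] (Path u fs w × All P fs × IsReduced fs)
    reduce (nil p) [] = [] , nil p , [] , []
    reduce {u = u} (step {e = e} p q) (pe ∷ a) with reduce q a
    ... | [] , q′ , _ , _ = e ∷ [] , step p q′ , pe ∷ [] , [-]
    ... | f ∷ fs , step r q′ , pf ∷ a′ , l with f ≟ᴱ rev e
    ... | yes f≈ē = fs , path-respˡ (V.trans (tgt-cong f≈ē) (V.trans (t-inv e) p)) q′ , a′ , Linked.tail l
    ... | no  f≉ē = e ∷ f ∷ fs , step p (step r q′) , pe ∷ pf ∷ a′ , f≉ē ∷ l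

    IsAcyclicIn : (Edge → Set) → Set
    IsAcyclicIn P = ∀ {u w es} → u ≈ⱽ w → Path u es w → All P es → IsReduced es → es ≡ []

    IsTreeIn : (Edge → Set) → Set
    IsTreeIn P = (Vertex × (∀ u w → Connected P u w)) × IsAcyclicIn P

    -- π : V → Fin n exhibits Fin n as the components of the forest P.
    record Forest (P : Edge → Set) (n : ℕ) (π : Vertex → Fin n) : Set where
      field
        P-resp   : ∀ {x y} → x ≈ᴱ y → P x → P y
        closed : ∀ {x} → P x → P (rev x)
        π-cong : ∀ {u w} → u ≈ⱽ w → π u ≡ π w
        surj   : ∀ i → ∃[ u ] π u ≡ i
        conn   : ∀ {u w} → π u ≡ π w → Connected P u w
        same   : ∀ {x} → P x → π (src x) ≡ π (tgt x)
        acyc   : IsAcyclicIn P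

      same-path : ∀ {u w es} → Path u es w → All P es → π u ≡ π w
      same-path (nil p)    []      = π-cong p
      same-path (step p q) (x ∷ a) = ≡.trans (π-cong (V.sym p)) (≡.trans (same x) (same-path q a))

    add : (Edge → Set) → Edge → Edge → Set
    add P e x = P x ⊎ x ∼ e

    module _ {P : Edge → Set} {n} {π : Vertex → Fin (suc n)} (F : Forest P (suc n) π)
             (e : Edge) (a≢b : π (src e) ≢ π (tgt e)) where
      open Forest F

      private
        New : Edge → Set
        New x = x ∼ e

        crosses : ∀ {x} → New x → π (src x) ≢ π (tgt x)
        crosses (inj₁ p) q = a≢b (≡.trans (π-cong (src-cong (E.sym p))) (≡.trans q (π-cong (tgt-cong p))))
        crosses (inj₂ p) q = a≢b (≡.trans (≡.sym (≡.trans (π-cong (tgt-cong p)) (π-cong (t-inv e))))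
          (≡.trans (≡.sym q) (≡.trans (π-cong (src-cong p)) (π-cong (o-inv e)))))

        opposite : ∀ {x y} → New x → New y → x ≈ᴱ y ⊎ x ≈ᴱ rev y
        opposite (inj₁ p) (inj₁ q) = inj₁ (E.trans p (E.sym q))
        opposite (inj₁ p) (inj₂ q) = inj₂ (E.trans p (E.trans (E.sym (inv-inv e)) (rev-cong (E.sym q))))
        opposite (inj₂ p) (inj₁ q) = inj₂ (E.trans p (rev-cong (E.sym q)))
        opposite (inj₂ p) (inj₂ q) = inj₁ (E.trans p (E.sym q))

        -- A reduced path in P ∪ {e} uses e at most once.
        data Crossing (u : Vertex) (es : List Edge) (w : Vertex) : Set where
          cross : ∀ {x fs gs} → es ≡ fs ++ x ∷ gs → New x → Path u fs (src x) → All P fs →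
                  π (tgt x) ≡ π w → Crossing u es w

        reduced-prefix : ∀ fs {x gs} → IsReduced (fs ++ x ∷ gs) → IsReduced fs
        reduced-prefix []           l       = []
        reduced-prefix (f ∷ [])     l       = [-]
        reduced-prefix (f ∷ g ∷ fs) (r ∷ l) = r ∷ reduced-prefix (g ∷ fs) l

        -- Suppose the new edge y is followed later by its next use x, with a P-path in between. If
        -- x = y, the P-path would join the two components that y separates. If x is the reverse of
        -- y, the P-path is closed and reduced, hence empty by acyclicity, and x would backtrack
        -- immediately after y.
        classify : ∀ {u es w} → Path u es w → All (add P e) es → IsReduced es →
          All P es ⊎ Crossing u es w
        classify (nil p) [] [] = inj₁ []
        classify (step {e = y} p q) (c ∷ a) l with classify q a (Linked.tail l)
        classify (step p q) (inj₁ py ∷ a) l | inj₁ b = inj₁ (py ∷ b)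
        classify (step p q) (inj₂ ny ∷ a) l | inj₁ b =
          inj₂ (cross {fs = []} refl ny (nil (V.sym p)) [] (same-path q b))
        classify (step p q) (inj₁ py ∷ a) l | inj₂ (cross refl nx r b m) =
          inj₂ (cross {fs = _ ∷ _} refl nx (step p r) (py ∷ b) m)
        classify (step {e = y} p q) (inj₂ ny ∷ a) l | inj₂ (cross {x} {fs} refl nx r b m) with opposite nx ny
        ... | inj₁ x≈y = contradiction (≡.sym (≡.trans (same-path r b) (π-cong (src-cong x≈y)))) (crosses ny)
        ... | inj₂ x≈ȳ with acyc (V.sym (V.trans (src-cong x≈ȳ) (o-inv y))) r b (reduced-prefix fs (Linked.tail l))
        ... | refl = contradiction x≈ȳ (Linked.head l)

      forest-add : Forest (add P e) n (merge a≢b ∘ π)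
      forest-add = record
        { P-resp   = λ { p (inj₁ x) → inj₁ (P-resp p x) ; p (inj₂ x) → inj₂ (∼-resp p x) }
        ; closed = λ { (inj₁ x) → inj₁ (closed x) ; (inj₂ x) → inj₂ (∼-rev x) }
        ; π-cong = λ p → cong (merge a≢b) (π-cong p)
        ; surj   = surj′
        ; conn   = conn′
        ; same   = λ { (inj₁ x) → cong (merge a≢b) (same x) ; (inj₂ x) → same′ x }
        ; acyc   = acyc′
        }
        where
        surj′ : ∀ i → ∃[ u ] merge a≢b (π u) ≡ i
        surj′ i = let (u , p) = surj _ in u , ≡.trans (cong (merge a≢b) p) (merge-punchIn a≢b i)
        wider : ∀ {u w} → Connected P u w → Connected (add P e) u w
        wider = connected-⊆ inj₁
        conn′ : ∀ {u w} → merge a≢b (π u) ≡ merge a≢b (π w) → Connected (add P e) u w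
        conn′ p with merge-kernel a≢b _ _ p
        ... | inj₁ q = wider (conn q)
        ... | inj₂ (inj₁ (q , r)) = connected-trans (wider (conn q))
                (connected-trans (single (inj₂ (inj₁ E.refl))) (wider (conn (≡.sym r))))
        ... | inj₂ (inj₂ (q , r)) = connected-trans (wider (conn (≡.trans q (≡.sym (π-cong (o-inv e))))))
                (connected-trans (single (inj₂ (inj₂ E.refl))) (wider (conn (≡.trans (π-cong (t-inv e)) (≡.sym r)))))
        same′ : ∀ {x} → x ∼ e → merge a≢b (π (src x)) ≡ merge a≢b (π (tgt x))
        same′ (inj₁ p) = ≡.trans (cong (merge a≢b) (π-cong (src-cong p)))
          (≡.trans (merge-ends a≢b) (cong (merge a≢b) (≡.sym (π-cong (tgt-cong p)))))
        same′ (inj₂ p) = ≡.trans (cong (merge a≢b) (≡.trans (π-cong (src-cong p)) (π-cong (o-inv e))))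
          (≡.trans (≡.sym (merge-ends a≢b)) (cong (merge a≢b) (≡.sym (≡.trans (π-cong (tgt-cong p)) (π-cong (t-inv e))))))
        acyc′ : IsAcyclicIn (add P e)
        acyc′ u≈w p a l with classify p a l
        ... | inj₁ b = acyc u≈w p b l
        ... | inj₂ (cross _ nx r b m) =
          contradiction (≡.trans (≡.sym (same-path r b)) (≡.trans (π-cong u≈w) (≡.sym m))) (crosses nx)

    chosen : ∀ {k} → (Edge → Set) → (Fin k → Edge) → Vec Bool k → Edge → Set
    chosen P ss []          = P
    chosen P ss (false ∷ T) = chosen P (ss ∘ suc) T
    chosen P ss (true ∷ T)  = chosen (add P (ss zero)) (ss ∘ suc) T

    chosen-⊇ : ∀ {k P} (ss : Fin k → Edge) T {x} → P x → chosen P ss T x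
    chosen-⊇ ss []          p = p
    chosen-⊇ ss (false ∷ T) p = chosen-⊇ (ss ∘ suc) T p
    chosen-⊇ ss (true ∷ T)  p = chosen-⊇ (ss ∘ suc) T (inj₁ p)

    chosen-intro : ∀ {k P} (ss : Fin k → Edge) T i {x} → lookup T i ≡ true → x ∼ ss i → chosen P ss T x
    chosen-intro ss (true ∷ T)  zero    p q = chosen-⊇ (ss ∘ suc) T (inj₂ q)
    chosen-intro ss (true ∷ T)  (suc i) p q = chosen-intro (ss ∘ suc) T i p q
    chosen-intro ss (false ∷ T) (suc i) p q = chosen-intro (ss ∘ suc) T i p q

    chosen-elim : ∀ {k P} (ss : Fin k → Edge) T {x} → chosen P ss T x →
      P x ⊎ ∃[ i ] (lookup T i ≡ true × x ∼ ss i)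
    chosen-elim ss []          p = inj₁ p
    chosen-elim ss (false ∷ T) p with chosen-elim (ss ∘ suc) T p
    ... | inj₁ q       = inj₁ q
    ... | inj₂ (i , q) = inj₂ (suc i , q)
    chosen-elim ss (true ∷ T) p with chosen-elim (ss ∘ suc) T p
    ... | inj₁ (inj₁ q) = inj₁ q
    ... | inj₁ (inj₂ q) = inj₂ (zero , refl , q)
    ... | inj₂ (i , q)  = inj₂ (suc i , q)

    endpoints : ∀ {k n} → (Vertex → Fin n) → (Fin k → Edge) → Edges n k
    endpoints π ss = tabulate (λ i → π (src (ss i)) , π (tgt (ss i)))

    endpoints-map : ∀ {k n m} (f : Fin n → Fin m) (π : Vertex → Fin n) (ss : Fin k → Edge) →
      mapEdges f (endpoints π ss) ≡ endpoints (f ∘ π) ss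
    endpoints-map f π ss = ≡.sym (Vec.tabulate-∘ _ _)

    spans⇒tree : ∀ {k n P} {π : Vertex → Fin n} (ss : Fin k → Edge) T → Forest P n π →
      spans n (endpoints π ss) T ≡ true → IsTreeIn (chosen P ss T)
    spans⇒tree {n = 1} {π = π} ss [] F p = (proj₁ (surj zero) , λ u w → conn (one _ _)) , acyc
      where
      open Forest F
      one : ∀ (i j : Fin 1) → i ≡ j
      one zero zero = refl
    spans⇒tree {n = zero} {π = π} ss (_ ∷ _) F p with () ← π (src (ss zero))
    spans⇒tree {n = suc n} ss (false ∷ T) F p = spans⇒tree (ss ∘ suc) T F p
    spans⇒tree {n = suc n} {π = π} ss (true ∷ T) F p with π (src (ss zero)) ≟ π (tgt (ss zero))
    ... | no a≢b = spans⇒tree (ss ∘ suc) T (forest-add F (ss zero) a≢b)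
                     (subst (λ es → spans n es T ≡ true) (endpoints-map _ π (ss ∘ suc)) p)

    -- A chosen edge with both ends in one component would close a cycle: the edge followed by a
    -- reduced P-path back to its source. `fresh` keeps the cycle reduced where the edge meets the
    -- path.
    tree⇒spans : ∀ {k n P} {π : Vertex → Fin n} (ss : Fin k → Edge) T → Forest P n π →
      (∀ i → ¬ P (ss i)) → (∀ i j → ss i ∼ ss j → i ≡ j) →
      IsTreeIn (chosen P ss T) → spans n (endpoints π ss) T ≡ true
    tree⇒spans {n = zero} {π = π} ss T F fresh dist ((v , _) , _) with () ← π v
    tree⇒spans {n = 1} ss [] F fresh dist tree = refl
    tree⇒spans {n = suc (suc n)} ss [] F fresh dist ((_ , c) , _) =
      let (u , p) = surj zero ; (w , q) = surj (suc zero) ; (_ , r , a) = c u w in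
      contradiction (≡.trans (≡.sym p) (≡.trans (same-path r a) q)) λ ()
      where open Forest F
    tree⇒spans {n = suc n} ss (false ∷ T) F fresh dist tree =
      tree⇒spans (ss ∘ suc) T F (fresh ∘ suc) (λ i j p → suc-injective (dist _ _ p)) tree
    tree⇒spans {n = suc n} {π = π} ss (true ∷ T) F fresh dist tree with π (src (ss zero)) ≟ π (tgt (ss zero))
    ... | no a≢b = subst (λ es → spans n es T ≡ true) (≡.sym (endpoints-map _ π (ss ∘ suc)))
      (tree⇒spans (ss ∘ suc) T (forest-add F (ss zero) a≢b)
        (λ { i (inj₁ p) → fresh (suc i) p ; i (inj₂ p) → contradiction (dist _ _ p) λ () })
        (λ i j p → suc-injective (dist _ _ p)) tree)
    ... | yes a≡b = ⊥-elim (cyclic (conn (≡.sym a≡b)))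
      where
      open Forest F
      e = ss zero
      cyclic : Connected _ (tgt e) (src e) → ⊥
      cyclic (_ , p , a) with reduce p a
      ... | fs , q , b , l with proj₂ tree V.refl (step V.refl q)
              (chosen-⊇ (ss ∘ suc) T (inj₂ (inj₁ E.refl)) ∷ All.map (λ x → chosen-⊇ (ss ∘ suc) T (inj₁ x)) b) (start b l)
        where
        start : ∀ {fs} → All _ fs → IsReduced fs → IsReduced (e ∷ fs)
        start []      l = [-]
        start (x ∷ b) l = (λ f≈ē → fresh zero (P-resp (inv-inv e) (closed (P-resp f≈ē x)))) ∷ l
      ... | ()

    module Subgraph (M : EdgeSet Y) where
      open EdgeSet M

      In : Edge → Set
      In x = mem x ≡ true

      Sub = spanningSubgraph Y M

      underlying : ∀ {u w} → Walk Sub u w → List Edge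
      underlying p = List.map proj₁ (edges Sub p)

      toPath : ∀ {u w} (p : Walk Sub u w) → Path u (underlying p) w × All In (underlying p)
      toPath (stop q)             = nil q , []
      toPath (step (e , e∈) q p) = let (r , a) = toPath p in step q r , e∈ ∷ a

      fromPath : ∀ {u w es} → Path u es w → All In es → Σ[ p ∈ Walk Sub u w ] underlying p ≡ es
      fromPath (nil q) [] = stop q , refl
      fromPath (step q p) (e∈ ∷ a) = let (r , eq) = fromPath p a in step (_ , e∈) q r , cong (_ ∷_) eq

      map≡[] : ∀ {A B : Set} {f : A → B} {xs} → List.map f xs ≡ [] → xs ≡ []
      map≡[] {xs = []} refl = refl

      tree⇒IsTree : ∀ {P} → (∀ {x} → P x → In x) → (∀ {x} → In x → P x) → IsTreeIn P → IsTree Sub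
      tree⇒IsTree f g ((v , c) , a) =
        (v , λ u w → let (_ , p , b) = c u w in proj₁ (fromPath p (All.map f b))) ,
        λ p l → map≡[] (let (q , b) = toPath p in a V.refl q (All.map g b) (Linked.map⁺ l))

      IsTree⇒tree : ∀ {P} → (∀ {x} → P x → In x) → (∀ {x} → In x → P x) → IsTree Sub → IsTreeIn P
      IsTree⇒tree f g ((v , c) , a) =
        (v , λ u w → let (q , b) = toPath (c u w) in _ , q , All.map g b) ,
        λ u≈w p b l → let (q , eq) = fromPath (path-respʳ (V.sym u≈w) p) (All.map f b) in
          ≡.trans (≡.sym eq) (cong (List.map proj₁) (a q (Linked.map⁻ (subst IsReduced (≡.sym eq) l))))

  module _ {n} (enum : Inverse V (≡.setoid (Fin n))) where
    private
      module enum = Inverse enum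

      Nothing : Edge → Set
      Nothing _ = ⊥

      discrete : Forest Nothing n enum.to
      discrete = record
        { P-resp = λ _ () ; closed = λ () ; π-cong = enum.to-cong
        ; surj = λ i → enum.from i , enum.inverseˡ V.refl
        ; conn = λ p → [] , nil (V.trans (V.sym (enum.inverseʳ (≡.sym p))) (enum.inverseʳ refl)) , []
        ; same = λ () ; acyc = λ { _ _ [] _ → refl } }

    endpointTable : Edges n size
    endpointTable = tabulate (λ i → enum.to (o ⟨$⟩ s i) , enum.to (t ⟨$⟩ s i))

    private
      Solution = ∃[ T ] spans n endpointTable T ≡ true

      edgeSet : Vec Bool size → EdgeSet Y
      edgeSet T = record
        { mem = λ e → lookup T (proj₁ (covers e))
        ; mem-cong = λ {x} {y} p → cong (lookup T) (index-unique (∼-resp p (proj₂ (covers x))) (proj₂ (covers y)))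
        ; mem-inv = λ x → cong (lookup T) (index-unique (proj₂ (covers (rev x))) (∼-rev (proj₂ (covers x)))) }

      ∼-mem : ∀ (M : EdgeSet Y) {x i} → x ∼ s i → EdgeSet.mem M x ≡ EdgeSet.mem M (s i)
      ∼-mem M (inj₁ p) = EdgeSet.mem-cong M p
      ∼-mem M (inj₂ p) = ≡.trans (EdgeSet.mem-cong M p) (EdgeSet.mem-inv M _)

      table : EdgeSet Y → Vec Bool size
      table M = tabulate (λ i → EdgeSet.mem M (s i))

      mem-table : ∀ M T → (∀ i → lookup T i ≡ EdgeSet.mem M (s i)) → ∀ {x} →
        (chosen Nothing s T x → EdgeSet.mem M x ≡ true) × (EdgeSet.mem M x ≡ true → chosen Nothing s T x)
      mem-table M T eq {x} =
          (λ c → [ (λ ()) , (λ (i , p , q) → ≡.trans (∼-mem M q) (≡.trans (≡.sym (eq i)) p)) ]′ (chosen-elim s T c))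
        , (λ m → let (i , q) = covers x in
             chosen-intro s T i (≡.trans (eq i) (≡.trans (≡.sym (∼-mem M q)) m)) q)

      toSolution : ∀ M → IsTree (spanningSubgraph Y M) → spans n endpointTable (table M) ≡ true
      toSolution M tree = tree⇒spans s (table M) discrete (λ _ ()) ∼-distinct
        (IsTree⇒tree (proj₁ (mem-table M (table M) eq)) (proj₂ (mem-table M (table M) eq)) tree)
        where
        open Subgraph M
        eq = λ i → Vec.lookup∘tabulate (λ i → EdgeSet.mem M (s i)) i
        ∼-distinct : ∀ i j → s i ∼ s j → i ≡ j
        ∼-distinct i j p = index-unique (inj₁ E.refl) p

      edgeSet-s : ∀ T i → lookup T i ≡ EdgeSet.mem (edgeSet T) (s i)
      edgeSet-s T i = cong (lookup T) (index-unique (inj₁ E.refl) (proj₂ (covers (s i))))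

      fromSolution : ∀ T → spans n endpointTable T ≡ true → IsTree (spanningSubgraph Y (edgeSet T))
      fromSolution T p = tree⇒IsTree (proj₁ (mem-table (edgeSet T) T (edgeSet-s T))) (proj₂ (mem-table (edgeSet T) T (edgeSet-s T)))
        (spans⇒tree s T discrete p)
        where open Subgraph (edgeSet T)

      solution-≡ : ∀ {x y : Solution} → proj₁ x ≡ proj₁ y → x ≡ y
      solution-≡ {T , p} {.T , q} refl = cong (T ,_) (Decidable⇒UIP.≡-irrelevant _≟ᵇ_ p q)

      trees↔solutions : Inverse (SpanningTrees Y) (≡.setoid Solution)
      trees↔solutions = record
        { to = λ (M , tree) → table M , toSolution M tree
        ; from = λ (T , p) → edgeSet T , fromSolution T p
        ; to-cong = λ p → solution-≡ (Vec.tabulate-cong (λ i → p (s i)))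
        ; from-cong = λ { refl e → refl }
        ; inverse = (λ {(T , _)} {(M , _)} p → solution-≡ (≡.trans (Vec.tabulate-cong (λ i → ≡.trans (p (s i)) (≡.sym (edgeSet-s T i)))) (Vec.tabulate∘lookup T)))
                  , (λ { {(M , _)} refl x → ≡.trans (Vec.lookup∘tabulate (λ i → EdgeSet.mem M (s i)) (proj₁ (covers x))) (≡.sym (∼-mem M (proj₂ (covers x)))) })
        }

    spanningTrees-size : HasSize (SpanningTrees Y) (treeCount n endpointTable)
    spanningTrees-size = inverse trees↔solutions (spans↔treeCount n endpointTable)

  HasSize-unique : ∀ {A n m} → HasSize A n → HasSize A m → n ≡ m
  HasSize-unique p q = Permutation.↔⇒≡ (inverse (Symmetry.inverse p) q)

-- Congruences, binomial coefficients and geometric sums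

module PrincipalQuotient (R : CommutativeRing 0ℓ 0ℓ) (p : CommutativeRing.Carrier R) where
  open CommutativeRing R
  open RingKit R
  open import Data.Integer.Base using (+_)

  infix 4 _≡ₚ_
  -- The multiple is a field because it is itself used: in the congruence Φ ≡ (X - 1)^φ modulo ℓ it
  -- is the cofactor that compares ℓ with a power of π.
  record _≡ₚ_ (a b : Carrier) : Set where
    constructor mk≡ₚ
    field
      multiple : Carrier
      equation : a ≈ b + p * multiple
  open _≡ₚ_ public

  ≈⇒≡ₚ : ∀ {a b} → a ≈ b → a ≡ₚ b
  ≈⇒≡ₚ q = mk≡ₚ 0# (trans q (solve 2 (λ b p → b := b :+ p :* con (+ 0)) refl _ p))

  quotientRing : CommutativeRing 0ℓ 0ℓ
  quotientRing = record
    { Carrier = Carrier ; _≈_ = _≡ₚ_ ; _+_ = _+_ ; _*_ = _*_ ; -_ = -_ ; 0# = 0# ; 1# = 1#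
    ; isCommutativeRing = record
      { isRing = record
        { +-isAbelianGroup = record
          { isGroup = record
            { isMonoid = record
              { isSemigroup = record
                { isMagma = record
                  { isEquivalence = record
                    { refl  = ≈⇒≡ₚ refl
                    ; sym   = λ { (mk≡ₚ c q) → mk≡ₚ (- c) (trans
                        (solve 3 (λ b p c → b := (b :+ p :* c) :+ p :* (:- c)) refl _ p c) (+-congʳ (sym q))) }
                    ; trans = λ { (mk≡ₚ c q) (mk≡ₚ d r) → mk≡ₚ (d + c) (trans q (trans (+-congʳ r)
                        (solve 4 (λ x p c d → (x :+ p :* d) :+ p :* c := x :+ p :* (d :+ c)) refl _ p c d))) } }
                  ; ∙-cong = λ { (mk≡ₚ c q) (mk≡ₚ d r) → mk≡ₚ (c + d) (trans (+-cong q r)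
                        (solve 5 (λ x y p c d → (x :+ p :* c) :+ (y :+ p :* d) := (x :+ y) :+ p :* (c :+ d)) refl _ _ p c d)) } }
                ; assoc = λ x y z → ≈⇒≡ₚ (+-assoc x y z) }
              ; identity = (λ x → ≈⇒≡ₚ (+-identityˡ x)) , (λ x → ≈⇒≡ₚ (+-identityʳ x)) }
            ; inverse = (λ x → ≈⇒≡ₚ (-‿inverseˡ x)) , (λ x → ≈⇒≡ₚ (-‿inverseʳ x))
            ; ⁻¹-cong = λ { (mk≡ₚ c q) → mk≡ₚ (- c) (trans (-‿cong q)
                (solve 3 (λ x p c → :- (x :+ p :* c) := :- x :+ p :* (:- c)) refl _ p c)) } }
          ; comm = λ x y → ≈⇒≡ₚ (+-comm x y) }
        ; *-cong = λ { {x} {y} {u} {v} (mk≡ₚ c q) (mk≡ₚ d r) → mk≡ₚ (y * d + c * v + p * c * d) (trans (*-cong q r)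
            (solve 5 (λ y v p c d → (y :+ p :* c) :* (v :+ p :* d) := y :* v :+ p :* (y :* d :+ c :* v :+ p :* c :* d)) refl y v p c d)) }
        ; *-assoc = λ x y z → ≈⇒≡ₚ (*-assoc x y z)
        ; *-identity = (λ x → ≈⇒≡ₚ (*-identityˡ x)) , (λ x → ≈⇒≡ₚ (*-identityʳ x))
        ; distrib = (λ x y z → ≈⇒≡ₚ (distribˡ x y z)) , (λ x y z → ≈⇒≡ₚ (distribʳ x y z)) }
      ; *-comm = λ x y → ≈⇒≡ₚ (*-comm x y) } }

module BinomialCoefficients where
  open import Data.Nat.Base as ℕ using (ℕ; zero; suc; _<_; s≤s)
  import Data.Nat.Properties as ℕ
  open import Data.Nat.Divisibility as ℕ using (_∣_; divides)
  open import Data.Nat.Primality using (Prime; euclidsLemma)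
  open import Data.Nat.Solver using (module +-*-Solver)
  open import Data.Sum.Base using (inj₁; inj₂)
  open import Relation.Binary.PropositionalEquality as ≡ using (_≡_)
  open import Relation.Nullary.Negation using (contradiction)

  bin : ℕ → ℕ → ℕ
  bin n       zero    = 1
  bin zero    (suc k) = 0
  bin (suc n) (suc k) = bin n k ℕ.+ bin n (suc k)

  bin-absorb : ∀ n k → suc k ℕ.* bin (suc n) (suc k) ≡ suc n ℕ.* bin n k
  bin-absorb zero    zero    = ≡.refl
  bin-absorb zero    (suc k) = ℕ.*-zeroʳ (suc (suc k))
  bin-absorb (suc n) zero    = ≡.cong suc (bin-absorb n zero)
  bin-absorb (suc n) (suc k) = begin′
    where
    a = bin n k
    b = bin n (suc k)
    c = bin n (suc (suc k))
    begin′ : suc (suc k) ℕ.* ((a ℕ.+ b) ℕ.+ (b ℕ.+ c)) ≡ suc (suc n) ℕ.* (a ℕ.+ b)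
    begin′ = ≡.trans
      (+-*-Solver.solve 4 (λ k a b c → (con 2 :+ k) :* ((a :+ b) :+ (b :+ c)) :=
         ((a :+ b) :+ (con 1 :+ k) :* (a :+ b)) :+ (con 2 :+ k) :* (b :+ c)) ≡.refl k a b c)
      (≡.trans (≡.cong₂ (λ x y → ((a ℕ.+ b) ℕ.+ x) ℕ.+ y) (bin-absorb n k) (bin-absorb n (suc k)))
      (+-*-Solver.solve 3 (λ n a b → ((a :+ b) :+ (con 1 :+ n) :* a) :+ (con 1 :+ n) :* b :=
         (con 2 :+ n) :* (a :+ b)) ≡.refl n a b))
      where open +-*-Solver

  -- By `bin-absorb` the prime divides k + 1 times the coefficient, and k + 1 is smaller than the
  -- prime.
  prime∣bin : ∀ {ℓ} → Prime (suc ℓ) → ∀ k → k < ℓ → suc ℓ ∣ bin (suc ℓ) (suc k)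
  prime∣bin {ℓ} pr k k<ℓ with euclidsLemma (suc k) (bin (suc ℓ) (suc k)) pr
      (divides (bin ℓ k) (≡.trans (bin-absorb ℓ k) (ℕ.*-comm (suc ℓ) _)))
  ... | inj₁ d = contradiction (ℕ.∣⇒≤ d) (ℕ.<⇒≱ (s≤s k<ℓ))
  ... | inj₂ d = d

  bin-n-n : ∀ n m → n < m → bin n m ≡ 0
  bin-n-n zero    (suc m) _         = ≡.refl
  bin-n-n (suc n) (suc m) (s≤s n<m) = ≡.cong₂ ℕ._+_ (bin-n-n n m n<m) (bin-n-n n (suc m) (ℕ.m<n⇒m<1+n n<m))

  bin-top : ∀ n → bin n n ≡ 1
  bin-top zero    = ≡.refl
  bin-top (suc n) = ≡.cong₂ ℕ._+_ (bin-top n) (bin-n-n n (suc n) ℕ.≤-refl)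

module GeometricSums (R : CommutativeRing 0ℓ 0ℓ) where
  open CommutativeRing R hiding (zero)
  open RingKit R
  open Determinant R using (sum-cong)
  open import Algebra.Properties.Semiring.Exp semiring using (_^_; ^-congˡ; ^-assocʳ)
  open import Algebra.Properties.Monoid.Sum +-monoid using (sum-init-last)
  open import Data.Integer.Base using (+_)
  open import Data.Fin.Base using (Fin; zero; suc; toℕ; inject₁) renaming (fromℕ to lastFin)
  open import Data.Fin.Properties using (toℕ-fromℕ; toℕ-inject₁; toℕ<n)
  open import Data.Nat.Base as ℕ using (ℕ; zero; suc; _<_; _≤_; s≤s)
  import Data.Nat.Properties as ℕ
  open import Data.Nat.Divisibility as ℕ using (divides)
  open BinomialCoefficients
  open import Relation.Binary.PropositionalEquality as ≡ using (_≡_)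
  open import Relation.Binary.Reasoning.Setoid setoid

  geo : ℕ → Carrier → Carrier
  geo zero    a = 0#
  geo (suc n) a = 1# + a * geo n a

  geo-cong : ∀ n {a b} → a ≈ b → geo n a ≈ geo n b
  geo-cong zero    p = refl
  geo-cong (suc n) p = +-congˡ (*-cong p (geo-cong n p))

  geo-sum : ∀ n a → sum {n} (λ i → a ^ toℕ i) ≈ geo n a
  geo-sum zero    a = refl
  geo-sum (suc n) a = +-congˡ (trans (sym (*-distribˡ-sum {n} a (λ i → a ^ toℕ i))) (*-congˡ (geo-sum n a)))

  geo-telescope : ∀ n a → (a - 1#) * geo n a ≈ a ^ n - 1#
  geo-telescope zero    a = solve 1 (λ a → (a :- con (+ 1)) :* con (+ 0) := con (+ 1) :- con (+ 1)) refl a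
  geo-telescope (suc n) a = begin
    (a - 1#) * (1# + a * geo n a)
      ≈⟨ solve 2 (λ a g → (a :- con (+ 1)) :* (con (+ 1) :+ a :* g) := (a :- con (+ 1)) :+ a :* ((a :- con (+ 1)) :* g)) refl a _ ⟩
    (a - 1#) + a * ((a - 1#) * geo n a)
      ≈⟨ +-congˡ (*-congˡ (geo-telescope n a)) ⟩
    (a - 1#) + a * (a ^ n - 1#)
      ≈⟨ solve 2 (λ a x → (a :- con (+ 1)) :+ a :* (x :- con (+ 1)) := a :* x :- con (+ 1)) refl a _ ⟩
    a * a ^ n - 1# ∎

  geo-last : ∀ n a → geo (suc n) a ≈ geo n a + a ^ n
  geo-last zero    a = solve 1 (λ a → con (+ 1) :+ a :* con (+ 0) := con (+ 0) :+ con (+ 1)) refl a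
  geo-last (suc n) a = trans (+-congˡ (*-congˡ (geo-last n a)))
    (solve 3 (λ a g x → con (+ 1) :+ a :* (g :+ x) := (con (+ 1) :+ a :* g) :+ a :* x) refl a _ _)

  private
    powers : ∀ N → (ℕ → ℕ) → Carrier → Carrier
    powers N f p = sum {N} (λ k → fromℕ (f (toℕ k)) * p ^ toℕ k)

    powers-+ : ∀ N f g p → powers N (λ k → f k ℕ.+ g k) p ≈ powers N f p + powers N g p
    powers-+ N f g p = trans
      (sum-cong {N} (λ k → trans (*-congʳ (⟪⟫-+ (+ f (toℕ k)) (+ g (toℕ k)))) (distribʳ _ _ _)))
      (∑-distrib-+ {N} (λ k → fromℕ (f (toℕ k)) * p ^ toℕ k) (λ k → fromℕ (g (toℕ k)) * p ^ toℕ k))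

    powers-suc : ∀ N f p → powers (suc N) f p ≈ fromℕ (f 0) + p * powers N (λ k → f (suc k)) p
    powers-suc N f p = +-cong (*-identityʳ _) (trans
      (sum-cong {N} (λ k → solve 3 (λ f p x → f :* (p :* x) := p :* (f :* x)) refl (fromℕ (f (suc (toℕ k)))) p (p ^ toℕ k)))
      (sym (*-distribˡ-sum {N} p (λ k → fromℕ (f (suc (toℕ k))) * p ^ toℕ k))))

    powers-0 : ∀ N f p → (∀ k → f k ≡ 0) → powers N f p ≈ 0#
    powers-0 N f p z = trans (sum-cong {N} (λ k → trans (*-congʳ (reflexive (≡.cong fromℕ (z (toℕ k))))) (zeroˡ _)))
                             (sum-replicate-zero N)

    binomial : ∀ n N p → n < N → powers N (bin n) p ≈ (1# + p) ^ n
    binomial zero (suc N) p _ = trans (powers-suc N (bin 0) p)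
      (trans (+-congˡ (trans (*-congˡ (powers-0 N (λ k → bin 0 (suc k)) p (λ _ → ≡.refl))) (zeroʳ p))) (+-identityʳ 1#))
    binomial (suc n) (suc N) p (s≤s n<N) = begin
      powers (suc N) (bin (suc n)) p
        ≈⟨ powers-suc N (bin (suc n)) p ⟩
      1# + p * powers N (λ k → bin n k ℕ.+ bin n (suc k)) p
        ≈⟨ +-congˡ (*-congˡ (powers-+ N (bin n) (λ k → bin n (suc k)) p)) ⟩
      1# + p * (powers N (bin n) p + powers N (λ k → bin n (suc k)) p)
        ≈⟨ solve 3 (λ p x y → con (+ 1) :+ p :* (x :+ y) := (con (+ 1) :+ p :* y) :+ p :* x) refl p _ _ ⟩
      (1# + p * powers N (λ k → bin n (suc k)) p) + p * powers N (bin n) p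
        ≈⟨ +-congʳ (powers-suc N (bin n) p) ⟨
      powers (suc N) (bin n) p + p * powers N (bin n) p
        ≈⟨ +-cong (binomial n (suc N) p (ℕ.m<n⇒m<1+n n<N)) (*-congˡ (binomial n N p n<N)) ⟩
      (1# + p) ^ n + p * (1# + p) ^ n
        ≈⟨ solve 2 (λ p x → x :+ p :* x := (con (+ 1) :+ p) :* x) refl p _ ⟩
      (1# + p) * (1# + p) ^ n ∎

    -- Both sides are ((1 + p)^n - 1)/p. Summing the binomial theorem over the exponents avoids
    -- dividing by `p`, and the slack in `N` lets one length of sum serve the whole induction.
    geo-binomial : ∀ n N p → n ≤ N → geo n (1# + p) ≈ powers N (λ k → bin n (suc k)) p
    geo-binomial zero    N p _ = sym (powers-0 N _ p (λ _ → ≡.refl))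
    geo-binomial (suc n) N p n<N = begin
      geo (suc n) (1# + p)
        ≈⟨ geo-last n _ ⟩
      geo n (1# + p) + (1# + p) ^ n
        ≈⟨ +-cong (geo-binomial n N p (ℕ.<⇒≤ n<N)) (sym (binomial n N p n<N)) ⟩
      powers N (λ k → bin n (suc k)) p + powers N (bin n) p
        ≈⟨ trans (+-comm _ _) (sym (powers-+ N (bin n) (λ k → bin n (suc k)) p)) ⟩
      powers N (λ k → bin (suc n) (suc k)) p ∎

  module PrimeCharacteristic {ℓ} (pr : Prime (suc ℓ)) (char : fromℕ (suc ℓ) ≈ 0#) where
    geo-prime : ∀ p → geo (suc ℓ) (1# + p) ≈ p ^ ℓ
    geo-prime p = begin
      geo (suc ℓ) (1# + p)
        ≈⟨ geo-binomial (suc ℓ) (suc ℓ) p ℕ.≤-refl ⟩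
      powers (suc ℓ) (λ k → bin (suc ℓ) (suc k)) p
        ≈⟨ sum-init-last {ℓ} term ⟩
      sum {ℓ} (λ i → term (inject₁ i)) + term (lastFin ℓ)
        ≈⟨ +-cong (trans (sum-cong {ℓ} low) (sum-replicate-zero ℓ)) top ⟩
      0# + p ^ ℓ
        ≈⟨ +-identityˡ _ ⟩
      p ^ ℓ ∎
      where
      term : Fin (suc ℓ) → Carrier
      term k = fromℕ (bin (suc ℓ) (suc (toℕ k))) * p ^ toℕ k
      low : ∀ i → term (inject₁ i) ≈ 0#
      low i with prime∣bin pr (toℕ (inject₁ i)) (≡.subst (_< ℓ) (≡.sym (toℕ-inject₁ i)) (toℕ<n i))
      ... | divides q eq = trans (*-congʳ (trans (reflexive (≡.cong fromℕ (≡.trans eq (ℕ.*-comm q (suc ℓ)))))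
          (trans (reflexive (≡.cong ⟪_⟫ (pos-* (suc ℓ) q))) (trans (⟪⟫-* (+ suc ℓ) (+ q)) (trans (*-congʳ char) (zeroˡ _)))))) (zeroˡ _)
        where open import Data.Integer.Properties using (pos-*)
      top : term (lastFin ℓ) ≈ p ^ ℓ
      top = trans (*-cong (reflexive (≡.cong fromℕ (≡.trans (≡.cong (λ k → bin (suc ℓ) (suc k)) (toℕ-fromℕ ℓ)) (bin-top (suc ℓ)))))
                          (reflexive (≡.cong (p ^_) (toℕ-fromℕ ℓ)))) (*-identityˡ _)

    frobenius-1+ : ∀ p → (1# + p) ^ suc ℓ ≈ 1# + p ^ suc ℓ
    frobenius-1+ p = begin
      (1# + p) ^ suc ℓ
        ≈⟨ solve 1 (λ x → x := con (+ 1) :+ (x :- con (+ 1))) refl _ ⟩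
      1# + ((1# + p) ^ suc ℓ - 1#)
        ≈⟨ +-congˡ (geo-telescope (suc ℓ) (1# + p)) ⟨
      1# + ((1# + p) - 1#) * geo (suc ℓ) (1# + p)
        ≈⟨ +-congˡ (*-cong (solve 1 (λ p → (con (+ 1) :+ p) :- con (+ 1) := p) refl p) (geo-prime p)) ⟩
      1# + p * p ^ ℓ ∎

    frobenius-1+-iterate : ∀ k p → (1# + p) ^ (suc ℓ ℕ.^ k) ≈ 1# + p ^ (suc ℓ ℕ.^ k)
    frobenius-1+-iterate zero    p = trans (*-identityʳ _) (+-congˡ (sym (*-identityʳ p)))
    frobenius-1+-iterate (suc k) p = begin
      (1# + p) ^ (suc ℓ ℕ.* suc ℓ ℕ.^ k)
        ≈⟨ ^-assocʳ (1# + p) (suc ℓ) (suc ℓ ℕ.^ k) ⟨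
      ((1# + p) ^ suc ℓ) ^ (suc ℓ ℕ.^ k)
        ≈⟨ ^-congˡ (suc ℓ ℕ.^ k) (frobenius-1+ p) ⟩
      (1# + p ^ suc ℓ) ^ (suc ℓ ℕ.^ k)
        ≈⟨ frobenius-1+-iterate k (p ^ suc ℓ) ⟩
      1# + (p ^ suc ℓ) ^ (suc ℓ ℕ.^ k)
        ≈⟨ +-congˡ (^-assocʳ p (suc ℓ) (suc ℓ ℕ.^ k)) ⟩
      1# + p ^ (suc ℓ ℕ.* suc ℓ ℕ.^ k) ∎

    -- The left side is the cyclotomic polynomial of order (suc ℓ)^(k+1) at 1 + p, with `ℓ` one less
    -- than the prime. Frobenius and the vanishing of the inner binomial coefficients leave a pure
    -- power, whose exponent is the degree.
    cyclotomic-prime : ∀ k p → geo (suc ℓ) ((1# + p) ^ (suc ℓ ℕ.^ k)) ≈ p ^ (suc ℓ ℕ.^ k ℕ.* ℓ)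
    cyclotomic-prime k p = trans (geo-cong (suc ℓ) (frobenius-1+-iterate k p))
      (trans (geo-prime (p ^ (suc ℓ ℕ.^ k))) (^-assocʳ p (suc ℓ ℕ.^ k) ℓ))

  -- The cofactor (geo n a - n)/(a - 1) of `geo-mod`. When `geo n a` vanishes it exhibits a - 1 as a
  -- divisor of n.
  geo-remainder : ℕ → Carrier → Carrier
  geo-remainder zero    a = 0#
  geo-remainder (suc n) a = geo-remainder n a + geo n a

  geo-mod : ∀ n a → geo n a ≈ fromℕ n + (a - 1#) * geo-remainder n a
  geo-mod zero    a = solve 1 (λ a → con (+ 0) := con (+ 0) :+ (a :- con (+ 1)) :* con (+ 0)) refl a
  geo-mod (suc n) a = begin
    1# + a * geo n a
      ≈⟨ solve 2 (λ a g → con (+ 1) :+ a :* g := con (+ 1) :+ (g :+ (a :- con (+ 1)) :* g)) refl a _ ⟩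
    1# + (geo n a + (a - 1#) * geo n a)
      ≈⟨ +-congˡ (+-congʳ (geo-mod n a)) ⟩
    1# + ((fromℕ n + (a - 1#) * geo-remainder n a) + (a - 1#) * geo n a)
      ≈⟨ solve 4 (λ f p r g → con (+ 1) :+ ((f :+ p :* r) :+ p :* g) := (con (+ 1) :+ f) :+ p :* (r :+ g)) refl _ _ _ _ ⟩
    (1# + fromℕ n) + (a - 1#) * (geo-remainder n a + geo n a)
      ≈⟨ +-congʳ (fromℕ-suc n) ⟨
    fromℕ (suc n) + (a - 1#) * geo-remainder (suc n) a ∎

-- Polynomials acting on integer sequences

module ShiftOperators where
  open import Data.Integer.Base as ℤ using (ℤ; +_)
  import Data.Integer.Properties as ℤ
  open import Data.Integer.Solver using (module +-*-Solver)
  import Data.Nat.Properties as ℕ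
  open import Relation.Binary.PropositionalEquality as ≡ using (_≡_; refl; cong; cong₂)

  -- Unnormalised expressions suffice: equality is imposed afterwards through the action on
  -- sequences, so degrees and division with remainder never enter.
  data Poly : Set where
    con : ℤ → Poly
    X : Poly
    _⊞_ _⊡_ : Poly → Poly → Poly
    neg : Poly → Poly

  infixl 6 _⊞_
  infixl 7 _⊡_

  Sequence : Set
  Sequence = ℕ → ℤ

  -- X acts as the shift.
  ⟦_⟧ : Poly → Sequence → Sequence
  ⟦ con c ⟧ s n = c ℤ.* s n
  ⟦ X ⟧     s n = s (suc n)
  ⟦ a ⊞ b ⟧ s n = ⟦ a ⟧ s n ℤ.+ ⟦ b ⟧ s n
  ⟦ a ⊡ b ⟧ s   = ⟦ a ⟧ (⟦ b ⟧ s)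
  ⟦ neg a ⟧ s n = ℤ.- ⟦ a ⟧ s n

  act-cong : ∀ a {s t : Sequence} → (∀ n → s n ≡ t n) → ∀ n → ⟦ a ⟧ s n ≡ ⟦ a ⟧ t n
  act-cong (con c) p n = cong (c ℤ.*_) (p n)
  act-cong X       p n = p (suc n)
  act-cong (a ⊞ b) p n = cong₂ ℤ._+_ (act-cong a p n) (act-cong b p n)
  act-cong (a ⊡ b) p n = act-cong a (act-cong b p) n
  act-cong (neg a) p n = cong ℤ.-_ (act-cong a p n)

  module Action where
    open +-*-Solver using (solve; _:=_; _:+_; _:*_; _:-_; :-_)

    shifted-difference : ∀ l x y u v →
      u ℤ.- v ≡ (x ℤ.- y) ℤ.* l ℤ.+ ((ℤ.- l ℤ.* x ℤ.+ u) ℤ.- (ℤ.- l ℤ.* y ℤ.+ v))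
    shifted-difference = solve 5 (λ l x y u v →
      u :- v := (x :- y) :* l :+ ((:- l :* x :+ u) :- (:- l :* y :+ v))) refl

    act-lin : ∀ a k s t n → ⟦ a ⟧ (λ m → k ℤ.* s m ℤ.+ t m) n ≡ k ℤ.* ⟦ a ⟧ s n ℤ.+ ⟦ a ⟧ t n
    act-lin (con c) k s t n = solve 4 (λ c k x y → c :* (k :* x :+ y) := k :* (c :* x) :+ c :* y) refl c k (s n) (t n)
    act-lin X       k s t n = refl
    act-lin (a ⊞ b) k s t n = ≡.trans (cong₂ ℤ._+_ (act-lin a k s t n) (act-lin b k s t n))
      (solve 5 (λ k x y z w → (k :* x :+ y) :+ (k :* z :+ w) := k :* (x :+ z) :+ (y :+ w)) refl k _ _ _ _)
    act-lin (a ⊡ b) k s t n = ≡.trans (act-cong a (act-lin b k s t) n) (act-lin a k (⟦ b ⟧ s) (⟦ b ⟧ t) n)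
    act-lin (neg a) k s t n = ≡.trans (cong ℤ.-_ (act-lin a k s t n))
      (solve 3 (λ k x y → :- (k :* x :+ y) := k :* (:- x) :+ :- y) refl k _ _)

    act-+ : ∀ a s t n → ⟦ a ⟧ (λ m → s m ℤ.+ t m) n ≡ ⟦ a ⟧ s n ℤ.+ ⟦ a ⟧ t n
    act-+ a s t n = ≡.trans (act-cong a (λ m → cong (ℤ._+ t m) (≡.sym (ℤ.*-identityˡ (s m)))) n)
      (≡.trans (act-lin a (+ 1) s t n) (cong (ℤ._+ ⟦ a ⟧ t n) (ℤ.*-identityˡ (⟦ a ⟧ s n))))

    act-scale : ∀ a k s n → ⟦ a ⟧ (λ m → k ℤ.* s m) n ≡ k ℤ.* ⟦ a ⟧ s n
    act-scale (con c) k s n = solve 3 (λ c k x → c :* (k :* x) := k :* (c :* x)) refl c k (s n)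
    act-scale X       k s n = refl
    act-scale (a ⊞ b) k s n = ≡.trans (cong₂ ℤ._+_ (act-scale a k s n) (act-scale b k s n))
      (≡.sym (ℤ.*-distribˡ-+ k _ _))
    act-scale (a ⊡ b) k s n = ≡.trans (act-cong a (act-scale b k s) n) (act-scale a k (⟦ b ⟧ s) n)
    act-scale (neg a) k s n = ≡.trans (cong ℤ.-_ (act-scale a k s n)) (ℤ.neg-distribʳ-* k _)

    act-neg : ∀ a s n → ⟦ a ⟧ (λ m → ℤ.- s m) n ≡ ℤ.- ⟦ a ⟧ s n
    act-neg a s n = ≡.trans (act-cong a (λ m → ≡.sym (ℤ.-1*i≡-i (s m))) n)
      (≡.trans (act-scale a ℤ.-1ℤ s n) (ℤ.-1*i≡-i _))

    act-shift : ∀ a s n → ⟦ a ⟧ (λ m → s (suc m)) n ≡ ⟦ a ⟧ s (suc n)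
    act-shift (con c) s n = refl
    act-shift X       s n = refl
    act-shift (a ⊞ b) s n = cong₂ ℤ._+_ (act-shift a s n) (act-shift b s n)
    act-shift (a ⊡ b) s n = ≡.trans (act-cong a (act-shift b s) n) (act-shift a (⟦ b ⟧ s) n)
    act-shift (neg a) s n = cong ℤ.-_ (act-shift a s n)

    act-comm : ∀ a b s n → ⟦ a ⟧ (⟦ b ⟧ s) n ≡ ⟦ b ⟧ (⟦ a ⟧ s) n
    act-comm a (con c) s n = act-scale a c s n
    act-comm a X       s n = act-shift a s n
    act-comm a (b ⊞ d) s n = ≡.trans (act-+ a (⟦ b ⟧ s) (⟦ d ⟧ s) n) (cong₂ ℤ._+_ (act-comm a b s n) (act-comm a d s n))
    act-comm a (b ⊡ d) s n = ≡.trans (act-comm a b (⟦ d ⟧ s) n) (act-cong b (act-comm a d s) n)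
    act-comm a (neg b) s n = ≡.trans (act-neg a (⟦ b ⟧ s) n) (cong ℤ.-_ (act-comm a b s n))

  open Action public

  module _ (M : Sequence → Set) where
    infix 4 _≈ᴹ_
    record _≈ᴹ_ (a b : Poly) : Set where
      constructor mk≈
      field
        agree : ∀ {s} → M s → ∀ n → ⟦ a ⟧ s n ≡ ⟦ b ⟧ s n
    open _≈ᴹ_ public

    -- ℤ[X] modulo the annihilator of the set M of sequences.
    opRing : CommutativeRing 0ℓ 0ℓ
    opRing = record
      { Carrier = Poly ; _≈_ = _≈ᴹ_ ; _+_ = _⊞_ ; _*_ = _⊡_ ; -_ = neg ; 0# = con (+ 0) ; 1# = con (+ 1)
      ; isCommutativeRing = record
        { isRing = record
          { +-isAbelianGroup = record
            { isGroup = record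
              { isMonoid = record
                { isSemigroup = record
                  { isMagma = record
                    { isEquivalence = record
                      { refl  = mk≈ λ _ _ → refl
                      ; sym   = λ p → mk≈ λ m n → ≡.sym (agree p m n)
                      ; trans = λ p q → mk≈ λ m n → ≡.trans (agree p m n) (agree q m n) }
                    ; ∙-cong = λ p q → mk≈ λ m n → cong₂ ℤ._+_ (agree p m n) (agree q m n) }
                  ; assoc = λ a b c → mk≈ λ {s} _ n → ℤ.+-assoc (⟦ a ⟧ s n) (⟦ b ⟧ s n) (⟦ c ⟧ s n) }
                ; identity = (λ a → mk≈ λ {s} _ n → ≡.trans (cong (ℤ._+ ⟦ a ⟧ s n) (ℤ.*-zeroˡ (s n))) (ℤ.+-identityˡ _))
                           , (λ a → mk≈ λ {s} _ n → ≡.trans (cong (λ x → ⟦ a ⟧ s n ℤ.+ x) (ℤ.*-zeroˡ (s n))) (ℤ.+-identityʳ _)) }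
              ; inverse = (λ a → mk≈ λ {s} _ n → ≡.trans (ℤ.+-inverseˡ (⟦ a ⟧ s n)) (≡.sym (ℤ.*-zeroˡ (s n))))
                        , (λ a → mk≈ λ {s} _ n → ≡.trans (ℤ.+-inverseʳ (⟦ a ⟧ s n)) (≡.sym (ℤ.*-zeroˡ (s n))))
              ; ⁻¹-cong = λ p → mk≈ λ m n → cong ℤ.-_ (agree p m n) }
            ; comm = λ a b → mk≈ λ {s} _ n → ℤ.+-comm (⟦ a ⟧ s n) (⟦ b ⟧ s n) }
          ; *-cong = λ {a} {a′} {b} {b′} p q → mk≈ λ {s} m n →
              ≡.trans (act-cong a (agree q m) n) (≡.trans (act-comm a b′ s n)
                (≡.trans (act-cong b′ (agree p m) n) (act-comm b′ a′ s n)))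
          ; *-assoc = λ a b c → mk≈ λ _ _ → refl
          ; *-identity = (λ a → mk≈ λ _ n → ℤ.*-identityˡ _)
                       , (λ a → mk≈ λ {s} _ n → act-cong a (λ k → ℤ.*-identityˡ (s k)) n)
          ; distrib = (λ a b c → mk≈ λ {s} _ n → act-+ a (⟦ b ⟧ s) (⟦ c ⟧ s) n)
                    , (λ a b c → mk≈ λ _ _ → refl) }
        ; *-comm = λ a b → mk≈ λ {s} _ n → act-comm a b s n } }

  -- Evaluation at X = 1.
  aug : Poly → ℤ
  aug (con c) = c
  aug X       = + 1
  aug (a ⊞ b) = aug a ℤ.+ aug b
  aug (a ⊡ b) = aug a ℤ.* aug b
  aug (neg a) = ℤ.- aug a

  -- The divided difference (a - a(1))/(X - 1), computed structurally; the product clause is its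
  -- Leibniz rule. See `aug-quo`.
  quo : Poly → Poly
  quo (con c) = con (+ 0)
  quo X       = con (+ 1)
  quo (a ⊞ b) = quo a ⊞ quo b
  quo (a ⊡ b) = quo a ⊡ b ⊞ con (aug a) ⊡ quo b
  quo (neg a) = neg (quo a)

  π : Poly
  π = X ⊞ neg (con (+ 1))

  infixr 8 _**_
  _**_ : Poly → ℕ → Poly
  a ** zero  = con (+ 1)
  a ** suc n = a ⊡ a ** n

  -- The substitution X ↦ X ^ j.
  σ : ℕ → Poly → Poly
  σ j (con c) = con c
  σ j X       = X ** j
  σ j (a ⊞ b) = σ j a ⊞ σ j b
  σ j (a ⊡ b) = σ j a ⊡ σ j b
  σ j (neg a) = neg (σ j a)

  act-X** : ∀ j s n → ⟦ X ** j ⟧ s n ≡ s (j ℕ.+ n)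
  act-X** zero    s n = ℤ.*-identityˡ (s n)
  act-X** (suc j) s n = ≡.trans (act-X** j s (suc n)) (cong s (ℕ.+-suc j n))

  -- Substituting X^j amounts to acting on the subsequence of stride j that starts at n. This is
  -- what transports annihilators along `σ j`.
  act-σ : ∀ j a s n i → ⟦ σ j a ⟧ s (i ℕ.* j ℕ.+ n) ≡ ⟦ a ⟧ (λ i → s (i ℕ.* j ℕ.+ n)) i
  act-σ j (con c) s n i = refl
  act-σ j X       s n i = ≡.trans (act-X** j s _) (cong s (≡.sym (ℕ.+-assoc j (i ℕ.* j) n)))
  act-σ j (a ⊞ b) s n i = cong₂ ℤ._+_ (act-σ j a s n i) (act-σ j b s n i)
  act-σ j (a ⊡ b) s n i = ≡.trans (act-σ j a (⟦ σ j b ⟧ s) n i) (act-cong a (act-σ j b s n) i)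
  act-σ j (neg a) s n i = cong ℤ.-_ (act-σ j a s n i)

  aug-** : ∀ a n → aug (a ** n) ≡ aug a ℤ.^ n
  aug-** a zero    = refl
  aug-** a (suc n) = cong (aug a ℤ.*_) (aug-** a n)

  act-one : ∀ a n → ⟦ a ⟧ (λ _ → + 1) n ≡ aug a
  act-one (con c) n = ℤ.*-identityʳ c
  act-one X       n = refl
  act-one (a ⊞ b) n = cong₂ ℤ._+_ (act-one a n) (act-one b n)
  act-one (a ⊡ b) n = ≡.trans (act-cong a (λ m → ≡.trans (act-one b m) (≡.sym (ℤ.*-identityʳ (aug b)))) n)
    (≡.trans (act-scale a (aug b) (λ _ → + 1) n) (≡.trans (cong (aug b ℤ.*_) (act-one a n)) (ℤ.*-comm (aug b) (aug a))))
  act-one (neg a) n = cong ℤ.-_ (act-one a n)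

  module OpRing (M : Sequence → Set) where
    private
      module R = CommutativeRing (opRing M)
    open module Kit = RingKit (opRing M) using (fromℕ; _:=_; _:+_; _:*_; _:-_; :-_) renaming (con to con′)
    open import Relation.Binary.Reasoning.Setoid R.setoid

    con-+ : ∀ x y → con (x ℤ.+ y) R.≈ con x ⊞ con y
    con-+ x y = mk≈ λ {s} _ n → ℤ.*-distribʳ-+ (s n) x y

    con-* : ∀ x y → con (x ℤ.* y) R.≈ con x ⊡ con y
    con-* x y = mk≈ λ {s} _ n → ℤ.*-assoc x y (s n)

    con-neg : ∀ x → con (ℤ.- x) R.≈ neg (con x)
    con-neg x = mk≈ λ {s} _ n → ≡.sym (ℤ.neg-distribˡ-* x (s n))

    fromℕ-con : ∀ n → fromℕ n R.≈ con (+ n)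
    fromℕ-con zero    = R.refl
    fromℕ-con (suc n) = R.trans (Kit.fromℕ-suc n) (R.trans (R.+-congˡ (fromℕ-con n)) (R.sym (con-+ (+ 1) (+ n))))

    aug-quo : ∀ a → a R.≈ con (aug a) ⊞ π ⊡ quo a
    aug-quo (con c) = Kit.solve 2 (λ c p → c := c :+ p :* con′ (+ 0)) R.refl (con c) π
    aug-quo X = Kit.solve 1 (λ x → x := con′ (+ 1) :+ (x :- con′ (+ 1)) :* con′ (+ 1)) R.refl X
    aug-quo (a ⊞ b) = R.trans (R.+-cong (aug-quo a) (aug-quo b)) (R.trans
      (Kit.solve 5 (λ p x y u v → (x :+ p :* u) :+ (y :+ p :* v) := (x :+ y) :+ p :* (u :+ v)) R.refl π _ _ _ _)
      (R.+-congʳ (R.sym (con-+ (aug a) (aug b)))))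
    aug-quo (a ⊡ b) = begin
      a ⊡ b
        ≈⟨ R.*-congʳ (aug-quo a) ⟩
      (con (aug a) ⊞ π ⊡ quo a) ⊡ b
        ≈⟨ Kit.solve 4 (λ x p u b → (x :+ p :* u) :* b := x :* b :+ p :* (u :* b)) R.refl _ _ _ _ ⟩
      con (aug a) ⊡ b ⊞ π ⊡ (quo a ⊡ b)
        ≈⟨ R.+-congʳ (R.*-congˡ (aug-quo b)) ⟩
      con (aug a) ⊡ (con (aug b) ⊞ π ⊡ quo b) ⊞ π ⊡ (quo a ⊡ b)
        ≈⟨ Kit.solve 5 (λ x y p v w → x :* (y :+ p :* v) :+ p :* w := x :* y :+ p :* (w :+ x :* v)) R.refl _ _ _ _ _ ⟩
      con (aug a) ⊡ con (aug b) ⊞ π ⊡ (quo a ⊡ b ⊞ con (aug a) ⊡ quo b)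
        ≈⟨ R.+-congʳ (con-* (aug a) (aug b)) ⟨
      con (aug a ℤ.* aug b) ⊞ π ⊡ (quo a ⊡ b ⊞ con (aug a) ⊡ quo b) ∎
    aug-quo (neg a) = R.trans (R.-‿cong (aug-quo a)) (R.trans
      (Kit.solve 3 (λ x p u → :- (x :+ p :* u) := :- x :+ p :* (:- u)) R.refl _ _ _)
      (R.+-congʳ (R.sym (con-neg (aug a)))))

    -- Cancellation takes place in ℤ, value by value. This is the gain from representing ring
    -- elements by their action on integer sequences.
    con-torsion-free : ∀ c .{{_ : ℤ.NonZero c}} {a b} → con c ⊡ a R.≈ con c ⊡ b → a R.≈ b
    con-torsion-free c p = mk≈ λ m n → ℤ.*-cancelˡ-≡ c _ _ (agree p m n)

    open import Algebra.Properties.Semiring.Exp R.semiring using (_^_)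

    **-^ : ∀ a n → a ** n R.≈ a ^ n
    **-^ a zero    = R.refl
    **-^ a (suc n) = R.*-congˡ (**-^ a n)

-- Inverses modulo a prime and its powers

module ModInverse where
  open import Data.Nat.Base as ℕ using (ℕ; zero; suc; _+_; _*_; _^_)
  import Data.Nat.Properties as ℕ
  open import Data.Nat.Coprimality using (Coprime; coprime-Bézout)
  open import Data.Nat.Divisibility as ℕ using (_∣_; divides; _∣?_)
  open import Data.Nat.GCD using (module Bézout)
  open import Data.Nat.Primality using (Prime; prime⇒irreducible; ¬prime[1])
  open import Data.Nat.Solver using (module +-*-Solver)
  open import Data.Product.Base using (_,_; ∃₂)
  open import Data.Sum.Base using (inj₁; inj₂)
  open import Relation.Binary.PropositionalEquality as ≡ using (_≡_; refl; cong; subst)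
  open import Relation.Nullary.Decidable using (yes; no)
  open import Relation.Nullary.Negation using (¬_; contradiction)
  open +-*-Solver using (solve; _:=_; _:+_; _:*_; con)

  ∤⇒coprime : ∀ {ℓ g} → Prime ℓ → ¬ (ℓ ∣ g) → Coprime g ℓ
  ∤⇒coprime pr ℓ∤g (i∣g , i∣ℓ) with prime⇒irreducible pr i∣ℓ
  ... | inj₁ i≡1  = i≡1
  ... | inj₂ refl = contradiction i∣g ℓ∤g

  mod-inverse : ∀ {p g} → Prime (suc p) → ¬ (suc p ∣ g) → ∃₂ λ c u → g * c ≡ 1 + suc p * u
  mod-inverse {p} {g} pr ℓ∤g with coprime-Bézout (∤⇒coprime pr ℓ∤g)
  ... | Bézout.+- x y eq = x , y , ≡.trans (ℕ.*-comm g x) (≡.trans (≡.sym eq) (cong suc (ℕ.*-comm y (suc p))))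
  mod-inverse {zero} pr ℓ∤g | Bézout.-+ x y eq = contradiction pr ¬prime[1]
  -- Here Bézout gives 1 + x g = y ℓ, so -x is the inverse; (ℓ - 1) x represents it by a natural
  -- number.
  mod-inverse {suc q} {g} pr ℓ∤g | Bézout.-+ x (suc y) eq =
    suc q * x , suc q * y + q , ℕ.+-cancelʳ-≡ (suc q) _ _ (≡.trans
      (solve 3 (λ q x g → g :* ((con 1 :+ q) :* x) :+ (con 1 :+ q) := (con 1 :+ q) :* (con 1 :+ x :* g)) refl q x g)
      (≡.trans (cong (suc q *_) eq)
      (solve 2 (λ q y → (con 1 :+ q) :* ((con 1 :+ y) :* (con 2 :+ q))
         := con 1 :+ (con 2 :+ q) :* ((con 1 :+ q) :* y :+ q) :+ (con 1 :+ q)) refl q y)))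

  -- For ζ of order ℓ^(k+1), a power ζ^g different from 1 has itself a power equal to the ℓ-th root
  -- of unity ζ^(ℓ^k), and this finds the exponent. Factors ℓ are split off g until it is invertible
  -- modulo ℓ.
  solve-power : ∀ {p} k g → Prime (suc p) → ¬ (suc p ^ k * suc p ∣ g) →
    ∃₂ λ c u → g * c ≡ suc p ^ k + (suc p ^ k * suc p) * u
  solve-power {p} zero g pr n = let (c , u , eq) = mod-inverse pr (λ d → n (subst (_∣ g) (≡.sym (ℕ.*-identityˡ (suc p))) d)) in
    c , u , ≡.trans eq (cong (λ x → 1 + x * u) (≡.sym (ℕ.*-identityˡ (suc p))))
  solve-power {p} (suc k) g pr n with suc p ∣? g
  ... | no ℓ∤g = let (c , u , eq) = mod-inverse pr ℓ∤g ; L = suc p ^ suc k in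
    c * L , u , ≡.trans (≡.sym (ℕ.*-assoc g c L)) (≡.trans (cong (_* L) eq)
      (solve 3 (λ l u L → (con 1 :+ l :* u) :* L := L :+ (L :* l) :* u) refl (suc p) u L))
  ... | yes (divides h refl) = let (c , u , eq) = solve-power k h pr ¬d ; L = suc p ^ k in
    c , u , ≡.trans (solve 3 (λ l h c → (h :* l) :* c := l :* (h :* c)) refl (suc p) h c) (≡.trans (cong (suc p *_) eq)
      (solve 3 (λ l u L → l :* (L :+ (L :* l) :* u) := l :* L :+ ((l :* L) :* l) :* u) refl (suc p) u L))
    where
    ¬d : ¬ (suc p ^ k * suc p ∣ h)
    ¬d d = n (subst (_∣ h * suc p) (cong (_* suc p) (ℕ.*-comm (suc p ^ k) (suc p))) (ℕ.*-monoˡ-∣ (suc p) d))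

-- The cyclotomic ring of order ℓ^(k+1)

module Cyclotomic (p : ℕ) (ℓ-prime : Prime (suc p)) (k : ℕ) where
  open import Data.Nat.Base as ℕ using (ℕ; zero; suc; _<_; _≤_; s≤s; z≤n)
  open ShiftOperators
  open import Data.Integer.Base as ℤ using (ℤ; +_)
  import Data.Integer.Properties as ℤ
  open import Data.Integer.Divisibility.Signed as ℤ using ()
  import Data.Nat.Properties as ℕ
  open import Data.Nat.DivMod using (_/_; _%_; m/n≡1+[m∸n]/n; m<n⇒m%n≡m; [m+n]%n≡m%n)
  import Data.Nat.Divisibility as ℕ
  open import Data.Unit.Base using (⊤)
  open import Relation.Binary.PropositionalEquality as ≡ using (_≡_; refl; cong; cong₂; subst)
  open import Relation.Nullary.Negation using (contradiction)

  ℓ M : ℕ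
  ℓ = suc p
  M = ℓ ℕ.^ k

  instance
    M≢0 : ℕ.NonZero M
    M≢0 = ℕ.m^n≢0 ℓ k

  geometric : ℕ → Poly → Poly
  geometric zero    a = con (+ 0)
  geometric (suc n) a = con (+ 1) ⊞ a ⊡ geometric n a

  -- The ℓ^(k+1)-th cyclotomic polynomial.
  Φ : Poly
  Φ = geometric ℓ (X ** M)

  Killed : Sequence → Set
  Killed s = ∀ n → ⟦ Φ ⟧ s n ≡ + 0

  -- ℤ[ζ] for a primitive root of unity ζ = X of order ℓ^(k+1).
  R : CommutativeRing 0ℓ 0ℓ
  R = opRing Killed

  module R = CommutativeRing R
  open R using (_≈_) public
  open RingKit R public using (fromℕ; ⟪_⟫; solve; _:=_; _:+_; _:*_; _:-_; :-_) renaming (con to con′)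
  open OpRing Killed public
  open GeometricSums R public
  open import Algebra.Properties.Semiring.Exp R.semiring public using (_^_; ^-congˡ; ^-congʳ; ^-homo-*; ^-assocʳ)
  open import Algebra.Properties.CommutativeSemiring.Exp R.commutativeSemiring public using (^-distrib-*)
  open import Relation.Binary.Reasoning.Setoid R.setoid

  private
    module Free where
      open CommutativeRing (opRing (λ _ → ⊤)) public
      open GeometricSums (opRing (λ _ → ⊤)) public
      open RingKit (opRing (λ _ → ⊤)) public using (fromℕ)
      open import Algebra.Properties.Semiring.Exp semiring public using (_^_)
      open OpRing (λ _ → ⊤) public using (**-^; fromℕ-con)

  geometric-geo : ∀ n a → geometric n a ≡ geo n a
  geometric-geo zero    a = refl
  geometric-geo (suc n) a = cong (λ g → con (+ 1) ⊞ a ⊡ g) (geometric-geo n a)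


  aug-geometric : ∀ n a → aug a ≡ + 1 → aug (geometric n a) ≡ + n
  aug-geometric zero    a q = refl
  aug-geometric (suc n) a q = ≡.trans (cong (λ x → + 1 ℤ.+ x)
    (≡.trans (cong₂ ℤ._*_ q (aug-geometric n a q)) (ℤ.*-identityˡ (+ n)))) refl

  aug-X** : ∀ n → aug (X ** n) ≡ + 1
  aug-X** n = ≡.trans (aug-** X n) (ℤ.^-zeroˡ n)

  aug-^ : ∀ a n → aug (a ^ n) ≡ aug a ℤ.^ n
  aug-^ a zero    = refl
  aug-^ a (suc n) = cong (aug a ℤ.*_) (aug-^ a n)

  aug-X^ : ∀ n → aug (X ^ n) ≡ + 1
  aug-X^ n = ≡.trans (aug-^ X n) (ℤ.^-zeroˡ n)

  Φ≈0 : Φ ≈ con (+ 0)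
  Φ≈0 = mk≈ λ {s} m n → ≡.trans (m n) (≡.sym (ℤ.*-zeroˡ (s n)))

  y : Poly
  y = X ^ M

  X**M≈y : X ** M ≈ y
  X**M≈y = **-^ X M

  geo-y : geo ℓ y ≈ con (+ 0)
  geo-y = R.trans (geo-cong ℓ (R.sym X**M≈y)) (R.trans (R.reflexive (≡.sym (geometric-geo ℓ (X ** M)))) Φ≈0)

  1-from-0 : ∀ {a} → a ⊞ neg (con (+ 1)) ≈ con (+ 0) → a ≈ con (+ 1)
  1-from-0 {a} q = R.trans (solve 1 (λ a → a := (a :- con′ (+ 1)) :+ con′ (+ 1)) R.refl a)
    (R.trans (R.+-congʳ q) (R.+-identityˡ _))

  N : ℕ
  N = M ℕ.* ℓ

  X^N≈1 : X ^ N ≈ con (+ 1)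
  X^N≈1 = R.trans (R.sym (^-assocʳ X M ℓ)) (1-from-0 (R.trans (R.sym (geo-telescope ℓ y))
    (R.trans (R.*-congˡ geo-y) (R.zeroʳ _))))

  1^n≈1 : ∀ n → con (+ 1) ^ n ≈ con (+ 1)
  1^n≈1 zero    = R.refl
  1^n≈1 (suc n) = R.trans (R.*-identityˡ _) (1^n≈1 n)

  X^multiple : ∀ g → N ℕ.∣ g → X ^ g ≈ con (+ 1)
  X^multiple g (ℕ.divides q refl) = R.trans (R.reflexive (cong (X ^_) (ℕ.*-comm q N)))
    (R.trans (R.sym (^-assocʳ X N q)) (R.trans (^-congˡ q X^N≈1) (1^n≈1 q)))

  -- Φ has the value ℓ at X = 1 and is zero in `R`, so ℓ is minus the remaining multiple of X - 1.
  ℓ∈π : con (+ ℓ) ≈ π ⊡ neg (quo Φ)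
  ℓ∈π = begin
    con (+ ℓ)
      ≈⟨ solve 3 (λ c p q → c := (c :+ p :* q) :+ p :* (:- q)) R.refl (con (+ ℓ)) π (quo Φ) ⟩
    (con (+ ℓ) ⊞ π ⊡ quo Φ) ⊞ π ⊡ neg (quo Φ)
      ≈⟨ R.+-congʳ (R.+-congʳ (R.reflexive (cong con (≡.sym (aug-geometric ℓ (X ** M) (aug-X** M)))))) ⟩
    (con (aug Φ) ⊞ π ⊡ quo Φ) ⊞ π ⊡ neg (quo Φ)
      ≈⟨ R.+-congʳ (R.trans (R.sym (aug-quo Φ)) Φ≈0) ⟩
    con (+ 0) ⊞ π ⊡ neg (quo Φ)
      ≈⟨ R.+-identityˡ _ ⟩
    π ⊡ neg (quo Φ) ∎

  cancel-ℓ : ∀ {a b} → con (+ ℓ) ⊡ a ≈ con (+ ℓ) ⊡ b → a ≈ b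
  cancel-ℓ = con-torsion-free (+ ℓ)

  private
    -- Divisors of ℓ inherit cancellation from the integer ℓ. This covers π and y - 1, the only
    -- non-rational elements that are ever cancelled.
    cancel-divisor : ∀ {d e} → con (+ ℓ) ≈ d ⊡ e → ∀ {a b} → d ⊡ a ≈ d ⊡ b → a ≈ b
    cancel-divisor {d} {e} q {a} {b} r = cancel-ℓ (begin
      con (+ ℓ) ⊡ a ≈⟨ R.*-congʳ q ⟩
      (d ⊡ e) ⊡ a   ≈⟨ solve 3 (λ d e a → (d :* e) :* a := e :* (d :* a)) R.refl d e a ⟩
      e ⊡ (d ⊡ a)   ≈⟨ R.*-congˡ r ⟩
      e ⊡ (d ⊡ b)   ≈⟨ solve 3 (λ d e a → (d :* e) :* a := e :* (d :* a)) R.refl d e b ⟨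
      (d ⊡ e) ⊡ b   ≈⟨ R.*-congʳ q ⟨
      con (+ ℓ) ⊡ b ∎)

  cancel-π : ∀ {a b} → π ⊡ a ≈ π ⊡ b → a ≈ b
  cancel-π = cancel-divisor ℓ∈π

  cancel-π^ : ∀ n {a b} → π ^ n ⊡ a ≈ π ^ n ⊡ b → a ≈ b
  cancel-π^ zero    q = R.trans (R.sym (R.*-identityˡ _)) (R.trans q (R.*-identityˡ _))
  cancel-π^ (suc n) q = cancel-π^ n (cancel-π (R.trans (R.sym (R.*-assoc _ _ _)) (R.trans q (R.*-assoc _ _ _))))

  cancel-y-1 : ∀ {a b} → (y ⊞ neg (con (+ 1))) ⊡ a ≈ (y ⊞ neg (con (+ 1))) ⊡ b → a ≈ b
  cancel-y-1 = cancel-divisor {e = neg (geo-remainder ℓ y)} (begin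
    con (+ ℓ)
      ≈⟨ fromℕ-con ℓ ⟨
    fromℕ ℓ
      ≈⟨ solve 3 (λ c p q → c := (c :+ p :* q) :+ p :* (:- q)) R.refl (fromℕ ℓ) d (geo-remainder ℓ y) ⟩
    (fromℕ ℓ ⊞ d ⊡ geo-remainder ℓ y) ⊞ d ⊡ neg (geo-remainder ℓ y)
      ≈⟨ R.+-congʳ (R.trans (R.sym (geo-mod ℓ y)) geo-y) ⟩
    con (+ 0) ⊞ d ⊡ neg (geo-remainder ℓ y)
      ≈⟨ R.+-identityˡ _ ⟩
    d ⊡ neg (geo-remainder ℓ y) ∎)
    where d = y ⊞ neg (con (+ 1))

  -- (w − 1) S = 0 gives w^c S = S; if w^c = y this forces S = 0.
  geo-vanishes : ∀ n g c → N ℕ.∣ n ℕ.* g → X ^ (g ℕ.* c) ≈ y → geo n (X ^ g) ≈ con (+ 0)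
  geo-vanishes n g c ord w^c = cancel-y-1 (begin
    (y ⊞ neg (con (+ 1))) ⊡ S
      ≈⟨ R.*-congʳ (R.+-congʳ (R.trans (R.sym w^c) (R.sym (^-assocʳ X g c)))) ⟩
    (w ^ c ⊞ neg (con (+ 1))) ⊡ S
      ≈⟨ R.*-congʳ (geo-telescope c w) ⟨
    ((w ⊞ neg (con (+ 1))) ⊡ geo c w) ⊡ S
      ≈⟨ solve 3 (λ d e a → (d :* e) :* a := e :* (d :* a)) R.refl _ _ S ⟩
    geo c w ⊡ ((w ⊞ neg (con (+ 1))) ⊡ S)
      ≈⟨ R.*-congˡ (geo-telescope n w) ⟩
    geo c w ⊡ (w ^ n ⊞ neg (con (+ 1)))
      ≈⟨ R.*-congˡ (R.+-congʳ (R.trans (^-assocʳ X g n) (X^multiple _ (subst (N ℕ.∣_) (ℕ.*-comm n g) ord)))) ⟩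
    geo c w ⊡ (con (+ 1) ⊞ neg (con (+ 1)))
      ≈⟨ solve 2 (λ g d → g :* (con′ (+ 1) :- con′ (+ 1)) := d :* con′ (+ 0)) R.refl _ _ ⟩
    (y ⊞ neg (con (+ 1))) ⊡ con (+ 0) ∎)
    where
    w = X ^ g
    S = geo n w

  -- The indicator of the multiples of ℓ. Any ℓ consecutive arguments contain exactly one of them,
  -- so Φ sends `χ` to the constant 1 while it sends the constant 1 to ℓ; hence Φ kills 1 - ℓ χ.
  ψ : ℕ → ℕ
  ψ q with q % ℓ
  ... | zero  = 1
  ... | suc _ = 0

  private
    ψ-cong : ∀ {a b} → a % ℓ ≡ b % ℓ → ψ a ≡ ψ b
    ψ-cong {a} {b} eq with a % ℓ | b % ℓ | eq
    ... | zero  | .zero    | refl = refl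
    ... | suc x | .(suc x) | refl = refl

    window : ℕ → ℕ → ℕ
    window zero    q = 0
    window (suc n) q = ψ q ℕ.+ window n (suc q)

    window-slide : ∀ n q → ψ q ℕ.+ window n (suc q) ≡ window n q ℕ.+ ψ (n ℕ.+ q)
    window-slide zero    q = ℕ.+-identityʳ (ψ q)
    window-slide (suc n) q = ≡.trans (cong (ψ q ℕ.+_) (window-slide n (suc q)))
      (≡.trans (≡.sym (ℕ.+-assoc (ψ q) _ _)) (cong (λ x → ψ q ℕ.+ window n (suc q) ℕ.+ ψ x) (ℕ.+-suc n q)))

    window-zero : ∀ n q → 0 < q → q ℕ.+ n ≤ ℓ → window n q ≡ 0
    window-zero zero    q 0<q le = refl
    window-zero (suc n) q 0<q le = cong₂ ℕ._+_ ψq≡0 (window-zero n (suc q) (s≤s z≤n) (subst (_≤ ℓ) (ℕ.+-suc q n) le))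
      where
      q<ℓ : q < ℓ
      q<ℓ = ℕ.≤-trans (s≤s (ℕ.m≤m+n q n)) (subst (_≤ ℓ) (ℕ.+-suc q n) le)
      ψq≡0 : ψ q ≡ 0
      ψq≡0 with q % ℓ | m<n⇒m%n≡m q<ℓ
      ... | zero  | refl = contradiction 0<q (λ ())
      ... | suc _ | _    = refl

    window-full : ∀ q → window ℓ q ≡ 1
    window-full zero    = cong suc (window-zero p 1 (s≤s z≤n) ℕ.≤-refl)
    window-full (suc q) = ℕ.+-cancelˡ-≡ (ψ q) _ _ (≡.trans (window-slide ℓ q)
      (≡.trans (cong₂ ℕ._+_ (window-full q) (ψ-cong {ℓ ℕ.+ q} {q} (≡.trans (cong (_% ℓ) (ℕ.+-comm ℓ q)) ([m+n]%n≡m%n q ℓ))))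
               (ℕ.+-comm 1 (ψ q))))

    χ : Sequence
    χ n = + ψ (n / M)

    window-χ : ∀ n i → ⟦ geometric n (X ** M) ⟧ χ i ≡ + window n (i / M)
    window-χ zero    i = ℤ.*-zeroˡ (χ i)
    window-χ (suc n) i = cong₂ ℤ._+_ (ℤ.*-identityˡ (χ i))
      (≡.trans (act-X** M (⟦ geometric n (X ** M) ⟧ χ) i) (≡.trans (window-χ n (M ℕ.+ i)) (cong (λ q → + window n q) next)))
      where
      next : (M ℕ.+ i) / M ≡ suc (i / M)
      next = ≡.trans (m/n≡1+[m∸n]/n (ℕ.m≤m+n M i)) (cong (λ x → suc (x / M)) (ℕ.m+n∸m≡n M i))

    -- Congruent to the constant sequence 1 modulo ℓ and killed by Φ.
    almost-one : Sequence
    almost-one n = ℤ.- (+ ℓ) ℤ.* χ n ℤ.+ + 1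

    act-almost-one : ∀ a n → ⟦ a ⟧ almost-one n ≡ ℤ.- (+ ℓ) ℤ.* ⟦ a ⟧ χ n ℤ.+ aug a
    act-almost-one a n = ≡.trans (act-lin a (ℤ.- (+ ℓ)) χ (λ _ → + 1) n)
      (cong (λ x → ℤ.- (+ ℓ) ℤ.* ⟦ a ⟧ χ n ℤ.+ x) (act-one a n))

    almost-one-killed : Killed almost-one
    almost-one-killed n = ≡.trans (act-almost-one Φ n)
      (≡.trans (cong₂ (λ x y → ℤ.- (+ ℓ) ℤ.* x ℤ.+ y) (≡.trans (window-χ ℓ n) (cong +_ (window-full (n / M))))
                      (aug-geometric ℓ (X ** M) (aug-X** M)))
        (≡.trans (cong (ℤ._+ + ℓ) (ℤ.*-identityʳ (ℤ.- (+ ℓ)))) (ℤ.+-inverseˡ (+ ℓ))))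

  -- Evaluation at 1 is thus well defined from `R` to ℤ/ℓ; this is the residue map at π. Equal
  -- operators agree on `almost-one`, where each takes its value at 1 up to a multiple of ℓ.
  aug-mod : ∀ {a b} → a ≈ b → + ℓ ℤ.∣ aug a ℤ.- aug b
  aug-mod {a} {b} q = ℤ.divides (x ℤ.- x′) (≡.trans (shifted-difference (+ ℓ) x x′ (aug a) (aug b))
    (≡.trans (cong (λ z → (x ℤ.- x′) ℤ.* + ℓ ℤ.+ z)
        (≡.trans (cong₂ ℤ._-_ (≡.sym (act-almost-one a 0)) (≡.sym (act-almost-one b 0)))
          (≡.trans (cong (ℤ._- ⟦ b ⟧ almost-one 0) (agree q almost-one-killed 0)) (ℤ.+-inverseʳ (⟦ b ⟧ almost-one 0)))))
      (ℤ.+-identityʳ _)))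
    where
    x x′ : ℤ
    x  = ⟦ a ⟧ χ 0
    x′ = ⟦ b ⟧ χ 0

-- The valuation at π

module Valuation (p : ℕ) (ℓ-prime : Prime (suc p)) (k : ℕ) where
  open import Data.Nat.Base as ℕ using (ℕ; zero; suc; _<_; _≤_)
  open import Data.Nat.Primality using (Prime; euclidsLemma)
  open Cyclotomic p ℓ-prime k
  open ShiftOperators
  open ModInverse
  open import Data.Fin.Base using (Fin; zero; suc)
  open import Data.Integer.Base as ℤ using (ℤ; +_)
  import Data.Integer.Properties as ℤ
  open import Data.Integer.Divisibility.Signed as ℤ using ()
  import Data.Nat.Properties as ℕ
  import Data.Nat.Divisibility as ℕ
  open import Data.Product.Base using (_×_; _,_; ∃-syntax)
  open import Data.Sum.Base using (_⊎_; inj₁; inj₂)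
  open import Data.Unit.Base using (⊤; tt)
  open import Relation.Binary.PropositionalEquality as ≡ using (_≡_; refl; cong; cong₂; subst)
  open import Relation.Nullary.Decidable using (yes; no)
  open import Relation.Nullary.Negation using (¬_; contradiction)
  open import Relation.Binary.Reasoning.Setoid R.setoid
  open import Defs using (Ord)
  open DeterminantProducts R using (prod)

  X^-via : ∀ {a m u} → a ≡ m ℕ.+ N ℕ.* u → X ^ a ≈ X ^ m
  X^-via {m = m} {u} refl = R.trans (^-homo-* X m (N ℕ.* u))
    (R.trans (R.*-congˡ (X^multiple _ (ℕ.m∣m*n u))) (R.*-identityʳ _))

  orthogonality : ∀ n g → N ℕ.∣ n ℕ.* g → ¬ (N ℕ.∣ g) → geo n (X ^ g) ≈ con (+ 0)
  orthogonality n g d nd = let (c , u , eq) = solve-power k g ℓ-prime nd in geo-vanishes n g c d (X^-via eq)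

  σ-geometric : ∀ j n a → σ j (geometric n a) ≡ geometric n (σ j a)
  σ-geometric j zero    a = refl
  σ-geometric j (suc n) a = cong (λ g → con (+ 1) ⊞ σ j a ⊡ g) (σ-geometric j n a)

  σ-** : ∀ j a n → σ j (a ** n) ≡ σ j a ** n
  σ-** j a zero    = refl
  σ-** j a (suc n) = cong (σ j a ⊡_) (σ-** j a n)

  σ-^ : ∀ j a n → σ j (a ^ n) ≡ σ j a ^ n
  σ-^ j a zero    = refl
  σ-^ j a (suc n) = cong (σ j a ⊡_) (σ-^ j a n)

  module _ (j : ℕ) (ℓ∤j : ¬ (ℓ ℕ.∣ j)) where
    private
      σΦ≈0 : σ j Φ ≈ con (+ 0)
      σΦ≈0 = begin
        σ j Φ
          ≡⟨ ≡.trans (σ-geometric j ℓ (X ** M)) (≡.trans (cong (geometric ℓ) (σ-** j X M)) (geometric-geo ℓ _)) ⟩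
        geo ℓ ((X ** j) ** M)
          ≈⟨ geo-cong ℓ (R.trans (**-^ _ M) (R.trans (^-congˡ M (**-^ X j)) (^-assocʳ X j M))) ⟩
        geo ℓ (X ^ (j ℕ.* M))
          ≈⟨ orthogonality ℓ (j ℕ.* M) (ℕ.divides j (≡.trans (≡.sym (ℕ.*-assoc ℓ j M))
               (≡.trans (cong (ℕ._* M) (ℕ.*-comm ℓ j)) (≡.trans (ℕ.*-assoc j ℓ M) (cong (j ℕ.*_) (ℕ.*-comm ℓ M))))))
               (λ d → ℓ∤j (ℕ.*-cancelˡ-∣ M (subst (N ℕ.∣_) (ℕ.*-comm j M) d))) ⟩
        con (+ 0) ∎

    -- For ℓ ∤ j the power X^j is again a root of Φ, so a sequence killed by Φ is killed by `σ j Φ`.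
    -- Its subsequences of stride j are then killed by Φ, and the given equation applies to them.
    σ-cong : ∀ {a b} → a ≈ b → σ j a ≈ σ j b
    σ-cong {a} {b} q = mk≈ λ {s} m n → ≡.trans (act-σ j a s n 0) (≡.trans
      (agree q (λ i → ≡.trans (≡.sym (act-σ j Φ s n i)) (≡.trans (agree σΦ≈0 {s} m (i ℕ.* j ℕ.+ n)) (ℤ.*-zeroˡ (s (i ℕ.* j ℕ.+ n))))) 0)
      (≡.sym (act-σ j b s n 0)))

  aug-σ : ∀ j a → aug (σ j a) ≡ aug a
  aug-σ j (con c) = refl
  aug-σ j X       = aug-X** j
  aug-σ j (a ⊞ b) = cong₂ ℤ._+_ (aug-σ j a) (aug-σ j b)
  aug-σ j (a ⊡ b) = cong₂ ℤ._*_ (aug-σ j a) (aug-σ j b)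
  aug-σ j (neg a) = cong ℤ.-_ (aug-σ j a)

  -- Units of the localisation at π: the residue class is the value at 1 modulo ℓ. Such an element
  -- need not be invertible in `R`.
  Unit : Poly → Set
  Unit a = ¬ (+ ℓ ℤ.∣ aug a)

  euclid : ∀ x y → + ℓ ℤ.∣ x ℤ.* y → (+ ℓ ℤ.∣ x) ⊎ (+ ℓ ℤ.∣ y)
  euclid x y d with euclidsLemma ℤ.∣ x ∣ ℤ.∣ y ∣ ℓ-prime (subst (ℓ ℕ.∣_) (ℤ.abs-* x y) (ℤ.∣⇒∣ᵤ d))
  ... | inj₁ e = inj₁ (ℤ.∣ᵤ⇒∣ e)
  ... | inj₂ e = inj₂ (ℤ.∣ᵤ⇒∣ e)

  unit-⊡ : ∀ {a b} → Unit a → Unit b → Unit (a ⊡ b)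
  unit-⊡ {a} {b} u v d with euclid (aug a) (aug b) d
  ... | inj₁ e = u e
  ... | inj₂ e = v e

  unit-cong : ∀ {a b} → a ≈ b → Unit a → Unit b
  unit-cong {a} {b} q u d = u (subst (+ ℓ ℤ.∣_) (≡.trans (ℤ.+-assoc (aug a) (ℤ.- aug b) (aug b))
    (≡.trans (cong (λ z → aug a ℤ.+ z) (ℤ.+-inverseˡ (aug b))) (ℤ.+-identityʳ (aug a)))) (ℤ.∣m∣n⇒∣m+n (aug-mod q) d))

  unit-≡ : ∀ {a b} → aug a ≡ aug b → Unit a → Unit b
  unit-≡ eq u d = u (subst (+ ℓ ℤ.∣_) (≡.sym eq) d)

  2≤ℓ : 2 ≤ ℓ
  2≤ℓ = prime≥2 ℓ-prime
    where
    open import Data.Nat.Primality using (prime⇒nonTrivial)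
    prime≥2 : ∀ {n} → Prime n → 2 ≤ n
    prime≥2 {n} pr = ℕ.nonTrivial⇒n>1 n {{prime⇒nonTrivial pr}}

  unit-1 : ∀ {a} → aug a ≡ + 1 → Unit a
  unit-1 eq d = ℕ.<⇒≱ 2≤ℓ (ℕ.∣⇒≤ (ℤ.∣⇒∣ᵤ (subst (+ ℓ ℤ.∣_) eq d)))

  unit-con : ∀ n → ¬ (ℓ ℕ.∣ n) → Unit (con (+ n))
  unit-con n nd d = nd (ℤ.∣⇒∣ᵤ d)

  unit-σ : ∀ j {a} → Unit a → Unit (σ j a)
  unit-σ j {a} = unit-≡ {a} {σ j a} (≡.sym (aug-σ j a))

  unit-+π : ∀ {a} n b → Unit a → Unit (a ⊞ π ⊡ (π ^ n ⊡ b))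
  unit-+π {a} n b = unit-≡ {a} {a ⊞ π ⊡ (π ^ n ⊡ b)} (≡.sym (ℤ.+-identityʳ (aug a)))

  -- A denominator is allowed because these units need not have inverses in `R`. It is used for ℓ
  -- itself, which is compared with π^φ only after multiplication by a unit.
  record Val (x : Poly) (n : ℕ) : Set where
    constructor val
    field
      {numerator denominator} : Poly
      numerator-unit   : Unit numerator
      denominator-unit : Unit denominator
      equation         : denominator ⊡ x ≈ π ^ n ⊡ numerator

  val-cong : ∀ {x y n} → x ≈ y → Val x n → Val y n
  val-cong q (val u v e) = val u v (R.trans (R.*-congˡ (R.sym q)) e)

  val-unit : ∀ {a} → Unit a → Val a 0
  val-unit u = val u (unit-1 {con (+ 1)} refl) R.refl

  val-⊡ : ∀ {x y n m} → Val x n → Val y m → Val (x ⊡ y) (n ℕ.+ m)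
  val-⊡ {x} {y} {n} {m} (val {b} {c} u v e) (val {b′} {c′} u′ v′ e′) =
    val (unit-⊡ {b} {b′} u u′) (unit-⊡ {c} {c′} v v′) (begin
      (c ⊡ c′) ⊡ (x ⊡ y)
        ≈⟨ solve 4 (λ c d x y → (c :* d) :* (x :* y) := (c :* x) :* (d :* y)) R.refl c c′ x y ⟩
      (c ⊡ x) ⊡ (c′ ⊡ y)
        ≈⟨ R.*-cong e e′ ⟩
      (π ^ n ⊡ b) ⊡ (π ^ m ⊡ b′)
        ≈⟨ solve 4 (λ c d x y → (c :* d) :* (x :* y) := (c :* x) :* (d :* y)) R.refl (π ^ n) b (π ^ m) b′ ⟩
      (π ^ n ⊡ π ^ m) ⊡ (b ⊡ b′)
        ≈⟨ R.*-congʳ (^-homo-* π n m) ⟨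
      π ^ (n ℕ.+ m) ⊡ (b ⊡ b′) ∎)

  val-^ : ∀ {x n} e → Val x n → Val (x ^ e) (e ℕ.* n)
  val-^ zero    v = val-unit {con (+ 1)} (unit-1 {con (+ 1)} refl)
  val-^ (suc e) v = val-⊡ v (val-^ e v)

  val-prod : ∀ {n v} {f : Fin n → Poly} → (∀ i → Val (f i) v) → Val (prod f) (n ℕ.* v)
  val-prod {zero}  h = val-unit {con (+ 1)} (unit-1 {con (+ 1)} refl)
  val-prod {suc n} h = val-⊡ (h zero) (val-prod {n} (λ i → h (suc i)))

  record Divisible (x : Poly) (n : ℕ) : Set where
    constructor divisible
    field
      cofactor : Poly
      x≈π^n*cofactor : x ≈ π ^ n ⊡ cofactor

  divisible-⊡ : ∀ {x y n m} → Divisible x n → Divisible y m → Divisible (x ⊡ y) (n ℕ.+ m)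
  divisible-⊡ {x} {y} {n} {m} (divisible b e) (divisible c f) = divisible (b ⊡ c) (R.trans (R.*-cong e f)
    (R.trans (solve 4 (λ c d x y → (c :* d) :* (x :* y) := (c :* x) :* (d :* y)) R.refl (π ^ n) b (π ^ m) c)
      (R.*-congʳ (R.sym (^-homo-* π n m)))))

  divisible-prod : ∀ {n v} {f : Fin n → Poly} → (∀ i → Divisible (f i) v) → Divisible (prod f) (n ℕ.* v)
  divisible-prod {zero}  h = divisible (con (+ 1)) (R.sym (R.*-identityˡ _))
  divisible-prod {suc n} h = divisible-⊡ (h zero) (divisible-prod {n} (λ i → h (suc i)))

  private
    -- Cross-multiplying and cancelling π^n would put the unit c b into the ideal of π, whose
    -- elements have residue 0.
    exceed : ∀ x n d {b c b′ c′} → Unit b → Unit c → c′ ⊡ x ≈ π ^ n ⊡ b → ¬ (c ⊡ x ≈ π ^ (n ℕ.+ suc d) ⊡ b′)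
    exceed x n d {b} {c} {b′} {c′} ub uc e f = unit-cong cb (unit-⊡ {c} {b} uc ub) (ℤ.divides (+ 0) refl)
      where
      cb : c ⊡ b ≈ π ⊡ (π ^ d ⊡ (c′ ⊡ b′))
      cb = cancel-π^ n (begin
        π ^ n ⊡ (c ⊡ b)
          ≈⟨ solve 3 (λ p c b → p :* (c :* b) := c :* (p :* b)) R.refl (π ^ n) c b ⟩
        c ⊡ (π ^ n ⊡ b)
          ≈⟨ R.*-congˡ e ⟨
        c ⊡ (c′ ⊡ x)
          ≈⟨ solve 3 (λ p c b → p :* (c :* b) := c :* (p :* b)) R.refl c c′ x ⟩
        c′ ⊡ (c ⊡ x)
          ≈⟨ R.*-congˡ (R.trans f (R.*-congʳ (^-homo-* π n (suc d)))) ⟩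
        c′ ⊡ ((π ^ n ⊡ (π ⊡ π ^ d)) ⊡ b′)
          ≈⟨ solve 5 (λ c p q r b → c :* ((p :* (q :* r)) :* b) := p :* (q :* (r :* (c :* b)))) R.refl c′ (π ^ n) π (π ^ d) b′ ⟩
        π ^ n ⊡ (π ⊡ (π ^ d ⊡ (c′ ⊡ b′))) ∎)

    bounded : ∀ {x n m b c} → Val x n → Unit c → c ⊡ x ≈ π ^ m ⊡ b → m ≤ n
    bounded {x} {n} {m} {b} {c} (val ub uc e) u f with m ℕ.≤? n
    ... | yes m≤n = m≤n
    ... | no m≰n with ℕ.m≤n⇒∃[o]m+o≡n (ℕ.≰⇒> m≰n)
    ... | d , refl = let f′ = R.trans f (R.*-congʳ (R.reflexive (cong (π ^_) (≡.sym (ℕ.+-suc n d))))) in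
      contradiction f′ (exceed x n d ub u e)

  divisible-⊡-bounded : ∀ {x y n m l} → Val x n → Divisible y m → Val (x ⊡ y) l → n ℕ.+ m ≤ l
  divisible-⊡-bounded {x} {y} {n} {m} (val {b} {c} u uc e) (divisible d f) w = bounded w uc (begin
    c ⊡ (x ⊡ y)
      ≈⟨ R.trans (R.sym (R.*-assoc c x y)) (R.*-cong e f) ⟩
    (π ^ n ⊡ b) ⊡ (π ^ m ⊡ d)
      ≈⟨ solve 4 (λ c d x y → (c :* d) :* (x :* y) := (c :* x) :* (d :* y)) R.refl (π ^ n) b (π ^ m) d ⟩
    (π ^ n ⊡ π ^ m) ⊡ (b ⊡ d)
      ≈⟨ R.*-congʳ (^-homo-* π n m) ⟨
    π ^ (n ℕ.+ m) ⊡ (b ⊡ d) ∎)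

  val-unique : ∀ {x n m} → Val x n → Val x m → n ≡ m
  val-unique v@(val u c e) v′@(val u′ c′ e′) = ℕ.≤-antisym (bounded v′ c e) (bounded v c′ e′)

  -- In `aug-quo` the constant term is a multiple of ℓ, hence of π.
  con-multiple : ∀ a → + ℓ ℤ.∣ aug a → Divisible a 1
  con-multiple a (ℤ.divides q eq) = divisible (neg (quo Φ) ⊡ con q ⊞ quo a) (begin
    a
      ≈⟨ aug-quo a ⟩
    con (aug a) ⊞ π ⊡ quo a
      ≈⟨ R.+-congʳ (R.trans (R.reflexive (cong con (≡.trans eq (ℤ.*-comm q (+ ℓ))))) (R.trans (con-* (+ ℓ) q) (R.*-congʳ ℓ∈π))) ⟩
    (π ⊡ neg (quo Φ)) ⊡ con q ⊞ π ⊡ quo a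
      ≈⟨ solve 4 (λ p f c a → (p :* f) :* c :+ p :* a := (p :* con′ (+ 1)) :* (f :* c :+ a)) R.refl π (neg (quo Φ)) (con q) (quo a) ⟩
    (π ⊡ con (+ 1)) ⊡ (neg (quo Φ) ⊡ con q ⊞ quo a) ∎)

  -- The search stops at `K` because an element may be zero. In the application `K` is k + 1, which
  -- exceeds the valuation λ + 1 in question.
  valuation-or-divisible : ∀ K x → (∃[ i ] ∃[ b ] (i < K × Unit b × x ≈ π ^ i ⊡ b)) ⊎ Divisible x K
  valuation-or-divisible zero    x = inj₂ (divisible x (R.sym (R.*-identityˡ x)))
  valuation-or-divisible (suc K) x with valuation-or-divisible K x
  ... | inj₁ (i , b , i<K , u , e) = inj₁ (i , b , ℕ.m<n⇒m<1+n i<K , u , e)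
  ... | inj₂ (divisible b e) with + ℓ ℤ.∣? aug b
  ... | no u  = inj₁ (K , b , ℕ.n<1+n K , u , e)
  ... | yes d = let divisible c f = con-multiple b d in inj₂ (divisible c (begin
    x                        ≈⟨ e ⟩
    π ^ K ⊡ b                ≈⟨ R.*-congˡ f ⟩
    π ^ K ⊡ ((π ⊡ con (+ 1)) ⊡ c)
      ≈⟨ solve 3 (λ q p c → q :* ((p :* con′ (+ 1)) :* c) := (p :* q) :* c) R.refl (π ^ K) π c ⟩
    (π ⊡ π ^ K) ⊡ c ∎))

  -- Passing from w to w^ℓ multiplies w - 1 by `geo ℓ w`, whose value at 1 is ℓ. For i ≤ k the true
  -- exponent is ℓ^i; the linear bound is enough because only valuations bounded independently of
  -- the level are compared.
  X^ℓ^-divisible : ∀ i → Divisible (X ^ (ℓ ℕ.^ i) ⊞ neg (con (+ 1))) (suc i)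
  X^ℓ^-divisible zero = divisible (con (+ 1)) (solve 1 (λ x → (x :* con′ (+ 1)) :- con′ (+ 1) :=
        ((x :- con′ (+ 1)) :* con′ (+ 1)) :* con′ (+ 1)) R.refl X)
  X^ℓ^-divisible (suc i) = let divisible b e = divisible-⊡ (X^ℓ^-divisible i) geo-divisible in
    divisible b (R.trans (R.trans (R.+-congʳ (R.trans (R.reflexive (cong (X ^_) (ℕ.*-comm ℓ (ℓ ℕ.^ i)))) (R.sym (^-assocʳ X (ℓ ℕ.^ i) ℓ))))
      (R.sym (geo-telescope ℓ w))) (R.trans e (R.*-congʳ (R.reflexive (cong (π ^_) (ℕ.+-comm (suc i) 1))))))
    where
    w = X ^ (ℓ ℕ.^ i)
    geo-divisible : Divisible (geo ℓ w) 1
    geo-divisible = con-multiple (geo ℓ w) (subst (+ ℓ ℤ.∣_)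
      (≡.sym (≡.trans (cong aug (≡.sym (geometric-geo ℓ w))) (aug-geometric ℓ w (aug-X^ (ℓ ℕ.^ i))))) ℤ.∣-refl)

  φ : ℕ
  φ = M ℕ.* p

  -- Modulo ℓ, Φ = (X − 1)^φ; evaluating the quotient at X = 1 shows it is a unit.
  module ℓ-Valuation where
    private
      -- On all sequences the annihilator is zero, so this ring is ℤ[X] itself, where evaluation at
      -- 1 takes values in ℤ and not merely in ℤ/ℓ.
      module Free = CommutativeRing (opRing (λ _ → ⊤))
      open PrincipalQuotient (opRing (λ _ → ⊤)) (con (+ ℓ))
      module FreeOps = OpRing (λ _ → ⊤)
      module FKit = RingKit (opRing (λ _ → ⊤))
      module Q = CommutativeRing quotientRing
      module QKit = RingKit quotientRing
      module QGeo = GeometricSums quotientRing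
      open import Algebra.Properties.Semiring.Exp Q.semiring using () renaming (_^_ to _^Q_)

    to-R : ∀ {a b} → a Free.≈ b → a ≈ b
    to-R q = mk≈ λ _ n → agree q tt n

    aug-free : ∀ {a b} → a Free.≈ b → aug a ≡ aug b
    aug-free {a} {b} q = ≡.trans (≡.sym (act-one a 0)) (≡.trans (agree q tt 0) (act-one b 0))

    private
      fromℕQ-con : ∀ n → QKit.fromℕ n Q.≈ con (+ n)
      fromℕQ-con zero    = Q.refl
      fromℕQ-con (suc n) = Q.trans (QKit.fromℕ-suc n) (Q.trans (Q.+-congˡ (fromℕQ-con n))
        (≈⇒≡ₚ (Free.sym (FreeOps.con-+ (+ 1) (+ n)))))

      characteristic : QKit.fromℕ ℓ Q.≈ con (+ 0)
      characteristic = Q.trans (fromℕQ-con ℓ) (mk≡ₚ (con (+ 1))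
        (FKit.solve 1 (λ l → l FKit.:= FKit.con (+ 0) FKit.:+ l FKit.:* FKit.con (+ 1)) Free.refl (con (+ ℓ))))

      geo-Q : ∀ n a → QGeo.geo n a ≡ geometric n a
      geo-Q zero    a = refl
      geo-Q (suc n) a = cong (λ g → con (+ 1) ⊞ a ⊡ g) (geo-Q n a)

      ^-Q : ∀ a n → a ^Q n ≡ a ** n
      ^-Q a zero    = refl
      ^-Q a (suc n) = cong (a ⊡_) (^-Q a n)

      1+π : Poly
      1+π = con (+ 1) ⊞ π

      Φ-mod-ℓ : geometric ℓ (1+π ** M) Q.≈ π ** φ
      Φ-mod-ℓ = subst₂ Q._≈_ (≡.trans (geo-Q ℓ _) (cong (geometric ℓ) (^-Q 1+π M))) (^-Q π φ)
        (QGeo.PrimeCharacteristic.cyclotomic-prime ℓ-prime characteristic k π)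
        where open ≡ using (subst₂)

      v : Poly
      v = multiple Φ-mod-ℓ

      aug-v : + ℓ ≡ + ℓ ℤ.* aug v
      aug-v = ≡.trans (≡.sym (aug-geometric ℓ (1+π ** M) (≡.trans (aug-** 1+π M) (ℤ.^-zeroˡ M))))
        (≡.trans (aug-free (equation Φ-mod-ℓ)) (≡.trans (cong (ℤ._+ + ℓ ℤ.* aug v) (≡.trans (aug-** π φ) (zero-power φ≢0)))
              (ℤ.+-identityˡ _)))
        where
        φ≢0 : ℕ.NonZero φ
        φ≢0 = ℕ.m*n≢0 M p {{M≢0}} {{ℕ.>-nonZero (ℕ.s≤s⁻¹ 2≤ℓ)}}
        zero-power : ∀ {n} → ℕ.NonZero n → (+ 0) ℤ.^ n ≡ + 0
        zero-power {suc n} _ = ℤ.*-zeroˡ ((+ 0) ℤ.^ n)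

    val-ℓ : Val (con (+ ℓ)) φ
    val-ℓ = val (unit-neg {con (+ 1)} (unit-1 {con (+ 1)} refl)) (unit-1 {v} aug-v≡1) (begin
      v ⊡ con (+ ℓ)
        ≈⟨ solve 3 (λ v l f → v :* l := (f :+ l :* v) :- f) R.refl v (con (+ ℓ)) (π ^ φ) ⟩
      (π ^ φ ⊞ con (+ ℓ) ⊡ v) ⊞ neg (π ^ φ)
        ≈⟨ R.+-congʳ (R.trans (R.+-congʳ (R.sym (**-^ π φ))) (R.trans (R.sym (to-R (equation Φ-mod-ℓ)))
             (R.trans (R.reflexive (geometric-geo ℓ _)) (R.trans (geo-cong ℓ 1+π^M≈y) geo-y)))) ⟩
      con (+ 0) ⊞ neg (π ^ φ)
        ≈⟨ solve 1 (λ f → con′ (+ 0) :- f := f :* (:- con′ (+ 1))) R.refl (π ^ φ) ⟩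
      π ^ φ ⊡ neg (con (+ 1)) ∎)
      where
      unit-neg : ∀ {a} → Unit a → Unit (neg a)
      unit-neg {a} u d = u (subst (+ ℓ ℤ.∣_) (ℤ.neg-involutive (aug a)) (ℤ.∣m⇒∣-m d))
      aug-v≡1 : aug v ≡ + 1
      aug-v≡1 = ℤ.*-cancelˡ-≡ (+ ℓ) _ _ (≡.trans (≡.sym aug-v) (≡.sym (ℤ.*-identityʳ (+ ℓ))))
      1+π^M≈y : 1+π ** M ≈ y
      1+π^M≈y = R.trans (**-^ 1+π M) (^-congˡ M (solve 1 (λ x → con′ (+ 1) :+ (x :- con′ (+ 1)) := x) R.refl X))

  open ℓ-Valuation public using (val-ℓ)

  val-ord : ∀ {n e} → Ord ℓ n e → Val (con (+ n)) (e ℕ.* φ)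
  val-ord {e = e} (ℕ.divides q refl , nd) = val-cong
    (R.trans (R.*-congˡ (con-^ e)) (R.sym (R.trans (R.reflexive (cong con (ℤ.pos-* q (ℓ ℕ.^ e)))) (con-* (+ q) (+ (ℓ ℕ.^ e))))))
    (val-⊡ (val-unit {con (+ q)} (unit-con q λ d → nd (ℕ.*-monoˡ-∣ (ℓ ℕ.^ e) d))) (val-^ e val-ℓ))
    where
    con-^ : ∀ e → con (+ ℓ) ^ e ≈ con (+ (ℓ ℕ.^ e))
    con-^ zero    = R.refl
    con-^ (suc e) = R.trans (R.*-congˡ (con-^ e)) (R.sym (R.trans (R.reflexive (cong con (ℤ.pos-* ℓ (ℓ ℕ.^ e))))
          (con-* (+ ℓ) (+ (ℓ ℕ.^ e)))))

-- Galois conjugation and congruences modulo y - 1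

module Conjugation (p : ℕ) (ℓ-prime : Prime (suc p)) (k : ℕ) where
  open import Data.Nat.Base as ℕ using (ℕ; zero; suc; _<_)
  open Cyclotomic p ℓ-prime k
  open Valuation p ℓ-prime k
  open ShiftOperators hiding (_**_)
  open import Data.Integer.Base using (+_)
  import Data.Nat.Properties as ℕ
  import Data.Nat.Divisibility as ℕ
  open import Relation.Binary.PropositionalEquality as ≡ using (refl; cong)
  open import Relation.Nullary.Negation using (¬_)
  open import Relation.Binary.Reasoning.Setoid R.setoid

  open PrincipalQuotient R (y ⊞ neg (con (+ 1))) using (_≡ₚ_; mk≡ₚ)

  module _ (j : ℕ) (ℓ∤j : ¬ (ℓ ℕ.∣ j)) where
    private
      σπ : σ j π ≈ π ⊡ geo j X
      σπ = R.trans (R.+-congʳ (**-^ X j)) (R.sym (geo-telescope j X))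

      σπ^ : ∀ n a → σ j (π ^ n ⊡ a) ≈ π ^ n ⊡ (geo j X ^ n ⊡ σ j a)
      σπ^ n a = R.trans (R.*-congʳ {σ j a} (R.trans (R.reflexive (σ-^ j π n)) (R.trans (^-congˡ n σπ) (^-distrib-* π (geo j X) n))))
        (R.*-assoc (π ^ n) (geo j X ^ n) (σ j a))

      unit-geo : ∀ n → Unit (geo j X ^ n)
      unit-geo zero    = unit-1 {con (+ 1)} refl
      unit-geo (suc n) = unit-⊡ {geo j X} {geo j X ^ n}
        (unit-≡ {con (+ j)} {geo j X} (≡.sym (≡.trans (cong aug (≡.sym (geometric-geo j X))) (aug-geometric j X refl))) (unit-con j ℓ∤j))
        (unit-geo n)

    -- σ_j multiplies π by `geo j X`, a unit with value j at 1, and so keeps valuations. The error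
    -- term is a multiple of y - 1, hence of π^(k+1), and cannot disturb a valuation of at most k.
    conjugate-val : ∀ {F f i a} → F ≡ₚ σ j f → i < suc k → Unit a → f ≈ π ^ i ⊡ a → Val F i
    conjugate-val {F} {f} {i} {a} (mk≡ₚ t q) i≤k ua e with X^ℓ^-divisible k | ℕ.m≤n⇒∃[o]m+o≡n i≤k
    ... | divisible d g | (m , eq) = val-cong (R.sym (begin
      F
        ≈⟨ q ⟩
      σ j f ⊞ (y ⊞ neg (con (+ 1))) ⊡ t
        ≈⟨ R.+-cong (R.trans (σ-cong j ℓ∤j e) (σπ^ i a)) (R.*-congʳ {t} g) ⟩
      π ^ i ⊡ w ⊞ (π ^ suc k ⊡ d) ⊡ t
        ≈⟨ R.+-congˡ {π ^ i ⊡ w} (R.*-congʳ {t} (R.*-congʳ {d} (R.trans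
              (^-congʳ π {suc k} {i ℕ.+ suc m} (≡.trans (≡.sym eq) (≡.sym (ℕ.+-suc i m)))) (^-homo-* π i (suc m))))) ⟩
      π ^ i ⊡ w ⊞ ((π ^ i ⊡ (π ⊡ π ^ m)) ⊡ d) ⊡ t
        ≈⟨ solve 6 (λ P w q r d t → P :* w :+ ((P :* (q :* r)) :* d) :* t := P :* (w :+ q :* (r :* (d :* t)))) R.refl
              (π ^ i) w π (π ^ m) d t ⟩
      π ^ i ⊡ (w ⊞ π ⊡ (π ^ m ⊡ (d ⊡ t))) ∎))
      (val {numerator = w ⊞ π ⊡ (π ^ m ⊡ (d ⊡ t))} {denominator = con (+ 1)}
        (unit-+π {w} m (d ⊡ t) (unit-⊡ {geo j X ^ i} {σ j a} (unit-geo i) (unit-σ j {a} ua))) (unit-1 {con (+ 1)} refl) (R.*-identityˡ _))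
      where
      w : Poly
      w = geo j X ^ i ⊡ σ j a

    conjugate-divisible : ∀ {F f} → F ≡ₚ σ j f → Divisible f (suc k) → Divisible F (suc k)
    conjugate-divisible {F} {f} (mk≡ₚ t q) (divisible a e) with X^ℓ^-divisible k
    ... | divisible d g = divisible (w ⊞ d ⊡ t) (begin
      F
        ≈⟨ q ⟩
      σ j f ⊞ (y ⊞ neg (con (+ 1))) ⊡ t
        ≈⟨ R.+-cong (R.trans (σ-cong j ℓ∤j e) (σπ^ (suc k) a)) (R.*-congʳ {t} g) ⟩
      π ^ suc k ⊡ w ⊞ (π ^ suc k ⊡ d) ⊡ t
        ≈⟨ solve 4 (λ P w d t → P :* w :+ (P :* d) :* t := P :* (w :+ d :* t)) R.refl (π ^ suc k) w d t ⟩
      π ^ suc k ⊡ (w ⊞ d ⊡ t) ∎)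
      where
      w : Poly
      w = geo j X ^ suc k ⊡ σ j a

-- Laplacians of abelian lifts

module LiftedLaplacians (R : CommutativeRing 0ℓ 0ℓ) where
  open CommutativeRing R hiding (zero)
  open RingKit R
  open Determinant R
  open DeterminantProducts R
  open MatrixTree R
  open Contraction using (Edges)
  open import Algebra.Properties.Semiring.Exp semiring using (_^_)
  open import Data.Integer.Base using (+_)
  open import Data.Fin.Base using (Fin; zero; suc; combine; remQuot; quotient; remainder; _↑ˡ_; _↑ʳ_)
  open import Data.Fin.Properties using (_≟_; combine-injective; combine-remQuot; remQuot-combine)
  open import Data.Product.Base using (_×_; _,_; proj₁; proj₂)
  open import Data.Vec.Base using ([]; _∷_; tabulate)
  open import Function.Base using (_∘_)
  open import Relation.Binary.PropositionalEquality as ≡ using (_≡_)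
  open import Relation.Binary.Reasoning.Setoid setoid
  open import Relation.Nullary.Decidable using (yes; no)

  sum-++ : ∀ n {m} (f : Fin (n ℕ.+ m) → Carrier) → sum f ≈ sum {n} (λ i → f (i ↑ˡ m)) + sum {m} (λ j → f (n ↑ʳ j))
  sum-++ zero    f = sym (+-identityˡ _)
  sum-++ (suc n) f = trans (+-congˡ (sum-++ n (f ∘ suc))) (sym (+-assoc _ _ _))

  sum-combine : ∀ n m (f : Fin (n ℕ.* m) → Carrier) → sum f ≈ sum {n} (λ a → sum {m} (λ x → f (combine a x)))
  sum-combine zero    m f = refl
  sum-combine (suc n) m f = trans (sum-++ m f) (+-congˡ (sum-combine n m (λ i → f (m ↑ʳ i))))

  sum-remQuot : ∀ n m (f : Fin n → Fin m → Carrier) →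
    sum {n ℕ.* m} (λ i → f (quotient m i) (remainder {n} m i)) ≈ sum {n} (λ a → sum {m} (f a))
  sum-remQuot n m f = trans (sum-combine n m (λ i → f (quotient m i) (remainder {n} m i)))
    (sum-cong {n} (λ a → sum-cong {m} (λ x → reflexive (≡.cong₂ f (≡.cong proj₁ (remQuot-combine a x))
          (≡.cong proj₂ (remQuot-combine a x))))))

  prod-++ : ∀ n {m} (f : Fin (n ℕ.+ m) → Carrier) → prod f ≈ prod {n} (λ i → f (i ↑ˡ m)) * prod {m} (λ j → f (n ↑ʳ j))
  prod-++ zero    f = sym (*-identityˡ _)
  prod-++ (suc n) f = trans (*-congˡ (prod-++ n (f ∘ suc))) (sym (*-assoc _ _ _))

  prod-combine : ∀ n m (f : Fin (n ℕ.* m) → Carrier) → prod f ≈ prod {n} (λ a → prod {m} (λ x → f (combine a x)))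
  prod-combine zero    m f = refl
  prod-combine (suc n) m f = trans (prod-++ m f) (*-congˡ (prod-combine n m (λ i → f (m ↑ʳ i))))

  δ-combine : ∀ {n m} (a b : Fin n) (x y : Fin m) → δ (combine a x) (combine b y) ≈ δ a b * δ x y
  δ-combine a b x y with a ≟ b | x ≟ y
  ... | yes ≡.refl | yes ≡.refl = trans (reflexive (δ-refl (combine a x)))
    (sym (trans (*-cong (reflexive (δ-refl a)) (reflexive (δ-refl x))) (*-identityˡ 1#)))
  ... | yes ≡.refl | no x≢y = trans (reflexive (δ-≢ (x≢y ∘ proj₂ ∘ combine-injective a x a y)))
    (sym (trans (*-congˡ (reflexive (δ-≢ x≢y))) (zeroʳ _)))
  ... | no a≢b | _ = trans (reflexive (δ-≢ (a≢b ∘ proj₁ ∘ combine-injective a x b y)))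
    (sym (trans (*-congʳ (reflexive (δ-≢ a≢b))) (zeroˡ _)))

  δ-remQuot : ∀ {n m} (a : Fin n) (x : Fin m) j → δ (combine a x) j ≈ δ a (quotient m j) * δ x (remainder {n} m j)
  δ-remQuot {n} {m} a x j = trans (reflexive (≡.cong (δ (combine a x)) (≡.sym (combine-remQuot {n} m j))))
    (δ-combine a (quotient m j) x (remainder {n} m j))

  laplacian-sum : ∀ {n k} (f : Fin k → Fin n × Fin n) c w i j →
    laplacian (tabulate f) c w i j
      ≈ sum (λ e → incidence (proj₁ (f e)) (proj₂ (f e)) i * incidence (proj₁ (f e)) (proj₂ (f e)) j) + c * (w i * w j)
  laplacian-sum {k = zero}  f c w i j = sym (+-identityˡ _)
  laplacian-sum {k = suc k} f c w i j = trans (+-congˡ (laplacian-sum (f ∘ suc) c w i j)) (sym (+-assoc _ _ _))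

  -- The Laplacian of the graph with edges u i → v i, twisted by edge weights s
  -- and weights s̄ on the reversed edges.
  twist : ∀ {kb nb} → (u v : Fin kb → Fin nb) → (s s̄ : Fin kb → Carrier) → Rows nb nb
  twist {kb} u v s s̄ x y = sum {kb} (λ i → (δ (u i) x - s̄ i * δ (v i) x) * (δ (u i) y - s i * δ (v i) y))

  -- A graph on Fin nb with edges u i → v i lifted along a free action of an
  -- abelian group on Fin q: edge i translates the group by act i, which the
  -- character c turns into multiplication by s i c.
  record Characters (q kb : ℕ) : Set where
    field
      act act⁻¹ : Fin kb → Fin q → Fin q
      act-act⁻¹ : ∀ i a → act i (act⁻¹ i a) ≡ a
      act⁻¹-act : ∀ i a → act⁻¹ i (act i a) ≡ a
      χ χ̄       : Fin q → Fin q → Carrier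
      s s̄       : Fin kb → Fin q → Carrier
      χ-act     : ∀ i c a → χ c (act i a) ≈ χ c a * s i c
      χ-act⁻¹   : ∀ i c a → χ c (act⁻¹ i a) ≈ χ c a * s̄ i c
      orthogonal : ∀ a b → sum {q} (λ c → χ c a * χ̄ c b) ≈ fromℕ q * δ a b
      trivial   : Fin q
      χ-trivial : ∀ a → χ trivial a ≈ 1#
      χ-sum     : ∀ c → sum {q} (χ c) ≈ fromℕ q * δ trivial c

  module _ {q kb nb : ℕ} (C : Characters q kb) (u v : Fin kb → Fin nb) where
    open Characters C

    liftedEdge : Fin (kb ℕ.* q) → Fin (q ℕ.* nb) × Fin (q ℕ.* nb)
    liftedEdge e = let (i , a) = remQuot {kb} q e in combine a (u i) , combine (act i a) (v i)

    liftedEdges : Edges (q ℕ.* nb) (kb ℕ.* q)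
    liftedEdges = tabulate liftedEdge

    twisted : Fin q → Rows nb nb
    twisted c = twist u v (λ i → s i c) (λ i → s̄ i c)

    module _ (z : Carrier) (cancel : ∀ {x y} → fromℕ q * x ≈ fromℕ q * y → x ≈ y) where
      -- The term z J is constant along fibres, so by `χ-sum` only the trivial character sees it,
      -- with multiplicity q.
      twistedJ : Fin q → Rows nb nb
      twistedJ c x y = twisted c x y + (z * fromℕ q) * δ trivial c

      private
        n = q ℕ.* nb

        qt : Fin n → Fin q
        qt = quotient nb
        rm : Fin n → Fin nb
        rm = remainder {q} nb

        L F F̄ : Rows n n
        L = laplacian liftedEdges z (λ _ → 1#)
        F i j = χ (qt j) (qt i) * δ (rm i) (rm j)
        F̄ i j = χ̄ (qt i) (qt j) * δ (rm i) (rm j)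

        inc : Fin kb → Fin q → Fin q → Fin nb → Carrier
        inc i a b x = δ a b * δ (u i) x - δ (act i a) b * δ (v i) x

        inc-pairing : ∀ i a c y →
          sum {q} (λ b → sum {nb} (λ x → inc i a b x * (χ c b * δ x y)))
            ≈ χ c a * (δ (u i) y - s i c * δ (v i) y)
        inc-pairing i a c y = begin
          sum {q} (λ b → sum {nb} (λ x → inc i a b x * (χ c b * δ x y)))
            ≈⟨ sum-cong {q} (λ b → trans (sum-cong {nb} (λ x → sym (*-assoc _ _ _))) (sum-δʳ y (λ x → inc i a b x * χ c b))) ⟩
          sum {q} (λ b → inc i a b y * χ c b)
            ≈⟨ sum-cong {q} (λ b → solve 5 (λ d e f g h → (d :* f :- e :* g) :* h := d :* (f :* h) :+ e :* (:- g :* h)) refl _ _ _ _ _) ⟩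
          sum {q} (λ b → δ a b * (δ (u i) y * χ c b) + δ (act i a) b * (- δ (v i) y * χ c b))
            ≈⟨ ∑-distrib-+ {q} (λ b → δ a b * (δ (u i) y * χ c b)) (λ b → δ (act i a) b * (- δ (v i) y * χ c b)) ⟩
          sum {q} (λ b → δ a b * (δ (u i) y * χ c b)) + sum {q} (λ b → δ (act i a) b * (- δ (v i) y * χ c b))
            ≈⟨ +-cong (sum-δ a (λ b → δ (u i) y * χ c b)) (sum-δ (act i a) (λ b → - δ (v i) y * χ c b)) ⟩
          δ (u i) y * χ c a + - δ (v i) y * χ c (act i a)
            ≈⟨ +-congˡ (*-congˡ (χ-act i c a)) ⟩
          δ (u i) y * χ c a + - δ (v i) y * (χ c a * s i c)
            ≈⟨ solve 4 (λ u v x s → u :* x :+ :- v :* (x :* s) := x :* (u :- s :* v)) refl _ _ _ _ ⟩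
          χ c a * (δ (u i) y - s i c * δ (v i) y) ∎

        δ-act : ∀ i a b → δ (act i a) b ≡ δ a (act⁻¹ i b)
        δ-act i a b = ≡.trans (≡.sym (δ-injective (act⁻¹ i) (λ {x} {y} p → ≡.trans (≡.sym (act-act⁻¹ i x)) (≡.trans (≡.cong (act i) p) (act-act⁻¹ i y))) (act i a) b))
          (≡.cong (λ x → δ x (act⁻¹ i b)) (act⁻¹-act i a))

        inc-transfer : ∀ i a c x →
          sum {q} (λ b → inc i b a x * χ c b) ≈ χ c a * (δ (u i) x - s̄ i c * δ (v i) x)
        inc-transfer i a c x = begin
          sum {q} (λ b → inc i b a x * χ c b)
            ≈⟨ sum-cong {q} (λ b → trans (*-congʳ (+-cong (*-congʳ (reflexive (δ-comm b a)))
                  (-‿cong (*-congʳ (reflexive (≡.trans (δ-act i b a) (δ-comm b (act⁻¹ i a))))))))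
                 (solve 5 (λ d e f g h → (d :* f :- e :* g) :* h := d :* (f :* h) :+ e :* (:- g :* h)) refl _ _ _ _ _)) ⟩
          sum {q} (λ b → δ a b * (δ (u i) x * χ c b) + δ (act⁻¹ i a) b * (- δ (v i) x * χ c b))
            ≈⟨ ∑-distrib-+ {q} (λ b → δ a b * (δ (u i) x * χ c b)) (λ b → δ (act⁻¹ i a) b * (- δ (v i) x * χ c b)) ⟩
          sum {q} (λ b → δ a b * (δ (u i) x * χ c b)) + sum {q} (λ b → δ (act⁻¹ i a) b * (- δ (v i) x * χ c b))
            ≈⟨ +-cong (sum-δ a (λ b → δ (u i) x * χ c b)) (sum-δ (act⁻¹ i a) (λ b → - δ (v i) x * χ c b)) ⟩
          δ (u i) x * χ c a + - δ (v i) x * χ c (act⁻¹ i a)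
            ≈⟨ +-congˡ (*-congˡ (χ-act⁻¹ i c a)) ⟩
          δ (u i) x * χ c a + - δ (v i) x * (χ c a * s̄ i c)
            ≈⟨ solve 4 (λ u v x s → u :* x :+ :- v :* (x :* s) := x :* (u :- s :* v)) refl _ _ _ _ ⟩
          χ c a * (δ (u i) x - s̄ i c * δ (v i) x) ∎

        ends : Fin (kb ℕ.* q) → Fin n → Carrier
        ends e = incidence (proj₁ (liftedEdge e)) (proj₂ (liftedEdge e))

        edge : Fin (kb ℕ.* q) → Fin kb
        edge = quotient q
        elt : Fin (kb ℕ.* q) → Fin q
        elt = remainder {kb} q

        ends-inc : ∀ e j → ends e j ≈ inc (edge e) (elt e) (qt j) (rm j)
        ends-inc e j = +-cong (δ-remQuot (elt e) (u (edge e)) j) (-‿cong (δ-remQuot (act (edge e) (elt e)) (v (edge e)) j))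

        χ-constant : ∀ c a → (z * fromℕ q) * δ trivial c ≈ χ c a * ((z * fromℕ q) * δ trivial c)
        χ-constant c a with trivial ≟ c
        ... | yes ≡.refl = sym (trans (*-congʳ (χ-trivial a)) (*-identityˡ _))
        ... | no t≢c = trans zero′ (sym (trans (*-congˡ zero′) (zeroʳ _)))
          where
          zero′ : (z * fromℕ q) * δ trivial c ≈ 0#
          zero′ = trans (*-congˡ (reflexive (δ-≢ t≢c))) (zeroʳ _)

        L⊗F : ∀ i j → (L ⊗ F) i j ≈ χ (qt j) (qt i) * twistedJ (qt j) (rm i) (rm j)
        L⊗F i j = begin
          sum {n} (λ l → L i l * F l j)
            ≈⟨ sum-cong {n} (λ l → trans (*-congʳ (laplacian-sum liftedEdge z (λ _ → 1#) i l)) (distribʳ _ _ _)) ⟩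
          sum {n} (λ l → sum {kb ℕ.* q} (λ e → ends e i * ends e l) * F l j + (z * (1# * 1#)) * F l j)
            ≈⟨ ∑-distrib-+ {n} (λ l → sum {kb ℕ.* q} (λ e → ends e i * ends e l) * F l j) (λ l → (z * (1# * 1#)) * F l j) ⟩
          sum {n} (λ l → sum {kb ℕ.* q} (λ e → ends e i * ends e l) * F l j) + sum {n} (λ l → (z * (1# * 1#)) * F l j)
            ≈⟨ +-cong edge-part J-part ⟩
          χ c a * twisted c x y + χ c a * ((z * fromℕ q) * δ trivial c)
            ≈⟨ distribˡ _ _ _ ⟨
          χ c a * twistedJ c x y ∎
          where
          a = qt i
          x = rm i
          c = qt j
          y = rm j
          J-part : sum {n} (λ l → (z * (1# * 1#)) * F l j) ≈ χ c a * ((z * fromℕ q) * δ trivial c)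
          J-part = begin
            sum {n} (λ l → (z * (1# * 1#)) * F l j)
              ≈⟨ *-distribˡ-sum {n} (z * (1# * 1#)) (λ l → F l j) ⟨
            (z * (1# * 1#)) * sum {n} (λ l → χ c (qt l) * δ (rm l) y)
              ≈⟨ *-congˡ (sum-remQuot q nb (λ b w → χ c b * δ w y)) ⟩
            (z * (1# * 1#)) * sum {q} (λ b → sum {nb} (λ w → χ c b * δ w y))
              ≈⟨ *-congˡ (sum-cong {q} (λ b → sum-δʳ y (λ _ → χ c b))) ⟩
            (z * (1# * 1#)) * sum {q} (χ c)
              ≈⟨ *-congˡ (χ-sum c) ⟩
            (z * (1# * 1#)) * (fromℕ q * δ trivial c)
              ≈⟨ solve 3 (λ z q d → (z :* (con (+ 1) :* con (+ 1))) :* (q :* d) := (z :* q) :* d) refl z (fromℕ q) _ ⟩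
            (z * fromℕ q) * δ trivial c
              ≈⟨ χ-constant c a ⟩
            χ c a * ((z * fromℕ q) * δ trivial c) ∎
          edge-part : sum {n} (λ l → sum {kb ℕ.* q} (λ e → ends e i * ends e l) * F l j) ≈ χ c a * twisted c x y
          edge-part = begin
            sum {n} (λ l → sum {kb ℕ.* q} (λ e → ends e i * ends e l) * F l j)
              ≈⟨ sum-cong {n} (λ l → trans (*-distribʳ-sum {kb ℕ.* q} (F l j) (λ e → ends e i * ends e l))
                    (sum-cong {kb ℕ.* q} (λ e → *-assoc _ _ _))) ⟩
            sum {n} (λ l → sum {kb ℕ.* q} (λ e → ends e i * (ends e l * F l j)))
              ≈⟨ ∑-comm {n} {kb ℕ.* q} (λ l e → ends e i * (ends e l * F l j)) ⟩
            sum {kb ℕ.* q} (λ e → sum {n} (λ l → ends e i * (ends e l * F l j)))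
              ≈⟨ sum-cong {kb ℕ.* q} (λ e → trans (sym (*-distribˡ-sum {n} (ends e i) (λ l → ends e l * F l j))) (*-cong (ends-inc e i)
                   (trans (sum-cong {n} (λ l → *-congʳ (ends-inc e l)))
                     (trans (sum-remQuot q nb (λ b w → inc (edge e) (elt e) b w * (χ c b * δ w y))) (inc-pairing (edge e) (elt e) c y))))) ⟩
            sum {kb ℕ.* q} (λ e → inc (edge e) (elt e) a x * (χ c (elt e) * r (edge e)))
              ≈⟨ sum-remQuot kb q (λ i′ b → inc i′ b a x * (χ c b * r i′)) ⟩
            sum {kb} (λ i′ → sum {q} (λ b → inc i′ b a x * (χ c b * r i′)))
              ≈⟨ sum-cong {kb} (λ i′ → trans (sum-cong {q} (λ b → sym (*-assoc _ _ _)))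
                    (trans (sym (*-distribʳ-sum {q} (r i′) (λ b → inc i′ b a x * χ c b)))
                   (trans (*-congʳ (inc-transfer i′ a c x)) (*-assoc _ _ _)))) ⟩
            sum {kb} (λ i′ → χ c a * ((δ (u i′) x - s̄ i′ c * δ (v i′) x) * r i′))
              ≈⟨ *-distribˡ-sum {kb} (χ c a) (λ i′ → (δ (u i′) x - s̄ i′ c * δ (v i′) x) * r i′) ⟨
            χ c a * twisted c x y ∎
            where
            r : Fin kb → Carrier
            r i′ = δ (u i′) y - s i′ c * δ (v i′) y

        F⊗D : ∀ i j → (F ⊗ blockDiagonal {q} {nb} twistedJ) i j ≈ χ (qt j) (qt i) * twistedJ (qt j) (rm i) (rm j)
        F⊗D i j = begin
          sum {n} (λ l → (χ (qt l) a * δ x (rm l)) * (δ (qt l) c * twistedJ (qt l) (rm l) y))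
            ≈⟨ sum-remQuot q nb (λ b w → (χ b a * δ x w) * (δ b c * twistedJ b w y)) ⟩
          sum {q} (λ b → sum {nb} (λ w → (χ b a * δ x w) * (δ b c * twistedJ b w y)))
            ≈⟨ sum-cong {q} (λ b → trans (sum-cong {nb} (λ w → solve 4
                  (λ k d e t → (k :* d) :* (e :* t) := d :* ((k :* t) :* e)) refl _ _ _ _))
                 (sum-δ x (λ w → (χ b a * twistedJ b w y) * δ b c))) ⟩
          sum {q} (λ b → (χ b a * twistedJ b x y) * δ b c)
            ≈⟨ sum-δʳ c (λ b → χ b a * twistedJ b x y) ⟩
          χ c a * twistedJ c x y ∎
          where
          a = qt i
          x = rm i
          c = qt j
          y = rm j

        F⊗F̄ : ∀ i j → (F ⊗ F̄) i j ≈ fromℕ q * δ i j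
        F⊗F̄ i j = begin
          sum {n} (λ l → (χ (qt l) a * δ x (rm l)) * (χ̄ (qt l) b * δ (rm l) y))
            ≈⟨ sum-remQuot q nb (λ c w → (χ c a * δ x w) * (χ̄ c b * δ w y)) ⟩
          sum {q} (λ c → sum {nb} (λ w → (χ c a * δ x w) * (χ̄ c b * δ w y)))
            ≈⟨ sum-cong {q} (λ c → trans (sum-cong {nb} (λ w → solve 4
                  (λ k d e t → (k :* d) :* (e :* t) := d :* ((k :* e) :* t)) refl _ _ _ _))
                 (sum-δ x (λ w → (χ c a * χ̄ c b) * δ w y))) ⟩
          sum {q} (λ c → (χ c a * χ̄ c b) * δ x y)
            ≈⟨ *-distribʳ-sum {q} (δ x y) (λ c → χ c a * χ̄ c b) ⟨
          sum {q} (λ c → χ c a * χ̄ c b) * δ x y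
            ≈⟨ *-congʳ (orthogonal a b) ⟩
          (fromℕ q * δ a b) * δ x y
            ≈⟨ *-assoc _ _ _ ⟩
          fromℕ q * (δ a b * δ x y)
            ≈⟨ *-congˡ (δ-remQuot a x j) ⟨
          fromℕ q * δ (combine a x) j
            ≡⟨ ≡.cong (λ i → fromℕ q * δ i j) (combine-remQuot {q} nb i) ⟩
          fromℕ q * δ i j ∎
          where
          a = qt i
          x = rm i
          b = qt j
          y = rm j

        cancel-^ : ∀ m {x y} → fromℕ q ^ m * x ≈ fromℕ q ^ m * y → x ≈ y
        cancel-^ zero    p = trans (sym (*-identityˡ _)) (trans p (*-identityˡ _))
        cancel-^ (suc m) p = cancel-^ m (cancel (trans (sym (*-assoc _ _ _)) (trans p (*-assoc _ _ _))))

      -- `F`, the character table tensored with the identity, intertwines the Laplacian with the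
      -- block diagonal matrix of its twists. It need not be invertible over `R`, but F F̄ = q, so
      -- its determinant cancels against a power of q.
      det-lifted : det (laplacian liftedEdges z (λ _ → 1#)) ≈ prod {q} (λ c → det (twistedJ c))
      det-lifted = cancel-^ n (begin
        fromℕ q ^ n * det L
          ≈⟨ *-congʳ (trans (sym (det-⊗ F F̄)) (trans (det-cong {n} F⊗F̄) (det-scalar n (fromℕ q)))) ⟨
        (det F * det F̄) * det L
          ≈⟨ solve 3 (λ f g l → (f :* g) :* l := g :* (l :* f)) refl _ _ _ ⟩
        det F̄ * (det L * det F)
          ≈⟨ *-congˡ (trans (sym (det-⊗ L F)) (trans (det-cong {n} (λ i j → trans (L⊗F i j) (sym (F⊗D i j))))
                (det-⊗ F (blockDiagonal {q} {nb} twistedJ)))) ⟩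
        det F̄ * (det F * det (blockDiagonal {q} {nb} twistedJ))
          ≈⟨ solve 3 (λ f g l → g :* (f :* l) := (f :* g) :* l) refl _ _ _ ⟩
        (det F * det F̄) * det (blockDiagonal {q} {nb} twistedJ)
          ≈⟨ *-cong (trans (sym (det-⊗ F F̄)) (trans (det-cong {n} F⊗F̄) (det-scalar n (fromℕ q)))) (det-blockDiagonal {q} {nb} twistedJ) ⟩
        fromℕ q ^ n * prod {q} (λ c → det (twistedJ c)) ∎)

-- Determinants under ring homomorphisms

module DeterminantHomomorphism (R S : CommutativeRing 0ℓ 0ℓ) where
  private
    module R = CommutativeRing R
    module S = CommutativeRing S
  private
    module DR = Determinant R
    module DS = Determinant S
  open RingKit R using () renaming (sum to sumR)
  open RingKit S using () renaming (sum to sumS)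
  open import Data.Fin.Base using (Fin; zero; suc)
  open import Data.Nat.Base using (zero; suc)
  open import Data.Vec.Functional using (_∷_)
  open import Function.Base using (_∘_)

  record IsRingHom (h : R.Carrier → S.Carrier) : Set where
    field
      h-+   : ∀ x y → h (x R.+ y) S.≈ h x S.+ h y
      h-*   : ∀ x y → h (x R.* y) S.≈ h x S.* h y
      h-neg : ∀ x → h (R.- x) S.≈ S.- h x
      h-0   : h R.0# S.≈ S.0#
      h-1   : h R.1# S.≈ S.1#

  module _ {h : R.Carrier → S.Carrier} (hom : IsRingHom h) where
    open IsRingHom hom

    private
      map-h : ∀ {n m} → DR.Rows n m → DS.Rows n m
      map-h M i j = h (M i j)

      ∷-map : ∀ {n m} (x : DR.Row m) (N : DR.Rows n m) → map-h (x ∷ N) DS.≋≋ ((h ∘ x) ∷ map-h N)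
      ∷-map x N zero    j = S.refl
      ∷-map x N (suc i) j = S.refl

      wedge-hom : ∀ {n m} (D : DR.Form n m) (D′ : DS.Form n m) →
        (∀ {M N} → M DS.≋≋ N → D′ M S.≈ D′ N) → (∀ N → h (D N) S.≈ D′ (map-h N)) →
        ∀ M → h (DR.wedge D M) S.≈ DS.wedge D′ (map-h M)
      wedge-hom {zero}  D D′ c p M = S.trans (h-* _ _) (S.*-congˡ (p _))
      wedge-hom {suc n} D D′ c p M = S.trans (h-+ _ _) (S.+-cong (S.trans (h-* _ _) (S.*-congˡ (p _)))
        (S.trans (h-neg _) (S.-‿cong (wedge-hom {n} _ _ (λ q → c (DS.∷-≋ (λ _ → S.refl) q))
          (λ N → S.trans (p _) (c (∷-map _ N))) _))))

    det-hom : ∀ {n} (M : DR.Rows n n) → h (DR.det M) S.≈ DS.det (λ i j → h (M i j))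
    det-hom {zero}  M = h-1
    det-hom {suc n} M = wedge-hom {n} DR.det DS.det (DS.det-cong {n}) (det-hom {n}) M

    sum-hom : ∀ {n} (f : Fin n → R.Carrier) → h (sumR f) S.≈ sumS (h ∘ f)
    sum-hom {zero}  f = h-0
    sum-hom {suc n} f = S.trans (h-+ _ _) (S.+-congˡ (sum-hom {n} (f ∘ suc)))

    δ-hom : ∀ {n} (i j : Fin n) → h (DR.δ i j) S.≈ DS.δ i j
    δ-hom zero    zero    = h-1
    δ-hom zero    (suc j) = h-0
    δ-hom (suc i) zero    = h-0
    δ-hom (suc i) (suc j) = δ-hom i j

-- Characters of cyclic groups and of products

module CharacterGroups (R : CommutativeRing 0ℓ 0ℓ) where
  open CommutativeRing R hiding (zero)
  open RingKit R
  open Determinant R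
  open MatrixTree R using (δ-refl; δ-≢)
  open LiftedLaplacians R
  open GeometricSums R
  open import Algebra.Properties.Semiring.Exp semiring using (_^_; ^-congˡ; ^-homo-*; ^-assocʳ)
  open import Data.Integer.Base as ℤ using (+_)
  import Data.Integer.Properties as ℤ
  open import Data.Fin.Base using (Fin; zero; suc; combine; quotient; remainder; toℕ; fromℕ<)
  open import Data.Fin.Properties using (_≟_; combine-remQuot; remQuot-combine; toℕ-fromℕ<; toℕ-injective; toℕ<n)
  open import Data.Nat.Base as ℕ using (ℕ; zero; suc; _<_; pred)
  import Data.Nat.Properties as ℕ
  import Data.Nat.Divisibility as ℕ
  open import Data.Nat.DivMod using (_%_; _/_; m%n<n; m≡m%n+[m/n]*n; m<n⇒m%n≡m; [m+kn]%n≡m%n; %-distribˡ-+; m%n%n≡m%n)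
  open import Data.Nat.Solver using (module +-*-Solver)
  open import Data.Product.Base using (_×_; _,_; proj₁; proj₂)
  open import Function.Base using (_∘_)
  open import Relation.Binary.PropositionalEquality as ≡ using (_≡_)
  open import Relation.Binary.Reasoning.Setoid setoid
  open import Relation.Nullary.Decidable using (yes; no)
  open import Relation.Nullary.Negation using (¬_)

  module _ {q₁ q₂ kb} (C₁ : Characters q₁ kb) (C₂ : Characters q₂ kb) where
    private
      module C₁ = Characters C₁
      module C₂ = Characters C₂
      fst = quotient {q₁} q₂
      snd = remainder {q₁} q₂

      lift : (Fin q₁ → Fin q₁) → (Fin q₂ → Fin q₂) → Fin (q₁ ℕ.* q₂) → Fin (q₁ ℕ.* q₂)
      lift f g a = combine (f (fst a)) (g (snd a))

      fst-lift : ∀ f g a → fst (lift f g a) ≡ f (fst a)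
      fst-lift f g a = ≡.cong proj₁ (remQuot-combine (f (fst a)) (g (snd a)))

      snd-lift : ∀ f g a → snd (lift f g a) ≡ g (snd a)
      snd-lift f g a = ≡.cong proj₂ (remQuot-combine (f (fst a)) (g (snd a)))

      lift-lift : ∀ {f f′ g g′} → (∀ a → f (f′ a) ≡ a) → (∀ a → g (g′ a) ≡ a) → ∀ a → lift f g (lift f′ g′ a) ≡ a
      lift-lift {f} {f′} {g} {g′} p r a = ≡.trans (≡.cong₂ combine
        (≡.trans (≡.cong f (fst-lift f′ g′ a)) (p (fst a)))
        (≡.trans (≡.cong g (snd-lift f′ g′ a)) (r (snd a)))) (combine-remQuot {q₁} q₂ a)

      fromℕ-* : ∀ m n → fromℕ (m ℕ.* n) ≈ fromℕ m * fromℕ n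
      fromℕ-* m n = trans (reflexive (≡.cong ⟪_⟫ (ℤ.pos-* m n))) (⟪⟫-* (+ m) (+ n))

      shuffle : ∀ {a b c d} → (a * b) * (c * d) ≈ (a * c) * (b * d)
      shuffle {a} {b} {c} {d} = solve 4 (λ a b c d → (a :* b) :* (c :* d) := (a :* c) :* (b :* d)) refl a b c d

      sum-product : ∀ (f : Fin q₁ → Carrier) (g : Fin q₂ → Carrier) →
        sum {q₁ ℕ.* q₂} (λ a → f (fst a) * g (snd a)) ≈ sum f * sum g
      sum-product f g = trans (sum-remQuot q₁ q₂ (λ a b → f a * g b)) (trans
        (sum-cong {q₁} (λ a → sym (*-distribˡ-sum {q₂} (f a) g))) (sym (*-distribʳ-sum {q₁} (sum g) f)))

    product : Characters (q₁ ℕ.* q₂) kb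
    product = record
      { act = λ i → lift (C₁.act i) (C₂.act i)
      ; act⁻¹ = λ i → lift (C₁.act⁻¹ i) (C₂.act⁻¹ i)
      ; act-act⁻¹ = λ i → lift-lift {C₁.act i} {C₁.act⁻¹ i} {C₂.act i} {C₂.act⁻¹ i} (C₁.act-act⁻¹ i) (C₂.act-act⁻¹ i)
      ; act⁻¹-act = λ i → lift-lift {C₁.act⁻¹ i} {C₁.act i} {C₂.act⁻¹ i} {C₂.act i} (C₁.act⁻¹-act i) (C₂.act⁻¹-act i)
      ; χ = λ c a → C₁.χ (fst c) (fst a) * C₂.χ (snd c) (snd a)
      ; χ̄ = λ c a → C₁.χ̄ (fst c) (fst a) * C₂.χ̄ (snd c) (snd a)
      ; s = λ i c → C₁.s i (fst c) * C₂.s i (snd c)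
      ; s̄ = λ i c → C₁.s̄ i (fst c) * C₂.s̄ i (snd c)
      ; χ-act = λ i c a → trans (*-cong
          (trans (reflexive (≡.cong (C₁.χ (fst c)) (fst-lift (C₁.act i) (C₂.act i) a))) (C₁.χ-act i (fst c) (fst a)))
          (trans (reflexive (≡.cong (C₂.χ (snd c)) (snd-lift (C₁.act i) (C₂.act i) a))) (C₂.χ-act i (snd c) (snd a)))) shuffle
      ; χ-act⁻¹ = λ i c a → trans (*-cong
          (trans (reflexive (≡.cong (C₁.χ (fst c)) (fst-lift (C₁.act⁻¹ i) (C₂.act⁻¹ i) a))) (C₁.χ-act⁻¹ i (fst c) (fst a)))
          (trans (reflexive (≡.cong (C₂.χ (snd c)) (snd-lift (C₁.act⁻¹ i) (C₂.act⁻¹ i) a))) (C₂.χ-act⁻¹ i (snd c) (snd a)))) shuffle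
      ; orthogonal = λ a b → begin
          sum {q₁ ℕ.* q₂} (λ c → (C₁.χ (fst c) (fst a) * C₂.χ (snd c) (snd a)) * (C₁.χ̄ (fst c) (fst b) * C₂.χ̄ (snd c) (snd b)))
            ≈⟨ sum-cong {q₁ ℕ.* q₂} (λ c → shuffle) ⟩
          sum {q₁ ℕ.* q₂} (λ c → (C₁.χ (fst c) (fst a) * C₁.χ̄ (fst c) (fst b)) * (C₂.χ (snd c) (snd a) * C₂.χ̄ (snd c) (snd b)))
            ≈⟨ sum-product (λ c → C₁.χ c (fst a) * C₁.χ̄ c (fst b)) (λ c → C₂.χ c (snd a) * C₂.χ̄ c (snd b)) ⟩
          sum {q₁} (λ c → C₁.χ c (fst a) * C₁.χ̄ c (fst b)) * sum {q₂} (λ c → C₂.χ c (snd a) * C₂.χ̄ c (snd b))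
            ≈⟨ *-cong (C₁.orthogonal (fst a) (fst b)) (C₂.orthogonal (snd a) (snd b)) ⟩
          (fromℕ q₁ * δ (fst a) (fst b)) * (fromℕ q₂ * δ (snd a) (snd b))
            ≈⟨ shuffle ⟩
          (fromℕ q₁ * fromℕ q₂) * (δ (fst a) (fst b) * δ (snd a) (snd b))
            ≈⟨ *-cong (fromℕ-* q₁ q₂) (δ-remQuot (fst a) (snd a) b) ⟨
          fromℕ (q₁ ℕ.* q₂) * δ (combine (fst a) (snd a)) b
            ≡⟨ ≡.cong (λ a → fromℕ (q₁ ℕ.* q₂) * δ a b) (combine-remQuot {q₁} q₂ a) ⟩
          fromℕ (q₁ ℕ.* q₂) * δ a b ∎
      ; trivial = combine C₁.trivial C₂.trivial
      ; χ-trivial = λ a → trans (*-cong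
          (trans (reflexive (≡.cong (λ c → C₁.χ (proj₁ c) (fst a)) (remQuot-combine C₁.trivial C₂.trivial))) (C₁.χ-trivial (fst a)))
          (trans (reflexive (≡.cong (λ c → C₂.χ (proj₂ c) (snd a)) (remQuot-combine C₁.trivial C₂.trivial))) (C₂.χ-trivial (snd a))))
          (*-identityˡ 1#)
      ; χ-sum = λ c → trans (sum-product (C₁.χ (fst c)) (C₂.χ (snd c)))
          (trans (*-cong (C₁.χ-sum (fst c)) (C₂.χ-sum (snd c))) (trans shuffle
            (*-cong (sym (fromℕ-* q₁ q₂)) (sym (δ-remQuot C₁.trivial C₂.trivial c)))))
      }

  trivialGroup : ∀ {kb} → Characters 1 kb
  trivialGroup = record
    { act = λ _ a → a ; act⁻¹ = λ _ a → a ; act-act⁻¹ = λ _ _ → ≡.refl ; act⁻¹-act = λ _ _ → ≡.refl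
    ; χ = λ _ _ → 1# ; χ̄ = λ _ _ → 1# ; s = λ _ _ → 1# ; s̄ = λ _ _ → 1#
    ; χ-act = λ _ _ _ → sym (*-identityʳ 1#) ; χ-act⁻¹ = λ _ _ _ → sym (*-identityʳ 1#)
    ; orthogonal = λ { zero zero → solve 0 (con (+ 1) :* con (+ 1) :+ con (+ 0) := con (+ 1) :* con (+ 1)) refl }
    ; trivial = zero ; χ-trivial = λ _ → refl
    ; χ-sum = λ { zero → solve 0 (con (+ 1) :+ con (+ 0) := con (+ 1) :* con (+ 1)) refl } }

  module _ (n : ℕ) .{{_ : ℕ.NonZero n}} (w : Carrier) (w^n≈1 : w ^ n ≈ 1#)
           (geo-zero : ∀ g → ¬ (n ℕ.∣ g) → geo n (w ^ g) ≈ 0#) where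

    origin : Fin n
    origin = fromℕ< (ℕ.>-nonZero⁻¹ n)

    toℕ-origin : toℕ origin ≡ 0
    toℕ-origin = toℕ-fromℕ< (ℕ.>-nonZero⁻¹ n)

    shiftMod : ℕ → Fin n → Fin n
    shiftMod b a = fromℕ< (m%n<n (toℕ a ℕ.+ b) n)

    toℕ-shiftMod : ∀ b a → toℕ (shiftMod b a) ≡ (toℕ a ℕ.+ b) % n
    toℕ-shiftMod b a = toℕ-fromℕ< (m%n<n (toℕ a ℕ.+ b) n)

    private
      1^≈1 : ∀ m → 1# ^ m ≈ 1#
      1^≈1 zero    = refl
      1^≈1 (suc m) = trans (*-identityˡ _) (1^≈1 m)

      w^multiple : ∀ m → w ^ (n ℕ.* m) ≈ 1#
      w^multiple m = trans (sym (^-assocʳ w n m)) (trans (^-congˡ m w^n≈1) (1^≈1 m))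

      w^-mod : ∀ c a → w ^ (c ℕ.* (a % n)) ≈ w ^ (c ℕ.* a)
      w^-mod c a = sym (trans (reflexive (≡.cong (w ^_) eq)) (trans (^-homo-* w (c ℕ.* (a % n)) (n ℕ.* (c ℕ.* (a / n))))
        (trans (*-congˡ (w^multiple (c ℕ.* (a / n)))) (*-identityʳ _))))
        where
        eq : c ℕ.* a ≡ c ℕ.* (a % n) ℕ.+ n ℕ.* (c ℕ.* (a / n))
        eq = ≡.trans (≡.cong (c ℕ.*_) (m≡m%n+[m/n]*n a n)) (ℕ-solve c (a % n) (a / n) n)
          where
          ℕ-solve : ∀ c r q n → c ℕ.* (r ℕ.+ q ℕ.* n) ≡ c ℕ.* r ℕ.+ n ℕ.* (c ℕ.* q)
          ℕ-solve c r q n = ≡.trans (ℕ.*-distribˡ-+ c r (q ℕ.* n)) (≡.cong (c ℕ.* r ℕ.+_)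
            (≡.trans (≡.sym (ℕ.*-assoc c q n)) (ℕ.*-comm (c ℕ.* q) n)))

      χ-shift : ∀ b (c a : Fin n) → w ^ (toℕ c ℕ.* toℕ (shiftMod b a)) ≈ w ^ (toℕ c ℕ.* toℕ a) * w ^ (toℕ c ℕ.* b)
      χ-shift b c a = trans (reflexive (≡.cong (λ x → w ^ (toℕ c ℕ.* x)) (toℕ-shiftMod b a)))
        (trans (w^-mod (toℕ c) (toℕ a ℕ.+ b)) (trans (reflexive (≡.cong (w ^_) (ℕ.*-distribˡ-+ (toℕ c) (toℕ a) b)))
          (^-homo-* w (toℕ c ℕ.* toℕ a) (toℕ c ℕ.* b))))

      shift-shift : ∀ b b′ → n ℕ.∣ b ℕ.+ b′ → ∀ a → shiftMod b (shiftMod b′ a) ≡ a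
      shift-shift b b′ (ℕ.divides k eq) a = toℕ-injective (≡.trans (toℕ-shiftMod b _)
        (≡.trans (≡.cong (λ x → (x ℕ.+ b) % n) (toℕ-shiftMod b′ a))
        (≡.trans (%-distribˡ-+ ((toℕ a ℕ.+ b′) % n) b n)
        (≡.trans (≡.cong (λ x → (x ℕ.+ b % n) % n) (m%n%n≡m%n (toℕ a ℕ.+ b′) n))
        (≡.trans (≡.sym (%-distribˡ-+ (toℕ a ℕ.+ b′) b n))
        (≡.trans (≡.cong (_% n) (≡.trans (ℕ.+-assoc (toℕ a) b′ b) (≡.cong (toℕ a ℕ.+_) (≡.trans (ℕ.+-comm b′ b) eq))))
        (≡.trans ([m+kn]%n≡m%n (toℕ a) k n) (m<n⇒m%n≡m (toℕ<n a)))))))))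

      -- Negatives modulo n are written as multiples by n - 1, which keeps all exponents natural
      -- numbers.
      pred* : ∀ b → b ℕ.+ pred n ℕ.* b ≡ n ℕ.* b
      pred* b = ≡.cong (ℕ._* b) (ℕ.suc-pred n)

      difference : ∀ (a b : Fin n) → n ℕ.∣ toℕ a ℕ.+ pred n ℕ.* toℕ b → a ≡ b
      difference a b (ℕ.divides k eq) = toℕ-injective (≡.trans (≡.sym (m<n⇒m%n≡m (toℕ<n a)))
        (≡.trans (≡.sym ([m+kn]%n≡m%n (toℕ a) (toℕ b) n))
        (≡.trans (≡.cong (_% n) (≡.trans (≡.cong (toℕ a ℕ.+_) (≡.trans (ℕ.*-comm (toℕ b) n) (≡.sym (pred* (toℕ b)))))
          (≡.trans (≡.cong (toℕ a ℕ.+_) (ℕ.+-comm (toℕ b) _)) (≡.trans (≡.sym (ℕ.+-assoc (toℕ a) _ _))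
            (≡.trans (≡.cong (ℕ._+ toℕ b) eq) (ℕ.+-comm _ (toℕ b)))))))
        (≡.trans ([m+kn]%n≡m%n (toℕ b) k n) (m<n⇒m%n≡m (toℕ<n b))))))

      geo-1 : ∀ m → geo m 1# ≈ fromℕ m
      geo-1 zero    = refl
      geo-1 (suc m) = trans (+-congˡ (trans (*-identityˡ _) (geo-1 m))) (sym (fromℕ-suc m))

      char-sum : ∀ g → sum {n} (λ c → w ^ (toℕ c ℕ.* g)) ≈ geo n (w ^ g)
      char-sum g = trans (sum-cong {n} (λ c → trans (reflexive (≡.cong (w ^_) (ℕ.*-comm (toℕ c) g))) (sym (^-assocʳ w g (toℕ c)))))
        (geo-sum n (w ^ g))

      full-sum : ∀ g → n ℕ.∣ g → geo n (w ^ g) ≈ fromℕ n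
      full-sum g (ℕ.divides k eq) = trans (geo-cong n (trans (reflexive (≡.cong (w ^_) (≡.trans eq (ℕ.*-comm k n))))
            (w^multiple k))) (geo-1 n)

      orthogonality : ∀ (a b : Fin n) → sum {n} (λ c → w ^ (toℕ c ℕ.* toℕ a) * w ^ (toℕ c ℕ.* (pred n ℕ.* toℕ b))) ≈ fromℕ n * δ a b
      orthogonality a b = trans (sum-cong {n} (λ c → trans (sym (^-homo-* w (toℕ c ℕ.* toℕ a) _))
          (reflexive (≡.cong (w ^_) (≡.sym (ℕ.*-distribˡ-+ (toℕ c) (toℕ a) _)))))) (trans (char-sum g) (cases (a ≟ b)))
        where
        g = toℕ a ℕ.+ pred n ℕ.* toℕ b
        open import Relation.Nullary.Decidable using (Dec)
        cases : Dec (a ≡ b) → geo n (w ^ g) ≈ fromℕ n * δ a b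
        cases (yes ≡.refl) = trans (full-sum g (ℕ.divides (toℕ a) (≡.trans (pred* (toℕ a)) (ℕ.*-comm n (toℕ a)))))
          (sym (trans (*-congˡ (reflexive (δ-refl a))) (*-identityʳ _)))
        cases (no a≢b) = trans (geo-zero g (a≢b ∘ difference a b)) (sym (trans (*-congˡ (reflexive (δ-≢ a≢b))) (zeroʳ _)))

      total : ∀ c → sum {n} (λ a → w ^ (toℕ c ℕ.* toℕ a)) ≈ fromℕ n * δ origin c
      total c = trans (sum-cong {n} (λ a → reflexive (≡.cong (w ^_) (ℕ.*-comm (toℕ c) (toℕ a)))))
            (trans (char-sum (toℕ c)) (cases (origin ≟ c)))
        where
        open import Relation.Nullary.Decidable using (Dec)
        cases : Dec (origin ≡ c) → geo n (w ^ toℕ c) ≈ fromℕ n * δ origin c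
        cases (yes ≡.refl) = trans (full-sum (toℕ origin) (≡.subst (n ℕ.∣_) (≡.sym toℕ-origin) (n ℕ.∣0)))
          (sym (trans (*-congˡ (reflexive (δ-refl origin))) (*-identityʳ _)))
        cases (no o≢c) = trans (geo-zero (toℕ c) n∤c) (sym (trans (*-congˡ (reflexive (δ-≢ o≢c))) (zeroʳ _)))
          where
          n∤c : ¬ (n ℕ.∣ toℕ c)
          n∤c d with toℕ c in eq
          ... | zero  = o≢c (toℕ-injective (≡.trans toℕ-origin (≡.sym eq)))
          ... | suc m = ℕ.<⇒≱ (≡.subst (_< n) eq (toℕ<n c)) (ℕ.∣⇒≤ d)

    cyclicGroup : ∀ {kb} → (Fin kb → ℕ) → Characters n kb
    cyclicGroup b = record
      { act = λ i → shiftMod (b i)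
      ; act⁻¹ = λ i → shiftMod (pred n ℕ.* b i)
      ; act-act⁻¹ = λ i → shift-shift (b i) _ (ℕ.divides (b i) (≡.trans (pred* (b i)) (ℕ.*-comm n (b i))))
      ; act⁻¹-act = λ i → shift-shift _ (b i) (ℕ.divides (b i) (≡.trans (ℕ.+-comm _ (b i)) (≡.trans (pred* (b i)) (ℕ.*-comm n (b i)))))
      ; χ = λ c a → w ^ (toℕ c ℕ.* toℕ a)
      ; χ̄ = λ c a → w ^ (toℕ c ℕ.* (pred n ℕ.* toℕ a))
      ; s = λ i c → w ^ (toℕ c ℕ.* b i)
      ; s̄ = λ i c → w ^ (toℕ c ℕ.* (pred n ℕ.* b i))
      ; χ-act = λ i c a → χ-shift (b i) c a
      ; χ-act⁻¹ = λ i c a → χ-shift (pred n ℕ.* b i) c a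
      ; orthogonal = orthogonality
      ; trivial = origin
      ; χ-trivial = λ a → reflexive (≡.cong (λ x → w ^ (x ℕ.* toℕ a)) toℕ-origin)
      ; χ-sum = total
      }

-- Tree numbers of consecutive levels

module LevelRelation (R : CommutativeRing 0ℓ 0ℓ) where
  open CommutativeRing R hiding (zero)
  open RingKit R
  open Contraction using (Edges; treeCount)
  open Determinant R
  open DeterminantProducts R
  open MatrixTree R
  open LiftedLaplacians R
  open CharacterGroups R using (product)
  open import Data.Fin.Base using (Fin; zero; suc; combine; remQuot)
  open import Data.Fin.Properties using (remQuot-combine)
  open import Data.Integer.Base as ℤ using (+_)
  import Data.Integer.Properties as ℤ
  import Data.Nat.Properties as ℕ
  open import Data.Product.Base using (proj₁; proj₂)
  open import Relation.Binary.PropositionalEquality as ≡ using (_≡_)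
  open import Relation.Binary.Reasoning.Setoid setoid

  twist-cong : ∀ {kb nb} (u v : Fin kb → Fin nb) {s s′ s̄ s̄′ : Fin kb → Carrier} →
    (∀ i → s i ≈ s′ i) → (∀ i → s̄ i ≈ s̄′ i) → twist u v s s̄ ≋≋ twist u v s′ s̄′
  twist-cong {kb} u v p q x y = sum-cong {kb} (λ i →
    *-cong (+-congˡ (-‿cong (*-congʳ (q i)))) (+-congˡ (-‿cong (*-congʳ (p i)))))

  fromℕ-* : ∀ m n → fromℕ (m ℕ.* n) ≈ fromℕ m * fromℕ n
  fromℕ-* m n = trans (reflexive (≡.cong ⟪_⟫ (ℤ.pos-* m n))) (⟪⟫-* (+ m) (+ n))

  sum-ones : ∀ m → sum {m} (λ _ → 1#) ≈ fromℕ m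
  sum-ones zero    = refl
  sum-ones (suc m) = trans (+-congˡ (sum-ones m)) (sym (fromℕ-suc m))

  count-trees : ∀ m .{{_ : ℕ.NonZero m}} {e} (es : Edges m e) z →
    det (laplacian es z (λ _ → 1#)) ≈ (z * (fromℕ m * fromℕ m)) * fromℕ (treeCount m es)
  count-trees m es z = trans (matrix-tree′ m es z (λ _ → 1#))
    (*-congʳ (*-congˡ (*-cong (sum-ones m) (sum-ones m))))

  at-combine : ∀ {a} {A : Set a} {m l} (f : Fin m → Fin l → A) c d →
    f (proj₁ (remQuot l (combine c d))) (proj₂ (remQuot {m} l (combine c d))) ≡ f c d
  at-combine f c d = ≡.cong (λ x → f (proj₁ x) (proj₂ x)) (remQuot-combine c d)

  -- Z refines Z′: the characters of Z whose index is a multiple of suc p are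
  -- those of the quotient Z′.
  module _ {a m p kb nb : ℕ} (K : Characters a kb) (Z : Characters (m ℕ.* suc p) kb) (Z′ : Characters m kb)
           (u v : Fin kb → Fin nb)
           (cancel : ∀ n .{{_ : ℕ.NonZero n}} {x y} → fromℕ n * x ≈ fromℕ n * y → x ≈ y) where
    private
      module K = Characters K
      module Z = Characters Z
      module Z′ = Characters Z′
      ℓ q q′ : ℕ
      ℓ = suc p
      q  = a ℕ.* (m ℕ.* ℓ)
      q′ = a ℕ.* m

    conjugates : Fin a → Fin (m ℕ.* ℓ) → Carrier
    conjugates c d = det (twist u v (λ i → K.s i c * Z.s i d) (λ i → K.s̄ i c * Z.s̄ i d))

    -- `combine j (suc t)` runs through the indices j (p + 1) + t + 1 that are not multiples of p +
    -- 1; in the application these are the characters faithful on the cyclic factor.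
    primitivePart : Carrier
    primitivePart = prod {a} (λ c → prod {m} (λ j → prod {p} (λ t → conjugates c (combine j (suc t)))))

    module _ (low-s : ∀ i j → Z.s i (combine j zero) ≈ Z′.s i j)
             (low-s̄ : ∀ i j → Z.s̄ i (combine j zero) ≈ Z′.s̄ i j)
             (low-trivial : Z.trivial ≡ combine Z′.trivial zero) where
      private
        full = product K Z
        low  = product K Z′

        q≡q′ℓ : q ≡ q′ ℕ.* ℓ
        q≡q′ℓ = ≡.sym (ℕ.*-assoc a m ℓ)

        module _ (cancel-q : ∀ {x y} → fromℕ q * x ≈ fromℕ q * y → x ≈ y)
                 (cancel-q′ : ∀ {x y} → fromℕ q′ * x ≈ fromℕ q′ * y → x ≈ y) where
          D : Fin q → Rows nb nb
          D = twistedJ full u v 1# cancel-q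

          D′ : Fin q′ → Rows nb nb
          -- Weight ℓ at the lower level makes the trivial characters match: they see 1 · q above
          -- and ℓ · q′ below, and q = q′ ℓ.
          D′ = twistedJ low u v (fromℕ ℓ) cancel-q′

          trivial-δ : ∀ c j t → δ (Characters.trivial full) (combine c (combine j t)) ≈ (δ K.trivial c * δ Z′.trivial j) * δ zero t
          trivial-δ c j t = trans (δ-combine K.trivial c Z.trivial (combine j t)) (trans (*-congˡ
            (trans (reflexive (≡.cong (λ z → δ z (combine j t)) low-trivial)) (δ-combine Z′.trivial j zero t))) (sym (*-assoc _ _ _)))

          D-low : ∀ c j → det (D (combine c (combine j zero))) ≈ det (D′ (combine c j))
          D-low c j = det-cong {nb} λ x y → +-cong
            (twist-cong u v
              (λ i → trans (reflexive (at-combine (λ c d → K.s i c * Z.s i d) c (combine j zero)))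
                (trans (*-congˡ (low-s i j)) (reflexive (≡.sym (at-combine (λ c d → K.s i c * Z′.s i d) c j)))))
              (λ i → trans (reflexive (at-combine (λ c d → K.s̄ i c * Z.s̄ i d) c (combine j zero)))
                (trans (*-congˡ (low-s̄ i j)) (reflexive (≡.sym (at-combine (λ c d → K.s̄ i c * Z′.s̄ i d) c j))))) x y)
            (*-cong (trans (*-identityˡ _) (trans (reflexive (≡.cong fromℕ (≡.trans q≡q′ℓ (ℕ.*-comm q′ ℓ)))) (fromℕ-* ℓ q′)))
              (trans (trivial-δ c j zero) (trans (*-identityʳ _) (sym (δ-combine K.trivial c Z′.trivial j)))))

          D-conjugate : ∀ c j t → det (D (combine c (combine j (suc t)))) ≈ conjugates c (combine j (suc t))
          D-conjugate c j t = det-cong {nb} λ x y → trans (+-cong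
            (twist-cong u v
              (λ i → reflexive (at-combine (λ c d → K.s i c * Z.s i d) c (combine j (suc t))))
              (λ i → reflexive (at-combine (λ c d → K.s̄ i c * Z.s̄ i d) c (combine j (suc t)))) x y)
            (trans (*-congˡ (trans (trivial-δ c j (suc t)) (zeroʳ _))) (zeroʳ _)))
            (+-identityʳ _)

          prod-D : prod {q} (λ c → det (D c)) ≈ prod {q′} (λ c → det (D′ c)) * primitivePart
          prod-D = begin
            prod {q} (λ c → det (D c))
              ≈⟨ prod-combine a (m ℕ.* ℓ) (λ c → det (D c)) ⟩
            prod {a} (λ c → prod {m ℕ.* ℓ} (λ d → det (D (combine c d))))
              ≈⟨ prod-cong {a} (λ c → trans (prod-combine m ℓ (λ d → det (D (combine c d))))
                   (trans (prod-cong {m} (λ j → *-cong (D-low c j) (prod-cong {p} (D-conjugate c j))))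
                     (prod-distrib-* {m} (λ j → det (D′ (combine c j))) (λ j → prod {p} (λ t → conjugates c (combine j (suc t))))))) ⟩
            prod {a} (λ c → prod {m} (λ j → det (D′ (combine c j))) * prod {m} (λ j → prod {p} (λ t → conjugates c (combine j (suc t)))))
              ≈⟨ prod-distrib-* {a} (λ c → prod {m} (λ j → det (D′ (combine c j))))
                    (λ c → prod {m} (λ j → prod {p} (λ t → conjugates c (combine j (suc t))))) ⟩
            prod {a} (λ c → prod {m} (λ j → det (D′ (combine c j)))) * primitivePart
              ≈⟨ *-congʳ (prod-combine a m (λ c → det (D′ c))) ⟨
            prod {q′} (λ c → det (D′ c)) * primitivePart ∎

      module _ .{{_ : ℕ.NonZero a}} .{{_ : ℕ.NonZero m}} .{{_ : ℕ.NonZero nb}} where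
        private
          n n′ : ℕ
          n  = q ℕ.* nb
          n′ = q′ ℕ.* nb
          instance
            mℓ≢0 : ℕ.NonZero (m ℕ.* ℓ)
            mℓ≢0 = ℕ.m*n≢0 m ℓ
            q≢0 : ℕ.NonZero q
            q≢0 = ℕ.m*n≢0 a (m ℕ.* ℓ)
            q′≢0 : ℕ.NonZero q′
            q′≢0 = ℕ.m*n≢0 a m
            n≢0 : ℕ.NonZero n
            n≢0 = ℕ.m*n≢0 q nb
            n′≢0 : ℕ.NonZero n′
            n′≢0 = ℕ.m*n≢0 q′ nb

          n≡n′ℓ : n ≡ n′ ℕ.* ℓ
          n≡n′ℓ = ≡.trans (≡.cong (ℕ._* nb) q≡q′ℓ) (≡.trans (ℕ.*-assoc q′ ℓ nb)
            (≡.trans (≡.cong (q′ ℕ.*_) (ℕ.*-comm ℓ nb)) (≡.sym (ℕ.*-assoc q′ nb ℓ))))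

        -- The matrix-tree theorem evaluates the two determinants as n² T and ℓ n′² T′, where n = n′
        -- ℓ. After cancelling n′² ℓ one factor ℓ survives on the left.
        level-relation : fromℕ ℓ * fromℕ (treeCount n (liftedEdges full u v))
          ≈ fromℕ (treeCount n′ (liftedEdges low u v)) * primitivePart
        level-relation = cancel n′ (cancel n′ (cancel ℓ (begin
          ℓ̂ * (m̂ * (m̂ * (ℓ̂ * t)))
            ≈⟨ solve 3 (λ l m t → l :* (m :* (m :* (l :* t))) := (con (+ 1) :* ((m :* l) :* (m :* l))) :* t) refl ℓ̂ m̂ t ⟩
          (1# * ((m̂ * ℓ̂) * (m̂ * ℓ̂))) * t
            ≈⟨ *-congʳ (*-congˡ (*-cong n̂ n̂)) ⟨
          (1# * (fromℕ n * fromℕ n)) * t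
            ≈⟨ count-trees n (liftedEdges full u v) 1# ⟨
          det (laplacian (liftedEdges full u v) 1# (λ _ → 1#))
            ≈⟨ det-lifted full u v 1# (cancel q) ⟩
          prod {q} (λ c → det (D (cancel q) (cancel q′) c))
            ≈⟨ prod-D (cancel q) (cancel q′) ⟩
          prod {q′} (λ c → det (D′ (cancel q) (cancel q′) c)) * primitivePart
            ≈⟨ *-congʳ (trans (sym (det-lifted low u v ℓ̂ (cancel q′))) (count-trees n′ (liftedEdges low u v) ℓ̂)) ⟩
          ((ℓ̂ * (m̂ * m̂)) * t′) * primitivePart
            ≈⟨ solve 4 (λ l m t e → ((l :* (m :* m)) :* t) :* e := l :* (m :* (m :* (t :* e)))) refl ℓ̂ m̂ t′ _ ⟩
          ℓ̂ * (m̂ * (m̂ * (t′ * primitivePart))) ∎)))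
          where
          ℓ̂ m̂ t t′ : Carrier
          ℓ̂ = fromℕ ℓ
          m̂ = fromℕ n′
          t = fromℕ (treeCount n (liftedEdges full u v))
          t′ = fromℕ (treeCount n′ (liftedEdges low u v))
          n̂ : fromℕ n ≈ m̂ * ℓ̂
          n̂ = trans (reflexive (≡.cong fromℕ n≡n′ℓ)) (fromℕ-* n′ ℓ)

-- Characters factoring through a cyclic quotient

module CyclicQuotient (R : CommutativeRing 0ℓ 0ℓ) (m p : ℕ) .{{_ : ℕ.NonZero m}} .{{_ : ℕ.NonZero (m ℕ.* suc p)}} where
  open CommutativeRing R hiding (zero)
  open RingKit R
  open import Algebra.Properties.Semiring.Exp semiring using (_^_; ^-congˡ; ^-congʳ; ^-homo-*; ^-assocʳ)
  open import Data.Fin.Base using (Fin; zero; suc; combine; toℕ)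
  open import Data.Fin.Properties using (toℕ-combine)
  import Data.Nat.Properties as ℕ
  import Data.Nat.Divisibility as ℕ
  open import Relation.Binary.PropositionalEquality as ≡ using (_≡_; cong)
  open import Relation.Binary.Reasoning.Setoid setoid

  private
    ℓ N : ℕ
    ℓ = suc p
    N = m ℕ.* ℓ

  toℕ-low : ∀ (j : Fin m) → toℕ (combine j (zero {p})) ≡ ℓ ℕ.* toℕ j
  toℕ-low j = ≡.trans (toℕ-combine j (zero {p})) (ℕ.+-identityʳ _)

  complement : ∀ m .{{_ : ℕ.NonZero m}} x y → x ℕ.* (ℕ.pred m ℕ.* y) ℕ.+ x ℕ.* y ≡ m ℕ.* (x ℕ.* y)
  complement (suc m) x y = ≡.trans (≡.sym (ℕ.*-distribˡ-+ x (m ℕ.* y) y)) (≡.trans (cong (x ℕ.*_) (ℕ.+-comm (m ℕ.* y) y))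
    (≡.trans (≡.sym (ℕ.*-assoc x (suc m) y)) (≡.trans (cong (ℕ._* y) (ℕ.*-comm x (suc m))) (ℕ.*-assoc (suc m) x y))))

  module _ (w : Carrier) (w^N≈1 : w ^ N ≈ 1#) where
    private
      1^≈1 : ∀ n → 1# ^ n ≈ 1#
      1^≈1 zero    = refl
      1^≈1 (suc n) = trans (*-identityˡ _) (1^≈1 n)

      inverse-unique : ∀ {a b e} → a * e ≈ 1# → b * e ≈ 1# → a ≈ b
      inverse-unique {a} {b} {e} p q = begin
        a            ≈⟨ trans (sym (*-identityʳ a)) (*-congˡ (sym q)) ⟩
        a * (b * e)  ≈⟨ solve 3 (λ a b e → a :* (b :* e) := (a :* e) :* b) refl a b e ⟩
        (a * e) * b  ≈⟨ trans (*-congʳ p) (*-identityˡ b) ⟩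
        b            ∎

      multiple : ∀ a b e k → a ℕ.+ b ≡ e → e ≡ N ℕ.* k → w ^ a * w ^ b ≈ 1#
      multiple a b e k eq eq′ = trans (sym (^-homo-* w a b)) (trans (^-congʳ w {a ℕ.+ b} {N ℕ.* k} (≡.trans eq eq′))
        (trans (sym (^-assocʳ w N k)) (trans (^-congˡ k w^N≈1) (1^≈1 k))))

    low-s : ∀ (j : Fin m) b → w ^ (toℕ (combine j (zero {p})) ℕ.* b) ≈ (w ^ ℓ) ^ (toℕ j ℕ.* b)
    low-s j b = trans (^-congʳ w {toℕ (combine j (zero {p})) ℕ.* b} {ℓ ℕ.* (toℕ j ℕ.* b)}
        (≡.trans (cong (ℕ._* b) (toℕ-low j)) (ℕ.*-assoc ℓ (toℕ j) b)))
      (sym (^-assocʳ w ℓ (toℕ j ℕ.* b)))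

    -- The exponents on the two sides differ as natural numbers, since N - 1 and m - 1 encode the
    -- negatives; both powers are inverse to the same power of `w`.
    low-s̄ : ∀ (j : Fin m) b → w ^ (toℕ (combine j (zero {p})) ℕ.* (ℕ.pred N ℕ.* b)) ≈ (w ^ ℓ) ^ (toℕ j ℕ.* (ℕ.pred m ℕ.* b))
    low-s̄ j b = inverse-unique {e = w ^ (J ℕ.* b)}
      (multiple (J ℕ.* (ℕ.pred N ℕ.* b)) (J ℕ.* b) (N ℕ.* (J ℕ.* b)) (J ℕ.* b) (complement N J b) ≡.refl)
      (trans (*-congʳ (^-assocʳ w ℓ (toℕ j ℕ.* (ℕ.pred m ℕ.* b))))
        (multiple (ℓ ℕ.* (toℕ j ℕ.* (ℕ.pred m ℕ.* b))) (J ℕ.* b) (ℓ ℕ.* (m ℕ.* (toℕ j ℕ.* b))) (toℕ j ℕ.* b)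
          (≡.trans (cong (ℓ ℕ.* (toℕ j ℕ.* (ℕ.pred m ℕ.* b)) ℕ.+_) (≡.trans (cong (ℕ._* b) (toℕ-low j)) (ℕ.*-assoc ℓ (toℕ j) b)))
            (≡.trans (≡.sym (ℕ.*-distribˡ-+ ℓ _ (toℕ j ℕ.* b))) (cong (ℓ ℕ.*_) (complement m (toℕ j) b))))
          (≡.trans (≡.sym (ℕ.*-assoc ℓ m _)) (cong (ℕ._* (toℕ j ℕ.* b)) (ℕ.*-comm ℓ m)))))
      where
      J : ℕ
      J = toℕ (combine j (zero {p}))

-- Norms of the twisted determinant

module Norms (p : ℕ) (ℓ-prime : Prime (suc p)) (k : ℕ) where
  open import Data.Nat.Base as ℕ using (ℕ; zero; suc; _<_)
  open Cyclotomic p ℓ-prime k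
  open Valuation p ℓ-prime k
  open Conjugation p ℓ-prime k
  open ShiftOperators hiding (_**_)
  open Contraction using (treeCount)
  open Determinant R hiding (vanish)
  open DeterminantProducts R
  open MatrixTree R
  open LiftedLaplacians R
  open LevelRelation R
  module CG = CharacterGroups R
  open RingKit R using (sum)
  open import Data.Fin.Base using (Fin; zero; suc; combine; quotient; remainder; toℕ)
  open import Data.Fin.Properties using (toℕ-combine; toℕ-injective; toℕ-fromℕ<; toℕ<n)
  open import Data.Integer.Base using (+_)
  import Data.Nat.Properties as ℕ
  import Data.Nat.Divisibility as ℕ
  open import Function.Base using (_∘_)
  open import Relation.Binary.PropositionalEquality as ≡ using (cong; subst)
  open import Relation.Nullary.Negation using (¬_)
  open import Relation.Binary.Reasoning.Setoid R.setoid
  open import Defs using (Ord)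

  private
    instance
      N≢0 : ℕ.NonZero N
      N≢0 = ℕ.m*n≢0 M ℓ

  ωGroup : ∀ {kb} → (Fin kb → ℕ) → Characters ℓ kb
  ωGroup = CG.cyclicGroup ℓ y (R.trans (^-assocʳ X M ℓ) X^N≈1) λ g ℓ∤g →
    R.trans (geo-cong ℓ (^-assocʳ X M g)) (orthogonality ℓ (M ℕ.* g)
      (ℕ.divides g (≡.trans (≡.sym (ℕ.*-assoc ℓ M g)) (≡.trans (ℕ.*-comm (ℓ ℕ.* M) g) (cong (g ℕ.*_) (ℕ.*-comm ℓ M)))))
      (λ d → ℓ∤g (ℕ.*-cancelˡ-∣ M d)))

  ωGroups : ∀ {kb} r → (Fin kb → Fin r → ℕ) → Characters (ℓ ℕ.^ r) kb
  ωGroups zero    κ = CG.trivialGroup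
  ωGroups (suc r) κ = CG.product (ωGroup (λ i → κ i zero)) (ωGroups r (λ i → κ i ∘ suc))

  ζGroup : ∀ {kb} → (Fin kb → ℕ) → Characters N kb
  ζGroup = CG.cyclicGroup N X X^N≈1 λ g → orthogonality N g (ℕ.m∣m*n g)

  ζ^ℓGroup : ∀ {kb} → (Fin kb → ℕ) → Characters M kb
  ζ^ℓGroup = CG.cyclicGroup M (X ^ ℓ) (R.trans (^-assocʳ X ℓ M) (X^multiple _ (ℕ.∣-reflexive (ℕ.*-comm M ℓ)))) λ g M∤g →
    R.trans (geo-cong M (^-assocʳ X ℓ g)) (orthogonality M (ℓ ℕ.* g)
      (ℕ.divides g (≡.trans (≡.sym (ℕ.*-assoc M ℓ g)) (ℕ.*-comm N g)))
      (λ d → M∤g (ℕ.*-cancelˡ-∣ ℓ (subst (ℕ._∣ ℓ ℕ.* g) (ℕ.*-comm M ℓ) d))))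

  open PrincipalQuotient R (y ⊞ neg (con (+ 1))) using (_≡ₚ_; mk≡ₚ; ≈⇒≡ₚ; quotientRing)
  private
    module Q = CommutativeRing quotientRing
    module DQ = Determinant quotientRing
    module QSum = RingKit quotientRing

    y≡1 : y ≡ₚ con (+ 1)
    y≡1 = mk≡ₚ (con (+ 1)) (solve 1 (λ y → y := con′ (+ 1) :+ (y :- con′ (+ 1)) :* con′ (+ 1)) R.refl y)

    y^≡1 : ∀ n → (y ^ n) ≡ₚ con (+ 1)
    y^≡1 zero    = Q.refl
    y^≡1 (suc n) = Q.trans (Q.*-cong y≡1 (y^≡1 n)) (Q.*-identityˡ _)

    ωGroups-s : ∀ {kb} r (κ : Fin kb → Fin r → ℕ) i c → Characters.s (ωGroups r κ) i c ≡ₚ con (+ 1)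
    ωGroups-s zero    κ i c = Q.refl
    ωGroups-s (suc r) κ i c = Q.trans (Q.*-cong (y^≡1 (toℕ (quotient {ℓ} (ℓ ℕ.^ r) c) ℕ.* κ i zero))
          (ωGroups-s r (λ i → κ i ∘ suc) i (remainder {ℓ} (ℓ ℕ.^ r) c))) (Q.*-identityˡ _)

    ωGroups-s̄ : ∀ {kb} r (κ : Fin kb → Fin r → ℕ) i c → Characters.s̄ (ωGroups r κ) i c ≡ₚ con (+ 1)
    ωGroups-s̄ zero    κ i c = Q.refl
    ωGroups-s̄ (suc r) κ i c = Q.trans (Q.*-cong (y^≡1 (toℕ (quotient {ℓ} (ℓ ℕ.^ r) c) ℕ.* (ℕ.pred ℓ ℕ.* κ i zero)))
          (ωGroups-s̄ r (λ i → κ i ∘ suc) i (remainder {ℓ} (ℓ ℕ.^ r) c))) (Q.*-identityˡ _)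

  cancel-fromℕ : ∀ m .{{_ : ℕ.NonZero m}} {x y} → fromℕ m ⊡ x ≈ fromℕ m ⊡ y → x ≈ y
  cancel-fromℕ (suc m) e = con-torsion-free (+ suc m)
    (R.trans (R.*-congʳ (R.sym (fromℕ-con (suc m)))) (R.trans e (R.*-congʳ (fromℕ-con (suc m)))))

  module _ {kb nb : ℕ} (u v : Fin kb → Fin nb) where
    private
      -- Reduction modulo y - 1 is the identity on elements, so determinants and sums are compared
      -- by transporting them along it.
      id-hom : DeterminantHomomorphism.IsRingHom R quotientRing (λ x → x)
      id-hom = record { h-+ = λ _ _ → Q.refl ; h-* = λ _ _ → Q.refl ; h-neg = λ _ → Q.refl ; h-0 = Q.refl ; h-1 = Q.refl }

      det-≡ₚ : ∀ {n} {A B : Rows n n} → (∀ i j → A i j ≡ₚ B i j) → det A ≡ₚ det B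
      det-≡ₚ {n} {A} {B} e = Q.trans (DeterminantHomomorphism.det-hom R quotientRing id-hom {n} A)
        (Q.trans (DQ.det-cong {n} e) (Q.sym (DeterminantHomomorphism.det-hom R quotientRing id-hom {n} B)))

      sum-≡ₚ : ∀ {n} {f g : Fin n → Poly} → (∀ i → f i ≡ₚ g i) → sum f ≡ₚ sum g
      sum-≡ₚ {n} {f} {g} e = Q.trans (DeterminantHomomorphism.sum-hom R quotientRing id-hom {n} f)
        (Q.trans (QSum.sum-cong-≋ {n} e) (Q.sym (DeterminantHomomorphism.sum-hom R quotientRing id-hom {n} g)))

    det-twist-≡ₚ : ∀ {s s′ s̄ s̄′ : Fin kb → Poly} → (∀ i → s i ≡ₚ s′ i) → (∀ i → s̄ i ≡ₚ s̄′ i) →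
      det (twist u v s s̄) ≡ₚ det (twist u v s′ s̄′)
    det-twist-≡ₚ p q = det-≡ₚ {nb} (λ x y → sum-≡ₚ {kb} (λ i →
      Q.*-cong (Q.+-congˡ (Q.-‿cong (Q.*-congʳ (q i)))) (Q.+-congˡ (Q.-‿cong (Q.*-congʳ (p i))))))

    private
      σ-hom : ∀ j → DeterminantHomomorphism.IsRingHom R R (σ j)
      σ-hom j = record { h-+ = λ _ _ → R.refl ; h-* = λ _ _ → R.refl ; h-neg = λ _ → R.refl ; h-0 = R.refl ; h-1 = R.refl }

    σ-det-twist : ∀ j (s s̄ : Fin kb → Poly) →
      σ j (det (twist u v s s̄)) ≈ det (twist u v (λ i → σ j (s i)) (λ i → σ j (s̄ i)))
    σ-det-twist j s s̄ = R.trans (H.det-hom (σ-hom j) {nb} (twist u v s s̄))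
      (det-cong {nb} (λ x y → R.trans (H.sum-hom (σ-hom j) {kb} (λ i → (δ (u i) x ⊞ neg (s̄ i ⊡ δ (v i) x)) ⊡
            (δ (u i) y ⊞ neg (s i ⊡ δ (v i) y))))
        (sum-cong {kb} (λ i → R.*-cong
          (R.+-cong (δσ (u i) x) (R.-‿cong (R.*-congˡ (δσ (v i) x))))
          (R.+-cong (δσ (u i) y) (R.-‿cong (R.*-congˡ (δσ (v i) y))))))))
      where
      module H = DeterminantHomomorphism R R
      δσ : ∀ {n} (a b : Fin n) → σ j (δ a b) ≈ δ a b
      δσ a b = H.δ-hom (σ-hom j) a b

    module _ (b : Fin kb → ℕ) where
      -- The determinant twisted by the faithful character of Γ.
      base : Poly
      base = det (twist u v (λ i → X ^ b i) (λ i → X ^ (ℕ.pred N ℕ.* b i)))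

      private
        σ-X^ : ∀ j n → σ j (X ^ n) ≈ X ^ (j ℕ.* n)
        σ-X^ j n = R.trans (R.reflexive (σ-^ j X n)) (R.trans (^-congˡ n (**-^ X j)) (^-assocʳ X j n))

      module _ {r : ℕ} (κ : Fin kb → Fin r → ℕ) where
        private
          K = ωGroups r κ
          module K = Characters K

        conjugate : Fin (ℓ ℕ.^ r) → Fin N → Poly
        conjugate = conjugates {ℓ ℕ.^ r} {M} {p} K (ζGroup b) (ζ^ℓGroup b) u v cancel-fromℕ

        -- The characters of the elementary abelian factor take values in the powers of y and become
        -- trivial modulo y - 1. The character of index d of the cyclic factor is σ_d of the one of
        -- index 1.
        conjugate≡σ-base : ∀ c d → conjugate c d ≡ₚ σ (toℕ d) base
        conjugate≡σ-base c d = Q.trans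
          (det-twist-≡ₚ
            (λ i → Q.trans (Q.*-congʳ (ωGroups-s r κ i c)) (≈⇒≡ₚ (R.trans (R.*-identityˡ _) (R.sym (σ-X^ (toℕ d) (b i))))))
            (λ i → Q.trans (Q.*-congʳ (ωGroups-s̄ r κ i c)) (≈⇒≡ₚ (R.trans (R.*-identityˡ _) (R.sym (σ-X^ (toℕ d) (ℕ.pred N ℕ.* b i)))))))
          (≈⇒≡ₚ (R.sym (σ-det-twist (toℕ d) (λ i → X ^ b i) (λ i → X ^ (ℕ.pred N ℕ.* b i)))))

        private
          ℓ∤exponent : ∀ (j : Fin M) (t : Fin p) → ¬ (ℓ ℕ.∣ toℕ (combine j (suc t)))
          ℓ∤exponent j t d = ℕ.<⇒≱ (toℕ<n (suc t)) (ℕ.∣⇒≤ (ℕ.∣m+n∣m⇒∣n (subst (ℓ ℕ.∣_) (toℕ-combine j (suc t)) d) (ℕ.m∣m*n (toℕ j))))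

        norm : Poly
        norm = primitivePart {ℓ ℕ.^ r} {M} {p} K (ζGroup b) (ζ^ℓGroup b) u v cancel-fromℕ

        norm-val : ∀ {i a} → i < suc k → Unit a → base ≈ π ^ i ⊡ a → Val norm (ℓ ℕ.^ r ℕ.* (M ℕ.* (p ℕ.* i)))
        norm-val i≤k ua e = val-prod {ℓ ℕ.^ r} (λ c → val-prod {M} (λ j → val-prod {p} (λ t →
          conjugate-val (toℕ (combine j (suc t))) (ℓ∤exponent j t) (conjugate≡σ-base c (combine j (suc t))) i≤k ua e)))

        norm-divisible : Divisible base (suc k) → Divisible norm (ℓ ℕ.^ r ℕ.* (M ℕ.* (p ℕ.* suc k)))
        norm-divisible d = divisible-prod {ℓ ℕ.^ r} (λ c → divisible-prod {M} (λ j → divisible-prod {p} (λ t →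
          conjugate-divisible (toℕ (combine j (suc t))) (ℓ∤exponent j t) (conjugate≡σ-base c (combine j (suc t))) d)))

        full : Characters (ℓ ℕ.^ r ℕ.* N) kb
        full = CG.product K (ζGroup b)

        low : Characters (ℓ ℕ.^ r ℕ.* M) kb
        low = CG.product K (ζ^ℓGroup b)

        fullCount lowCount : ℕ
        fullCount = treeCount ((ℓ ℕ.^ r ℕ.* N) ℕ.* nb) (liftedEdges full u v)
        lowCount  = treeCount ((ℓ ℕ.^ r ℕ.* M) ℕ.* nb) (liftedEdges low u v)

        norm-relation : .{{_ : ℕ.NonZero nb}} → fromℕ ℓ ⊡ fromℕ fullCount ≈ fromℕ lowCount ⊡ norm
        norm-relation = level-relation {ℓ ℕ.^ r} {M} {p} K (ζGroup b) (ζ^ℓGroup b) u v cancel-fromℕ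
          (λ i j → CyclicQuotient.low-s R M p X X^N≈1 j (b i))
          (λ i j → CyclicQuotient.low-s̄ R M p X X^N≈1 j (b i))
          (toℕ-injective (≡.trans (toℕ-fromℕ< (ℕ.>-nonZero⁻¹ N))
            (≡.sym (≡.trans (CyclicQuotient.toℕ-low R M p (Characters.trivial (ζ^ℓGroup b)))
              (≡.trans (cong (ℓ ℕ.*_) (toℕ-fromℕ< (ℕ.>-nonZero⁻¹ M))) (ℕ.*-zeroʳ ℓ))))))
          {{ℕ.m^n≢0 ℓ r}}

  val-fromℕ : ∀ {t e} → Ord ℓ t e → Val (fromℕ t) (e ℕ.* φ)
  val-fromℕ {t} {e} o = val-cong (R.sym (fromℕ-con t)) (val-ord {t} {e} o)

  val-ℓ̂ : Val (fromℕ ℓ) φ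
  val-ℓ̂ = val-cong (R.sym (fromℕ-con ℓ)) val-ℓ

-- Comparison of ℓ-adic orders

module OrderComparison (p : ℕ) (ℓ-prime : Prime (suc p)) (k : ℕ) where
  open import Data.Nat.Base as ℕ using (ℕ; zero; suc; _<_; _≤_)
  open Cyclotomic p ℓ-prime k
  open Valuation p ℓ-prime k
  open Norms p ℓ-prime k
  import Data.Nat.Properties as ℕ
  open import Data.Nat.Solver using (module +-*-Solver)
  open import Data.Product.Base using (_×_; _,_; ∃-syntax)
  open import Data.Sum.Base using ([_,_]′)
  open import Relation.Binary.PropositionalEquality as ≡ using (_≡_; refl; cong; subst)
  open import Relation.Nullary.Negation using (contradiction)
  open import Defs using (Ord)
  open ShiftOperators using (Poly; π) renaming (_⊡_ to _⊡ᴾ_)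

  private
    open +-*-Solver using () renaming (solve to ℕ-solve; _:=_ to _⊜_; _:+_ to _⊞_; _:*_ to _⊡_; con to lit)

    φ≢0 : ℕ.NonZero φ
    φ≢0 = ℕ.m*n≢0 M p {{M≢0}} {{ℕ.>-nonZero (ℕ.s≤s⁻¹ 2≤ℓ)}}

    regroup : ∀ e r m p i → e ℕ.* (m ℕ.* p) ℕ.+ r ℕ.* (m ℕ.* (p ℕ.* i)) ≡ (e ℕ.+ r ℕ.* i) ℕ.* (m ℕ.* p)
    regroup = ℕ-solve 5 (λ e r m p i → e ⊡ (m ⊡ p) ⊞ r ⊡ (m ⊡ (p ⊡ i)) ⊜ (e ⊞ r ⊡ i) ⊡ (m ⊡ p)) refl

    collect : ∀ e r i → e ℕ.* φ ℕ.+ r ℕ.* (M ℕ.* (p ℕ.* i)) ≡ (e ℕ.+ r ℕ.* i) ℕ.* φ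
    collect e r i = regroup e r M p i

    cancel-φ : ∀ {a b} → a ℕ.* φ ≡ b ℕ.* φ → a ≡ b
    cancel-φ {a} {b} = ℕ.*-cancelʳ-≡ a b φ {{φ≢0}}

    cancel-φ-≤ : ∀ {a b} → a ℕ.* φ ≤ b ℕ.* φ → a ≤ b
    cancel-φ-≤ {a} {b} = ℕ.*-cancelʳ-≤ a b φ {{φ≢0}}

  -- The exact power of ℓ gained between consecutive levels of the tower is read
  -- off π-adically.
  module _ {T T′ : ℕ} {E : Poly} {e₁ e₀ : ℕ} (relation : fromℕ ℓ ⊡ᴾ fromℕ T ≈ fromℕ T′ ⊡ᴾ E)
           (full-ord : Ord ℓ T e₁) (low-ord : Ord ℓ T′ e₀) where
    private
      lhs : Val (fromℕ T′ ⊡ᴾ E) (suc e₁ ℕ.* φ)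
      lhs = val-cong relation (val-⊡ {fromℕ ℓ} {fromℕ T} val-ℓ̂ (val-fromℕ {T} {e₁} full-ord))

    -- In the application `E` is a product of r φ determinants of valuation i, and ℓ has valuation
    -- φ, so φ divides out. The `suc` comes from the factor ℓ in the level relation.
    gain : ∀ {r i} → Val E (r ℕ.* (M ℕ.* (p ℕ.* i))) → suc e₁ ≡ e₀ ℕ.+ r ℕ.* i
    gain {r} {i} v = cancel-φ (≡.trans (val-unique lhs (val-⊡ (val-fromℕ {T′} {e₀} low-ord) v)) (collect e₀ r i))

    gain-≥ : ∀ {r i} → Divisible E (r ℕ.* (M ℕ.* (p ℕ.* i))) → e₀ ℕ.+ r ℕ.* i ≤ suc e₁
    gain-≥ {r} {i} d = cancel-φ-≤ (subst (_≤ suc e₁ ℕ.* φ) (collect e₀ r i)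
      (divisible-⊡-bounded (val-fromℕ {T′} {e₀} low-ord) d lhs))

  -- The first tower determines the valuation of `f`: if π^(k+1) divided `f`, the order of its tree
  -- number would grow by at least k + 1 > i. So `f` has valuation i, and the same `f` governs the
  -- second tower.
  compare : ∀ {T₀ T₀′ T T′ : ℕ} {E₀ E f : Poly} {e₁ e₀ f₁ f₀ r i : ℕ} →
    fromℕ ℓ ⊡ᴾ fromℕ T₀ ≈ fromℕ T₀′ ⊡ᴾ E₀ → fromℕ ℓ ⊡ᴾ fromℕ T ≈ fromℕ T′ ⊡ᴾ E →
    (∀ {i a} → i < suc k → Unit a → f ≈ π ^ i ⊡ᴾ a → Val E₀ (1 ℕ.* (M ℕ.* (p ℕ.* i)))) →
    (Divisible f (suc k) → Divisible E₀ (1 ℕ.* (M ℕ.* (p ℕ.* suc k)))) →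
    (∀ {i a} → i < suc k → Unit a → f ≈ π ^ i ⊡ᴾ a → Val E (r ℕ.* (M ℕ.* (p ℕ.* i)))) →
    Ord ℓ T₀ e₁ → Ord ℓ T₀′ e₀ → Ord ℓ T f₁ → Ord ℓ T′ f₀ →
    suc e₁ ≡ e₀ ℕ.+ i → i < suc k → suc f₁ ≡ f₀ ℕ.+ r ℕ.* i
  compare {T₀} {T₀′} {T} {T′} {E₀} {E} {f} {e₁} {e₀} {f₁} {f₀} {r} {i} rel₀ rel val₀ div₀ valᴱ o₁ o₀ p₁ p₀ eq i≤k =
    [ exact , excluded ]′ (valuation-or-divisible (suc k) f)
    where
    Exact : Set
    Exact = ∃[ i ] ∃[ a ] (i < suc k × Unit a × f ≈ π ^ i ⊡ᴾ a)
    excluded : Divisible f (suc k) → suc f₁ ≡ f₀ ℕ.+ r ℕ.* i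
    excluded d = contradiction i≤k (ℕ.≤⇒≯ (ℕ.+-cancelˡ-≤ e₀ (suc k) i
      (subst (e₀ ℕ.+ suc k ≤_) eq (subst (λ x → e₀ ℕ.+ x ≤ suc e₁) (ℕ.*-identityˡ (suc k))
        (gain-≥ {T₀} {T₀′} {E₀} {e₁} {e₀} rel₀ o₁ o₀ {1} {suc k} (div₀ d))))))
    exact : Exact → suc f₁ ≡ f₀ ℕ.+ r ℕ.* i
    exact (i′ , a , i′≤k , ua , e) = subst (λ i → suc f₁ ≡ f₀ ℕ.+ r ℕ.* i) i′≡i
      (gain {T} {T′} {E} {f₁} {f₀} rel p₁ p₀ {r} {i′} (valᴱ i′≤k ua e))
      where
      i′≡i : i′ ≡ i
      i′≡i = ℕ.+-cancelˡ-≡ e₀ i′ i (≡.trans (cong (e₀ ℕ.+_) (≡.sym (ℕ.*-identityˡ i′)))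
        (≡.trans (≡.sym (gain {T₀} {T₀′} {E₀} {e₁} {e₀} rel₀ o₁ o₀ {1} {i′} (val₀ i′≤k ua e))) eq))

module NormComparison (p : ℕ) (ℓ-prime : Prime (suc p)) (k : ℕ) where
  open import Data.Nat.Base as ℕ using (ℕ; zero; suc; _<_)
  open Cyclotomic p ℓ-prime k
  open Norms p ℓ-prime k
  open OrderComparison p ℓ-prime k
  open import Data.Fin.Base using (Fin)
  open import Relation.Binary.PropositionalEquality using (_≡_)
  open import Defs using (Ord)

  module _ {kb nb : ℕ} .{{_ : ℕ.NonZero nb}} (u v : Fin kb → Fin nb) (b : Fin kb → ℕ) where
    -- Rank 0 over the same base graph describes the tower at level n; this is why both norms are
    -- built from the single determinant `base u v b`.
    comparison : ∀ {r e₁ e₀ f₁ f₀ i} (κ₀ : Fin kb → Fin 0 → ℕ) (κ : Fin kb → Fin r → ℕ) →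
      Ord ℓ (fullCount u v b κ₀) e₁ → Ord ℓ (lowCount u v b κ₀) e₀ →
      Ord ℓ (fullCount u v b κ) f₁ → Ord ℓ (lowCount u v b κ) f₀ →
      suc e₁ ≡ e₀ ℕ.+ i → i < suc k → suc f₁ ≡ f₀ ℕ.+ ℓ ℕ.^ r ℕ.* i
    comparison {r} {e₁} {e₀} {f₁} {f₀} {i} κ₀ κ o₁ o₀ p₁ p₀ =
      compare {fullCount u v b κ₀} {lowCount u v b κ₀} {fullCount u v b κ} {lowCount u v b κ}
        {norm u v b κ₀} {norm u v b κ} {base u v b} {e₁} {e₀} {f₁} {f₀} {ℓ ℕ.^ r} {i}
        (norm-relation u v b κ₀) (norm-relation u v b κ)
        (norm-val u v b κ₀) (norm-divisible u v b κ₀) (norm-val u v b κ) o₁ o₀ p₁ p₀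

-- Cyclic shifts and elementary abelian groups

module Shift where
  open import Data.Fin.Base using (Fin; toℕ; fromℕ<)
  open import Data.Nat.Base as ℕ using (ℕ)
  open import Data.Nat.DivMod using (m%n<n)

  -- The formula of `shiftMod` freed from the ring of character values, so that enumerations of
  -- groups can refer to it; the two agree definitionally.
  shift : ∀ n .{{_ : ℕ.NonZero n}} → ℕ → Fin n → Fin n
  shift n b a = fromℕ< (m%n<n (toℕ a ℕ.+ b) n)

module ElementaryAbelian (p : ℕ) (ℓ-prime : Prime (suc p)) where
  open import Data.Nat.Base as ℕ using (ℕ; zero; suc; _<_; _≤_)
  open import Data.Fin.Base using (Fin; zero; suc; toℕ; combine; quotient; remainder)
  open import Data.Fin.Properties using (toℕ-fromℕ<; toℕ-injective; toℕ<n; combine-remQuot; remQuot-combine; all?; any?; ¬∀⟶∃¬; injective⇒≤)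
  import Data.Fin.Properties as Fin
  import Data.Fin.Permutation as Permutation
  import Data.Nat.Properties as ℕ
  import Data.Nat.Divisibility as ℕ
  open import Data.Nat.DivMod using (_%_; _/_; m%n<n; m≡m%n+[m/n]*n)
  open import Data.Empty using (⊥)
  open import Data.Product.Base using (_×_; _,_; proj₁; proj₂)
  open import Data.Vec.Functional using (_∷_)
  open import Function.Base using (_∘_)
  open import Function.Bundles using (Inverse)
  open import Function.Construct.Composition using (inverse)
  import Function.Construct.Symmetry as Symmetry
  open ModInverse using (mod-inverse)
  open Shift
  open import Relation.Binary.Definitions using (tri<; tri≈; tri>)
  open import Relation.Binary.PropositionalEquality as ≡ using (_≡_; refl; cong)
  open import Relation.Nullary.Decidable using (Dec; yes; no; map′)
  open import Relation.Nullary.Negation using (¬_; contradiction)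

  private
    ℓ : ℕ
    ℓ = suc p

  shiftAll : ∀ r → (Fin r → ℕ) → Fin (ℓ ℕ.^ r) → Fin (ℓ ℕ.^ r)
  shiftAll zero    κ a = a
  shiftAll (suc r) κ a = combine (shift ℓ (κ zero) (quotient {ℓ} (ℓ ℕ.^ r) a)) (shiftAll r (κ ∘ suc) (remainder {ℓ} (ℓ ℕ.^ r) a))

  digits : ∀ r → Fin (ℓ ℕ.^ r) → Fin r → ℕ
  digits (suc r) a zero    = toℕ (quotient {ℓ} (ℓ ℕ.^ r) a)
  digits (suc r) a (suc i) = digits r (remainder {ℓ} (ℓ ℕ.^ r) a) i

  module _ (A : AbelianGroup 0ℓ 0ℓ) where
    open AbelianGroup A hiding (inverse) renaming (refl to ≈-refl)
    open import Algebra.Properties.Monoid.Mult monoid using (×-homo-+; ×-assocˡ) renaming (_×_ to _⋆_)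
    open import Algebra.Properties.AbelianGroup A using (∙-cancelˡ)
    open import Algebra.Properties.CommutativeSemigroup commutativeSemigroup using (interchange)
    open import Relation.Binary.Reasoning.Setoid setoid

    module _ (torsion : ∀ x → ℓ ⋆ x ≈ ε) where
      private
        multiple : ∀ k x → (k ℕ.* ℓ) ⋆ x ≈ ε
        multiple zero    x = ≈-refl
        multiple (suc k) x = trans (×-homo-+ x ℓ (k ℕ.* ℓ)) (trans (∙-cong (torsion x) (multiple k x)) (identityˡ ε))

        mod-⋆ : ∀ a x → (a % ℓ) ⋆ x ≈ a ⋆ x
        mod-⋆ a x = sym (trans (reflexive (cong (_⋆ x) (m≡m%n+[m/n]*n a ℓ))) (trans (×-homo-+ x (a % ℓ) (a / ℓ ℕ.* ℓ))
          (trans (∙-congˡ (multiple (a / ℓ) x)) (identityʳ _))))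

      lin : ∀ {r} → (Fin r → Carrier) → (Fin r → ℕ) → Carrier
      lin {zero}  g κ = ε
      lin {suc r} g κ = κ zero ⋆ g zero ∙ lin (g ∘ suc) (κ ∘ suc)

      element : ∀ {r} → (Fin r → Carrier) → Fin (ℓ ℕ.^ r) → Carrier
      element {r} g a = lin g (digits r a)

      private
        quot-combine : ∀ r (x : Fin ℓ) (y : Fin (ℓ ℕ.^ r)) → quotient {ℓ} (ℓ ℕ.^ r) (combine x y) ≡ x
        quot-combine r x y = cong proj₁ (remQuot-combine x y)

        rem-combine : ∀ r (x : Fin ℓ) (y : Fin (ℓ ℕ.^ r)) → remainder {ℓ} (ℓ ℕ.^ r) (combine x y) ≡ y
        rem-combine r x y = cong proj₂ (remQuot-combine x y)

      element-combine : ∀ {r} (g : Fin (suc r) → Carrier) x y →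
        element g (combine x y) ≈ toℕ x ⋆ g zero ∙ element (g ∘ suc) y
      element-combine {r} g x y = ∙-cong (reflexive (cong (λ z → toℕ z ⋆ g zero) (quot-combine r x y)))
        (reflexive (cong (element (g ∘ suc)) (rem-combine r x y)))

      element-shiftAll : ∀ {r} (g : Fin r → Carrier) κ a → element g (shiftAll r κ a) ≈ element g a ∙ lin g κ
      element-shiftAll {zero}  g κ a = sym (identityˡ ε)
      element-shiftAll {suc r} g κ a = begin
        element g (combine (shift ℓ (κ zero) q) (shiftAll r (κ ∘ suc) s))
          ≈⟨ element-combine g (shift ℓ (κ zero) q) (shiftAll r (κ ∘ suc) s) ⟩
        toℕ (shift ℓ (κ zero) q) ⋆ g zero ∙ element (g ∘ suc) (shiftAll r (κ ∘ suc) s)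
          ≈⟨ ∙-cong (trans (reflexive (cong (_⋆ g zero) (toℕ-fromℕ< (m%n<n (toℕ q ℕ.+ κ zero) ℓ))))
               (trans (mod-⋆ (toℕ q ℕ.+ κ zero) (g zero)) (×-homo-+ (g zero) (toℕ q) (κ zero)))) (element-shiftAll (g ∘ suc) (κ ∘ suc) s) ⟩
        (toℕ q ⋆ g zero ∙ κ zero ⋆ g zero) ∙ (element (g ∘ suc) s ∙ lin (g ∘ suc) (κ ∘ suc))
          ≈⟨ interchange _ _ _ _ ⟩
        element g a ∙ lin g κ ∎
        where
        q = quotient {ℓ} (ℓ ℕ.^ r) a
        s = remainder {ℓ} (ℓ ℕ.^ r) a

      private
        record Spanned {r} (g : Fin r → Carrier) (x : Carrier) : Set where
          constructor spanned
          field
            index : Fin (ℓ ℕ.^ r)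
            element≈ : element g index ≈ x

        spanned-≈ : ∀ {r} {g : Fin r → Carrier} {x y} → x ≈ y → Spanned g x → Spanned g y
        spanned-≈ q (spanned a p) = spanned a (trans p q)

        spanned-∙ : ∀ {r} {g : Fin r → Carrier} {x y} → Spanned g x → Spanned g y → Spanned g (x ∙ y)
        spanned-∙ {r} {g} (spanned a p) (spanned b q) = spanned (shiftAll r (digits r b) a)
          (trans (element-shiftAll g (digits r b) a) (∙-cong p q))

        spanned-suc-⋆ : ∀ {r} {g : Fin r → Carrier} {x} n → Spanned g x → Spanned g (suc n ⋆ x)
        spanned-suc-⋆ zero    s = spanned-≈ (sym (identityʳ _)) s
        spanned-suc-⋆ (suc n) s = spanned-∙ s (spanned-suc-⋆ n s)

        spanned-⋆ : ∀ {r} {g : Fin r → Carrier} {x} n → Spanned g x → Spanned g (n ⋆ x)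
        -- The identity is reached as ℓ ⋆ x, by torsion.
        spanned-⋆ zero    s = spanned-≈ (torsion _) (spanned-suc-⋆ p s)
        spanned-⋆ (suc n) s = spanned-suc-⋆ n s

        Independent : ∀ {r} → (Fin r → Carrier) → Set
        Independent g = ∀ a b → element g a ≈ element g b → a ≡ b

        extend-independent : ∀ {r} {g : Fin r → Carrier} {x} → Independent g → ¬ Spanned g x → Independent (x ∷ g)
        extend-independent {r} {g} {x} ind ¬s a b eq = ≡.trans (≡.sym (combine-remQuot {ℓ} (ℓ ℕ.^ r) a))
          (≡.trans (cases (ℕ.<-cmp (toℕ qa) (toℕ qb))) (combine-remQuot {ℓ} (ℓ ℕ.^ r) b))
          where
          qa = quotient {ℓ} (ℓ ℕ.^ r) a
          qb = quotient {ℓ} (ℓ ℕ.^ r) b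
          ra = remainder {ℓ} (ℓ ℕ.^ r) a
          rb = remainder {ℓ} (ℓ ℕ.^ r) b
          -- If j < j′ and j x + e = j′ x + e′, then x is a multiple of e − e′.
          clash : ∀ j j′ e e′ → j < j′ → j′ < ℓ → j ⋆ x ∙ element g e ≈ j′ ⋆ x ∙ element g e′ → ⊥
          clash j j′ e e′ j<j′ j′<ℓ q with ℕ.m≤n⇒∃[o]m+o≡n j<j′
          ... | d , refl = ¬s (spanned-≈ c-d-x (spanned-⋆ c spanned-dx))
            where
            dx : element g e ≈ suc d ⋆ x ∙ element g e′
            dx = ∙-cancelˡ (j ⋆ x) _ _ (trans q (trans (∙-congʳ (trans (reflexive (cong (_⋆ x) (≡.sym (ℕ.+-suc j d))))
                  (×-homo-+ x j (suc d)))) (assoc _ _ _)))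
            spanned-dx : Spanned g (suc d ⋆ x)
            -- p ⋆ e′ plays the role of -e′, again by torsion.
            spanned-dx = spanned-≈ (trans (∙-congʳ dx) (trans (assoc _ _ _) (trans (∙-congˡ (torsion (element g e′))) (identityʳ _))))
              (spanned-∙ (spanned e ≈-refl) (spanned-⋆ p (spanned e′ ≈-refl)))
            ℓ∤d : ¬ (ℓ ℕ.∣ suc d)
            ℓ∤d div = ℕ.<⇒≱ (ℕ.≤-<-trans (ℕ.≤-trans (ℕ.m≤n+m (suc d) j) (ℕ.≤-reflexive (ℕ.+-suc j d))) j′<ℓ) (ℕ.∣⇒≤ div)
            c u : ℕ
            c = proj₁ (mod-inverse ℓ-prime ℓ∤d)
            u = proj₁ (proj₂ (mod-inverse ℓ-prime ℓ∤d))
            c-d-x : c ⋆ (suc d ⋆ x) ≈ x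
            c-d-x = begin
              c ⋆ (suc d ⋆ x)       ≈⟨ ×-assocˡ x c (suc d) ⟩
              (c ℕ.* suc d) ⋆ x     ≡⟨ cong (_⋆ x) (≡.trans (ℕ.*-comm c (suc d))
                    (≡.trans (proj₂ (proj₂ (mod-inverse ℓ-prime ℓ∤d))) (cong suc (ℕ.*-comm ℓ u)))) ⟩
              x ∙ (u ℕ.* ℓ) ⋆ x     ≈⟨ trans (∙-congˡ (multiple u x)) (identityʳ x) ⟩
              x                     ∎
          cases : _ → combine qa ra ≡ combine qb rb
          cases (tri< lt _ _) = contradiction eq (clash (toℕ qa) (toℕ qb) ra rb lt (toℕ<n qb))
          cases (tri> _ _ gt) = contradiction (sym eq) (clash (toℕ qb) (toℕ qa) rb ra gt (toℕ<n qa))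
          cases (tri≈ _ eq′ _) = ≡.cong₂ combine (toℕ-injective eq′)
            (ind ra rb (∙-cancelˡ (toℕ qa ⋆ x) _ _ (trans eq (∙-congʳ (reflexive (cong (_⋆ x) (≡.sym eq′)))))))

      record Basis : Set where
        field
          rank        : ℕ
          generators  : Fin rank → Carrier
          coordinates : Inverse setoid (≡.setoid (Fin (ℓ ℕ.^ rank)))
          from-element : ∀ a → Inverse.from coordinates a ≡ element generators a

        displacement : Carrier → Fin rank → ℕ
        displacement x = digits rank (Inverse.to coordinates x)

        translate : ∀ a x → Inverse.to coordinates (Inverse.from coordinates a ∙ x) ≡ shiftAll rank (displacement x) a
        translate a x = C.inverseˡ (begin
          C.from a ∙ x
            ≈⟨ ∙-cong (reflexive (from-element a)) (trans (sym (C.inverseʳ refl)) (reflexive (from-element (C.to x)))) ⟩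
          element generators a ∙ element generators (C.to x)
            ≈⟨ element-shiftAll generators (displacement x) a ⟨
          element generators (shiftAll rank (displacement x) a)
            ≡⟨ from-element _ ⟨
          C.from (shiftAll rank (displacement x) a) ∎)
          where module C = Inverse coordinates

      module _ {n : ℕ} (size : Inverse setoid (≡.setoid (Fin n))) where
        private
          module size = Inverse size

          _≟_ : ∀ x y → Dec (x ≈ y)
          x ≟ y = map′ (λ q → trans (sym (size.inverseʳ refl)) (size.inverseʳ q)) size.to-cong (size.to x Fin.≟ size.to y)

          spanned? : ∀ {r} (g : Fin r → Carrier) x → Dec (Spanned g x)
          spanned? g x = map′ (λ (a , q) → spanned a q) (λ (spanned a q) → a , q) (any? (λ a → element g a ≟ x))

          r<ℓ^r : ∀ r → r < ℓ ℕ.^ r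
          r<ℓ^r zero    = ℕ.≤-refl
          r<ℓ^r (suc r) = ℕ.≤-trans (ℕ.s≤s (r<ℓ^r r)) (ℕ.≤-trans (ℕ.+-monoˡ-≤ (ℓ ℕ.^ r) (ℕ.≤-trans (ℕ.s≤s ℕ.z≤n) (r<ℓ^r r)))
            (ℕ.≤-trans (ℕ.≤-reflexive (cong (ℓ ℕ.^ r ℕ.+_) (≡.sym (ℕ.+-identityʳ _)))) (ℕ.*-monoˡ-≤ (ℓ ℕ.^ r) 2≤ℓ)))
            where
            open import Data.Nat.Primality using (prime⇒nonTrivial)
            2≤ℓ : 2 ≤ ℓ
            2≤ℓ = ℕ.nonTrivial⇒n>1 ℓ {{prime⇒nonTrivial ℓ-prime}}

          rank-bound : ∀ {r} (g : Fin r → Carrier) → Independent g → r ≤ n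
          rank-bound {r} g ind = ℕ.≤-trans (ℕ.<⇒≤ (r<ℓ^r r)) (injective⇒≤ {f = size.to ∘ element g}
            (λ {a} {b} q → ind a b (trans (sym (size.inverseʳ refl)) (size.inverseʳ q))))

          finish : ∀ {r} (g : Fin r → Carrier) → Independent g → (∀ k → Spanned g (size.from k)) → Basis
          finish {r} g ind sp = record
            { rank = r
            ; generators = g
            ; coordinates = record
                { to = coordinate
                ; from = element g
                ; to-cong = λ {x} {y} q → ind _ _ (trans (element-coordinate x) (trans q (sym (element-coordinate y))))
                ; from-cong = λ { refl → ≈-refl }
                ; inverse = (λ {a} {x} q → ind _ _ (trans (element-coordinate x) q))
                          , (λ { {x} refl → element-coordinate x }) }
            ; from-element = λ _ → refl }
            where
            coordinate : Carrier → Fin (ℓ ℕ.^ r)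
            coordinate x = Spanned.index (sp (size.to x))
            element-coordinate : ∀ x → element g (coordinate x) ≈ x
            element-coordinate x = trans (Spanned.element≈ (sp (size.to x))) (size.inverseʳ refl)

          -- Generators outside the span are added greedily. An independent family of size r has ℓ^r
          -- > r distinct combinations, so r is at most the order n of the group, and the fuel
          -- cannot run out.
          grow : ∀ fuel {r} (g : Fin r → Carrier) → Independent g → n < fuel ℕ.+ r → Basis
          grow zero    g ind lt = contradiction (rank-bound g ind) (ℕ.<⇒≱ lt)
          grow (suc fuel) {r} g ind lt with all? (λ k → spanned? g (size.from k))
          ... | yes sp = finish g ind sp
          ... | no ¬sp = let (k , ¬s) = ¬∀⟶∃¬ n _ (λ k → spanned? g (size.from k)) ¬sp in
            grow fuel (size.from k ∷ g) (extend-independent ind ¬s) (ℕ.≤-trans lt (ℕ.≤-reflexive (≡.sym (ℕ.+-suc fuel r))))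

        basis : Basis
        basis = grow (suc n) {0} (λ ()) (λ { zero zero _ → refl }) (ℕ.≤-reflexive (≡.sym (ℕ.+-identityʳ (suc n))))

        basis-size : ℓ ℕ.^ Basis.rank basis ≡ n
        basis-size = Permutation.↔⇒≡ (inverse (Symmetry.inverse (Basis.coordinates basis)) size)

-- Derived graphs as lifts of a base graph

module DerivedGraphs {X : Graph} (S : Orientation X) where
  open import Defs hiding (quotient)
  open Contraction using (treeCount)
  open import Data.Fin.Base using (Fin; zero; suc; combine; remQuot; quotient; remainder)
  open import Data.Fin.Properties using (remQuot-combine; combine-remQuot)
  open import Data.Empty using (⊥-elim)
  open import Data.Product.Base using (_×_; _,_; proj₁; proj₂; ∃-syntax)
  open import Data.Sum.Base using (_⊎_; inj₁; inj₂)
  open import Data.Vec.Base using (tabulate)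
  import Data.Vec.Properties as Vec
  open import Function.Bundles using (Inverse; _⟨$⟩_; Func)
  open import Relation.Binary.PropositionalEquality as ≡ using (_≡_; refl; cong; cong₂)
  import Algebra.Properties.Group as GroupProperties
  open SpanningTreeCount using (spanningTrees-size; HasSize-unique)

  open Graph X
  open Orientation S

  module _ (G : Group 0ℓ 0ℓ) (α : Voltage S G) where
    private module G = Group G

    extend-s : ∀ i → (extend S G α ⟨$⟩ s i) G.≈ α i
    extend-s i with covers (s i)
    ... | j , inj₁ p = G.reflexive (cong α (≡.sym (distinct i j p)))
    ... | j , inj₂ p = ⊥-elim (disjoint i j p)

    module _ {m : ℕ} (index : Fin m → Fin size) (elt : Fin m → G.Carrier) (code : Fin size → G.Carrier → Fin m)
             (code-cong : ∀ i {g h} → g G.≈ h → code i g ≡ code i h)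
             (index-code : ∀ i g → index (code i g) ≡ i) (elt-code : ∀ i g → elt (code i g) G.≈ g)
             (code-index : ∀ e → code (index e) (elt e) ≡ e) where
      private
        Y = derived S G α
        module Y = Graph Y

        edge : Fin m → Y.E.Carrier
        edge e = s (index e) , elt e

        at : ∀ i g → edge (code i g) Y.≈ᴱ (s i , g)
        at i g = E.reflexive (cong s (index-code i g)) , elt-code i g

        cov : ∀ x → ∃[ e ] (x Y.≈ᴱ edge e ⊎ x Y.≈ᴱ (Y.inv ⟨$⟩ edge e))
        cov (x , g) with covers x
        ... | i , inj₁ p = code i g , inj₁ (Y.E.trans {x , g} {s i , g} {edge (code i g)} (p , G.refl)
              (Y.E.sym {edge (code i g)} {s i , g} (at i g)))
        ... | i , inj₂ p = code i h , inj₂ (Y.E.trans {x , g} {Y.inv ⟨$⟩ (s i , h)} {Y.inv ⟨$⟩ edge (code i h)}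
                (p , G.sym (//-rightDividesˡ _ g))
                (Func.cong Y.inv {s i , h} {edge (code i h)} (Y.E.sym {edge (code i h)} {s i , h} (at i h))))
          where
          open GroupProperties G using (//-rightDividesˡ)
          h : G.Carrier
          -- The edge over the reverse of `s i` starting at g is the reverse of the edge over `s i`
          -- starting at g α(s i)⁻¹.
          h = g G.∙ (extend S G α ⟨$⟩ s i) G.⁻¹

      derivedOrientation : Orientation Y
      derivedOrientation = record
        { size = m
        ; s = edge
        ; distinct = λ e f (p , r) → ≡.trans (≡.sym (code-index e)) (≡.trans
            (≡.trans (cong (λ i → code i (elt e)) (distinct _ _ p)) (code-cong (index f) r)) (code-index f))
        ; disjoint = λ e f (p , _) → disjoint _ _ p
        ; covers = cov
        }

  -- Counting the spanning trees of X(G, S, γ) through an enumeration of G by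
  -- pairs: a point of a base, and a fibre coordinate.
  module _ (G : Group 0ℓ 0ℓ) (γ : Voltage S G) {nX cn q : ℕ}
    (encX : Inverse V (≡.setoid (Fin nX)))
    (encG : Inverse (Group.setoid G) (≡.setoid (Fin cn × Fin q)))
    (next : Fin size → Fin cn → Fin cn)
    (act : Fin size → Fin cn → Fin q → Fin q)
    (step : ∀ i c x → Inverse.to encG (Group._∙_ G (Inverse.from encG (c , x)) (γ i)) ≡ (next i c , act i c x))
    where
    private
      module G = Group G
      module encX = Inverse encX
      module encG = Inverse encG
      nb kb : ℕ
      nb = nX ℕ.* cn
      kb = size ℕ.* cn

    baseSource baseTarget : Fin kb → Fin nb
    baseSource e = combine (encX.to (o ⟨$⟩ s (quotient cn e))) (remainder {size} cn e)
    baseTarget e = combine (encX.to (t ⟨$⟩ s (quotient cn e))) (next (quotient cn e) (remainder {size} cn e))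

    baseAct : Fin kb → Fin q → Fin q
    baseAct e = act (quotient cn e) (remainder {size} cn e)

    private
      Y = derived S G γ
      module Y = Graph Y

      -- The edges of Y are enumerated by ((s , c) , x), its vertices by (x , (v , c)).
      encV : Inverse Y.V (≡.setoid (Fin (q ℕ.* nb)))
      encV = record
        { to = flat
        ; from = unflat
        ; to-cong = λ (p , r) → cong₂ (λ v (c , x) → combine x (combine v c)) (encX.to-cong p) (encG.to-cong r)
        ; from-cong = λ { refl → Y.V.refl }
        ; inverse = (λ {i} (p , r) → ≡.trans (cong₂ (λ v (c , x) → combine x (combine v c)) (≡.trans (encX.to-cong p) (encX.inverseˡ V.refl))
                        (≡.trans (encG.to-cong r) (encG.inverseˡ G.refl)))
                              (≡.trans (cong (combine {q} (quotient nb i)) (combine-remQuot {nX} cn (remainder {q} nb i)))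
                              (combine-remQuot {q} nb i)))
                  , (λ { {v , g} refl → Y.V.trans {unflat (flat (v , g))} {encX.from (encX.to v) , encG.from (encG.to g)} {v , g}
                        (≡⇒≈ (retract (encX.to v) (encG.to g))) (encX.inverseʳ refl , encG.inverseʳ refl) }) }
        where
        flat : Y.V.Carrier → Fin (q ℕ.* nb)
        flat (v , g) = let (c , x) = encG.to g in combine x (combine (encX.to v) c)
        unflat : Fin (q ℕ.* nb) → Y.V.Carrier
        unflat i = encX.from (quotient cn (remainder {q} nb i)) , encG.from (remainder {nX} cn (remainder {q} nb i) , quotient nb i)
        ≡⇒≈ : ∀ {x y : Y.V.Carrier} → x ≡ y → x Y.≈ⱽ y
        ≡⇒≈ refl = Y.V.refl
        retract : ∀ v y → unflat (combine (proj₂ y) (combine v (proj₁ y))) ≡ (encX.from v , encG.from y)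
        retract v (c , x) = ≡.trans
          (cong (λ z → encX.from (quotient cn (proj₂ z)) , encG.from (remainder {nX} cn (proj₂ z) , proj₁ z))
                (remQuot-combine x (combine v c)))
          (cong (λ z → encX.from (proj₁ z) , encG.from (proj₂ z , x)) (remQuot-combine v c))

      code : Fin size → G.Carrier → Fin (kb ℕ.* q)
      code i g = let (c , x) = encG.to g in combine (combine i c) x

      index : Fin (kb ℕ.* q) → Fin size
      index e = quotient cn (quotient q e)

      elt : Fin (kb ℕ.* q) → G.Carrier
      elt e = encG.from (remainder {size} cn (quotient q e) , remainder {kb} q e)

      unpack : ∀ {A : Set} (f : Fin size → Fin cn → Fin q → A) i c x →
        f (quotient cn (quotient q (combine (combine i c) x))) (remainder {size} cn (quotient q (combine (combine i c) x)))
              (remainder {kb} q (combine (combine i c) x))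
          ≡ f i c x
      unpack f i c x = ≡.trans
        (cong (λ z → f (quotient cn (proj₁ z)) (remainder {size} cn (proj₁ z)) (proj₂ z)) (remQuot-combine (combine i c) x))
        (cong (λ z → f (proj₁ z) (proj₂ z) x) (remQuot-combine i c))

      orientation : Orientation Y
      orientation = derivedOrientation G γ index elt code
        (λ i p → cong (λ (c , x) → combine (combine i c) x) (encG.to-cong p))
        (λ i g → unpack (λ i _ _ → i) i (proj₁ (encG.to g)) (proj₂ (encG.to g)))
        (λ i g → G.trans (G.reflexive (unpack (λ _ c x → encG.from (c , x)) i (proj₁ (encG.to g)) (proj₂ (encG.to g))))
              (encG.inverseʳ refl))
        (λ e → ≡.trans (cong (λ (c , x) → combine (combine (index e) c) x) (encG.inverseˡ G.refl))
          (≡.trans (cong (λ z → combine z (remainder {kb} q e)) (combine-remQuot {size} cn (quotient q e))) (combine-remQuot {kb} q e)))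

      liftedTable : Fin (kb ℕ.* q) → Fin (q ℕ.* nb) × Fin (q ℕ.* nb)
      liftedTable e = let (i , x) = remQuot {kb} q e in combine x (baseSource i) , combine (baseAct i x) (baseTarget i)

      source-table : ∀ e → Inverse.to encV (Y.o ⟨$⟩ Orientation.s orientation e) ≡ proj₁ (liftedTable e)
      source-table e = cong (λ (c , x) → combine x (combine (encX.to (o ⟨$⟩ s (index e))) c)) (encG.inverseˡ G.refl)

      target-table : ∀ e → Inverse.to encV (Y.t ⟨$⟩ Orientation.s orientation e) ≡ proj₂ (liftedTable e)
      target-table e = cong (λ (c , x) → combine x (combine (encX.to (t ⟨$⟩ s (index e))) c))
        (≡.trans (encG.to-cong (G.∙-congˡ {elt e} (extend-s G γ (index e)))) (step (index e) _ _))

      derived-treeCount : ∀ {κ} → HasSize (SpanningTrees Y) κ → treeCount (q ℕ.* nb) (tabulate liftedTable) ≡ κ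
      derived-treeCount size = ≡.trans (cong (treeCount (q ℕ.* nb))
          (Vec.tabulate-cong (λ e → cong₂ _,_ (≡.sym (source-table e)) (≡.sym (target-table e)))))
        (HasSize-unique Y orientation (spanningTrees-size Y orientation encV) size)

    module _ (R : CommutativeRing 0ℓ 0ℓ) (C : LiftedLaplacians.Characters R q kb)
             (act≡baseAct : ∀ i x → LiftedLaplacians.Characters.act C i x ≡ baseAct i x) where
      lifted-treeCount : ∀ {κ} → HasSize (SpanningTrees Y) κ →
        treeCount (q ℕ.* nb) (LiftedLaplacians.liftedEdges R C baseSource baseTarget) ≡ κ
      lifted-treeCount size = ≡.trans (cong (treeCount (q ℕ.* nb)) (Vec.tabulate-cong (λ e →
          cong (λ z → combine (remainder {kb} q e) (baseSource (quotient q e)) , combine z (baseTarget (quotient q e)))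
            (act≡baseAct (quotient q e) (remainder {kb} q e)))))
        (derived-treeCount size)

-- Central extensions with elementary abelian kernel

module CentralExtension (p : ℕ) (ℓ-prime : Prime (suc p)) (G : Group 0ℓ 0ℓ) (L L′ : NormalSubgroup G)
  (L′⊆L : ∀ {x} → NormalSubgroup.mem L′ x → NormalSubgroup.mem L x)
  (central : ∀ {h} g → NormalSubgroup.mem L h → NormalSubgroup.mem L′ (⁅_,_⁆ G h g))
  (powers : ∀ {h} → NormalSubgroup.mem L h → NormalSubgroup.mem L′ (Algebra.Definitions.RawMonoid._×_ (Group.rawMonoid G) (suc p) h))
  where
  open import Defs
  open NormalSubgroup
  import Algebra.Definitions.RawMonoid as RawMonoidDefs
  open ElementaryAbelian p ℓ-prime
  open import Data.Fin.Base using (Fin; zero)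
  open import Data.Product.Base using (Σ; _×_; _,_; proj₁; proj₂)
  open import Function.Bundles using (Inverse)
  open import Relation.Binary.PropositionalEquality as ≡ using (_≡_; refl; cong)
  import Algebra.Properties.Group as GroupProperties

  private
    module G = Group G
    module P = Group (quotient G L)
    module Q = Group (quotient G L′)
    open GroupProperties G using (⁻¹-anti-homo-∙)

    lift : ∀ (N : NormalSubgroup G) {x y} → x G.≈ y → Group._≈_ (quotient G N) x y
    lift N {x} q = mem-≈ N (G.trans (G.sym (G.inverseˡ x)) (G.∙-congˡ q)) (mem-ε N)

    commute : ∀ {h} g → mem L h → (g G.∙ h) Q.≈ (h G.∙ g)
    commute g h∈ = mem-≈ L′ (G.∙-congʳ (G.sym (⁻¹-anti-homo-∙ g _))) (central g h∈)

    absorb : ∀ {h} g → mem L h → (g G.∙ h) P.≈ g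
    absorb {h} g h∈ = P.trans {g G.∙ h} {g G.∙ G.ε} {g} (P.∙-congˡ {g} {h} {G.ε}
      (mem-≈ L (G.sym (G.identityʳ (h G.⁻¹))) (mem-⁻¹ L h∈))) (lift L (G.identityʳ g))

  -- L/L′ as a group of its own: elements of L under the equality of G/L′. Centrality makes it
  -- commutative.
  factorGroup : AbelianGroup 0ℓ 0ℓ
  factorGroup = record
    { Carrier = Σ G.Carrier (mem L)
    ; _≈_ = λ x y → proj₁ x Q.≈ proj₁ y
    ; _∙_ = λ (x , x∈) (y , y∈) → x G.∙ y , mem-∙ L x∈ y∈
    ; ε = G.ε , mem-ε L
    ; _⁻¹ = λ (x , x∈) → x G.⁻¹ , mem-⁻¹ L x∈
    ; isAbelianGroup = record
      { isGroup = record
        { isMonoid = record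
          { isSemigroup = record
            { isMagma = record
              { isEquivalence = record
                { refl = λ {x} → Q.refl {proj₁ x}
                ; sym = λ {x} {y} → Q.sym {proj₁ x} {proj₁ y}
                ; trans = λ {x} {y} {z} → Q.trans {proj₁ x} {proj₁ y} {proj₁ z} }
              ; ∙-cong = λ {x} {y} {u} {v} → Q.∙-cong {proj₁ x} {proj₁ y} {proj₁ u} {proj₁ v} }
            ; assoc = λ x y z → Q.assoc (proj₁ x) (proj₁ y) (proj₁ z) }
          ; identity = (λ x → Q.identityˡ (proj₁ x)) , (λ x → Q.identityʳ (proj₁ x)) }
        ; inverse = (λ x → Q.inverseˡ (proj₁ x)) , (λ x → Q.inverseʳ (proj₁ x))
        ; ⁻¹-cong = λ {x} {y} → Q.⁻¹-cong {proj₁ x} {proj₁ y} }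
      ; comm = λ (x , x∈) (y , y∈) → commute x y∈ } }

  private
    module K = AbelianGroup factorGroup
    open import Algebra.Properties.Monoid.Mult K.monoid using () renaming (_×_ to _⋆_)

  torsion : ∀ x → suc p ⋆ x K.≈ K.ε
  torsion x = Q.sym {G.ε} {proj₁ (suc p ⋆ x)} (mem-≈ L′ (G.trans (G.reflexive (≡.sym (pow-⋆ (suc p)))) ε⁻¹∙) (powers (proj₂ x)))
    where
    open RawMonoidDefs G.rawMonoid using () renaming (_×_ to pow)
    pow-⋆ : ∀ n → proj₁ (n ⋆ x) ≡ pow n (proj₁ x)
    pow-⋆ zero    = refl
    pow-⋆ (suc n) = cong (proj₁ x G.∙_) (pow-⋆ n)
    ε⁻¹∙ : ∀ {y} → y G.≈ G.ε G.⁻¹ G.∙ y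
    ε⁻¹∙ {y} = G.sym (G.trans (G.∙-congʳ (GroupProperties.ε⁻¹≈ε G)) (G.identityˡ y))

  module _ {c m : ℕ} (classes : Inverse P.setoid (≡.setoid (Fin c))) (size : HasSize K.setoid m) where
    private
      module classes = Inverse classes
      B = basis factorGroup torsion size
      module B = Basis B
      module C = Inverse B.coordinates
      open GroupProperties G using (\\-leftDividesˡ; \\-leftDividesʳ)

      rep : Fin c → G.Carrier
      rep = classes.from

    rank : ℕ
    rank = B.rank

    rank-size : suc p ℕ.^ rank ≡ m
    rank-size = basis-size factorGroup torsion size

    next : G.Carrier → Fin c → Fin c
    next g i = classes.to (rep i G.∙ g)

    private
      ratio : ∀ i x → rep i P.≈ x → K.Carrier
      ratio i x q = rep i G.⁻¹ G.∙ x , q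

      residue : G.Carrier → K.Carrier
      residue x = ratio (classes.to x) x (classes.inverseʳ refl)

      -- The Schreier cocycle: `rep i ∙ g` is `rep (next g i)` times this element of L.
      cocycle : G.Carrier → Fin c → K.Carrier
      cocycle g i = residue (rep i G.∙ g)

    displacementAt : G.Carrier → Fin c → Fin rank → ℕ
    displacementAt g i = B.displacement (cocycle g i)

    private
      encode : G.Carrier → Fin c × Fin (suc p ℕ.^ rank)
      encode x = classes.to x , C.to (residue x)

      decode : Fin c × Fin (suc p ℕ.^ rank) → G.Carrier
      decode (i , a) = rep i G.∙ proj₁ (C.from a)

      encode-≡ : ∀ {x i a} k → classes.to x ≡ i → rep i G.∙ proj₁ k Q.≈ x → C.to k ≡ a → encode x ≡ (i , a)
      encode-≡ {x} {i} k refl q refl = cong (i ,_) (C.to-cong {residue x} {k}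
        (Q.sym {proj₁ k} {rep i G.⁻¹ G.∙ x} (Q.trans {proj₁ k} {rep i G.⁻¹ G.∙ (rep i G.∙ proj₁ k)} {rep i G.⁻¹ G.∙ x}
          (lift L′ (G.sym (\\-leftDividesʳ (rep i) (proj₁ k)))) (Q.∙-congˡ {rep i G.⁻¹} {rep i G.∙ proj₁ k} {x} q))))

      recombine : ∀ x → rep (classes.to x) G.∙ proj₁ (residue x) Q.≈ x
      recombine x = lift L′ (\\-leftDividesˡ (rep (classes.to x)) x)

    coordinates : Inverse Q.setoid (≡.setoid (Fin c × Fin (suc p ℕ.^ rank)))
    coordinates = record
      { to = encode
      ; from = decode
      ; to-cong = λ {x} {y} → encode-cong {x} {y}
      ; from-cong = λ { {x} refl → Q.refl {decode x} }
      ; inverse = (λ {y} {x} q → ≡.trans (encode-cong {x} {decode y} q) (encode-decode y))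
                , (λ { {x} refl → decode-encode x }) }
      where
      encode-cong : ∀ {x y} → x Q.≈ y → encode x ≡ encode y
      encode-cong {x} {y} q = encode-≡ {x} (residue y) (classes.to-cong (L′⊆L q))
        (Q.trans {rep (classes.to y) G.∙ proj₁ (residue y)} {y} {x} (recombine y) (Q.sym {x} {y} q)) refl
      encode-decode : ∀ y → encode (decode y) ≡ y
      encode-decode (i , a) = encode-≡ {decode (i , a)} (C.from a)
        (classes.inverseˡ (absorb (rep i) (proj₂ (C.from a)))) (Q.refl {decode (i , a)}) (C.inverseˡ (K.refl {C.from a}))
      decode-encode : ∀ x → decode (encode x) Q.≈ x
      decode-encode x = Q.trans {decode (encode x)} {rep (classes.to x) G.∙ proj₁ (residue x)} {x}
        (Q.∙-congˡ {rep (classes.to x)} {proj₁ (C.from (C.to (residue x)))} {proj₁ (residue x)} (C.inverseʳ {residue x} refl)) (recombine x)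

    -- Centrality moves g past the fibre coordinate, so right multiplication by g translates the
    -- fibre over i by the cocycle. The translation depends on i, hence the displacement is attached
    -- to edges of the base graph over X × G/L rather than to edges of X.
    coordinates-step : ∀ g i a → Inverse.to coordinates (Inverse.from coordinates (i , a) G.∙ g)
      ≡ (next g i , shiftAll rank (displacementAt g i) a)
    coordinates-step g i a = encode-≡ {decode (i , a) G.∙ g} (C.from a K.∙ cocycle g i)
      (classes.to-cong (P.∙-congʳ {g} {decode (i , a)} {rep i} (absorb (rep i) (proj₂ (C.from a)))))
      moved (B.translate a (cocycle g i))
      where
      j : Fin c
      j = next g i
      h k : G.Carrier
      h = proj₁ (C.from a)
      k = proj₁ (cocycle g i)
      open import Relation.Binary.Reasoning.Setoid Q.setoid
      moved : rep j G.∙ (h G.∙ k) Q.≈ (rep i G.∙ h) G.∙ g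
      moved = begin
        rep j G.∙ (h G.∙ k)
          ≈⟨ Q.∙-congˡ {rep j} {h G.∙ k} {k G.∙ h} (K.comm (C.from a) (cocycle g i)) ⟩
        rep j G.∙ (k G.∙ h)
          ≈⟨ lift L′ (G.sym (G.assoc (rep j) k h)) ⟩
        (rep j G.∙ k) G.∙ h
          ≈⟨ lift L′ (G.∙-congʳ (\\-leftDividesˡ (rep j) (rep i G.∙ g))) ⟩
        (rep i G.∙ g) G.∙ h
          ≈⟨ lift L′ (G.assoc (rep i) g h) ⟩
        rep i G.∙ (g G.∙ h)
          ≈⟨ Q.∙-congˡ {rep i} {g G.∙ h} {h G.∙ g} (commute g (proj₂ (C.from a))) ⟩
        rep i G.∙ (h G.∙ g)
          ≈⟨ lift L′ (G.sym (G.assoc (rep i) h g)) ⟩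
        (rep i G.∙ h) G.∙ g ∎

    -- G/L with one-point fibres, so that it has the same shape as `coordinates` with rank 0 and the
    -- same `next`.
    coarse : Inverse P.setoid (≡.setoid (Fin c × Fin (suc p ℕ.^ 0)))
    coarse = record
      { to = λ x → classes.to x , zero
      ; from = λ (i , _) → rep i
      ; to-cong = λ q → cong (_, zero) (classes.to-cong q)
      ; from-cong = λ { {x} refl → P.refl {rep (proj₁ x)} }
      ; inverse = (λ { {i , zero} q → cong (_, zero) (classes.inverseˡ q) })
                , (λ { refl → classes.inverseʳ refl }) }

    coarse-step : ∀ g i a → Inverse.to coarse (Inverse.from coarse (i , a) G.∙ g) ≡ (next g i , a)
    coarse-step g i zero = refl

-- The lower central ℓ-series of a uniform group

module LowerSeries (p : ℕ) (ℓ-prime : Prime (suc p)) (𝒢 : ProGroup (suc p)) where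
  open import Defs
  open import Data.Fin.Base using (zero)
  open import Data.Fin.Properties using (*↔×)
  open import Data.Product.Base using (_×_; _,_; proj₂; ∃-syntax)
  open import Function.Construct.Composition using (inverse)
  import Function.Construct.Symmetry as Symmetry
  open import Relation.Binary.PropositionalEquality using (refl)
  open import Relation.Unary using (Pred)
  open Pro 𝒢
  open NormalSubgroup

  private
    ℓ = suc p
    module G = Group limit

    generated-mono : ∀ {A B : Pred Carrier 0ℓ} → (∀ {x} → A x → B x) → ∀ {x} → ⟨_⟩ limit A x → ⟨_⟩ limit B x
    generated-mono f (gen a)    = gen (f a)
    generated-mono f (resp q a) = resp q (generated-mono f a)
    generated-mono f unit       = unit
    generated-mono f (mul a b)  = mul (generated-mono f a) (generated-mono f b)
    generated-mono f (invs a)   = invs (generated-mono f a)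

    closure-mono : ∀ {A B : Pred Carrier 0ℓ} → (∀ {x} → A x → B x) → ∀ {x} → closure A x → closure B x
    closure-mono f c i = let (a , a∈ , q) = c i in a , f a∈ , q

    closure-∋ : ∀ {A : Pred Carrier 0ℓ} {x} → A x → closure A x
    closure-∋ {x = x} a i = x , a , G.refl {x} i

  lower-⊆ : ∀ n {x} → mem (lower (suc n)) x → mem (lower n) x
  lower-⊆ zero    _ = _
  lower-⊆ (suc n) (a , b , a∈ , b∈ , q) = a , b
    , closure-mono {⟨_⟩ limit (Powers limit (lower (suc n)) ℓ)} {⟨_⟩ limit (Powers limit (lower n) ℓ)}
        (generated-mono (λ (x , x∈ , r) → x , lower-⊆ n x∈ , r)) {a} a∈
    , closure-mono {⟨_⟩ limit (Commutators limit (lower (suc n)) (whole limit))} {⟨_⟩ limit (Commutators limit (lower n) (whole limit))}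
        (generated-mono (λ (x , y , x∈ , y∈ , r) → x , y , lower-⊆ n x∈ , y∈ , r)) {b} b∈
    , q

  lower-central : ∀ n {h} g → mem (lower n) h → mem (lower (suc n)) (⁅_,_⁆ limit h g)
  lower-central n {h} g h∈ = G.ε , ⁅_,_⁆ limit h g
    , mem-ε (powerSubgroup (lower n) ℓ)
    , closure-∋ {⟨_⟩ limit (Commutators limit (lower n) (whole limit))} {⁅_,_⁆ limit h g} (gen (h , g , h∈ , _ , G.refl {⁅_,_⁆ limit h g}))
    , G.sym {G.ε G.∙ ⁅_,_⁆ limit h g} {⁅_,_⁆ limit h g} (G.identityˡ (⁅_,_⁆ limit h g))

  import Algebra.Definitions.RawMonoid as RawMonoidDefs
  open RawMonoidDefs G.rawMonoid using () renaming (_×_ to pow)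

  lower-powers : ∀ n {h} → mem (lower n) h → mem (lower (suc n)) (pow ℓ h)
  lower-powers n {h} h∈ = pow ℓ h , G.ε
    , closure-∋ {⟨_⟩ limit (Powers limit (lower n) ℓ)} {pow ℓ h} (gen (h , h∈ , G.refl {pow ℓ h}))
    , mem-ε (commutatorSubgroup (lower n) (whole limit))
    , G.sym {pow ℓ h G.∙ G.ε} {pow ℓ h} (G.identityʳ (pow ℓ h))

  module Step (n : ℕ) = CentralExtension p ℓ-prime limit (lower n) (lower (suc n)) (lower-⊆ n) (lower-central n) (lower-powers n)

  module _ (d : ℕ) (uniform : IsUniform) (dimension : HasDimension d) where
    factor-size : ∀ n → HasSize (AbelianGroup.setoid (Step.factorGroup n)) (ℓ ℕ.^ d)
    -- The index equality starts at n = 1; for n = 0 the size is the definition of the dimension.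
    factor-size zero    = proj₂ dimension
    factor-size (suc n) = inverse (IsUniform.indices uniform (suc n) (ℕ.s≤s ℕ.z≤n)) (proj₂ dimension)

    classes : ∀ n → ∃[ c ] HasSize (Group.setoid (quotient limit (lower n))) c
    classes zero = 1 , record
      { to = λ _ → zero ; from = λ _ → G.ε ; to-cong = λ _ → refl ; from-cong = λ _ → _
      ; inverse = (λ { {zero} _ → refl }) , (λ _ → _) }
    classes (suc n) = let (c , enum) = classes n in
      c ℕ.* ℓ ℕ.^ Step.rank n enum (factor-size n) , inverse (Step.coordinates n enum (factor-size n)) (Symmetry.inverse *↔×)

-- Cyclic groups and their enumerations

module CyclicGroups where
  open import Algebra.Morphism.Structures using (module GroupMorphisms)
  open import Defs using (GroupIsomorphic; ℤ/_)
  open Shift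
  open import Data.Fin.Base using (Fin; toℕ; fromℕ<)
  open import Data.Fin.Properties using (toℕ-fromℕ<; toℕ-injective; toℕ<n)
  open import Data.Integer.Base as ℤ using (ℤ; +_)
  import Data.Integer.Properties as ℤ
  import Data.Integer.Divisibility.Signed as ℤ
  import Data.Integer.DivMod as ℤ
  open import Data.Integer.Solver using (module +-*-Solver)
  open import Data.Nat.Base as ℕ using (ℕ; zero; suc; _<_; _≤_)
  import Data.Nat.Properties as ℕ
  import Data.Nat.Divisibility as ℕ
  open import Data.Nat.DivMod using (_%_; m%n<n; m<n⇒m%n≡m; %-distribˡ-+; %-distribˡ-*; m%n%n≡m%n)
  open import Data.Product.Base using (_×_; _,_; proj₁; proj₂; ∃-syntax)
  open import Data.Sum.Base using (inj₁; inj₂)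
  open import Function.Bundles using (Inverse)
  open import Relation.Binary.PropositionalEquality as ≡ using (_≡_; refl; cong; cong₂; subst)
  open import Relation.Nullary.Negation using (contradiction)

  record Cyclic (C : Group 0ℓ 0ℓ) (N : ℕ) .{{_ : ℕ.NonZero N}} : Set where
    open Group C using (Carrier; _≈_; _∙_)
    field
      code      : Carrier → ℕ
      code<N    : ∀ x → code x < N
      code-cong : ∀ {x y} → x ≈ y → code x ≡ code y
      code-inj  : ∀ {x y} → code x ≡ code y → x ≈ y
      code-∙    : ∀ x y → code (x ∙ y) ≡ (code x ℕ.+ code y) % N
      decode    : ∀ j → j < N → ∃[ x ] code x ≡ j

  private
    module Residue where
      open +-*-Solver
      regroup : ∀ a r q s t N → a ≡ r ℤ.+ q ℤ.* N → ∀ b → b ≡ s ℤ.+ t ℤ.* N → r ℤ.- s ≡ (ℤ.- (ℤ.- a ℤ.+ b)) ℤ.+ (t ℤ.- q) ℤ.* N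
      regroup _ r q s t N refl _ refl = solve 5 (λ r q s t N → r :- s := (:- (:- (r :+ q :* N) :+ (s :+ t :* N))) :+
            (t :- q) :* N) refl r q s t N
      regroup′ : ∀ r q (s : ℤ) t N → ℤ.- (r ℤ.+ q ℤ.* N) ℤ.+ (r ℤ.+ t ℤ.* N) ≡ (t ℤ.- q) ℤ.* N
      regroup′ = solve 5 (λ r q s t N → :- (r :+ q :* N) :+ (r :+ t :* N) := (t :- q) :* N) refl

  module _ (N : ℕ) .{{_ : ℕ.NonZero N}} where
    private
      small : ∀ {r s} → r ≤ s → s < N → + N ℤ.∣ + r ℤ.- + s → r ≡ s
      small {r} {s} r≤s s<N d with s ℕ.∸ r in eq
      ... | zero  = ℕ.≤-antisym r≤s (ℕ.m∸n≡0⇒m≤n eq)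
      ... | suc e = contradiction (ℕ.≤-<-trans (ℕ.m∸n≤m s r) s<N) (ℕ.≤⇒≯
            (subst (N ≤_) (≡.sym eq) (ℕ.∣⇒≤ (subst (N ℕ.∣_) eq (subst (N ℕ.∣_) abs (ℤ.∣⇒∣ᵤ d))))))
        where
        abs : ℤ.∣ + r ℤ.- + s ∣ ≡ s ℕ.∸ r
        abs = ≡.trans (cong ℤ.∣_∣ (ℤ.[+m]-[+n]≡m⊖n r s)) (≡.trans (ℤ.∣m⊖n∣≡∣n⊖m∣ r s) (cong ℤ.∣_∣ (ℤ.⊖-≥ r≤s)))

      residue-unique : ∀ {r s} → r < N → s < N → + N ℤ.∣ + r ℤ.- + s → r ≡ s
      residue-unique {r} {s} r<N s<N d with ℕ.≤-total r s
      ... | inj₁ r≤s = small r≤s s<N d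
      ... | inj₂ s≤r = ≡.sym (small s≤r r<N (subst (+ N ℤ.∣_) (≡.trans (ℤ.neg-distrib-+ (+ r) (ℤ.- + s))
            (≡.trans (cong (λ x → ℤ.- + r ℤ.+ x) (ℤ.neg-involutive (+ s))) (ℤ.+-comm (ℤ.- + r) (+ s)))) (ℤ.∣m⇒∣-m d)))

      res : ℤ → ℕ
      res a = a ℤ.%ℕ N

      -- a ≡ b modulo N, in the form used by the quotient group ℤ/N.
      infix 4 _~_
      _~_ : ℤ → ℤ → Set
      a ~ b = + N ℤ.∣ ℤ.- a ℤ.+ b

      res-~ : ∀ {a b} → a ~ b → res a ≡ res b
      res-~ {a} {b} d = residue-unique (ℤ.n%ℕd<d a N) (ℤ.n%ℕd<d b N) (subst (+ N ℤ.∣_)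
        (≡.sym (Residue.regroup a (+ res a) (a ℤ./ℕ N) (+ res b) (b ℤ./ℕ N) (+ N) (ℤ.a≡a%ℕn+[a/ℕn]*n a N) b (ℤ.a≡a%ℕn+[a/ℕn]*n b N)))
        (ℤ.∣m∣n⇒∣m+n (ℤ.∣m⇒∣-m d) (ℤ.divides (b ℤ./ℕ N ℤ.- a ℤ./ℕ N) refl)))

      ~-res : ∀ {a b} → res a ≡ res b → a ~ b
      ~-res {a} {b} eq = ℤ.divides (b ℤ./ℕ N ℤ.- a ℤ./ℕ N) (≡.trans
        (cong₂ (λ x y → ℤ.- x ℤ.+ y) (ℤ.a≡a%ℕn+[a/ℕn]*n a N) (≡.trans (ℤ.a≡a%ℕn+[a/ℕn]*n b N)
              (cong (λ r → + r ℤ.+ (b ℤ./ℕ N) ℤ.* + N) (≡.sym eq))))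
        (Residue.regroup′ (+ res a) (a ℤ./ℕ N) (+ res a) (b ℤ./ℕ N) (+ N)))

      res-+ : ∀ a b → res (a ℤ.+ b) ≡ (res a ℕ.+ res b) % N
      res-+ a b = res-~ {a ℤ.+ b} {+ (res a ℕ.+ res b)} (subst (λ x → x ~ + (res a ℕ.+ res b)) (≡.sym sum)
        (ℤ.divides (ℤ.- (a ℤ./ℕ N ℤ.+ b ℤ./ℕ N)) (cancel (+ (res a ℕ.+ res b)) (a ℤ./ℕ N ℤ.+ b ℤ./ℕ N))))
        where
        open +-*-Solver
        sum : a ℤ.+ b ≡ + (res a ℕ.+ res b) ℤ.+ (a ℤ./ℕ N ℤ.+ b ℤ./ℕ N) ℤ.* + N
        sum = ≡.trans (cong₂ ℤ._+_ (ℤ.a≡a%ℕn+[a/ℕn]*n a N) (ℤ.a≡a%ℕn+[a/ℕn]*n b N))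
          (solve 5 (λ r s x y n → (r :+ x :* n) :+ (s :+ y :* n) := (r :+ s) :+ (x :+ y) :* n) refl (+ res a) (+ res b)
                (a ℤ./ℕ N) (b ℤ./ℕ N) (+ N))
        cancel : ∀ c x → ℤ.- (c ℤ.+ x ℤ.* + N) ℤ.+ c ≡ ℤ.- x ℤ.* + N
        cancel c x = solve 3 (λ c x n → :- (c :+ x :* n) :+ c := :- x :* n) refl c x (+ N)

    fromIsomorphism : ∀ {C} → GroupIsomorphic C (ℤ/ N) → Cyclic C N
    fromIsomorphism {C} (f , iso) = record
      { code      = λ x → res (f x)
      ; code<N    = λ x → ℤ.n%ℕd<d (f x) N
      ; code-cong = λ {x} {y} q → res-~ {f x} {f y} (f.⟦⟧-cong {x} {y} q)
      ; code-inj  = λ {x} {y} eq → f.injective {x} {y} (~-res {f x} {f y} eq)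
      ; code-∙    = λ x y → ≡.trans (res-~ {f (Group._∙_ C x y)} {f x ℤ.+ f y} (f.∙-homo x y)) (res-+ (f x) (f y))
      ; decode    = λ j j<N → let (x , q) = f.surjective (+ j) in
          x , ≡.trans (res-~ {f x} {+ j} (q {x} (Group.refl C {x}))) (m<n⇒m%n≡m j<N) }
      where module f = GroupMorphisms.IsGroupIsomorphism iso

  module _ {C : Group 0ℓ 0ℓ} {N : ℕ} .{{_ : ℕ.NonZero N}} (cyc : Cyclic C N) where
    open Cyclic cyc
    open Group C using (_∙_; setoid)

    -- The codes are rescaled by a unit c modulo N with inverse u. This freedom serves to align the
    -- isomorphisms given at two successive levels of the tower, which need not be compatible.
    enumerate : ∀ c u → (∀ j → j < N → c ℕ.* u ℕ.* j % N ≡ j) → Inverse setoid (≡.setoid (Fin N))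
    enumerate c u cu = record
      { to = to
      ; from = from
      ; to-cong = λ q → cong (λ z → fromℕ< (m%n<n (c ℕ.* z) N)) (code-cong q)
      ; from-cong = λ { refl → Group.refl C }
      ; inverse = (λ {j} {x} q → ≡.trans (cong (λ z → fromℕ< (m%n<n (c ℕ.* z) N)) (code-cong q)) (to-from j))
                , (λ { {x} refl → code-inj (begin
                    code (from (to x))                     ≡⟨ code-from (to x) ⟩
                    (u ℕ.* toℕ (to x)) % N                 ≡⟨ cong (λ z → (u ℕ.* z) % N) (toℕ-fromℕ< (m%n<n (c ℕ.* code x) N)) ⟩
                    (u ℕ.* ((c ℕ.* code x) % N)) % N       ≡⟨ mul-mod u (c ℕ.* code x) ⟩
                    (u ℕ.* (c ℕ.* code x)) % N             ≡⟨ cong (_% N)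
                          (≡.trans (≡.sym (ℕ.*-assoc u c (code x))) (cong (ℕ._* code x) (ℕ.*-comm u c))) ⟩
                    (c ℕ.* u ℕ.* code x) % N               ≡⟨ cu (code x) (code<N x) ⟩
                    code x                                 ∎) }) }
      where
      open ≡.≡-Reasoning
      mul-mod : ∀ a b → (a ℕ.* (b % N)) % N ≡ (a ℕ.* b) % N
      mul-mod a b = ≡.trans (%-distribˡ-* a (b % N) N) (≡.trans (cong (λ z → (a % N ℕ.* z) % N) (m%n%n≡m%n b N))
            (≡.sym (%-distribˡ-* a b N)))
      to : Group.Carrier C → Fin N
      to x = fromℕ< (m%n<n (c ℕ.* code x) N)
      from : Fin N → Group.Carrier C
      from j = proj₁ (decode ((u ℕ.* toℕ j) % N) (m%n<n (u ℕ.* toℕ j) N))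
      code-from : ∀ j → code (from j) ≡ (u ℕ.* toℕ j) % N
      code-from j = proj₂ (decode ((u ℕ.* toℕ j) % N) (m%n<n (u ℕ.* toℕ j) N))
      to-from : ∀ j → to (from j) ≡ j
      to-from j = toℕ-injective (begin
        toℕ (to (from j))                     ≡⟨ toℕ-fromℕ< (m%n<n (c ℕ.* code (from j)) N) ⟩
        (c ℕ.* code (from j)) % N             ≡⟨ cong (λ z → (c ℕ.* z) % N) (code-from j) ⟩
        (c ℕ.* ((u ℕ.* toℕ j) % N)) % N       ≡⟨ mul-mod c (u ℕ.* toℕ j) ⟩
        (c ℕ.* (u ℕ.* toℕ j)) % N             ≡⟨ cong (_% N) (≡.sym (ℕ.*-assoc c u (toℕ j))) ⟩
        (c ℕ.* u ℕ.* toℕ j) % N               ≡⟨ cu (toℕ j) (toℕ<n j) ⟩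
        toℕ j                                 ∎)

    enumerate-step : ∀ c u cu b x → (c ℕ.* code x) % N ≡ b % N → ∀ j →
      Inverse.to (enumerate c u cu) (Inverse.from (enumerate c u cu) j ∙ x) ≡ shift N b j
    enumerate-step c u cu b x eq j = toℕ-injective (begin
      toℕ (I.to (y ∙ x))                          ≡⟨ toℕ-fromℕ< (m%n<n (c ℕ.* code (y ∙ x)) N) ⟩
      (c ℕ.* code (y ∙ x)) % N                    ≡⟨ cong (λ z → (c ℕ.* z) % N) (code-∙ y x) ⟩
      (c ℕ.* ((code y ℕ.+ code x) % N)) % N       ≡⟨ mul-mod c (code y ℕ.+ code x) ⟩
      (c ℕ.* (code y ℕ.+ code x)) % N             ≡⟨ cong (_% N) (ℕ.*-distribˡ-+ c (code y) (code x)) ⟩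
      (c ℕ.* code y ℕ.+ c ℕ.* code x) % N         ≡⟨ %-distribˡ-+ (c ℕ.* code y) (c ℕ.* code x) N ⟩
      ((c ℕ.* code y) % N ℕ.+ (c ℕ.* code x) % N) % N
        ≡⟨ cong₂ (λ s t → (s ℕ.+ t) % N) (≡.trans (≡.sym (toℕ-fromℕ< (m%n<n (c ℕ.* code y) N)))
              (cong toℕ (I.inverseˡ {j} (Group.refl C {y})))) eq ⟩
      (toℕ j ℕ.+ b % N) % N                       ≡⟨ cong (λ z → (z ℕ.+ b % N) % N) (≡.sym (m<n⇒m%n≡m (toℕ<n j))) ⟩
      (toℕ j % N ℕ.+ b % N) % N                   ≡⟨ %-distribˡ-+ (toℕ j) b N ⟨
      (toℕ j ℕ.+ b) % N                           ≡⟨ toℕ-fromℕ< (m%n<n (toℕ j ℕ.+ b) N) ⟨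
      toℕ (shift N b j) ∎)
      where
      open ≡.≡-Reasoning
      module I = Inverse (enumerate c u cu)
      y = I.from j
      mul-mod : ∀ a b → (a ℕ.* (b % N)) % N ≡ (a ℕ.* b) % N
      mul-mod a b = ≡.trans (%-distribˡ-* a (b % N) N) (≡.trans (cong (λ z → (a % N ℕ.* z) % N) (m%n%n≡m%n b N))
            (≡.sym (%-distribˡ-* a b N)))

-- Galois groups of consecutive levels of the tower

module TowerLevels {ℓ : ℕ} {X : Graph} (T : Tower ℓ X) (S : Orientation X) (β : Voltage S (TowerGal.GalLimit T)) where
  open import Defs
  open import Data.Nat.Base as ℕ using (ℕ; zero; suc; _<_)
  import Algebra.Definitions.RawMonoid as RawMonoidDefs
  open import Algebra.Construct.DirectProduct using () renaming (group to product)
  open CyclicGroups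
  open Shift
  open import Data.Fin.Base using (Fin)
  import Data.Nat.Properties as ℕ
  open import Data.Nat.DivMod using (_%_; m%n<n; m<n⇒m%n≡m; %-distribˡ-+; %-distribˡ-*; m%n%n≡m%n)
  open import Data.Product.Base using (_×_; _,_; proj₁; proj₂; ∃-syntax)
  open import Data.Sum.Base using (inj₁; inj₂)
  open import Function.Bundles using (Inverse; _⟨$⟩_; Func)
  open import Relation.Binary.PropositionalEquality as ≡ using (_≡_; cong)

  open Tower T
  open TowerGal T

  private
    module Γ m = Group (GalAt m)
    module Θ = Group GalLimit
    open RawMonoidDefs Θ.rawMonoid using () renaming (_×_ to pow)

    module L m = Graph (level m)

  -- The map between the levels is a cover, hence surjective on vertices and edges, so the commuting
  -- square leaves only one restriction.
  restriction-unique : ∀ m (x y : GalThread) → Γ._≈_ (suc m) (at x (suc m)) (at y (suc m)) → Γ._≈_ m (at x m) (at y m)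
  restriction-unique m x y (p , q) = onVertices , onEdges
    where
    open L m
    f = map m
    lift-edge : ∀ e → ∃[ e′ ] (onE f ⟨$⟩ e′) ≈ᴱ e
    lift-edge e = let (w , fw≈oe) = proj₁ (cover m) (o ⟨$⟩ e)
                      ((e′ , oe′) , r) = proj₂ (proj₂ (cover m) w) (e , V.sym fw≈oe)
                  in e′ , r {e′ , oe′} (Graph.E.refl (level (suc m)))
    onVertices : ∀ v → _
    onVertices v = let (w , fw) = proj₁ (cover m) v ; σ = to (proj₁ (at x m)) ; τ = to (proj₁ (at y m)) in
      V.trans (Func.cong (onV σ) (V.sym fw)) (V.trans (V.sym (proj₁ (coh x m) w)) (V.trans (Func.cong (onV f) (p w))
        (V.trans (proj₁ (coh y m) w) (Func.cong (onV τ) fw))))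
    onEdges : ∀ e → _
    onEdges e = let (e′ , fe) = lift-edge e ; σ = to (proj₁ (at x m)) ; τ = to (proj₁ (at y m)) in
      E.trans (Func.cong (onE σ) (E.sym fe)) (E.trans (E.sym (proj₂ (coh x m) e′)) (E.trans (Func.cong (onE f) (q e′))
        (E.trans (proj₂ (coh y m) e′) (Func.cong (onE τ) fe))))

  module _ (H : Group 0ℓ 0ℓ) (α : Voltage S H) (m : ℕ) where
    private
      module H = Group H
      HΓ : Group 0ℓ 0ℓ
      HΓ = product H (GalAt m)
      γ : Voltage S HΓ
      γ i = α i , at (β i) m
      Y = derived S HΓ γ
      module Y = Graph Y
      module G = Group (GalAt m)

      component : Y.V.Carrier → G.Carrier
      component (v , h , σ) = σ

      edge-thread : ∀ e → ∃[ θ ] proj₂ (extend S HΓ γ ⟨$⟩ e) G.≈ at θ m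
      edge-thread e with Orientation.covers S e
      ... | i , inj₁ _ = β i , G.refl {at (β i) m}
      ... | i , inj₂ _ = β i Θ.⁻¹ , G.refl {at (β i Θ.⁻¹) m}

      walk-thread : ∀ {x y} → Walk Y x y → ∃[ θ ] component y G.≈ (component x G.∙ at θ m)
      walk-thread {x} {y} (stop (_ , _ , q)) = Θ.ε , G.trans {component y} {component x} {component x G.∙ G.ε}
        (G.sym {component x} {component y} q) (G.sym {component x G.∙ G.ε} {component x} (G.identityʳ (component x)))
      walk-thread {x} {y} (step (e , h , σ) (_ , _ , q) p) =
        let (θ , r) = edge-thread e ; (θ′ , r′) = walk-thread p ; g = proj₂ (extend S HΓ γ ⟨$⟩ e) in
        θ Θ.∙ θ′ ,
        G.trans {component y} {(σ G.∙ g) G.∙ at θ′ m} {component x G.∙ (at θ m G.∙ at θ′ m)} r′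
          (G.trans {(σ G.∙ g) G.∙ at θ′ m} {(component x G.∙ at θ m) G.∙ at θ′ m} {component x G.∙ (at θ m G.∙ at θ′ m)}
            (G.∙-congʳ {at θ′ m} {σ G.∙ g} {component x G.∙ at θ m} (G.∙-cong {σ} {component x} {g} {at θ m} q r))
            (G.assoc (component x) (at θ m) (at θ′ m)))

    -- A walk from (v, ε, ε) to (v, ε, σ) multiplies the voltages along its edges, and each of them
    -- is the m-th component of a thread. The product of these threads lifts σ to Γ.
    thread-at : IsConnected Y → ∀ σ → ∃[ θ ] at θ m G.≈ σ
    thread-at ((v , _) , walk) σ = let (θ , q) = walk-thread (walk (v , H.ε , G.ε) (v , H.ε , σ)) in
      θ , G.sym {σ} {at θ m} (G.trans {σ} {G.ε G.∙ at θ m} {at θ m} q (G.identityˡ (at θ m)))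

  module _ {N : ℕ} .{{_ : ℕ.NonZero N}} (m : ℕ) (cyc : Cyclic (GalAt m) N) where
    open Cyclic cyc
    private module G = Group (GalAt m)

    code-ε : code G.ε ≡ 0
    code-ε = let (y , q) = decode 0 (ℕ.>-nonZero⁻¹ N) in ≡.trans (≡.sym (m<n⇒m%n≡m (code<N G.ε)))
      (≡.trans (cong (_% N) (≡.trans (≡.sym (ℕ.+-identityʳ (code G.ε))) (cong (code G.ε ℕ.+_) (≡.sym q))))
      (≡.trans (≡.sym (code-∙ G.ε y)) (≡.trans (code-cong (G.identityˡ y)) q)))

    code-pow : ∀ n θ → code (at (pow n θ) m) ≡ (n ℕ.* code (at θ m)) % N
    code-pow zero    θ = ≡.trans code-ε (≡.sym (m<n⇒m%n≡m (ℕ.>-nonZero⁻¹ N)))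
    code-pow (suc n) θ = ≡.trans (code-∙ (at θ m) (at (pow n θ) m)) (≡.trans (cong (λ z → (code (at θ m) ℕ.+ z) % N) (code-pow n θ))
      (≡.trans (cong (λ z → (z ℕ.+ (n ℕ.* code (at θ m)) % N) % N) (≡.sym (m<n⇒m%n≡m (code<N (at θ m)))))
        (≡.sym (%-distribˡ-+ (code (at θ m)) (n ℕ.* code (at θ m)) N))))

  -- Enumerations of Γ^(m) and Γ^(m+1) for which β s has the same displacement.
  module _ (m : ℕ) {M N : ℕ} .{{_ : ℕ.NonZero M}} .{{_ : ℕ.NonZero N}} (1<N : 1 < N)
    (low : Cyclic (GalAt m) M) (full : Cyclic (GalAt (suc m)) N)
    (low-thread : ∀ σ → ∃[ θ ] Γ._≈_ m (at θ m) σ)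
    (full-thread : ∀ σ → ∃[ θ ] Γ._≈_ (suc m) (at θ (suc m)) σ)
    where
    private
      module low = Cyclic low
      module full = Cyclic full

      generator : Γ.Carrier (suc m)
      generator = proj₁ (full.decode 1 1<N)

      -- θ has code 1 at level m + 1 and θ′ has code 1 modulo M at level m. The code of θ′ above and
      -- that of θ below are the mutually inverse units c and u.
      θ θ′ : GalThread
      θ  = proj₁ (full-thread generator)
      θ′ = proj₁ (low-thread (proj₁ (low.decode (1 % M) (m%n<n 1 M))))

      codeᴴ codeᴸ : GalThread → ℕ
      codeᴴ x = full.code (at x (suc m))
      codeᴸ x = low.code (at x m)

      c u : ℕ
      c = codeᴴ θ′
      u = codeᴸ θ

      codeᴴ-θ : codeᴴ θ ≡ 1
      codeᴴ-θ = ≡.trans (full.code-cong {at θ (suc m)} {generator} (proj₂ (full-thread generator))) (proj₂ (full.decode 1 1<N))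

      -- At level m + 1 the thread x agrees with the power of θ whose exponent is its code. By
      -- uniqueness of restrictions they agree at level m as well.
      codeᴸ-via : ∀ x → codeᴸ x ≡ (codeᴴ x ℕ.* u) % M
      codeᴸ-via x = ≡.trans (low.code-cong {at x m} {at y m} (restriction-unique m x y (full.code-inj {at x (suc m)} {at y (suc m)}
          (≡.sym (≡.trans (code-pow (suc m) full (codeᴴ x) θ) (≡.trans (cong (λ z → (codeᴴ x ℕ.* z) % N) codeᴴ-θ)
            (≡.trans (cong (_% N) (ℕ.*-identityʳ (codeᴴ x))) (m<n⇒m%n≡m (full.code<N (at x (suc m)))))))))))
        (code-pow m low (codeᴴ x) θ)
        where
        y : GalThread
        y = pow (codeᴴ x) θ

      cu≡1 : (c ℕ.* u) % M ≡ 1 % M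
      cu≡1 = ≡.trans (≡.sym (codeᴸ-via θ′)) (≡.trans (low.code-cong {at θ′ m} {σ} (proj₂ (low-thread σ)))
            (proj₂ (low.decode (1 % M) (m%n<n 1 M))))
        where
        σ : Γ.Carrier m
        σ = proj₁ (low.decode (1 % M) (m%n<n 1 M))

      cu-cancel : ∀ j → (c ℕ.* u ℕ.* j) % M ≡ j % M
      cu-cancel j = ≡.trans (%-distribˡ-* (c ℕ.* u) j M) (≡.trans (cong (λ z → (z ℕ.* (j % M)) % M) cu≡1)
        (≡.trans (≡.sym (%-distribˡ-* 1 j M)) (cong (_% M) (ℕ.*-identityˡ j))))

      cu-bijective : ∀ j → j < M → (c ℕ.* u ℕ.* j) % M ≡ j
      cu-bijective j j<M = ≡.trans (cu-cancel j) (m<n⇒m%n≡m j<M)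

      1-bijective : ∀ j → j < N → (1 ℕ.* 1 ℕ.* j) % N ≡ j
      1-bijective j j<N = ≡.trans (cong (_% N) (ℕ.*-identityˡ j)) (m<n⇒m%n≡m j<N)

    displacementΓ : Fin (Orientation.size S) → ℕ
    displacementΓ i = codeᴴ (β i)

    lowEnumeration : Inverse (Γ.setoid m) (≡.setoid (Fin M))
    lowEnumeration = enumerate low c u cu-bijective

    fullEnumeration : Inverse (Γ.setoid (suc m)) (≡.setoid (Fin N))
    fullEnumeration = enumerate full 1 1 1-bijective

    lowEnumeration-step : ∀ i j → Inverse.to lowEnumeration (Γ._∙_ m (Inverse.from lowEnumeration j) (at (β i) m)) ≡ shift M
          (displacementΓ i) j
    lowEnumeration-step i = enumerate-step low c u cu-bijective (displacementΓ i) (at (β i) m)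
      (≡.trans (cong (λ z → (c ℕ.* z) % M) (codeᴸ-via (β i))) (≡.trans (%-distribˡ-* c _ M)
            (≡.trans (cong (λ z → (c % M ℕ.* z) % M) (m%n%n≡m%n (b ℕ.* u) M))
        (≡.trans (≡.sym (%-distribˡ-* c (b ℕ.* u) M)) (≡.trans (cong (_% M)
              (≡.trans (cong (c ℕ.*_) (ℕ.*-comm b u)) (≡.sym (ℕ.*-assoc c u b)))) (cu-cancel b))))))
      where
      b : ℕ
      b = displacementΓ i

    fullEnumeration-step : ∀ i j → Inverse.to fullEnumeration (Γ._∙_ (suc m) (Inverse.from fullEnumeration j)
          (at (β i) (suc m))) ≡ shift N (displacementΓ i) j
    fullEnumeration-step i = enumerate-step full 1 1 1-bijective (displacementΓ i) (at (β i) (suc m))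
          (cong (_% N) (ℕ.*-identityˡ (displacementΓ i)))

-- Coordinates on the finite groups and the passage from n to n + 1

module ProductEnumeration where
  open import Algebra.Construct.DirectProduct using () renaming (group to product)
  open import Data.Fin.Base using (Fin; combine; quotient; remainder)
  open import Data.Fin.Properties using (combine-remQuot; remQuot-combine)
  open import Data.Nat.Base as ℕ using (ℕ)
  open import Data.Product.Base using (_×_; _,_; proj₁; proj₂)
  open import Function.Bundles using (Inverse)
  open import Relation.Binary.PropositionalEquality as ≡ using (_≡_; refl; cong; cong₂)

  module _ (H Γ : Group 0ℓ 0ℓ) {c a N : ℕ}
    (encH : Inverse (Group.setoid H) (≡.setoid (Fin c × Fin a)))
    (encΓ : Inverse (Group.setoid Γ) (≡.setoid (Fin N)))
    where
    private
      module H = Group H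
      module Γ = Group Γ
      module encH = Inverse encH
      module encΓ = Inverse encΓ
      module HΓ = Group (product H Γ)

      encode : HΓ.Carrier → Fin c × Fin (a ℕ.* N)
      encode (h , g) = let (y , x) = encH.to h in y , combine x (encΓ.to g)

      decode : Fin c × Fin (a ℕ.* N) → HΓ.Carrier
      decode (y , x) = encH.from (y , quotient N x) , encΓ.from (remainder {a} N x)

      encode-decode : ∀ y → encode (decode y) ≡ y
      encode-decode (y , x) = ≡.trans (cong₂ (λ (y , x) j → y , combine x j) (encH.inverseˡ H.refl) (encΓ.inverseˡ Γ.refl))
        (cong (y ,_) (combine-remQuot {a} N x))

      encode-cong : ∀ {h g} → h HΓ.≈ g → encode h ≡ encode g
      encode-cong (p , r) = cong₂ (λ (y , x) j → y , combine x j) (encH.to-cong p) (encΓ.to-cong r)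

      decode-encode : ∀ g → decode (encode g) HΓ.≈ g
      decode-encode (h , g) =
          H.trans (H.reflexive (cong (λ y → encH.from (proj₁ (encH.to h) , proj₁ y))
                (remQuot-combine (proj₂ (encH.to h)) (encΓ.to g)))) (encH.inverseʳ refl)
        , Γ.trans (Γ.reflexive (cong (λ y → encΓ.from (proj₂ y)) (remQuot-combine (proj₂ (encH.to h)) (encΓ.to g)))) (encΓ.inverseʳ refl)

    productEnumeration : Inverse HΓ.setoid (≡.setoid (Fin c × Fin (a ℕ.* N)))
    productEnumeration = record
      { to = encode
      ; from = decode
      ; to-cong = encode-cong
      ; from-cong = λ { refl → HΓ.refl }
      ; inverse = (λ {y} q → ≡.trans (encode-cong q) (encode-decode y)) , (λ { {g} refl → decode-encode g }) }

    productEnumeration-step : ∀ {h g} {y y′ : Fin c} {f : Fin a → Fin a} {f′ : Fin N → Fin N} →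
      (∀ x → encH.to (encH.from (y , x) H.∙ h) ≡ (y′ , f x)) → (∀ j → encΓ.to (encΓ.from j Γ.∙ g) ≡ f′ j) →
      ∀ x → encode (decode (y , x) HΓ.∙ (h , g)) ≡ (y′ , combine (f (quotient N x)) (f′ (remainder {a} N x)))
    productEnumeration-step p q x = cong₂ (λ (y , x) j → y , combine x j) (p _) (q _)

module LevelStep (p : ℕ) (ℓ-prime : Prime (suc p)) (k : ℕ) {X : Graph} (S : Orientation X) where
  open import Data.Nat.Base as ℕ using (ℕ; zero; suc; _<_)
  open import Defs hiding (quotient)
  open import Data.Fin.Base using (Fin; zero; suc; combine; quotient; remainder)
  open import Function.Bundles using (Inverse; _⟨$⟩_)
  open import Relation.Binary.PropositionalEquality as ≡ using (_≡_; refl; cong; subst)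
  open Shift
  open ElementaryAbelian p ℓ-prime using (shiftAll)
  open import Function.Base using (_∘_)
  import Data.Nat.Properties as ℕ

  private
    ℓ M N : ℕ
    ℓ = suc p
    M = ℓ ℕ.^ k
    N = M ℕ.* ℓ

    instance
      M≢0 : ℕ.NonZero M
      M≢0 = ℕ.m^n≢0 ℓ k
      N≢0 : ℕ.NonZero N
      N≢0 = ℕ.m*n≢0 M ℓ

    module Nm = Norms p ℓ-prime k
    R = Cyclotomic.R p ℓ-prime k

    ωGroups-act : ∀ {kb} r (κ : Fin kb → Fin r → ℕ) i a → LiftedLaplacians.Characters.act (Nm.ωGroups r κ) i a ≡ shiftAll r (κ i) a
    ωGroups-act zero    κ i a = refl
    ωGroups-act (suc r) κ i a = cong (combine (shift ℓ (κ i zero) (quotient {ℓ} (ℓ ℕ.^ r) a)))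
      (ωGroups-act r (λ i → κ i ∘ suc) i (remainder {ℓ} (ℓ ℕ.^ r) a))

  private
    Enumeration : Group 0ℓ 0ℓ → ℕ → ℕ → Set
    Enumeration G c q = Inverse (Group.setoid G) (≡.setoid (Fin c × Fin q))

  module _ {nX c : ℕ} (encX : Inverse (Graph.V X) (≡.setoid (Fin nX)))
    (next : Fin (Orientation.size S) → Fin c → Fin c) (b₀ : Fin (Orientation.size S) → ℕ) where

    private
      size kb nb : ℕ
      size = Orientation.size S
      kb = size ℕ.* c
      nb = nX ℕ.* c

      u v : Fin kb → Fin nb
      u e = combine (Inverse.to encX (Graph.o X ⟨$⟩ Orientation.s S (quotient c e))) (remainder {size} c e)
      v e = combine (Inverse.to encX (Graph.t X ⟨$⟩ Orientation.s S (quotient c e))) (next (quotient c e) (remainder {size} c e))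

      b : Fin kb → ℕ
      b e = b₀ (quotient c e)

    Displacement : ℕ → Set
    Displacement r = Fin (Orientation.size S) → Fin c → Fin r → ℕ

    move : ∀ {r} n .{{_ : ℕ.NonZero n}} → Displacement r → Fin (Orientation.size S) → Fin c → Fin (ℓ ℕ.^ r ℕ.* n) → Fin (ℓ ℕ.^ r ℕ.* n)
    move {r} n disp i x a = combine (shiftAll r (disp i x) (quotient n a)) (shift n (b₀ i) (remainder {ℓ ℕ.^ r} n a))

    Steps : ∀ (G : Group 0ℓ 0ℓ) (γ : Voltage S G) {r} n .{{_ : ℕ.NonZero n}} → Enumeration G c (ℓ ℕ.^ r ℕ.* n) → Displacement r → Set
    Steps G γ n enc disp = ∀ i x a → Inverse.to enc (Group._∙_ G (Inverse.from enc (x , a)) (γ i)) ≡ (next i x , move n disp i x a)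

    private
      displacements : ∀ {r} → Displacement r → Fin kb → Fin r → ℕ
      displacements disp e = disp (quotient c e) (remainder {size} c e)

      module _ (G : Group 0ℓ 0ℓ) (γ : Voltage S G) (r : ℕ) (disp : Displacement r) where
        full-count : (enc : Enumeration G c (ℓ ℕ.^ r ℕ.* N)) → Steps G γ N enc disp →
          ∀ {t} → HasSize (SpanningTrees (derived S G γ)) t → Nm.fullCount u v b (displacements disp) ≡ t
        full-count enc steps = DerivedGraphs.lifted-treeCount S G γ encX enc next (move N disp) steps
          R (Nm.full u v b (displacements disp)) (λ i x → cong (λ z → combine z (shift N (b i) (remainder {ℓ ℕ.^ r} N x)))
                (ωGroups-act r (displacements disp) i (quotient N x)))

        low-count : (enc : Enumeration G c (ℓ ℕ.^ r ℕ.* M)) → Steps G γ M enc disp →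
          ∀ {t} → HasSize (SpanningTrees (derived S G γ)) t → Nm.lowCount u v b (displacements disp) ≡ t
        low-count enc steps = DerivedGraphs.lifted-treeCount S G γ encX enc next (move M disp) steps
          R (Nm.low u v b (displacements disp)) (λ i x → cong (λ z → combine z (shift M (b i) (remainder {ℓ ℕ.^ r} M x)))
                (ωGroups-act r (displacements disp) i (quotient M x)))

    -- F and L stand for the levels with cyclic factor of order N and M; the indices 0 and 1 stand
    -- for elementary abelian factors of rank 0 and r. All four graphs lift one base graph with
    -- common `next` and `b₀`.
    order-step : .{{_ : ℕ.NonZero (nX ℕ.* c)}} → ∀ (r : ℕ) (disp₀ : Displacement 0) (disp₁ : Displacement r)
      {F₀ L₀ F₁ L₁ : Group 0ℓ 0ℓ} (f₀ : Voltage S F₀) (l₀ : Voltage S L₀) (f₁ : Voltage S F₁) (l₁ : Voltage S L₁)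
      (encF₀ : Enumeration F₀ c (ℓ ℕ.^ 0 ℕ.* N)) → Steps F₀ f₀ N encF₀ disp₀ →
      (encL₀ : Enumeration L₀ c (ℓ ℕ.^ 0 ℕ.* M)) → Steps L₀ l₀ M encL₀ disp₀ →
      (encF₁ : Enumeration F₁ c (ℓ ℕ.^ r ℕ.* N)) → Steps F₁ f₁ N encF₁ disp₁ →
      (encL₁ : Enumeration L₁ c (ℓ ℕ.^ r ℕ.* M)) → Steps L₁ l₁ M encL₁ disp₁ →
      ∀ {t₁ t₀ s₁ s₀ e₁ e₀ g₁ g₀ i} →
      HasSize (SpanningTrees (derived S F₀ f₀)) t₁ → Ord ℓ t₁ e₁ →
      HasSize (SpanningTrees (derived S L₀ l₀)) t₀ → Ord ℓ t₀ e₀ →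
      HasSize (SpanningTrees (derived S F₁ f₁)) s₁ → Ord ℓ s₁ g₁ →
      HasSize (SpanningTrees (derived S L₁ l₁)) s₀ → Ord ℓ s₀ g₀ →
      suc e₁ ≡ e₀ ℕ.+ i → i < suc k → suc g₁ ≡ g₀ ℕ.+ ℓ ℕ.^ r ℕ.* i
    order-step r disp₀ disp₁ {F₀} {L₀} {F₁} {L₁} f₀ l₀ f₁ l₁ encF₀ stF₀ encL₀ stL₀ encF₁ stF₁ encL₁ stL₁
      {e₁ = e₁} {e₀} {g₁} {g₀} {i} T₁ o₁ T₀ o₀ U₁ q₁ U₀ q₀ eq i≤k =
      NormComparison.comparison p ℓ-prime k u v b {r} {e₁} {e₀} {g₁} {g₀} {i}
        (displacements disp₀) (displacements disp₁)
        (subst (λ t → Ord ℓ t e₁) (≡.sym (full-count F₀ f₀ 0 disp₀ encF₀ stF₀ T₁)) o₁)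
        (subst (λ t → Ord ℓ t e₀) (≡.sym (low-count L₀ l₀ 0 disp₀ encL₀ stL₀ T₀)) o₀)
        (subst (λ t → Ord ℓ t g₁) (≡.sym (full-count F₁ f₁ r disp₁ encF₁ stF₁ U₁)) q₁)
        (subst (λ t → Ord ℓ t g₀) (≡.sym (low-count L₁ l₁ r disp₁ encL₁ stL₁ U₀)) q₀) eq i≤k

module OrderStep (p : ℕ) (ℓ-prime : Prime (suc p)) {X : Graph} (X-finite : IsFiniteGraph X) (vertex : Setoid.Carrier (Graph.V X))
  (S : Orientation X) (𝒢 : ProGroup (suc p)) (α : Voltage S (Pro.limit 𝒢))
  (T : Tower (suc p) X) (β : Voltage S (TowerGal.GalLimit T))
  (d : ℕ) (uniform : Pro.IsUniform 𝒢) (dimension : Pro.HasDimension 𝒢 d)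
  (connected : ∀ n m → IsConnected (derivedLevel S 𝒢 T (λ i → α i , β i) n m))
  where
  open import Data.Nat.Base as ℕ using (ℕ; zero; suc; _<_; s≤s; z≤n)
  open import Defs hiding (quotient)
  import Defs
  open import Data.Product.Base using (_×_; _,_; proj₁; proj₂; ∃-syntax)
  open ProductEnumeration
  open CyclicGroups
  open ElementaryAbelian p ℓ-prime using (shiftAll)
  open Shift
  open import Data.Fin.Base using (Fin; zero; suc)
  import Data.Nat.Properties as ℕ
  open import Function.Base using (_∘_)
  open import Function.Bundles using (Inverse)
  open import Relation.Binary.PropositionalEquality as ≡ using (_≡_; subst)

  private
    ℓ : ℕ
    ℓ = suc p

  module _ (n k′ : ℕ) where
    private
      k M N : ℕ
      -- Positive, because the cyclic Galois group of the lower level is provided only from level 1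
      -- on.
      k = suc k′
      M = ℓ ℕ.^ k
      N = M ℕ.* ℓ

      instance
        M≢0 : ℕ.NonZero M
        M≢0 = ℕ.m^n≢0 ℓ k
        N≢0 : ℕ.NonZero N
        N≢0 = ℕ.m*n≢0 M ℓ

      nX : ℕ
      nX = proj₁ (proj₁ X-finite)
      encX : HasSize (Graph.V X) nX
      encX = proj₂ (proj₁ X-finite)

      module LS = LowerSeries p ℓ-prime 𝒢
      module St = LS.Step n

      c : ℕ
      c = proj₁ (LS.classes d uniform dimension n)
      encN : HasSize (Group.setoid (Defs.quotient (Pro.limit 𝒢) (Pro.lower 𝒢 n))) c
      encN = proj₂ (LS.classes d uniform dimension n)
      size : HasSize _ (ℓ ℕ.^ d)
      size = LS.factor-size d uniform dimension n

      r : ℕ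
      r = St.rank encN size

      module TL = TowerLevels T S β

      low : Cyclic (TowerGal.GalAt T k) M
      low = fromIsomorphism M {TowerGal.GalAt T k} (Tower.group T k (s≤s z≤n))

      full : Cyclic (TowerGal.GalAt T (suc k)) N
      full = fromIsomorphism N {TowerGal.GalAt T (suc k)} (subst (λ N → GroupIsomorphic (TowerGal.GalAt T (suc k)) (ℤ/ N))
            (ℕ.*-comm ℓ M) (Tower.group T (suc k) (s≤s z≤n)))

      1<N : 1 < N
      1<N = ℕ.≤-trans (ℕ.nonTrivial⇒n>1 ℓ {{prime⇒nonTrivial ℓ-prime}}) (ℕ.m≤n*m ℓ M)
        where open import Data.Nat.Primality using (prime⇒nonTrivial)

      G₀ : Group 0ℓ 0ℓ
      G₀ = Defs.quotient (Pro.limit 𝒢) (Pro.lower 𝒢 0)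

      low-thread : ∀ σ → ∃[ θ ] Group._≈_ (TowerGal.GalAt T k) (TowerGal.GalThread.at θ k) σ
      low-thread = TL.thread-at G₀ α k (connected 0 k)

      full-thread : ∀ σ → ∃[ θ ] Group._≈_ (TowerGal.GalAt T (suc k)) (TowerGal.GalThread.at θ (suc k)) σ
      full-thread = TL.thread-at G₀ α (suc k) (connected 0 (suc k))

      b₀ : Fin (Orientation.size S) → ℕ
      b₀ = TL.displacementΓ k 1<N low full low-thread full-thread

      encLow : Inverse (Group.setoid (TowerGal.GalAt T k)) (≡.setoid (Fin M))
      encLow = TL.lowEnumeration k 1<N low full low-thread full-thread

      encFull : Inverse (Group.setoid (TowerGal.GalAt T (suc k))) (≡.setoid (Fin N))
      encFull = TL.fullEnumeration k 1<N low full low-thread full-thread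

      nb≢0 : ℕ.NonZero (nX ℕ.* c)
      nb≢0 = ℕ.m*n≢0 nX c {{inhabited (Inverse.to encX vertex)}} {{inhabited (Inverse.to encN (Group.ε (Pro.limit 𝒢)))}}
        where
        inhabited : ∀ {m} → Fin m → ℕ.NonZero m
        inhabited {suc m} _ = _

    private
      G⁽_⁾ : ℕ → Group 0ℓ 0ℓ
      G⁽ n ⁾ = Defs.quotient (Pro.limit 𝒢) (Pro.lower 𝒢 n)

      next : Fin (Orientation.size S) → Fin c → Fin c
      next i = St.next encN size (α i)

      disp₀ : Fin (Orientation.size S) → Fin c → Fin 0 → ℕ
      disp₀ _ _ ()

      disp₁ : Fin (Orientation.size S) → Fin c → Fin r → ℕ
      disp₁ i = St.displacementAt encN size (α i)

      Enumeration : Group 0ℓ 0ℓ → ℕ → Set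
      Enumeration G q = Inverse (Group.setoid G) (≡.setoid (Fin c × Fin q))

      encF₀ : Enumeration (finiteLevel S 𝒢 T n (suc (suc k′))) (ℓ ℕ.^ 0 ℕ.* N)
      encF₀ = productEnumeration G⁽ n ⁾ (TowerGal.GalAt T (suc k)) (St.coarse encN size) encFull
      encL₀ : Enumeration (finiteLevel S 𝒢 T n (suc k′)) (ℓ ℕ.^ 0 ℕ.* M)
      encL₀ = productEnumeration G⁽ n ⁾ (TowerGal.GalAt T k) (St.coarse encN size) encLow
      encF₁ : Enumeration (finiteLevel S 𝒢 T (suc n) (suc (suc k′))) (ℓ ℕ.^ r ℕ.* N)
      encF₁ = productEnumeration G⁽ suc n ⁾ (TowerGal.GalAt T (suc k)) (St.coordinates encN size) encFull
      encL₁ : Enumeration (finiteLevel S 𝒢 T (suc n) (suc k′)) (ℓ ℕ.^ r ℕ.* M)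
      encL₁ = productEnumeration G⁽ suc n ⁾ (TowerGal.GalAt T k) (St.coordinates encN size) encLow

      module LStep = LevelStep p ℓ-prime k S

      stepF₀ : LStep.Steps encX next b₀ (finiteLevel S 𝒢 T n (suc (suc k′)))
            (toFiniteLevel S 𝒢 T n (suc (suc k′)) ∘ (λ i → α i , β i)) N encF₀ disp₀
      stepF₀ i x = productEnumeration-step G⁽ n ⁾ (TowerGal.GalAt T (suc k)) (St.coarse encN size) encFull
        {α i} {TowerGal.GalThread.at (β i) (suc k)} {x} {next i x} {(λ a → a)} {shift N (b₀ i)}
        (St.coarse-step encN size (α i) x) (TL.fullEnumeration-step k 1<N low full low-thread full-thread i)
      stepL₀ : LStep.Steps encX next b₀ (finiteLevel S 𝒢 T n (suc k′)) (toFiniteLevel S 𝒢 T n (suc k′) ∘ (λ i → α i , β i)) M encL₀ disp₀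
      stepL₀ i x = productEnumeration-step G⁽ n ⁾ (TowerGal.GalAt T k) (St.coarse encN size) encLow
        {α i} {TowerGal.GalThread.at (β i) k} {x} {next i x} {(λ a → a)} {shift M (b₀ i)}
        (St.coarse-step encN size (α i) x) (TL.lowEnumeration-step k 1<N low full low-thread full-thread i)
      stepF₁ : LStep.Steps encX next b₀ (finiteLevel S 𝒢 T (suc n) (suc (suc k′)))
            (toFiniteLevel S 𝒢 T (suc n) (suc (suc k′)) ∘ (λ i → α i , β i)) N encF₁ disp₁
      stepF₁ i x = productEnumeration-step G⁽ suc n ⁾ (TowerGal.GalAt T (suc k)) (St.coordinates encN size) encFull
        {α i} {TowerGal.GalThread.at (β i) (suc k)} {x} {next i x} {(shiftAll r (disp₁ i x))} {shift N (b₀ i)}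
        (St.coordinates-step encN size (α i) x) (TL.fullEnumeration-step k 1<N low full low-thread full-thread i)
      stepL₁ : LStep.Steps encX next b₀ (finiteLevel S 𝒢 T (suc n) (suc k′))
            (toFiniteLevel S 𝒢 T (suc n) (suc k′) ∘ (λ i → α i , β i)) M encL₁ disp₁
      stepL₁ i x = productEnumeration-step G⁽ suc n ⁾ (TowerGal.GalAt T k) (St.coordinates encN size) encLow
        {α i} {TowerGal.GalThread.at (β i) k} {x} {next i x} {(shiftAll r (disp₁ i x))} {shift M (b₀ i)}
        (St.coordinates-step encN size (α i) x) (TL.lowEnumeration-step k 1<N low full low-thread full-thread i)

    -- In the application i is λ_n + 1. The bound keeps it below the precision π^(k+1) to which the
    -- characters of G_n/G_{n+1} are trivial.
    order-step : ∀ {t₁ t₀ s₁ s₀ e₁ e₀ g₁ g₀ i} →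
      HasSize (SpanningTrees (derivedLevel S 𝒢 T (λ i → α i , β i) n (suc (suc k′)))) t₁ → Ord ℓ t₁ e₁ →
      HasSize (SpanningTrees (derivedLevel S 𝒢 T (λ i → α i , β i) n (suc k′))) t₀ → Ord ℓ t₀ e₀ →
      HasSize (SpanningTrees (derivedLevel S 𝒢 T (λ i → α i , β i) (suc n) (suc (suc k′)))) s₁ → Ord ℓ s₁ g₁ →
      HasSize (SpanningTrees (derivedLevel S 𝒢 T (λ i → α i , β i) (suc n) (suc k′))) s₀ → Ord ℓ s₀ g₀ →
      suc e₁ ≡ e₀ ℕ.+ i → i < suc (suc k′) → suc g₁ ≡ g₀ ℕ.+ ℓ ℕ.^ d ℕ.* i
    order-step {t₁} {t₀} {s₁} {s₀} {e₁} {e₀} {g₁} {g₀} {i} T₁ o₁ T₀ o₀ U₁ q₁ U₀ q₀ eq i≤k =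
      subst (λ z → suc g₁ ≡ g₀ ℕ.+ z ℕ.* i) (St.rank-size encN size)
        (LStep.order-step encX next b₀ {{nb≢0}} r disp₀ disp₁
          {finiteLevel S 𝒢 T n (suc (suc k′))} {finiteLevel S 𝒢 T n (suc k′)} {finiteLevel S 𝒢 T (suc n) (suc (suc k′))}
                {finiteLevel S 𝒢 T (suc n) (suc k′)} (toFiniteLevel S 𝒢 T n (suc (suc k′)) ∘ (λ i → α i , β i))
                (toFiniteLevel S 𝒢 T n (suc k′) ∘ (λ i → α i , β i)) (toFiniteLevel S 𝒢 T (suc n) (suc (suc k′)) ∘
                (λ i → α i , β i)) (toFiniteLevel S 𝒢 T (suc n) (suc k′) ∘ (λ i → α i , β i))
          encF₀ stepF₀ encL₀ stepL₀ encF₁ stepF₁ encL₁ stepL₁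
          {t₁} {t₀} {s₁} {s₀} {e₁} {e₀} {g₁} {g₀} {i} T₁ o₁ T₀ o₀ U₁ q₁ U₀ q₀ eq i≤k)

-- Growth of the Iwasawa invariants

module GrowthArithmetic where
  open import Data.Integer.Base as ℤ using (ℤ; +_)
  import Data.Integer.Properties as ℤ
  import Data.Integer.Solver as ℤ
  open import Data.Nat.Base as ℕ using (ℕ; zero; suc; _+_; _*_; _^_)
  import Data.Nat.Properties as ℕ
  open import Data.Nat.Solver using (module +-*-Solver)
  open import Relation.Binary.PropositionalEquality as ≡ using (_≡_; refl; cong)
  open ℤ.+-*-Solver using () renaming (solve to ℤ-solve; _:=_ to _⊜_; _:+_ to _⊞_)
  open +-*-Solver using (solve; _:=_; _:+_; _:*_; con)

  difference : ∀ {k₁ k₀ a₁ a₀} (ν : ℤ) → + k₁ ≡ + a₁ ℤ.+ ν → + k₀ ≡ + a₀ ℤ.+ ν → k₁ + a₀ ≡ k₀ + a₁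
  difference {k₁} {k₀} {a₁} {a₀} ν p q = ℤ.+-injective (≡.trans (cong (ℤ._+ + a₀) p)
    (≡.trans (ℤ-solve 3 (λ a b n → (a ⊞ n) ⊞ b ⊜ (b ⊞ n) ⊞ a) refl (+ a₁) (+ a₀) ν) (cong (ℤ._+ + a₁) (≡.sym q))))

  -- The growth exponent increases by (lam + 1) − 1 at each level, up to μ ℓ^m.
  slope : ∀ {k₁ k₀} p μ lam m D → let ℓ = suc p in
    k₁ + (μ * ℓ ^ m + lam * m) ≡ k₀ + (μ * ℓ ^ suc m + lam * suc m) →
    suc k₁ ≡ k₀ + D → p * (μ * ℓ ^ m) + suc lam ≡ D
  slope {k₁} {k₀} p μ lam m D e f = ℕ.+-cancelˡ-≡ (k₀ + (μ * suc p ^ m + lam * m)) _ _ (≡.trans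
    (solve 6 (λ k p μ e l m → (k :+ (μ :* e :+ l :* m)) :+ (p :* (μ :* e) :+ (con 1 :+ l))
        := con 1 :+ (k :+ (μ :* ((con 1 :+ p) :* e) :+ l :* (con 1 :+ m)))) refl k₀ p μ (suc p ^ m) lam m)
    (≡.trans (cong suc (≡.sym e)) (≡.trans (cong (_+ (μ * suc p ^ m + lam * m)) f)
      (solve 3 (λ k d a → (k :+ d) :+ a := (k :+ a) :+ d) refl k₀ D (μ * suc p ^ m + lam * m)))))

  -- The two left sides differ by (ℓ - 1)² μ ℓ^m, so equality forces μ = 0. Writing ℓ as p + 2 makes
  -- ℓ - 1 visibly nonzero.
  slope-constant : ∀ p μ lam m D → let ℓ = suc (suc p) in
    suc p * (μ * ℓ ^ m) + suc lam ≡ D → suc p * (μ * ℓ ^ suc m) + suc lam ≡ D → (μ ≡ 0) × (suc lam ≡ D)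
  slope-constant p μ lam m D e f with zero-μ
    where
    x = μ * suc (suc p) ^ m
    pp-x≡0 : suc p * (suc p * x) ≡ 0
    pp-x≡0 = ℕ.+-cancelˡ-≡ (suc p * x) _ _ (≡.trans
      (solve 3 (λ p μ e → (con 1 :+ p) :* (μ :* e) :+ (con 1 :+ p) :* ((con 1 :+ p) :* (μ :* e))
          := (con 1 :+ p) :* (μ :* ((con 2 :+ p) :* e))) refl p μ (suc (suc p) ^ m))
      (≡.trans (ℕ.+-cancelʳ-≡ (suc lam) _ _ (≡.trans f (≡.sym e))) (≡.sym (ℕ.+-identityʳ _))))
    x≡0 : x ≡ 0
    x≡0 = ℕ.*-cancelˡ-≡ x 0 (suc p) (≡.trans (ℕ.*-cancelˡ-≡ (suc p * x) 0 (suc p) (≡.trans pp-x≡0 (≡.sym (ℕ.*-zeroʳ (suc p)))))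
          (≡.sym (ℕ.*-zeroʳ (suc p))))
    zero-μ : μ ≡ 0
    zero-μ = ℕ.*-cancelʳ-≡ μ 0 (suc (suc p) ^ m) {{ℕ.m^n≢0 (suc (suc p)) m}} x≡0
  ... | refl = refl , ≡.trans (≡.sym (cong (_+ suc lam) (ℕ.*-zeroʳ (suc p)))) e

  μ≡0-step : ∀ {k₁ k₀} lam m b c → k₁ + (0 * b + lam * m) ≡ k₀ + (0 * c + lam * suc m) → suc k₁ ≡ k₀ + suc lam
  μ≡0-step {k₁} {k₀} lam m b c e = ≡.trans (cong suc (ℕ.+-cancelʳ-≡ (lam * m) k₁ (k₀ + lam)
    (≡.trans e (solve 3 (λ k l m → k :+ l :* (con 1 :+ m) := (k :+ l) :+ l :* m) refl k₀ lam m)))) (≡.sym (ℕ.+-suc k₀ lam))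

module Growth (p : ℕ) (ℓ-prime : Prime (suc (suc p))) {X : Graph} (X-finite : IsFiniteGraph X) (vertex : Setoid.Carrier (Graph.V X))
  (S : Orientation X) (𝒢 : ProGroup (suc (suc p))) (α : Voltage S (Pro.limit 𝒢))
  (T : Tower (suc (suc p)) X) (β : Voltage S (TowerGal.GalLimit T))
  (d : ℕ) (uniform : Pro.IsUniform 𝒢) (dimension : Pro.HasDimension 𝒢 d)
  (connected : ∀ n m → IsConnected (derivedLevel S 𝒢 T (λ i → α i , β i) n m))
  (μ lam : ℕ → ℕ)
  (invariants : ∀ n → IwasawaInvariants (suc (suc p)) (derivedLevel S 𝒢 T (λ i → α i , β i) n) (μ n) (lam n))
  where
  open import Defs
  open import Data.Fin.Base using (Fin; inject≤)
  open import Data.Nat.Base using (ℕ; zero; suc; _+_; _*_; _^_; _∸_; _≤_; _<_; _⊔_; s≤s)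
  open import Data.Nat.Primality using (Prime; ¬prime[0]; ¬prime[1])
  open import Data.Product.Base using (_×_; _,_; proj₁; proj₂; ∃-syntax)
  open import Relation.Binary.PropositionalEquality using (_≡_; sym; trans; cong)
  open import Relation.Nullary.Negation using (¬_; contradiction)
  import Data.Nat.Properties as ℕ
  import Data.Integer.Base as ℤ
  open GrowthArithmetic
  private
    ℓ : ℕ
    ℓ = suc (suc p)

    start : ℕ → ℕ
    start n = proj₁ (proj₂ (invariants n))

    data-at : ∀ n m → start n ≤ m → ∃[ κ ] ∃[ k ] (HasSize (SpanningTrees (derivedLevel S 𝒢 T (λ i → α i , β i) n m)) κ × Ord ℓ κ k
      × ℤ.+ k ≡ ℤ.+ (μ n * ℓ ^ m + lam n * m) ℤ.+ proj₁ (invariants n))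
    data-at n = proj₂ (proj₂ (invariants n))

    module Levels (n : ℕ) (μ≡0 : μ n ≡ 0) where
      D : ℕ
      D = ℓ ^ d * suc (lam n)

      base-step : ∀ {e₁ e₀} m ν → ℤ.+ e₁ ≡ ℤ.+ (μ n * ℓ ^ suc (suc m) + lam n * suc (suc m)) ℤ.+ ν →
        ℤ.+ e₀ ≡ ℤ.+ (μ n * ℓ ^ suc m + lam n * suc m) ℤ.+ ν → suc e₁ ≡ e₀ + suc (lam n)
      base-step {e₁} {e₀} m ν r₁ r₀ = μ≡0-step (lam n) (suc m) (ℓ ^ suc m) (ℓ ^ suc (suc m))
        (trans (cong (λ z → e₁ + (z * ℓ ^ suc m + lam n * suc m)) (sym μ≡0))
          (trans (difference ν r₁ r₀) (cong (λ z → e₀ + (z * ℓ ^ suc (suc m) + lam n * suc (suc m))) μ≡0)))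

      -- The growth from level m + 1 to m + 2 in tower n + 1 is computed twice: from its invariants,
      -- and from the determinant of tower n, which gives one less than ℓ^d (λ_n + 1).
      slope-at : ∀ m → start n ≤ suc m → start (suc n) ≤ suc m → lam n < suc m →
        suc p * (μ (suc n) * ℓ ^ suc m) + suc (lam (suc n)) ≡ D
      slope-at m a b c =
        let (_ , e₀ , T₀ , o₀ , r₀) = data-at n (suc m) a
            (_ , e₁ , T₁ , o₁ , r₁) = data-at n (suc (suc m)) (ℕ.m≤n⇒m≤1+n a)
            (_ , g₀ , U₀ , q₀ , s₀) = data-at (suc n) (suc m) b
            (_ , g₁ , U₁ , q₁ , s₁) = data-at (suc n) (suc (suc m)) (ℕ.m≤n⇒m≤1+n b)
        in slope {g₁} {g₀} (suc p) (μ (suc n)) (lam (suc n)) (suc m) D (difference (proj₁ (invariants (suc n))) s₁ s₀)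
          (OrderStep.order-step (suc p) ℓ-prime {X} X-finite vertex S 𝒢 α T β d uniform dimension connected n m
            {proj₁ (data-at n (suc (suc m)) (ℕ.m≤n⇒m≤1+n a))} {proj₁ (data-at n (suc m) a)}
                  {proj₁ (data-at (suc n) (suc (suc m)) (ℕ.m≤n⇒m≤1+n b))} {proj₁ (data-at (suc n) (suc m) b)} {e₁} {e₀} {g₁}
                  {g₀} {suc (lam n)} T₁ o₁ T₀ o₀ U₁ q₁ U₀ q₀ (base-step m (proj₁ (invariants n)) r₁ r₀) (s≤s c))

      next-level : (μ (suc n) ≡ 0) × (suc (lam (suc n)) ≡ D)
      next-level = slope-constant p (μ (suc n)) (lam (suc n)) (suc m) D
        (slope-at m (ℕ.m≤n⇒m≤1+n a) (ℕ.m≤n⇒m≤1+n b) (s≤s c))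
        (slope-at (suc m) (ℕ.m≤n⇒m≤1+n (ℕ.m≤n⇒m≤1+n a)) (ℕ.m≤n⇒m≤1+n (ℕ.m≤n⇒m≤1+n b)) (s≤s (ℕ.m≤n⇒m≤1+n c)))
        where
        m : ℕ
        -- Beyond both thresholds the growth formulas hold, and m ≥ λ_n supplies the precision.
        -- Growth is then read off between levels m + 2, m + 3 and m + 4.
        m = start n ⊔ start (suc n) ⊔ lam n
        a : start n ≤ m
        a = ℕ.≤-trans (ℕ.m≤m⊔n (start n) (start (suc n))) (ℕ.m≤m⊔n _ (lam n))
        b : start (suc n) ≤ m
        b = ℕ.≤-trans (ℕ.m≤n⊔m (start n) (start (suc n))) (ℕ.m≤m⊔n _ (lam n))
        c : lam n ≤ m
        c = ℕ.m≤n⊔m (start n ⊔ start (suc n)) (lam n)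

  growth : μ 0 ≡ 0 → ∀ n → (μ n ≡ 0) × (suc (lam n) ≡ ℓ ^ (d * n) * (lam 0 + 1))
  growth μ≡0 zero = μ≡0 , sym (trans (cong (λ e → ℓ ^ e * (lam 0 + 1)) (ℕ.*-zeroʳ d)) (trans (ℕ.*-identityˡ _) (ℕ.+-comm (lam 0) 1)))
  growth μ≡0 (suc n) = let (μn , λn) = growth μ≡0 n ; (μ′ , λ′) = Levels.next-level n μn in
    μ′ , trans λ′ (trans (cong (ℓ ^ d *_) λn) (trans (sym (ℕ.*-assoc (ℓ ^ d) (ℓ ^ (d * n)) _))
      (cong (_* (lam 0 + 1)) (trans (sym (ℕ.^-distribˡ-+-* ℓ d (d * n))) (cong (ℓ ^_) (sym (ℕ.*-suc d n)))))))

open import Defs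
open import Data.Fin.Base using (Fin; inject≤)
open import Data.Nat.Base using (_+_; _*_; _^_; _∸_; _≤_)

theorem5p2 :
    ∀ (ℓ : ℕ) → Prime ℓ →
    ∀ (X : Graph) → IsFiniteGraph X → IsConnected X →
    ∀ (S : Orientation X) (𝒢 : ProGroup ℓ) →
    let G = Pro.limit 𝒢
        t = Orientation.size S
    in
    ¬ Finite (Group.setoid G) →
    ∀ (k : ℕ) (k≤t : k ≤ t) (g : Fin k → Group.Carrier G) →
    Pro.TopologicallyGenerate 𝒢 g →
    ∀ (α : Voltage S G) →
    (∀ (i : Fin k) → Group._≈_ G (α (inject≤ i k≤t)) (g i)) →
    ∀ (T : Tower ℓ X) (β : Voltage S (TowerGal.GalLimit T)) →
    IsVoltageTower T S β →
    let Y : ℕ → ℕ → Graph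
        Y n m = derivedLevel S 𝒢 T (λ i → α i , β i) n m
    in
    ∀ (d : ℕ) → Pro.IsUniform 𝒢 → Pro.HasDimension 𝒢 d →
    (∀ n m → IsConnected (Y n m)) →
    ∀ (μ lam : ℕ → ℕ) →
    (∀ n → IwasawaInvariants ℓ (Y n) (μ n) (lam n)) →
    μ 0 ≡ 0 →
    ∀ n → (μ n ≡ 0) × (lam n ≡ ℓ ^ (d * n) * (lam 0 + 1) ∸ 1)
theorem5p2 zero          pr = contradiction pr ¬prime[0]
theorem5p2 (suc zero)    pr = contradiction pr ¬prime[1]
theorem5p2 (suc (suc p)) pr X X-finite ((v , _)) S 𝒢 _ _ _ _ _ α _ T β _ d uniform dimension connected μ lam invariants μ≡0 n =
  let (μn , λn) = Growth.growth p pr {X} X-finite v S 𝒢 α T β d uniform dimension connected μ lam invariants μ≡0 n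
  -- The induction carries λ_n + 1, so the truncated subtraction is exact.
  in μn , cong (_∸ 1) λn
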